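{- Fix $a\in\mathcal{F}$ and define $q_a:\mathbb{N}^n\to\mathbb{N}$ by $q_a(\lambda_1,\dots,\lambda_n)=|\mathcal{I}_a(\lambda_1\varpi_1+\dots+\lambda_n\varpi_n)|$. Then the restriction of $q_a$ to $\mathbb{N}_{\ge2}^n=\{(\lambda_1,\dots,\lambda_n):\lambda_i\ge2\ \forall i\}$ agrees with a quasi-polynomial of degree $n$. Moreover, its top homogeneous component is a polynomial and it is independent of $a$.
   Context: Fix $n\ge1$; type $A_n$: $E=\{x\in\mathbb{R}^{n+1}:\sum x_i=0\}$, $\Phi=\{\varepsilon_i-\varepsilon_j:i\ne j\}$, $\alpha_i=\varepsilon_i-\varepsilon_{i+1}$, $\Phi^+=\{\varepsilon_i-\varepsilon_j:i<j\}$, $\tilde\alpha=\varepsilon_1-\varepsilon_{n+1}$, fundamental weights $\varpi_i$ with $\langle\varpi_i,\alpha_j\rangle=\delta_{ij}$, $\Lambda^+$ the dominant weights (nonnegative integer combinations of the $\varpi_i$). $W_{\mathrm{aff}}$ is generated by reflections in the hyperplanes $\{\langle x,\alpha\rangle=k\}$, $\alpha\in\Phi,k\in\mathbb{Z}$; $W_{\mathrm f}$ generated by $s_{\alpha_i,0}$ with longest element $w_0$; fundamental alcove $\mathcal{A}_{\mathrm{id}}=\{x:-1<\langle x,\alpha\rangle<0\ \forall\alpha\in\Phi^+\}$, $\mathcal{A}_w=w(\mathcal{A}_{\mathrm{id}})$; Bruhat order $\le$ w.r.t. $S=\{s_{\alpha_i,0}\}\cup\{s_{\tilde\alpha,-1}\}$.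 $\Pi^+=\{x:0\le\langle x,\alpha_i\rangle\le1\ \forall i\}$, $\Pi^-=w_0(\Pi^+)$, $\mathcal{F}=\{a\in W_{\mathrm{aff}}:\mathcal{A}_a\subset\Pi^-\}$; for $\lambda\in\Lambda^+$, $\theta_a(\lambda)$ is the unique element with $\mathcal{A}_{\theta_a(\lambda)}=\mathcal{A}_{w_0a}+\lambda$ and $\mathcal{I}_a(\lambda)=\{x:x\le\theta_a(\lambda)\}$. $\mathbb{N}=\{0,1,2,\dots\}$. A function $q$ on (a subset of) $\mathbb{Z}^n$ is a quasi-polynomial of degree $d$ if there is a subgroup $\Gamma\subseteq\mathbb{Z}^n$ of finite index and, for each coset $g+\Gamma$, a polynomial $p_g$ of degree $d$ with $q=p_g$ on $g+\Gamma$ (where $q$ is defined); its top homogeneous component is the family of degree-$d$ homogeneous parts of the $p_g$, and it is a polynomial if these coincide. -}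

module Defs where

open import Data.Nat as ℕ using (ℕ; zero; suc)
open import Data.Integer as ℤ using (ℤ; +_; -[1+_])
open import Data.Rational as ℚ using (ℚ; 0ℚ; 1ℚ; _/_)
import Data.Fin.Properties
open import Data.Fin as Fin using (Fin; toℕ; inject₁; fromℕ)
open import Data.Vec as Vec using (Vec; []; _∷_; lookup; tabulate; foldr)
open import Data.List as List using (List; []; _∷_; length)
open import Data.List.Relation.Unary.All as LAll using ()
open import Data.List.Relation.Unary.Any as LAny using ()
open import Data.List.Relation.Unary.AllPairs using (AllPairs)
open import Data.List.Relation.Binary.Sublist.Propositional using (_⊆_)
open import Data.Product using (Σ; _×_; _,_; ∃)
open import Relation.Binary.PropositionalEquality using (_≡_; _≢_)
open import Relation.Nullary using (¬_)

-- Type A_n, realised on ℚ-points of ℝ^{n+1}.  Coordinates are indexed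
-- by Fin (suc n) (0-based: coordinate c corresponds to ε_{c+1}).

Pt : ℕ → Set
Pt n = Vec ℚ (suc n)

sumℚ : ∀ {k} → Vec ℚ k → ℚ
sumℚ = foldr _ ℚ._+_ 0ℚ

InE : ∀ {n} → Pt n → Set
InE x = sumℚ x ≡ 0ℚ

pair : ∀ {n} → Pt n → Fin (suc n) → Fin (suc n) → ℚ
pair x i j = lookup x i ℚ.- lookup x j

-- the affine reflection s_{α,k} for α = ε_i - ε_j (α^∨ = α in type A):
--   s_{α,k}(x) = x - (⟨x,α⟩ - k) α
record Refl (n : ℕ) : Set where
  constructor refl⟨_,_,_,_⟩
  field
    ri : Fin (suc n)
    rj : Fin (suc n)
    ri≢rj : ri ≢ rj
    rk : ℤ

ℤ→ℚ : ℤ → ℚ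
ℤ→ℚ z = z / 1

coordDelta : ∀ {n} → Fin (suc n) → Fin (suc n) → Fin (suc n) → ℚ
coordDelta i j c with toℕ c ℕ.≟ toℕ i | toℕ c ℕ.≟ toℕ j
... | Relation.Nullary.yes _ | _ = 1ℚ
... | Relation.Nullary.no _ | Relation.Nullary.yes _ = ℚ.- 1ℚ
... | Relation.Nullary.no _ | Relation.Nullary.no _ = 0ℚ

reflect : ∀ {n} → Refl n → Pt n → Pt n
reflect {n} refl⟨ i , j , _ , k ⟩ x =
  tabulate λ c → lookup x c ℚ.- ((pair x i j ℚ.- ℤ→ℚ k) ℚ.* coordDelta {n} i j c)

-- Elements of W_aff: words in the generating reflections s_{α,k}
-- (α ∈ Φ, k ∈ ℤ), acting by composition (first letter applied last).
Waff : ℕ → Set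
Waff n = List (Refl n)

act : ∀ {n} → Waff n → Pt n → Pt n
act [] x = x
act (r ∷ w) x = reflect r (act w x)

_≈W_ : ∀ {n} → Waff n → Waff n → Set
_≈W_ {n} u v = (x : Pt n) → InE x → act u x ≡ act v x

-- Simple reflections S = {s_{α_i,0}} ∪ {s_{α̃,-1}}.
-- Index zero ↦ s_{α̃,-1} (α̃ = ε_1 - ε_{n+1}); index suc i ↦ s_{α_{i+1},0}.

suc≢inject₁ : ∀ {n} (i : Fin n) → inject₁ i ≢ Fin.suc i
suc≢inject₁ Fin.zero ()
suc≢inject₁ (Fin.suc i) eq = suc≢inject₁ i (Data.Fin.Properties.suc-injective eq)
  where import Data.Fin.Properties

zero≢last : ∀ {n} → 1 ℕ.≤ n → Fin.zero {n} ≢ fromℕ n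
zero≢last {suc n} _ ()

simple : ∀ {n} → 1 ℕ.≤ n → Fin (suc n) → Refl n
simple {n} h Fin.zero = refl⟨ Fin.zero , fromℕ n , zero≢last h , -[1+ 0 ] ⟩
simple h (Fin.suc i) = refl⟨ inject₁ i , Fin.suc i , suc≢inject₁ i , + 0 ⟩

SWord : ℕ → Set
SWord n = List (Fin (suc n))

⟦_⟧S : ∀ {n} → 1 ℕ.≤ n → SWord n → Waff n
⟦_⟧S h = List.map (simple h)

IsReducedFor : ∀ {n} (h : 1 ℕ.≤ n) → SWord n → Waff n → Set
IsReducedFor h v y =
  (⟦ h ⟧S v ≈W y) × (∀ v′ → ⟦ h ⟧S v′ ≈W y → length v ℕ.≤ length v′)

Bruhat≤ : ∀ {n} (h : 1 ℕ.≤ n) → Waff n → Waff n → Set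
Bruhat≤ h x y =
  Σ (SWord _) λ v → IsReducedFor h v y × Σ (SWord _) λ u → (u ⊆ v) × (⟦ h ⟧S u ≈W x)

Φ⁺pair : ∀ {n} → Fin (suc n) → Fin (suc n) → Set
Φ⁺pair i j = toℕ i ℕ.< toℕ j

InAid : ∀ {n} → Pt n → Set
InAid x = InE x × (∀ i j → Φ⁺pair i j →
  (ℚ.- 1ℚ ℚ.< pair x i j) × (pair x i j ℚ.< 0ℚ))

InAlcove : ∀ {n} → Waff n → Pt n → Set
InAlcove w y = Σ _ λ x → InAid x × (act w x ≡ y)

w₀ : ∀ {n} → Pt n → Pt n
w₀ x = Vec.reverse x

InΠ⁺ : ∀ {n} → Pt n → Set
InΠ⁺ {n} x = InE x × ((i : Fin n) →
  (0ℚ ℚ.≤ pair x (inject₁ i) (Fin.suc i)) × (pair x (inject₁ i) (Fin.suc i) ℚ.≤ 1ℚ))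

InΠ⁻ : ∀ {n} → Pt n → Set
InΠ⁻ y = Σ _ λ x → InΠ⁺ x × (w₀ x ≡ y)

InF : ∀ {n} → Waff n → Set
InF {n} a = (y : Pt n) → InAlcove a y → InΠ⁻ y

-- fundamental weight ϖ_{i+1} (i : Fin n):
--   ϖ_{i+1} = ε_1 + … + ε_{i+1} - ((i+1)/(n+1)) (ε_1 + … + ε_{n+1})
ϖ : ∀ {n} → Fin n → Pt n
ϖ {n} i = tabulate λ c →
  (if⟨ toℕ c ℕ.≤? toℕ i ⟩) ℚ.- ((+ suc (toℕ i)) / suc n)
  where
  if⟨_⟩ : {P : Set} → Relation.Nullary.Dec P → ℚ
  if⟨ Relation.Nullary.yes _ ⟩ = 1ℚ
  if⟨ Relation.Nullary.no _ ⟩ = 0ℚ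

weight : ∀ {n} → Vec ℕ n → Pt n
weight {n} l = Vec.foldr _ (Vec.zipWith ℚ._+_) (Vec.replicate _ 0ℚ)
  (tabulate λ i → Vec.map (λ q → ((+ lookup l i) / 1) ℚ.* q) (ϖ i))

-- θ is θ_a(λ):  A_θ = A_{w₀a} + λ   (as sets of points of E)
IsTheta : ∀ {n} → Waff n → Vec ℕ n → Waff n → Set
IsTheta {n} a l θ = (y : Pt n) → InE y →
  (InAlcove θ y → Σ _ λ z → InAlcove a z × (Vec.zipWith ℚ._+_ (w₀ z) (weight l) ≡ y))
  × ((Σ _ λ z → InAlcove a z × (Vec.zipWith ℚ._+_ (w₀ z) (weight l) ≡ y)) → InAlcove θ y)

HasCard : ∀ {n} → (Waff n → Set) → ℕ → Set
HasCard {n} P N = Σ (List (Waff n)) λ L →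
  (length L ≡ N) × LAll.All P L × AllPairs (λ u v → ¬ (u ≈W v)) L
  × ((w : Waff n) → P w → LAny.Any (λ u → w ≈W u) L)

-- q_a(λ) = |I_a(λ)| = v  (v ∈ ℚ): θ_a(λ) exists, and for (every) θ_a(λ),
-- the Bruhat interval {x ≤ θ_a(λ)} is finite with v elements
qaIs : ∀ {n} → 1 ℕ.≤ n → Waff n → Vec ℕ n → ℚ → Set
qaIs h a l v = (Σ _ λ θ → IsTheta a l θ)
  × (∀ θ → IsTheta a l θ → Σ ℕ λ N → HasCard (λ x → Bruhat≤ h x θ) N × ((+ N) / 1 ≡ v))

-- Polynomials in n variables over ℚ, as coefficient functions on
-- exponent vectors.

Poly : ℕ → Set
Poly n = Vec ℕ n → ℚ

totalDeg : ∀ {n} → Vec ℕ n → ℕ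
totalDeg = Vec.sum

HasDegree : ∀ {n} → ℕ → Poly n → Set
HasDegree d p = (∀ e → d ℕ.< totalDeg e → p e ≡ 0ℚ)
  × (Σ _ λ e → (totalDeg e ≡ d) × (p e ≢ 0ℚ))

box : (k d : ℕ) → List (Vec ℕ k)
box zero d = [] ∷ []
box (suc k) d = List.concatMap (λ i → List.map (i ∷_) (box k d)) (List.upTo (suc d))

powℚ : ℚ → ℕ → ℚ
powℚ q zero = 1ℚ
powℚ q (suc m) = q ℚ.* powℚ q m

monomial : ∀ {n} → Vec ℕ n → Vec ℕ n → ℚ
monomial e l = Vec.foldr _ ℚ._*_ 1ℚ (Vec.zipWith (λ li ei → powℚ ((+ li) / 1) ei) l e)

-- evaluation of a polynomial of degree ≤ d at a point of ℕ^n
eval : ∀ {n} → ℕ → Poly n → Vec ℕ n → ℚ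
eval {n} d p l = List.foldr ℚ._+_ 0ℚ (List.map (λ e → p e ℚ.* monomial e l) (box n d))

{-# OPTIONS --safe #-}

-- Put N = n + 1 and encode an alcove by N times its barycentre, an integer vector P with pairwise
-- distinct residues mod N; left reflections permute and translate the entries, a simple reflection on
-- the right exchanges two neighbouring residues, and the i-th vertex of the alcove is ⌊(P + i) / N⌋.
-- For y in the dominant chamber, x ≤ y in Bruhat order iff every vertex of x lies in the convex hull of
-- the W_f-orbit of the corresponding vertex of y.  One goes down from y to w₀ through dominant alcoves;
-- each step changes a single vertex by a root, and an uncrossing argument shows that the set cut out by
-- the vertex conditions for y is the union of the one for ys and its translate by s.  That every reduced
-- word of y gives the same set follows by following the dominant rearrangement of its prefixes.
--
-- For y = θ_a(λ), fixing the residues r of x turns the vertex conditions into q(S) ≤ g(S) for all subsets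
-- S of the coordinates, where q are the integer parts and g(S) = G_λ(|S|) + c_{a,r}(S), with G_λ linear in
-- λ and c_{a,r} constant.  When all λ_i ≥ 1, g is submodular.  The number of lattice points of the base
-- polytope of a submodular g is a universal polynomial of degree n in the values of g: slice by the first
-- coordinate t; a slice is again a base polytope, of min(g(S), g(S ∪ {1}) - t), and on a chain of sets S
-- the breakpoints in t are ordered, so sums of products along chains are again of this kind.  Replacing g by
-- G_λ only affects lower order terms, so the leading form does not depend on a; it is nonzero because the
-- permutohedra contain at least (J + 1)^n lattice points when λ = (2nJ, …, 2nJ).
module Submission where

open import Defs

-- Scaling by N keeps the geometry in the integers: a vertex coordinate is a floor, consecutive
-- vertices differ by a 0/1 vector, and every estimate is a sum of integer inequalities. The vertex
-- order is stated for decreasing Y only, because the s largest coordinates of each vertex are then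
-- its first s. Lengths are controlled by the sum of ⌊(x - y) / N⌋ over entries x standing before y.
-- A generator on the right changes it by exactly one, so it bounds word lengths from below, and on
-- dominant alcoves the bound is attained. The obstacle in the count is that c_{a,r} is a minimum
-- over the N vertices, and a minimum of submodular functions need not be submodular. Uncrossing S
-- and T at two different vertices costs at most the number of elements of T outside S; λ_i ≥ 1
-- makes G_λ concave enough to pay for this. Slicing introduces further minima: a product over
-- arbitrary sets would sum to a piecewise polynomial, and restricting to chains is what keeps one
-- formula valid throughout.

module Proof where

  open import Data.Nat as ℕ using (ℕ; zero; suc; z≤n; s≤s)
  import Data.Nat.Properties as ℕ
  import Data.Nat.Coprimality as Coprime
  open import Data.Integer as ℤ using (ℤ; +_; -[1+_]; _+_; _-_; _*_; -_; _≤_; _<_; _⊓_; 0ℤ; 1ℤ; +≤+; _/ℕ_)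
  import Data.Integer.Properties as ℤ
  import Data.Integer.DivMod as ℤ
  open import Data.Integer.Tactic.RingSolver using (solve-∀)
  open import Data.Rational as ℚ using (ℚ; 0ℚ; 1ℚ; mkℚ)
  import Data.Rational.Properties as ℚ
  open import Data.Bool using (true; false)
  open import Data.Fin as Fin using (Fin; toℕ; fromℕ<)
  import Data.Fin.Properties as Fin
  open import Data.Fin.Subset using (Subset; _∪_; _∩_) renaming (∣_∣ to size; ⊤ to ⊤ˢ; ⊥ to ⊥ˢ)
  import Data.Fin.Subset.Properties as Subset
  open import Data.Vec as Vec using (Vec; []; _∷_; map; lookup; tabulate)
  import Data.Vec.Properties as Vec
  open import Data.Vec.Relation.Unary.All as All using (All; []; _∷_)
  open import Data.Vec.Relation.Unary.Any using (here; there)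
  open import Data.Vec.Relation.Unary.AllPairs as AllPairs using (AllPairs; []; _∷_)
  open import Data.Vec.Membership.Propositional using (_∈_)
  open import Data.Vec.Membership.Propositional.Properties using (∈-map⁺)
  open import Data.List as List using (List; []; _∷_; length; _++_)
  import Data.List.Properties as List
  open import Data.List.Relation.Binary.Sublist.Propositional using (_⊆_; []; _∷_; _∷ʳ_)
  open import Data.List.Relation.Binary.Sublist.Heterogeneous.Properties using (length-mono-≤; reverse⁺)
  open import Data.List.Relation.Unary.All as LAll using ([]; _∷_)
  import Data.List.Relation.Unary.All.Properties as LAll
  open import Data.List.Relation.Unary.AllPairs as LPairs using ([]; _∷_)
  import Data.List.Relation.Unary.AllPairs.Properties as LPairs
  import Data.List.Relation.Unary.Any as LAny
  import Data.List.Relation.Unary.Any.Properties as LAny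
  open import Data.List.Membership.Propositional using () renaming (_∈_ to _∈ᴸ_)
  open import Data.List.Membership.Propositional.Properties using (∈-++⁺ˡ; ∈-++⁺ʳ; ∈-filter⁺) renaming (∈-map⁺ to ∈ᴸ-map⁺)
  open import Data.Product using (Σ; ∃; _×_; _,_; proj₁; proj₂)
  open import Data.Sum using (_⊎_; inj₁; inj₂)
  open import Data.Empty using (⊥; ⊥-elim)
  open import Level using (0ℓ)
  open import Relation.Nullary using (¬_; Dec; yes; no)
  open import Relation.Nullary.Decidable using (¬?; _×-dec_; dec⇒maybe)
  open import Relation.Binary.Definitions using (tri<; tri≈; tri>)
  open import Relation.Binary.PropositionalEquality using (_≡_; _≢_; refl; sym; trans; cong; cong₂; subst; subst₂)
  open import Tactic.RingSolver using () renaming (solve-∀ to solve-∀-over)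
  open import Tactic.RingSolver.Core.AlmostCommutativeRing using (AlmostCommutativeRing; fromCommutativeRing)

  -- Linear arithmetic over ℤ

  infixl 6 _⊹_
  _⊹_ : ∀ {a b c d} → a ≤ b → c ≤ d → a + c ≤ b + d
  _⊹_ = ℤ.+-mono-≤

  -- Linear arithmetic by certificate: hypotheses are added up with `⊹`, and the ring solver checks
  -- that the goal has the same slack as their sum.
  lin : ∀ {x y a b} → x ≤ y → b - a ≡ y - x → a ≤ b
  lin x≤y eq = ℤ.0≤i-j⇒j≤i (subst (0ℤ ≤_) (sym eq) (ℤ.i≤j⇒0≤j-i x≤y))

  lin≡ : ∀ {x y a b} → x ≡ y → b - a ≡ y - x → a ≡ b
  lin≡ {x} {_} {a} {b} refl eq = trans (e₁ a b) (trans (cong (λ t → b - t) eq) (e₂ b x))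
    where
    e₁ : ∀ a b → a ≡ b - (b - a)
    e₁ = solve-∀
    e₂ : ∀ b x → b - (x - x) ≡ b
    e₂ = solve-∀

  <⇒+1≤ : ∀ {a b} → a < b → a + 1ℤ ≤ b
  <⇒+1≤ {a} {b} a<b = subst (_≤ b) (ℤ.+-comm 1ℤ a) (ℤ.i<j⇒suc[i]≤j a<b)

  +1≤⇒< : ∀ {a b} → a + 1ℤ ≤ b → a < b
  +1≤⇒< {a} {b} p = ℤ.suc[i]≤j⇒i<j (subst (_≤ b) (ℤ.+-comm a 1ℤ) p)

  ≰⇒+1≤ : ∀ {a b} → ¬ (a ≤ b) → b + 1ℤ ≤ a
  ≰⇒+1≤ a≰b = <⇒+1≤ (ℤ.≰⇒> a≰b)

  1≰0 : ¬ (1ℤ ≤ 0ℤ)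
  1≰0 (+≤+ ())

  -- The same device for contradictions: the hypotheses add up to an inequality that fails by
  -- exactly one.
  absurd : ∀ {x y} → x ≤ y → x - y ≡ 1ℤ → ⊥
  absurd {x} {y} x≤y eq = 1≰0 (lin x≤y (trans (cong -_ (sym eq)) (e x y)))
    where
    e : ∀ x y → - (x - y) ≡ y - x
    e = solve-∀

  -- Floors, residues and generators modulo N

  module Floor (n : ℕ) (1≤n : 1 ℕ.≤ n) where

    -- `N` and `fl` are sealed so that they stay atoms for the ring solver; later arguments see them
    -- only through the facts of this block.
    opaque
      N : ℤ
      N = + suc n

      N-def : N ≡ + suc n
      N-def = refl

      fl : ℤ → ℤ
      fl z = z /ℕ suc n

      fl-lower : ∀ z → N * fl z ≤ z
      fl-lower z = subst (_≤ z) (ℤ.*-comm (fl z) N) (ℤ.[n/ℕd]*d≤n z (suc n))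

      fl-upper : ∀ z → z + 1ℤ ≤ N * fl z + N
      fl-upper z = subst (z + 1ℤ ≤_) (e (fl z) N) (<⇒+1≤ (ℤ.n<s[n/ℕd]*d z (suc n)))
        where
        e : ∀ f N → (1ℤ + f) * N ≡ N * f + N
        e = solve-∀

      N*-mono : ∀ {f g} → f ≤ g → N * f ≤ N * g
      N*-mono = ℤ.*-monoˡ-≤-nonNeg N

      N*-cancel : ∀ {f g} → N * f < N * g → f < g
      N*-cancel = ℤ.*-cancelˡ-<-nonNeg N

      1≤N : 1ℤ ≤ N
      1≤N = +≤+ (s≤s z≤n)

      2≤N : + 2 ≤ N
      2≤N = +≤+ (s≤s 1≤n)

      fl-0 : fl 0ℤ ≡ 0ℤ
      fl-0 = refl

    Dvd : ℤ → Set
    Dvd z = ∃ λ m → z ≡ N * m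

    N*-cancel-< : ∀ {f g} → N * f + 1ℤ ≤ N * g + N → f ≤ g
    N*-cancel-< {f} {g} p = lin (<⇒+1≤ (N*-cancel {f} {g + 1ℤ} (+1≤⇒< (subst (N * f + 1ℤ ≤_) (e g N) p)))) (e′ f g)
      where
      e : ∀ g N → N * g + N ≡ N * (g + 1ℤ)
      e = solve-∀
      e′ : ∀ f g → g - f ≡ (g + 1ℤ) - (f + 1ℤ)
      e′ = solve-∀

    fl-greatest : ∀ {f z} → N * f ≤ z → f ≤ fl z
    fl-greatest {f} {z} p = N*-cancel-< (lin (p ⊹ fl-upper z) (e N f z (fl z)))
      where
      e : ∀ N f z g → (N * g + N) - (N * f + 1ℤ) ≡ (z + (N * g + N)) - (N * f + (z + 1ℤ))
      e = solve-∀

    fl-least : ∀ {f z} → z + 1ℤ ≤ N * f + N → fl z ≤ f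
    fl-least {f} {z} p = N*-cancel-< (lin (p ⊹ fl-lower z) (e N f z (fl z)))
      where
      e : ∀ N f z g → (N * f + N) - (N * g + 1ℤ) ≡ ((N * f + N) + z) - ((z + 1ℤ) + N * g)
      e = solve-∀

    fl-unique : ∀ {f z} → N * f ≤ z → z + 1ℤ ≤ N * f + N → fl z ≡ f
    fl-unique p q = ℤ.≤-antisym (fl-least q) (fl-greatest p)

    fl-mono : ∀ {x y} → x ≤ y → fl x ≤ fl y
    fl-mono {x} x≤y = fl-greatest (ℤ.≤-trans (fl-lower x) x≤y)

    fl-shift : ∀ z m → fl (z + N * m) ≡ fl z + m
    fl-shift z m = fl-unique (lin (fl-lower z) (e₁ N m z (fl z))) (lin (fl-upper z) (e₂ N m z (fl z)))
      where
      e₁ : ∀ N m z g → (z + N * m) - (N * (g + m)) ≡ z - N * g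
      e₁ = solve-∀
      e₂ : ∀ N m z g → (N * (g + m) + N) - (z + N * m + 1ℤ) ≡ (N * g + N) - (z + 1ℤ)
      e₂ = solve-∀

    opaque
      -- The indicator of the multiples of N, taken as a jump of the floor so that floors telescope
      -- along it.
      χ : ℤ → ℤ
      χ z = fl z - fl (z - 1ℤ)

      fl-step : ∀ z → fl z ≡ fl (z - 1ℤ) + χ z
      fl-step z = e (fl z) (fl (z - 1ℤ))
        where
        e : ∀ a b → a ≡ b + (a - b)
        e = solve-∀

      χ-shift : ∀ z m → χ (z + N * m) ≡ χ z
      χ-shift z m = trans (cong₂ _-_ (fl-shift z m) (trans (cong fl (e₁ z (N * m))) (fl-shift (z - 1ℤ) m))) (e₂ (fl z) (fl (z - 1ℤ)) m)
        where
        e₁ : ∀ z k → z + k - 1ℤ ≡ (z - 1ℤ) + k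
        e₁ = solve-∀
        e₂ : ∀ a b m → (a + m) - (b + m) ≡ a - b
        e₂ = solve-∀

      χ-nonneg : ∀ z → 0ℤ ≤ χ z
      χ-nonneg z = ℤ.i≤j⇒0≤j-i (fl-mono {z - 1ℤ} {z} (lin (+≤+ z≤n) (e z)))
        where
        e : ∀ z → z - (z - 1ℤ) ≡ 1ℤ - 0ℤ
        e = solve-∀

      χ≤1 : ∀ z → χ z ≤ 1ℤ
      χ≤1 z = lin (fl-least {fl (z - 1ℤ) + 1ℤ} (lin (fl-upper (z - 1ℤ) ⊹ 1≤N) (e₁ N z (fl (z - 1ℤ))))) (e₂ (fl z) (fl (z - 1ℤ)))
        where
        e₁ : ∀ N z g → (N * (g + 1ℤ) + N) - (z + 1ℤ) ≡ (N * g + N + N) - (z - 1ℤ + 1ℤ + 1ℤ)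
        e₁ = solve-∀
        e₂ : ∀ a b → 1ℤ - (a - b) ≡ (b + 1ℤ) - a
        e₂ = solve-∀

      Dvd⇒χ≡1 : ∀ {z} → Dvd z → χ z ≡ 1ℤ
      Dvd⇒χ≡1 (m , refl) = trans (cong₂ _-_ a b) (e₃ m)
        where
        e₀ : ∀ k → 0ℤ + k ≡ k
        e₀ = solve-∀
        a : fl (N * m) ≡ m
        a = trans (cong fl (sym (e₀ (N * m)))) (trans (fl-shift 0ℤ m) (trans (cong (_+ m) fl-0) (e₀ m)))
        e₁ : ∀ N m → (N * m - 1ℤ) - N * (m - 1ℤ) ≡ N - 1ℤ
        e₁ = solve-∀
        e₂ : ∀ N m → (N * (m - 1ℤ) + N) - (N * m - 1ℤ + 1ℤ) ≡ 0ℤ - 0ℤ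
        e₂ = solve-∀
        e₃ : ∀ m → m - (m - 1ℤ) ≡ 1ℤ
        e₃ = solve-∀
        b : fl (N * m - 1ℤ) ≡ m - 1ℤ
        b = fl-unique (lin 1≤N (e₁ N m)) (lin (ℤ.≤-refl {0ℤ}) (e₂ N m))

      χ≡1⇒Dvd : ∀ {z} → χ z ≡ 1ℤ → Dvd z
      χ≡1⇒Dvd {z} p = fl z , ℤ.≤-antisym (lin (fl-upper (z - 1ℤ) ⊹ N*-mono (ℤ.≤-reflexive (sym (lin≡ p (e₁ (fl z) (fl (z - 1ℤ))))))) (e₂ N z (fl z) (fl (z - 1ℤ)))) (fl-lower z)
        where
        e₁ : ∀ a b → (b + 1ℤ) - a ≡ 1ℤ - (a - b)
        e₁ = solve-∀
        e₂ : ∀ N z a b → N * a - z ≡ N * b + N + N * a - (z - 1ℤ + 1ℤ + N * (b + 1ℤ))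
        e₂ = solve-∀

    data χView (z : ℤ) : Set where
      one  : Dvd z → χ z ≡ 1ℤ → χView z
      zero : ¬ Dvd z → χ z ≡ 0ℤ → χView z

    χ-view : ∀ z → χView z
    χ-view z with χ z ℤ.≟ 1ℤ
    ... | yes p = one (χ≡1⇒Dvd p) p
    ... | no ¬p = zero (λ d → ¬p (Dvd⇒χ≡1 d)) (ℤ.≤-antisym (lin (<⇒+1≤ (ℤ.≤∧≢⇒< (χ≤1 z) ¬p)) (e (χ z))) (χ-nonneg z))
      where
      e : ∀ c → 0ℤ - c ≡ 1ℤ - (c + 1ℤ)
      e = solve-∀

    fl-pred : ∀ z → fl (z - 1ℤ) ≡ fl z - χ z
    fl-pred z = trans (e (fl (z - 1ℤ)) (χ z)) (cong (_- χ z) (sym (fl-step z)))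
      where
      e : ∀ a b → a ≡ a + b - b
      e = solve-∀

    fl-succ : ∀ z → fl (z + 1ℤ) ≡ fl z + χ (z + 1ℤ)
    fl-succ z = trans (fl-step (z + 1ℤ)) (cong (λ t → fl t + χ (z + 1ℤ)) (e z))
      where
      e : ∀ a → a + 1ℤ - 1ℤ ≡ a
      e = solve-∀

    Dvd-+ : ∀ {a b} → Dvd a → Dvd b → Dvd (a + b)
    Dvd-+ (m , refl) (m′ , refl) = m + m′ , sym (ℤ.*-distribˡ-+ N m m′)

    Dvd-neg : ∀ {a} → Dvd a → Dvd (- a)
    Dvd-neg (m , refl) = - m , ℤ.neg-distribʳ-* N m

    Dvd-sub : ∀ {a b} → Dvd a → Dvd b → Dvd (a - b)
    Dvd-sub p q = Dvd-+ p (Dvd-neg q)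

    Dvd-0 : Dvd 0ℤ
    Dvd-0 = 0ℤ , sym (ℤ.*-zeroʳ N)

    fl-1 : fl 1ℤ ≡ 0ℤ
    fl-1 = fl-unique (subst (_≤ 1ℤ) (sym (ℤ.*-zeroʳ N)) (+≤+ z≤n)) (subst (λ t → + 2 ≤ t + N) (sym (ℤ.*-zeroʳ N)) (subst (+ 2 ≤_) (sym (ℤ.+-identityˡ N)) 2≤N))

    χ-1 : χ 1ℤ ≡ 0ℤ
    χ-1 = trans (e (χ 1ℤ)) (trans (cong (_+ χ 1ℤ) (sym fl-0)) (trans (sym (fl-step 1ℤ)) fl-1))
      where
      e : ∀ a → a ≡ 0ℤ + a
      e = solve-∀

    ¬Dvd-1 : ¬ Dvd 1ℤ
    ¬Dvd-1 d with trans (sym (Dvd⇒χ≡1 d)) χ-1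
    ... | ()

    ¬Dvd-consecutive : ∀ {z} → Dvd z → ¬ Dvd (z + 1ℤ)
    ¬Dvd-consecutive {z} p q = ¬Dvd-1 (subst Dvd (e z) (Dvd-sub q p))
      where
      e : ∀ z → z + 1ℤ - z ≡ 1ℤ
      e = solve-∀

    ¬Dvd⇒χ≡0 : ∀ {z} → ¬ Dvd z → χ z ≡ 0ℤ
    ¬Dvd⇒χ≡0 {z} ¬d with χ-view z
    ... | one d _  = ⊥-elim (¬d d)
    ... | zero _ p = p

    χ-cong-Dvd : ∀ {a b} → Dvd (b - a) → χ b ≡ χ a
    χ-cong-Dvd {a} {b} (m , p) = trans (cong χ (trans (e a b) (cong (λ t → a + t) p))) (χ-shift a m)
      where
      e : ∀ a b → b ≡ a + (b - a)
      e = solve-∀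

    opaque
      -- Right multiplication by the k-th generator: the residue classes k and k - 1 are exchanged
      -- by moving their members one unit. The form with indicators lets its floors be computed
      -- without cases.
      ρ : ℤ → ℤ → ℤ
      ρ k z = z - χ (z - k) + χ (z - k + 1ℤ)

      ρ-def : ∀ k z → ρ k z ≡ z - χ (z - k) + χ (z - k + 1ℤ)
      ρ-def k z = refl

    data ρView (k z : ℤ) : Set where
      down : Dvd (z - k) → χ (z - k) ≡ 1ℤ → χ (z - k + 1ℤ) ≡ 0ℤ → ρ k z ≡ z - 1ℤ → ρView k z
      up   : Dvd (z - k + 1ℤ) → χ (z - k) ≡ 0ℤ → χ (z - k + 1ℤ) ≡ 1ℤ → ρ k z ≡ z + 1ℤ → ρView k z
      fix  : ¬ Dvd (z - k) → ¬ Dvd (z - k + 1ℤ) → χ (z - k) ≡ 0ℤ → χ (z - k + 1ℤ) ≡ 0ℤ → ρ k z ≡ z → ρView k z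

    ρ-value : ∀ k z {a b} → χ (z - k) ≡ a → χ (z - k + 1ℤ) ≡ b → ρ k z ≡ z - a + b
    ρ-value k z p q = trans (ρ-def k z) (cong₂ (λ s t → z - s + t) p q)

    ρ-view : ∀ k z → ρView k z
    ρ-view k z with χ-view (z - k) | χ-view (z - k + 1ℤ)
    ... | one d p   | one d′ _  = ⊥-elim (¬Dvd-consecutive d d′)
    ... | one d p   | zero _ q  = down d p q (trans (ρ-value k z p q) (ℤ.+-identityʳ (z - 1ℤ)))
    ... | zero _ p  | one d q   = up d p q (trans (ρ-value k z p q) (cong (_+ 1ℤ) (ℤ.+-identityʳ z)))
    ... | zero ¬d p | zero ¬d′ q = fix ¬d ¬d′ p q (trans (ρ-value k z p q) (trans (ℤ.+-identityʳ _) (ℤ.+-identityʳ z)))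

    ρ-shift : ∀ k z m → ρ k (z + N * m) ≡ ρ k z + N * m
    ρ-shift k z m = trans (ρ-value k (z + N * m) (χ-cong-Dvd (m , e₁ z (N * m) k)) (χ-cong-Dvd (m , e₂ z (N * m) k)))
      (trans (e₃ z (N * m) (χ (z - k)) (χ (z - k + 1ℤ))) (cong (_+ N * m) (sym (ρ-def k z))))
      where
      e₁ : ∀ z c k → (z + c - k) - (z - k) ≡ c
      e₁ = solve-∀
      e₂ : ∀ z c k → (z + c - k + 1ℤ) - (z - k + 1ℤ) ≡ c
      e₂ = solve-∀
      e₃ : ∀ z c a b → z + c - a + b ≡ z - a + b + c
      e₃ = solve-∀

    ρ-involutive : ∀ k z → ρ k (ρ k z) ≡ z
    ρ-involutive k z with ρ-view k z
    ... | fix _ _ _ _ p = trans (cong (ρ k) p) p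
    ... | down d _ _ p = trans (cong (ρ k) p) (help (ρ-view k (z - 1ℤ)))
      where
      e₁ : ∀ z k → z - k ≡ (z - 1ℤ) - k + 1ℤ
      e₁ = solve-∀
      e₂ : ∀ z → z - 1ℤ + 1ℤ ≡ z
      e₂ = solve-∀
      d′ : Dvd ((z - 1ℤ) - k + 1ℤ)
      d′ = subst Dvd (e₁ z k) d
      help : ρView k (z - 1ℤ) → ρ k (z - 1ℤ) ≡ z
      help (down d″ _ _ _)  = ⊥-elim (¬Dvd-consecutive d″ d′)
      help (up _ _ _ q)     = trans q (e₂ z)
      help (fix _ ¬d _ _ _) = ⊥-elim (¬d d′)
    ... | up d _ _ p = trans (cong (ρ k) p) (help (ρ-view k (z + 1ℤ)))
      where
      e₁ : ∀ z k → z - k + 1ℤ ≡ (z + 1ℤ) - k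
      e₁ = solve-∀
      e₂ : ∀ z → z + 1ℤ - 1ℤ ≡ z
      e₂ = solve-∀
      d′ : Dvd ((z + 1ℤ) - k)
      d′ = subst Dvd (e₁ z k) d
      help : ρView k (z + 1ℤ) → ρ k (z + 1ℤ) ≡ z
      help (down _ _ _ q)   = trans q (e₂ z)
      help (up d″ _ _ _)    = ⊥-elim (¬Dvd-consecutive d′ d″)
      help (fix ¬d _ _ _ _) = ⊥-elim (¬d d′)

    fl-pred′ : ∀ z i → fl (z - 1ℤ + i) ≡ fl (z + i) - χ (z + i)
    fl-pred′ z i = trans (cong fl (e z i)) (fl-pred (z + i))
      where
      e : ∀ z i → z - 1ℤ + i ≡ z + i - 1ℤ
      e = solve-∀

    fl-succ′ : ∀ z i → fl (z + 1ℤ + i) ≡ fl (z + i) + χ (z + i + 1ℤ)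
    fl-succ′ z i = trans (cong fl (e z i)) (fl-succ (z + i))
      where
      e : ∀ z i → z + 1ℤ + i ≡ z + i + 1ℤ
      e = solve-∀

    private
      a≡a-0 : ∀ a → a ≡ a - 0ℤ
      a≡a-0 = solve-∀
      a≡a+0 : ∀ a → a ≡ a + 0ℤ
      a≡a+0 = solve-∀

    -- After adding i, an entry of residue k sits on a multiple of N and loses one in the floor when
    -- lowered; an entry of residue k - 1 sits just below a multiple and gains one. `fl-ρ-same` says
    -- that all other vertices stay.
    fl-ρ-moved : ∀ k i z → Dvd (k + i) → fl (ρ k z + i) ≡ fl (z + i) - χ (z + i) + χ (z + i + 1ℤ)
    fl-ρ-moved k i z d with χ-cong-Dvd {z - k} {z + i} (subst Dvd (e z k i) d) | χ-cong-Dvd {z - k + 1ℤ} {z + i + 1ℤ} (subst Dvd (e′ z k i) d)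
      where
      e : ∀ z k i → k + i ≡ (z + i) - (z - k)
      e = solve-∀
      e′ : ∀ z k i → k + i ≡ (z + i + 1ℤ) - (z - k + 1ℤ)
      e′ = solve-∀
    ... | p | q with ρ-view k z
    ...   | down _ _ b r = trans (cong (λ t → fl (t + i)) r) (trans (fl-pred′ z i) (trans (a≡a+0 _) (cong (λ t → fl (z + i) - χ (z + i) + t) (sym (trans q b)))))
    ...   | up _ a _ r   = trans (cong (λ t → fl (t + i)) r) (trans (fl-succ′ z i) (cong (_+ χ (z + i + 1ℤ)) {fl (z + i)} (trans (a≡a-0 (fl (z + i))) (cong (λ t → fl (z + i) - t) (sym (trans p a))))))
    ...   | fix _ _ a b r = trans (cong (λ t → fl (t + i)) r) (trans (a≡a-0 _) (trans (a≡a+0 _) (cong₂ (λ s t → fl (z + i) - s + t) (sym (trans p a)) (sym (trans q b)))))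

    fl-ρ-same : ∀ k i z → ¬ Dvd (k + i) → fl (ρ k z + i) ≡ fl (z + i)
    fl-ρ-same k i z ¬d with ρ-view k z
    ... | down d _ _ r  = trans (cong (λ t → fl (t + i)) r) (trans (fl-pred′ z i) (trans (cong (λ t → fl (z + i) - t) (¬Dvd⇒χ≡0 (λ d′ → ¬d (subst Dvd (e z k i) (Dvd-sub d′ d))))) (sym (a≡a-0 _))))
      where
      e : ∀ z k i → (z + i) - (z - k) ≡ k + i
      e = solve-∀
    ... | up d _ _ r    = trans (cong (λ t → fl (t + i)) r) (trans (fl-succ′ z i) (trans (cong (λ t → fl (z + i) + t) (¬Dvd⇒χ≡0 (λ d′ → ¬d (subst Dvd (e z k i) (Dvd-sub d′ d))))) (sym (a≡a+0 _))))
      where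
      e : ∀ z k i → (z + i + 1ℤ) - (z - k + 1ℤ) ≡ k + i
      e = solve-∀
    ... | fix _ _ _ _ r = cong (λ t → fl (t + i)) r

    -- Adjacent alcoves are separated by one hyperplane, so only the difference of the two entries
    -- of residues k and k - 1 changes its floor.
    fl-ρ-pair : ∀ k x y → ¬ Dvd (x - y) →
      fl (ρ k x - ρ k y) ≡ fl (x - y) - χ (x - k) * χ (y - k + 1ℤ) + χ (x - k + 1ℤ) * χ (y - k)
    fl-ρ-pair k x y ¬d = go (ρ-view k x) (ρ-view k y)
      where
      Goal : Set
      Goal = fl (ρ k x - ρ k y) ≡ fl (x - y) - χ (x - k) * χ (y - k + 1ℤ) + χ (x - k + 1ℤ) * χ (y - k)
      finish : ∀ {x′ y′ a b c d} → ρ k x ≡ x′ → ρ k y ≡ y′ → χ (x - k) ≡ a → χ (x - k + 1ℤ) ≡ b → χ (y - k) ≡ c → χ (y - k + 1ℤ) ≡ d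
        → fl (x′ - y′) ≡ fl (x - y) - a * d + b * c → Goal
      finish refl refl refl refl refl refl p = p
      χxy : χ (x - y) ≡ 0ℤ
      χxy = ¬Dvd⇒χ≡0 ¬d
      g₁ : ∀ x y k → (x - k) - (y - k) ≡ x - y
      g₁ = solve-∀
      g₂ : ∀ x y k → (x - k + 1ℤ) - (y - k + 1ℤ) ≡ x - y
      g₂ = solve-∀
      g₃ : ∀ a → a ≡ a - 0ℤ + 0ℤ
      g₃ = solve-∀
      predxy : fl (x - y - 1ℤ) ≡ fl (x - y)
      predxy = trans (fl-pred (x - y)) (trans (cong (λ t → fl (x - y) - t) χxy) (sym (a≡a-0 _)))
      succxy : ¬ Dvd (x - y + 1ℤ) → fl (x - y + 1ℤ) ≡ fl (x - y)
      succxy ¬d′ = trans (fl-succ (x - y)) (trans (cong (λ t → fl (x - y) + t) (¬Dvd⇒χ≡0 ¬d′)) (sym (a≡a+0 _)))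
      s₁ : ∀ x y → (x - 1ℤ) - y ≡ x - y - 1ℤ
      s₁ = solve-∀
      s₂ : ∀ x y → (x + 1ℤ) - y ≡ x - y + 1ℤ
      s₂ = solve-∀
      s₃ : ∀ x y → x - (y - 1ℤ) ≡ x - y + 1ℤ
      s₃ = solve-∀
      s₄ : ∀ x y → x - (y + 1ℤ) ≡ x - y - 1ℤ
      s₄ = solve-∀
      s₅ : ∀ x y → (x - 1ℤ) - (y + 1ℤ) ≡ (x - y - 1ℤ) - 1ℤ
      s₅ = solve-∀
      s₆ : ∀ x y → (x + 1ℤ) - (y - 1ℤ) ≡ (x - y + 1ℤ) + 1ℤ
      s₆ = solve-∀
      d₁ : ∀ x y k → (x - k) - (y - k + 1ℤ) ≡ x - y - 1ℤ
      d₁ = solve-∀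
      d₂ : ∀ x y k → (x - k + 1ℤ) - (y - k) ≡ x - y + 1ℤ
      d₂ = solve-∀
      d₃ : ∀ x y k → (x - k + 1ℤ) - (x - y + 1ℤ) ≡ y - k
      d₃ = solve-∀
      d₄ : ∀ x y k → (x - y + 1ℤ) + (y - k) ≡ x - k + 1ℤ
      d₄ = solve-∀
      f₁ : ∀ a → a - 1ℤ ≡ a - 1ℤ * 1ℤ + 0ℤ * 0ℤ
      f₁ = solve-∀
      f₂ : ∀ a → a + 1ℤ + 0ℤ ≡ a - 0ℤ * 0ℤ + 1ℤ * 1ℤ
      f₂ = solve-∀
      go : ρView k x → ρView k y → Goal
      go (down p _ _ _) (down q _ _ _) = ⊥-elim (¬d (subst Dvd (g₁ x y k) (Dvd-sub p q)))
      go (up p _ _ _) (up q _ _ _)     = ⊥-elim (¬d (subst Dvd (g₂ x y k) (Dvd-sub p q)))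
      go (fix _ _ a b r) (fix _ _ c d s) = finish r s a b c d (g₃ _)
      go (down p a b r) (fix _ _ c d s) = finish r s a b c d (trans (cong fl (s₁ x y)) (trans predxy (g₃ _)))
      go (fix _ _ a b r) (up q c d s)   = finish r s a b c d (trans (cong fl (s₄ x y)) (trans predxy (g₃ _)))
      go (up p a b r) (fix ¬q _ c d s)  = finish r s a b c d (trans (cong fl (s₂ x y)) (trans (succxy (λ d′ → ¬q (subst Dvd (d₃ x y k) (Dvd-sub p d′)))) (g₃ _)))
      go (fix _ ¬p a b r) (down q c d s) = finish r s a b c d (trans (cong fl (s₃ x y)) (trans (succxy (λ d′ → ¬p (subst Dvd (d₄ x y k) (Dvd-+ d′ q)))) (g₃ _)))
      go (down p a b r) (up q c d s) = finish r s a b c d (trans (cong fl (s₅ x y)) (trans (fl-pred (x - y - 1ℤ)) (trans (cong₂ _-_ predxy (Dvd⇒χ≡1 (subst Dvd (d₁ x y k) (Dvd-sub p q)))) (f₁ (fl (x - y))))))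
      go (up p a b r) (down q c d s) = finish r s a b c d (trans (cong fl (s₆ x y)) (trans (fl-succ (x - y + 1ℤ)) (trans (cong₂ _+_ (trans (fl-succ (x - y)) (cong (λ t → fl (x - y) + t) (Dvd⇒χ≡1 dd))) (¬Dvd⇒χ≡0 (¬Dvd-consecutive dd))) (f₂ (fl (x - y))))))
        where
        dd : Dvd (x - y + 1ℤ)
        dd = subst Dvd (d₂ x y k) (Dvd-sub p q)

  -- Subset sums and the vertex order

  private
    interchange : ∀ a b c d → (a + b) + (c + d) ≡ (a + c) + (b + d)
    interchange = solve-∀

  ∑ : (ℤ → ℤ) → ∀ {m} → Subset m → Vec ℤ m → ℤ
  ∑ h [] [] = 0ℤ
  ∑ h (true ∷ S) (x ∷ P) = h x + ∑ h S P
  ∑ h (false ∷ S) (x ∷ P) = ∑ h S P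

  ∑-cong : ∀ {h k} → (∀ x → h x ≡ k x) → ∀ {m} (S : Subset m) P → ∑ h S P ≡ ∑ k S P
  ∑-cong p [] [] = refl
  ∑-cong p (true ∷ S) (x ∷ P) = cong₂ _+_ (p x) (∑-cong p S P)
  ∑-cong p (false ∷ S) (x ∷ P) = ∑-cong p S P

  ∑-+ : ∀ h k {m} (S : Subset m) P → ∑ (λ x → h x + k x) S P ≡ ∑ h S P + ∑ k S P
  ∑-+ h k [] [] = refl
  ∑-+ h k (true ∷ S) (x ∷ P) = trans (cong (λ t → (h x + k x) + t) (∑-+ h k S P)) (interchange (h x) (k x) (∑ h S P) (∑ k S P))
  ∑-+ h k (false ∷ S) (x ∷ P) = ∑-+ h k S P

  ∑-map : ∀ h f {m} (S : Subset m) P → ∑ h S (map f P) ≡ ∑ (λ x → h (f x)) S P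
  ∑-map h f [] [] = refl
  ∑-map h f (true ∷ S) (x ∷ P) = cong (λ t → h (f x) + t) (∑-map h f S P)
  ∑-map h f (false ∷ S) (x ∷ P) = ∑-map h f S P

  ∑-const : ∀ c {m} (S : Subset m) P → ∑ (λ _ → c) S P ≡ c * + size S
  ∑-const c [] [] = sym (ℤ.*-zeroʳ c)
  ∑-const c (true ∷ S) (x ∷ P) = trans (cong (λ t → c + t) (∑-const c S P)) (e c (+ size S))
    where
    e : ∀ c s → c + c * s ≡ c * (1ℤ + s)
    e = solve-∀
  ∑-const c (false ∷ S) (x ∷ P) = ∑-const c S P

  ∑-modular : ∀ h {m} (S T : Subset m) P → ∑ h (S ∪ T) P + ∑ h (S ∩ T) P ≡ ∑ h S P + ∑ h T P
  ∑-modular h [] [] [] = refl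
  ∑-modular h (true ∷ S) (true ∷ T) (x ∷ P) = trans (interchange (h x) _ (h x) _) (trans (cong (λ t → h x + h x + t) (∑-modular h S T P)) (interchange (h x) (h x) _ _))
  ∑-modular h (true ∷ S) (false ∷ T) (x ∷ P) = trans (ℤ.+-assoc (h x) _ _) (trans (cong (λ t → h x + t) (∑-modular h S T P)) (sym (ℤ.+-assoc (h x) _ _)))
  ∑-modular h (false ∷ S) (true ∷ T) (x ∷ P) = trans (ℤ.+-assoc (h x) _ _) (trans (cong (λ t → h x + t) (∑-modular h S T P)) (e (h x) (∑ h S P) (∑ h T P)))
    where
    e : ∀ a b c → a + (b + c) ≡ b + (a + c)
    e = solve-∀
  ∑-modular h (false ∷ S) (false ∷ T) (x ∷ P) = ∑-modular h S T P

  ∑-nonneg : ∀ {h} → (∀ x → 0ℤ ≤ h x) → ∀ {m} (S : Subset m) P → 0ℤ ≤ ∑ h S P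
  ∑-nonneg p [] [] = +≤+ z≤n
  ∑-nonneg p (true ∷ S) (x ∷ P) = p x ⊹ ∑-nonneg p S P
  ∑-nonneg p (false ∷ S) (x ∷ P) = ∑-nonneg p S P

  private
    ≤-addˡ : ∀ {a b c} → 0ℤ ≤ c → a ≤ b → a ≤ c + b
    ≤-addˡ {a} {b} {c} p q = subst (_≤ c + b) (ℤ.+-identityˡ a) (p ⊹ q)

  ∑-∪ˡ : ∀ {h} → (∀ x → 0ℤ ≤ h x) → ∀ {m} (S T : Subset m) P → ∑ h S P ≤ ∑ h (S ∪ T) P
  ∑-∪ˡ p [] [] [] = ℤ.≤-refl
  ∑-∪ˡ {h} p (true ∷ S) (_ ∷ T) (x ∷ P) = ℤ.+-monoʳ-≤ (h x) (∑-∪ˡ p S T P)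
  ∑-∪ˡ p (false ∷ S) (true ∷ T) (x ∷ P) = ≤-addˡ (p x) (∑-∪ˡ p S T P)
  ∑-∪ˡ p (false ∷ S) (false ∷ T) (x ∷ P) = ∑-∪ˡ p S T P

  ∑≤∑⊤ : ∀ {h} → (∀ x → 0ℤ ≤ h x) → ∀ {m} (S : Subset m) P → ∑ h S P ≤ ∑ h ⊤ˢ P
  ∑≤∑⊤ p [] [] = ℤ.≤-refl
  ∑≤∑⊤ {h} p (true ∷ S) (x ∷ P) = ℤ.+-monoʳ-≤ (h x) (∑≤∑⊤ p S P)
  ∑≤∑⊤ p (false ∷ S) (x ∷ P) = ≤-addˡ (p x) (∑≤∑⊤ p S P)

  pre : (ℤ → ℤ) → ℕ → ∀ {m} → Vec ℤ m → ℤ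
  pre h zero P = 0ℤ
  pre h (suc s) [] = 0ℤ
  pre h (suc s) (x ∷ P) = h x + pre h s P

  pre-cong : ∀ {h k} → (∀ x → h x ≡ k x) → ∀ s {m} (P : Vec ℤ m) → pre h s P ≡ pre k s P
  pre-cong p zero P = refl
  pre-cong p (suc s) [] = refl
  pre-cong p (suc s) (x ∷ P) = cong₂ _+_ (p x) (pre-cong p s P)

  pre-+ : ∀ h k s {m} (P : Vec ℤ m) → pre (λ x → h x + k x) s P ≡ pre h s P + pre k s P
  pre-+ h k zero P = refl
  pre-+ h k (suc s) [] = refl
  pre-+ h k (suc s) (x ∷ P) = trans (cong (λ t → (h x + k x) + t) (pre-+ h k s P)) (interchange (h x) (k x) (pre h s P) (pre k s P))

  pre-map : ∀ h f s {m} (P : Vec ℤ m) → pre h s (map f P) ≡ pre (λ x → h (f x)) s P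
  pre-map h f zero P = refl
  pre-map h f (suc s) [] = refl
  pre-map h f (suc s) (x ∷ P) = cong (λ t → h (f x) + t) (pre-map h f s P)

  pre-const : ∀ c s {m} (P : Vec ℤ m) → s ℕ.≤ m → pre (λ _ → c) s P ≡ c * + s
  pre-const c zero P _ = sym (ℤ.*-zeroʳ c)
  pre-const c (suc s) (x ∷ P) (s≤s s≤m) = trans (cong (λ t → c + t) (pre-const c s P s≤m)) (e c (+ s))
    where
    e : ∀ c s → c + c * s ≡ c * (1ℤ + s)
    e = solve-∀

  pre-nonneg : ∀ {h} → (∀ x → 0ℤ ≤ h x) → ∀ s {m} (P : Vec ℤ m) → 0ℤ ≤ pre h s P
  pre-nonneg p zero P = +≤+ z≤n
  pre-nonneg p (suc s) [] = +≤+ z≤n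
  pre-nonneg p (suc s) (x ∷ P) = p x ⊹ pre-nonneg p s P

  pre-full : ∀ h {m} (P : Vec ℤ m) → pre h m P ≡ ∑ h ⊤ˢ P
  pre-full h [] = refl
  pre-full h (x ∷ P) = cong (λ t → h x + t) (pre-full h P)

  pre≤∑⊤ : ∀ {h} → (∀ x → 0ℤ ≤ h x) → ∀ s {m} (P : Vec ℤ m) → pre h s P ≤ ∑ h ⊤ˢ P
  pre≤∑⊤ p zero P = ∑-nonneg p ⊤ˢ P
  pre≤∑⊤ p (suc s) [] = ℤ.≤-refl
  pre≤∑⊤ {h} p (suc s) (x ∷ P) = ℤ.+-monoʳ-≤ (h x) (pre≤∑⊤ p s P)

  Gap : (ℤ → ℤ) → ℤ → ∀ {m} → Vec ℤ m → Set
  Gap h δ = AllPairs (λ x y → h y + δ ≤ h x)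

  pre-shift : ∀ {h δ} s {m} x (P : Vec ℤ m) → s ℕ.≤ m → Gap h δ (x ∷ P) → pre h s P + δ * + s ≤ pre h s (x ∷ P)
  pre-shift {δ = δ} zero x P _ _ = ℤ.≤-reflexive (trans (ℤ.+-identityˡ (δ * 0ℤ)) (ℤ.*-zeroʳ δ))
  pre-shift {h} {δ} (suc s) x (y ∷ P) (s≤s s≤m) ((yx ∷ _) ∷ g) =
    lin (yx ⊹ pre-shift {h} {δ} s y P s≤m g) (e (h x) (h y) δ (+ s) (pre h s P) (pre h s (y ∷ P)))
    where
    e : ∀ x y d s a b → (x + b) - (y + a + d * (1ℤ + s)) ≡ (x + b) - ((y + d) + (a + d * s))
    e = solve-∀

  -- Prefix sums of a decreasing sequence are concave, and each of p q comparisons contributes a gap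
  -- δ. The case δ = 0 gives submodularity in the size of a set; δ = 1 is the extra room provided by
  -- λ.
  pre-concave : ∀ {h δ} w p q {m} (P : Vec ℤ m) → w ℕ.+ (p ℕ.+ q) ℕ.≤ m → Gap h δ P →
    pre h (w ℕ.+ (p ℕ.+ q)) P + pre h w P + δ * + p * + q ≤ pre h (w ℕ.+ p) P + pre h (w ℕ.+ q) P
  pre-concave {h} {δ} zero zero q P _ _ = ℤ.≤-reflexive (e (pre h q P) δ (+ q))
    where
    e : ∀ a d q → a + 0ℤ + d * 0ℤ * q ≡ 0ℤ + a
    e = solve-∀
  pre-concave {h} {δ} zero (suc p) q (x ∷ P) (s≤s b) g@(_ ∷ g′) =
    lin (pre-concave {h} {δ} zero p q P b g′ ⊹ pre-shift {h} {δ} q x P (ℕ.≤-trans (ℕ.m≤n+m q p) b) g)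
      (e (h x) (pre h (p ℕ.+ q) P) (pre h p P) (pre h q P) (pre h q (x ∷ P)) δ (+ p) (+ q))
    where
    e : ∀ x a b c c′ d p q → (x + b + c′) - (x + a + 0ℤ + d * (1ℤ + p) * q) ≡ (b + c + c′) - (a + 0ℤ + d * p * q + (c + d * q))
    e = solve-∀
  pre-concave {h} {δ} (suc w) p q (x ∷ P) (s≤s b) (_ ∷ g) =
    lin (pre-concave {h} {δ} w p q P b g) (e (h x) (pre h (w ℕ.+ (p ℕ.+ q)) P) (pre h w P) (pre h (w ℕ.+ p) P) (pre h (w ℕ.+ q) P) (δ * + p * + q))
    where
    e : ∀ x a b c d k → (x + c + (x + d)) - (x + a + (x + b) + k) ≡ (c + d) - (a + b + k)
    e = solve-∀

  -- Here p and q are the sizes of S minus T and of T minus S, in the form that `pre-concave` takes.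
  record Sizes {m} (S T : Subset m) : Set where
    constructor sizes
    field
      p q  : ℕ
      size-S : size S ≡ size (S ∩ T) ℕ.+ p
      size-T : size T ≡ size (S ∩ T) ℕ.+ q
      size-∪ : size (S ∪ T) ≡ size (S ∩ T) ℕ.+ (p ℕ.+ q)

  mkSizes : ∀ {m} (S T : Subset m) → Sizes S T
  mkSizes [] [] = sizes 0 0 refl refl refl
  mkSizes (true ∷ S) (true ∷ T) with mkSizes S T
  ... | sizes p q a b c = sizes p q (cong suc a) (cong suc b) (cong suc c)
  mkSizes (true ∷ S) (false ∷ T) with mkSizes S T
  ... | sizes p q a b c = sizes (suc p) q (trans (cong suc a) (sym (ℕ.+-suc _ p))) b (trans (cong suc c) (sym (ℕ.+-suc _ (p ℕ.+ q))))
  mkSizes (false ∷ S) (true ∷ T) with mkSizes S T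
  ... | sizes p q a b c = sizes p (suc q) a (trans (cong suc b) (sym (ℕ.+-suc _ q))) (trans (cong suc c) (trans (sym (ℕ.+-suc _ (p ℕ.+ q))) (cong ((size (S ∩ T)) ℕ.+_) (sym (ℕ.+-suc p q)))))
  mkSizes (false ∷ S) (false ∷ T) = lift (mkSizes S T)
    where
    lift : Sizes S T → Sizes (false ∷ S) (false ∷ T)
    lift (sizes p q a b c) = sizes p q a b c

  pre-submodular : ∀ {h} {m} (S T : Subset m) (P : Vec ℤ m) → Gap h 0ℤ P →
    pre h (size (S ∪ T)) P + pre h (size (S ∩ T)) P ≤ pre h (size S) P + pre h (size T) P
  pre-submodular {h} S T P g with mkSizes S T
  ... | sizes p q a b c = subst₂ _≤_
    (cong (λ u → pre h u P + pre h (size (S ∩ T)) P) (sym c))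
    (cong₂ (λ u v → pre h u P + pre h v P) (sym a) (sym b))
    (lin (pre-concave {h} {0ℤ} (size (S ∩ T)) p q P (subst (ℕ._≤ _) c (Subset.∣p∣≤n (S ∪ T))) g)
      (e (pre h (size (S ∩ T) ℕ.+ p) P + pre h (size (S ∩ T) ℕ.+ q) P) (pre h (size (S ∩ T) ℕ.+ (p ℕ.+ q)) P + pre h (size (S ∩ T)) P) (+ p) (+ q)))
    where
    e : ∀ a b p q → a - b ≡ a - (b + 0ℤ * p * q)
    e = solve-∀

  module Order (n : ℕ) (1≤n : 1 ℕ.≤ n) where

    open Floor n 1≤n public

    -- An alcove is encoded by N times its barycentre P; its vertices are the vectors V i P, and V (i + 1) P - V i P is the unit vector X (i + 1) P.
    V : ℤ → ℤ → ℤ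
    V i z = fl (z + i)

    X : ℤ → ℤ → ℤ
    X i z = χ (z + i)

    -- Hermite's identity: every residue modulo N occurs exactly once among the entries of P, whose sum is normalised.
    Good : Vec ℤ (suc n) → Set
    Good P = ∀ i → ∑ (V i) ⊤ˢ P ≡ i

    -- For decreasing Y: each vertex of P lies in the convex hull of the permutations of the corresponding vertex of Y.
    D : Vec ℤ (suc n) → Vec ℤ (suc n) → Set
    D P Y = ∀ i S → ∑ (V i) S P ≤ pre (V i) (size S) Y

    X-nonneg : ∀ i z → 0ℤ ≤ X i z
    X-nonneg i z = χ-nonneg (z + i)

    V-pred : ∀ i z → V i z ≡ V (i - 1ℤ) z + X i z
    V-pred i z = trans (fl-step (z + i)) (cong (λ t → fl t + χ (z + i)) (ℤ.+-assoc z i (- 1ℤ)))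

    V-succ : ∀ i z → V (i + 1ℤ) z ≡ V i z + X (i + 1ℤ) z
    V-succ i z = trans (V-pred (i + 1ℤ) z) (cong (λ t → V t z + X (i + 1ℤ) z) (e i))
      where
      e : ∀ i → i + 1ℤ - 1ℤ ≡ i
      e = solve-∀

    -- Crossing the k-th wall exchanges two unit steps on the path V (i - 1), V i, V (i + 1): the
    -- step X (i + 1) is now taken before X i.
    V-ρ : ∀ k i z → Dvd (k + i) → V i (ρ k z) ≡ V (i - 1ℤ) z + X (i + 1ℤ) z
    V-ρ k i z d = trans (fl-ρ-moved k i z d) (cong₂ _+_ (trans (cong (_- X i z) (V-pred i z)) (e (V (i - 1ℤ) z) (X i z))) (cong χ (ℤ.+-assoc z i 1ℤ)))
      where
      e : ∀ a b → a + b - b ≡ a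
      e = solve-∀

    V-shift : ∀ i m z → V (i + N * m) z ≡ V i z + m
    V-shift i m z = trans (cong fl (sym (ℤ.+-assoc z i (N * m)))) (fl-shift (z + i) m)

    ∑X-total : ∀ {P} → Good P → ∀ i → ∑ (X i) ⊤ˢ P ≡ 1ℤ
    ∑X-total {P} g i = lin≡ (sym (trans (sym (g i)) (trans (∑-cong (V-pred i) ⊤ˢ P) (trans (∑-+ (V (i - 1ℤ)) (X i) ⊤ˢ P) (cong (_+ ∑ (X i) ⊤ˢ P) (g (i - 1ℤ))))))) (e i (∑ (X i) ⊤ˢ P))
      where
      e : ∀ i x → 1ℤ - x ≡ i - (i - 1ℤ + x)
      e = solve-∀

    ∑X≤1 : ∀ {P} → Good P → ∀ i S → ∑ (X i) S P ≤ 1ℤ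
    ∑X≤1 {P} g i S = subst (∑ (X i) S P ≤_) (∑X-total {P} g i) (∑≤∑⊤ (X-nonneg i) S P)

    ρ-Good : ∀ k {P} → Good P → Good (map (ρ k) P)
    ρ-Good k {P} g i with χ-view (k + i)
    ... | zero ¬d _ = trans (∑-map (V i) (ρ k) ⊤ˢ P) (trans (∑-cong (λ z → fl-ρ-same k i z ¬d) ⊤ˢ P) (g i))
    ... | one d _ = trans (∑-map (V i) (ρ k) ⊤ˢ P) (trans (∑-cong (λ z → V-ρ k i z d) ⊤ˢ P) (trans (∑-+ (V (i - 1ℤ)) (X (i + 1ℤ)) ⊤ˢ P) (trans (cong₂ _+_ (g (i - 1ℤ)) (∑X-total {P} g (i + 1ℤ))) (e i))))
      where
      e : ∀ i → i - 1ℤ + 1ℤ ≡ i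
      e = solve-∀

    -- Desc k Y says that the entry of Y with residue k stands before the entry with residue k - 1.
    Desc : ℤ → Vec ℤ (suc n) → Set
    Desc k Y = ∀ i → Dvd (k + i) → ∀ s → pre (X (i + 1ℤ)) s Y ≤ pre (X i) s Y

    module Levels (k : ℤ) (i : ℤ) (d : Dvd (k + i)) where

      ∑-V : ∀ S (P : Vec ℤ (suc n)) → ∑ (V i) S P ≡ ∑ (V (i - 1ℤ)) S P + ∑ (X i) S P
      ∑-V S P = trans (∑-cong (V-pred i) S P) (∑-+ (V (i - 1ℤ)) (X i) S P)

      ∑-V⁺ : ∀ S (P : Vec ℤ (suc n)) → ∑ (V (i + 1ℤ)) S P ≡ ∑ (V (i - 1ℤ)) S P + ∑ (X i) S P + ∑ (X (i + 1ℤ)) S P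
      ∑-V⁺ S P = trans (∑-cong (V-succ i) S P) (trans (∑-+ (V i) (X (i + 1ℤ)) S P) (cong (_+ ∑ (X (i + 1ℤ)) S P) (∑-V S P)))

      ∑-Vρ : ∀ S (P : Vec ℤ (suc n)) → ∑ (V i) S (map (ρ k) P) ≡ ∑ (V (i - 1ℤ)) S P + ∑ (X (i + 1ℤ)) S P
      ∑-Vρ S P = trans (∑-map (V i) (ρ k) S P) (trans (∑-cong (λ z → V-ρ k i z d) S P) (∑-+ (V (i - 1ℤ)) (X (i + 1ℤ)) S P))

      pre-V : ∀ s (P : Vec ℤ (suc n)) → pre (V i) s P ≡ pre (V (i - 1ℤ)) s P + pre (X i) s P
      pre-V s P = trans (pre-cong (V-pred i) s P) (pre-+ (V (i - 1ℤ)) (X i) s P)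

      pre-V⁺ : ∀ s (P : Vec ℤ (suc n)) → pre (V (i + 1ℤ)) s P ≡ pre (V (i - 1ℤ)) s P + pre (X i) s P + pre (X (i + 1ℤ)) s P
      pre-V⁺ s P = trans (pre-cong (V-succ i) s P) (trans (pre-+ (V i) (X (i + 1ℤ)) s P) (cong (_+ pre (X (i + 1ℤ)) s P) (pre-V s P)))

      pre-Vρ : ∀ s (P : Vec ℤ (suc n)) → pre (V i) s (map (ρ k) P) ≡ pre (V (i - 1ℤ)) s P + pre (X (i + 1ℤ)) s P
      pre-Vρ s P = trans (pre-map (V i) (ρ k) s P) (trans (pre-cong (λ z → V-ρ k i z d) s P) (pre-+ (V (i - 1ℤ)) (X (i + 1ℤ)) s P))

    ∑-Vρ-same : ∀ k i → ¬ Dvd (k + i) → ∀ S (P : Vec ℤ (suc n)) → ∑ (V i) S (map (ρ k) P) ≡ ∑ (V i) S P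
    ∑-Vρ-same k i ¬d S P = trans (∑-map (V i) (ρ k) S P) (∑-cong (λ z → fl-ρ-same k i z ¬d) S P)

    pre-Vρ-same : ∀ k i → ¬ Dvd (k + i) → ∀ s (P : Vec ℤ (suc n)) → pre (V i) s (map (ρ k) P) ≡ pre (V i) s P
    pre-Vρ-same k i ¬d s P = trans (pre-map (V i) (ρ k) s P) (pre-cong (λ z → fl-ρ-same k i z ¬d) s P)

    -- The lifting property. If the prefix of Y contains its step X i, the bound at level i - 1
    -- leaves room for one more unit. Otherwise, by `Desc`, the prefix contains neither step, and
    -- the bound at level i + 1 suffices.
    D-closed : ∀ k {P Y} → Good P → Desc k Y → D P Y → D (map (ρ k) P) Y
    D-closed k {P} {Y} gP desc dP i S with χ-view (k + i)
    ... | zero ¬d _ = subst (_≤ pre (V i) (size S) Y) (sym (∑-Vρ-same k i ¬d S P)) (dP i S)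
    ... | one d _ = subst₂ _≤_ (sym (∑-Vρ S P)) (sym (pre-V s Y)) (go (1ℤ ℤ.≤? pre (X i) s Y))
      where
      open Levels k i d
      s : ℕ
      s = (size S)
      a b c A B C : ℤ
      a = ∑ (V (i - 1ℤ)) S P
      b = ∑ (X i) S P
      c = ∑ (X (i + 1ℤ)) S P
      A = pre (V (i - 1ℤ)) s Y
      B = pre (X i) s Y
      C = pre (X (i + 1ℤ)) s Y
      e₁ : ∀ a c A B → (A + B) - (a + c) ≡ (A + 1ℤ + B) - (a + c + 1ℤ)
      e₁ = solve-∀
      e₂ : ∀ a b c A B C → (A + B) - (a + c) ≡ ((A + B + C) + b + B + 0ℤ) - ((a + b + c) + 0ℤ + C + B)
      e₂ = solve-∀
      go : Dec (1ℤ ≤ B) → a + c ≤ A + B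
      go (yes 1≤B) = lin (dP (i - 1ℤ) S ⊹ ∑X≤1 {P} gP (i + 1ℤ) S ⊹ 1≤B) (e₁ a c A B)
      go (no 1≰B) = lin (subst₂ _≤_ (∑-V⁺ S P) (pre-V⁺ s Y) (dP (i + 1ℤ) S) ⊹ ∑-nonneg (X-nonneg i) S P ⊹ desc i d s ⊹ B≤0) (e₂ a b c A B C)
        where
        e₃ : ∀ B → 0ℤ - B ≡ 1ℤ - (B + 1ℤ)
        e₃ = solve-∀
        B≤0 : B ≤ 0ℤ
        B≤0 = lin (≰⇒+1≤ 1≰B) (e₃ B)

    D-weaken : ∀ k {P Y} → Desc k Y → D P (map (ρ k) Y) → D P Y
    D-weaken k {P} {Y} desc dP i S with χ-view (k + i)
    ... | zero ¬d _ = subst (∑ (V i) S P ≤_) (pre-Vρ-same k i ¬d (size S) Y) (dP i S)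
    ... | one d _ = ℤ.≤-trans (dP i S) (subst₂ _≤_ (sym (pre-Vρ (size S) Y)) (sym (pre-V (size S) Y)) (ℤ.+-monoʳ-≤ (pre (V (i - 1ℤ)) (size S) Y) (desc i d (size S))))
      where
      open Levels k i d

    V-shift-≤ : ∀ {P Y : Vec ℤ (suc n)} i m S → ∑ (V i) S P ≤ pre (V i) (size S) Y → ∑ (V (i + N * m)) S P ≤ pre (V (i + N * m)) (size S) Y
    V-shift-≤ {P} {Y} i m S p = subst₂ _≤_
      (sym (trans (∑-cong (V-shift i m) S P) (trans (∑-+ (V i) (λ _ → m) S P) (cong (λ t → ∑ (V i) S P + t) (∑-const m S P)))))
      (sym (trans (pre-cong (V-shift i m) (size S) Y) (trans (pre-+ (V i) (λ _ → m) (size S) Y) (cong (λ t → pre (V i) (size S) Y + t) (pre-const m (size S) Y (Subset.∣p∣≤n S))))))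
      (p ⊹ ℤ.≤-refl {m * + size S})

    D-from-level : ∀ k {P Y : Vec ℤ (suc n)} → (∀ S → ∑ (V (- k)) S P ≤ pre (V (- k)) (size S) Y) →
      ∀ i → Dvd (k + i) → ∀ S → ∑ (V i) S P ≤ pre (V i) (size S) Y
    D-from-level k {P} {Y} p i (m , q) S = subst (λ t → ∑ (V t) S P ≤ pre (V t) (size S) Y) (trans (cong (λ t → - k + t) (sym q)) (e k i)) (V-shift-≤ {P} {Y} (- k) m S (p S))
      where
      e : ∀ k i → - k + (k + i) ≡ i
      e = solve-∀

    -- Suppose both alternatives fail, at sets S and T. Then S contains the entry of P that steps at
    -- i, T the one that steps at i + 1, and the union both. The bounds at level i + 1 for the union
    -- and at level i - 1 for the intersection then contradict concavity of the prefix sums of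
    -- `map (ρ k) Y`. Failure is decided at the single level - k by a search over subsets; the other
    -- levels of its class are translates.
    D-split : ∀ k {P Y} → Good P → Good Y → Desc k Y → AllPairs (λ x y → y ≤ x) (map (ρ k) Y) → D P Y → D P (map (ρ k) Y) ⊎ D (map (ρ k) P) (map (ρ k) Y)
    D-split k {P} {Y} gP gY desc dec dP
      with Subset.anySubset? (λ S → ¬? (∑ (V (- k)) S P ℤ.≤? pre (V (- k)) (size S) (map (ρ k) Y)))
         | Subset.anySubset? (λ S → ¬? (∑ (V (- k)) S (map (ρ k) P) ℤ.≤? pre (V (- k)) (size S) (map (ρ k) Y)))
    ... | no none | _ = inj₁ λ i S → go i S (χ-view (k + i))
      where
      ok : ∀ S → ∑ (V (- k)) S P ≤ pre (V (- k)) (size S) (map (ρ k) Y)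
      ok S with ∑ (V (- k)) S P ℤ.≤? pre (V (- k)) (size S) (map (ρ k) Y)
      ... | yes p = p
      ... | no ¬p = ⊥-elim (none (S , ¬p))
      go : ∀ i S → χView (k + i) → ∑ (V i) S P ≤ pre (V i) (size S) (map (ρ k) Y)
      go i S (zero ¬d _) = subst (∑ (V i) S P ≤_) (sym (pre-Vρ-same k i ¬d (size S) Y)) (dP i S)
      go i S (one d _) = D-from-level k {P} {map (ρ k) Y} ok i d S
    ... | yes _ | no none = inj₂ λ i S → go i S (χ-view (k + i))
      where
      ok : ∀ S → ∑ (V (- k)) S (map (ρ k) P) ≤ pre (V (- k)) (size S) (map (ρ k) Y)
      ok S with ∑ (V (- k)) S (map (ρ k) P) ℤ.≤? pre (V (- k)) (size S) (map (ρ k) Y)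
      ... | yes p = p
      ... | no ¬p = ⊥-elim (none (S , ¬p))
      go : ∀ i S → χView (k + i) → ∑ (V i) S (map (ρ k) P) ≤ pre (V i) (size S) (map (ρ k) Y)
      go i S (zero ¬d _) = subst₂ _≤_ (sym (∑-Vρ-same k i ¬d S P)) (sym (pre-Vρ-same k i ¬d (size S) Y)) (dP i S)
      go i S (one d _) = D-from-level k {map (ρ k) P} {map (ρ k) Y} ok i d S
    ... | yes (S , ¬S) | yes (T , ¬T) = ⊥-elim impossible
      where
      i : ℤ
      i = - k
      d : Dvd (k + i)
      d = subst Dvd (sym (ℤ.+-inverseʳ k)) Dvd-0
      open Levels k i d
      U I : Subset (suc n)
      U = S ∪ T
      I = S ∩ T
      a b c : Subset (suc n) → ℤ
      a R = ∑ (V (i - 1ℤ)) R P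
      b R = ∑ (X i) R P
      c R = ∑ (X (i + 1ℤ)) R P
      A B C : Subset (suc n) → ℤ
      A R = pre (V (i - 1ℤ)) (size R) Y
      B R = pre (X i) (size R) Y
      C R = pre (X (i + 1ℤ)) (size R) Y
      vS : A S + C S + 1ℤ ≤ a S + b S
      vS = subst₂ (λ x y → x + 1ℤ ≤ y) (pre-Vρ (size S) Y) (∑-V S P) (≰⇒+1≤ ¬S)
      vT : A T + C T + 1ℤ ≤ a T + c T
      vT = subst₂ (λ x y → x + 1ℤ ≤ y) (pre-Vρ (size T) Y) (∑-Vρ T P) (≰⇒+1≤ ¬T)
      0≤C : ∀ R → 0ℤ ≤ C R
      0≤C R = pre-nonneg (X-nonneg (i + 1ℤ)) (size R) Y
      B≤1 : ∀ R → B R ≤ 1ℤ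
      B≤1 R = subst (B R ≤_) (∑X-total {Y} gY i) (pre≤∑⊤ (X-nonneg i) (size R) Y)
      -- Level i - 1 is not violated, so the excess can only come from the unit step, which
      -- therefore falls inside S.
      bS : C S + 1ℤ ≤ b S
      bS = lin (vS ⊹ dP (i - 1ℤ) S) (f₁ (a S) (b S) (A S) (C S))
        where
        f₁ : ∀ a b A C → b - (C + 1ℤ) ≡ (a + b + A) - (A + C + 1ℤ + a)
        f₁ = solve-∀
      cT : C T + 1ℤ ≤ c T
      cT = lin (vT ⊹ dP (i - 1ℤ) T) (f₁ (a T) (c T) (A T) (C T))
        where
        f₁ : ∀ a b A C → b - (C + 1ℤ) ≡ (a + b + A) - (A + C + 1ℤ + a)
        f₁ = solve-∀
      c∪ : c T ≤ c U
      c∪ = subst (λ R → c T ≤ c R) (Subset.∪-comm T S) (∑-∪ˡ (X-nonneg (i + 1ℤ)) T S P)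
      b∪ : b S ≤ b U
      b∪ = ∑-∪ˡ (X-nonneg i) S T P
      conc : (A U + C U) + (A I + C I) ≤ (A S + C S) + (A T + C T)
      conc = subst₂ _≤_ (cong₂ _+_ (pre-Vρ (size U) Y) (pre-Vρ (size I) Y)) (cong₂ _+_ (pre-Vρ (size S) Y) (pre-Vρ (size T) Y))
        (pre-submodular {V i} S T (map (ρ k) Y) (AllPairs.map (λ {x} {y} y≤x → subst (_≤ V i x) (sym (ℤ.+-identityʳ (V i y))) (fl-mono (y≤x ⊹ ℤ.≤-refl {i}))) dec))
      top : a U + b U + c U ≤ A U + B U + C U
      top = subst₂ _≤_ (∑-V⁺ U P) (pre-V⁺ (size U) Y) (dP (i + 1ℤ) U)
      modular : a S + a T ≤ a U + a I
      modular = ℤ.≤-reflexive (sym (∑-modular (V (i - 1ℤ)) S T P))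
      impossible : ⊥
      impossible = absurd
        (vS ⊹ vT ⊹ ∑X≤1 {P} gP i S ⊹ ∑X≤1 {P} gP (i + 1ℤ) T ⊹ bS ⊹ b∪ ⊹ cT ⊹ c∪ ⊹ conc ⊹ top ⊹ modular ⊹ dP (i - 1ℤ) I ⊹ B≤1 U ⊹ 0≤C I ⊹ 0≤C S ⊹ 0≤C T)
        (e (a S) (b S) (c S) (a T) (c T) (a U) (b U) (c U) (a I) (A S) (C S) (A T) (C T) (A U) (B U) (C U) (A I) (C I))
        where
        e : ∀ aS bS cS aT cT aU bU cU aI AS CS AT CT AU BU CU AI CI →
          (AS + CS + 1ℤ) + (AT + CT + 1ℤ) + bS + cT + (CS + 1ℤ) + bS + (CT + 1ℤ) + cT + (AU + CU + (AI + CI)) + (aU + bU + cU) + (aS + aT) + aI + BU + 0ℤ + 0ℤ + 0ℤ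
          - ((aS + bS) + (aT + cT) + 1ℤ + 1ℤ + bS + bU + cT + cU + ((AS + CS) + (AT + CT)) + (AU + BU + CU) + (aU + aI) + AI + 1ℤ + CI + CS + CT) ≡ 1ℤ
        e = solve-∀

  -- Decreasing vectors and runs of consecutive integers

  ℤ-induction : (Q : ℤ → Set) → Q 0ℤ → (∀ i → Q i → Q (i + 1ℤ)) → (∀ i → Q (i + 1ℤ) → Q i) → ∀ i → Q i
  ℤ-induction Q q₀ up down (+ m) = go m
    where
    go : ∀ m → Q (+ m)
    go zero = q₀
    go (suc m) = subst Q (cong +_ (ℕ.+-comm m 1)) (up (+ m) (go m))
  ℤ-induction Q q₀ up down -[1+ m ] = go m
    where
    go : ∀ m → Q -[1+ m ]
    go zero = down -[1+ 0 ] q₀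
    go (suc m) = down -[1+ suc m ] (go m)

  ∑-zero : ∀ {h m} (P : Vec ℤ m) → All (λ x → h x ≡ 0ℤ) P → ∑ h ⊤ˢ P ≡ 0ℤ
  ∑-zero [] [] = refl
  ∑-zero (x ∷ P) (p ∷ ps) = cong₂ _+_ p (∑-zero P ps)

  ∈⇒≤∑ : ∀ {h m} → (∀ x → 0ℤ ≤ h x) → {P : Vec ℤ m} → ∀ {x} → x ∈ P → h x ≤ ∑ h ⊤ˢ P
  ∈⇒≤∑ {h} nn {x ∷ P} (here refl) = subst (_≤ h x + ∑ h ⊤ˢ P) (ℤ.+-identityʳ (h x)) (ℤ.+-monoʳ-≤ (h x) (∑-nonneg nn ⊤ˢ P))
  ∈⇒≤∑ {h} nn {y ∷ P} {x} (there i) = subst (_≤ h y + ∑ h ⊤ˢ P) (ℤ.+-identityˡ (h x)) (nn y ⊹ ∈⇒≤∑ nn i)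

  All-from-∈ : ∀ {m} {Q : ℤ → Set} (P : Vec ℤ m) → (∀ x → x ∈ P → Q x) → All Q P
  All-from-∈ [] f = []
  All-from-∈ (x ∷ P) f = f x (here refl) ∷ All-from-∈ P (λ y i → f y (there i))

  All⇒∈ : ∀ {m} {Q : ℤ → Set} {P : Vec ℤ m} → All Q P → ∀ {x} → x ∈ P → Q x
  All⇒∈ (p ∷ _) (here refl) = p
  All⇒∈ (_ ∷ ps) (there i) = All⇒∈ ps i

  ∈-map⁻ : ∀ {m} (f : ℤ → ℤ) (P : Vec ℤ m) {y} → y ∈ map f P → ∃ λ x → x ∈ P × y ≡ f x
  ∈-map⁻ f (x ∷ P) (here p) = x , here refl , p
  ∈-map⁻ f (x ∷ P) (there i) with ∈-map⁻ f P i
  ... | z , j , q = z , there j , q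

  Decr : ∀ {m} → Vec ℤ m → Set
  Decr = AllPairs (λ x y → y + 1ℤ ≤ x)

  Decr-≤ : ∀ {m} {Y : Vec ℤ m} → Decr Y → AllPairs (λ x y → y ≤ x) Y
  Decr-≤ = AllPairs.map (λ {x} {y} p → lin (p ⊹ +≤+ (z≤n {1})) (e x y))
    where
    e : ∀ x y → x - y ≡ (x + 1ℤ) - (y + 1ℤ + 0ℤ)
    e = solve-∀

  -- A pigeonhole argument that needs no permutations: in decreasing vectors the heads are the
  -- largest values, so they can be stripped together. `Decr-⊆-≡` then makes a decreasing
  -- rearrangement unique.
  Decr-⊆-length : ∀ {p q} (Y : Vec ℤ p) (Z : Vec ℤ q) → Decr Y → Decr Z → All (_∈ Z) Y → p ℕ.≤ q
  Decr-⊆-tail : ∀ {p q y z} (Y : Vec ℤ p) (Z : Vec ℤ q) → All (λ x → x + 1ℤ ≤ y) Y → y ≤ z → All (_∈ (z ∷ Z)) Y → All (_∈ Z) Y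

  Decr-⊆-tail [] Z [] _ [] = []
  Decr-⊆-tail {y = y} {z} (x ∷ Y) Z (p ∷ ps) y≤z (here refl ∷ is) = ⊥-elim (absurd (p ⊹ y≤z) (e x y))
    where
    e : ∀ x y → x + 1ℤ + y - (y + x) ≡ 1ℤ
    e = solve-∀
  Decr-⊆-tail (x ∷ Y) Z (_ ∷ ps) y≤z (there i ∷ is) = i ∷ Decr-⊆-tail Y Z ps y≤z is

  Decr-⊆-length [] Z _ _ _ = z≤n
  Decr-⊆-length (y ∷ Y) (z ∷ Z) (py ∷ dY) (pz ∷ dZ) (here refl ∷ is) = s≤s (Decr-⊆-length Y Z dY dZ (Decr-⊆-tail Y Z py ℤ.≤-refl is))
  Decr-⊆-length (y ∷ Y) (z ∷ Z) (py ∷ dY) (pz ∷ dZ) (there i ∷ is) = s≤s (Decr-⊆-length Y Z dY dZ (Decr-⊆-tail Y Z py y≤z is))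
    where
    e : ∀ y z → z - y ≡ z + 1ℤ - (y + 1ℤ + 0ℤ)
    e = solve-∀
    y≤z : y ≤ z
    y≤z = lin (All⇒∈ pz i ⊹ +≤+ (z≤n {1})) (e y z)

  Decr-⊆-≡ : ∀ {p} (Y Z : Vec ℤ p) → Decr Y → Decr Z → All (_∈ Z) Y → Y ≡ Z
  Decr-⊆-≡ [] [] _ _ _ = refl
  Decr-⊆-≡ (y ∷ Y) (z ∷ Z) (py ∷ dY) (pz ∷ dZ) (here refl ∷ is) = cong (y ∷_) (Decr-⊆-≡ Y Z dY dZ (Decr-⊆-tail Y Z py ℤ.≤-refl is))
  Decr-⊆-≡ (y ∷ Y) (z ∷ Z) d@(py ∷ dY) (pz ∷ dZ) (there i ∷ is) = ⊥-elim (ℕ.<-irrefl refl (Decr-⊆-length (y ∷ Y) Z d dZ (i ∷ Decr-⊆-tail Y Z py y≤z is)))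
    where
    e : ∀ y z → z - y ≡ z + 1ℤ - (y + 1ℤ + 0ℤ)
    e = solve-∀
    y≤z : y ≤ z
    y≤z = lin (All⇒∈ pz i ⊹ +≤+ (z≤n {1})) (e y z)

  upFrom : ℤ → ∀ m → Vec ℤ m
  upFrom x zero = []
  upFrom x (suc m) = x ∷ upFrom (x + 1ℤ) m

  downFrom : ℤ → ∀ m → Vec ℤ m
  downFrom x zero = []
  downFrom x (suc m) = x ∷ downFrom (x - 1ℤ) m

  lookup-upFrom : ∀ x m (c : Fin m) → lookup (upFrom x m) c ≡ x + + toℕ c
  lookup-upFrom x (suc m) Fin.zero = sym (ℤ.+-identityʳ x)
  lookup-upFrom x (suc m) (Fin.suc c) = trans (lookup-upFrom (x + 1ℤ) m c) (ℤ.+-assoc x 1ℤ (+ toℕ c))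

  downFrom-shift : ∀ x d m → downFrom (x + d) m ≡ map (_+ d) (downFrom x m)
  downFrom-shift x d zero = refl
  downFrom-shift x d (suc m) = cong ((x + d) ∷_) (trans (cong (λ t → downFrom t m) (e x d)) (downFrom-shift (x - 1ℤ) d m))
    where
    e : ∀ x d → x + d - 1ℤ ≡ x - 1ℤ + d
    e = solve-∀

  upFrom-bounds : ∀ x m → All (λ z → x ≤ z × z + 1ℤ ≤ x + + m) (upFrom x m)
  upFrom-bounds x zero = []
  upFrom-bounds x (suc m) = (ℤ.≤-refl , lin (+≤+ (z≤n {m})) (e x (+ m))) ∷ All.map (λ {z} (a , b) → lin (a ⊹ +≤+ (z≤n {1})) (e₁ x z) , ℤ.≤-trans b (ℤ.≤-reflexive (ℤ.+-assoc x 1ℤ (+ m)))) (upFrom-bounds (x + 1ℤ) m)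
    where
    e : ∀ x m → x + (1ℤ + m) - (x + 1ℤ) ≡ m - 0ℤ
    e = solve-∀
    e₁ : ∀ x z → z - x ≡ z + 1ℤ - (x + 1ℤ + 0ℤ)
    e₁ = solve-∀

  downFrom-bounds : ∀ x m → All (λ z → z ≤ x × x + 1ℤ ≤ z + + m) (downFrom x m)
  downFrom-bounds x zero = []
  downFrom-bounds x (suc m) = (ℤ.≤-refl , lin (+≤+ (z≤n {m})) (e x (+ m))) ∷ All.map (λ {z} (a , b) → lin (a ⊹ +≤+ (z≤n {1})) (e₁ x z) , lin b (e₂ x z (+ m))) (downFrom-bounds (x - 1ℤ) m)
    where
    e : ∀ x m → x + (1ℤ + m) - (x + 1ℤ) ≡ m - 0ℤ
    e = solve-∀
    e₁ : ∀ x z → x - z ≡ x - 1ℤ + 1ℤ - (z + 0ℤ)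
    e₁ = solve-∀
    e₂ : ∀ x z m → z + (1ℤ + m) - (x + 1ℤ) ≡ z + m - (x - 1ℤ + 1ℤ)
    e₂ = solve-∀

  downFrom-Decr : ∀ x m → Decr (downFrom x m)
  downFrom-Decr x zero = []
  downFrom-Decr x (suc m) = All.map (λ {z} (a , _) → lin a (e x z)) (downFrom-bounds (x - 1ℤ) m) ∷ downFrom-Decr (x - 1ℤ) m
    where
    e : ∀ x z → x - (z + 1ℤ) ≡ x - 1ℤ - z
    e = solve-∀

  pre-downFrom-⊆ : ∀ h s y m → s ℕ.≤ m → pre h s (downFrom y (suc m)) ≡ pre h s (downFrom y m)
  pre-downFrom-⊆ h zero y m _ = refl
  pre-downFrom-⊆ h (suc s) y (suc m) (s≤s s≤m) = cong (λ t → h y + t) (pre-downFrom-⊆ h s (y - 1ℤ) m s≤m)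

  pre-downFrom-suc : ∀ h s y m → s ℕ.≤ m → pre h (suc s) (downFrom y (suc m)) ≡ pre h s (downFrom y m) + h (y - + s)
  pre-downFrom-suc h zero y m _ = trans (ℤ.+-comm (h y) 0ℤ) (cong (λ t → 0ℤ + h t) (sym (ℤ.+-identityʳ y)))
  pre-downFrom-suc h (suc s) y (suc m) (s≤s s≤m) = trans (cong (λ t → h y + t) (pre-downFrom-suc h s (y - 1ℤ) m s≤m))
    (trans (sym (ℤ.+-assoc (h y) _ _)) (cong (λ t → h y + pre h s (downFrom (y - 1ℤ) m) + h t) (e y (+ s))))
    where
    e : ∀ y s → y - 1ℤ - s ≡ y - (1ℤ + s)
    e = solve-∀

  -- The smallest chosen entry of the increasing run is matched with the last term of the prefix of
  -- the decreasing run, and so on. This puts the identity below w₀ in the vertex order.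
  ∑-upFrom≤pre-downFrom : ∀ {h} → (∀ {x y} → x ≤ y → h x ≤ h y) → ∀ m x y (S : Subset m) → y + 1ℤ ≡ x + + m →
    ∑ h S (upFrom x m) ≤ pre h (size S) (downFrom y m)
  ∑-upFrom≤pre-downFrom mono zero x y [] _ = ℤ.≤-refl
  ∑-upFrom≤pre-downFrom {h} mono (suc m) x y (false ∷ S) p =
    subst (∑ h S (upFrom (x + 1ℤ) m) ≤_) (sym (pre-downFrom-⊆ h (size S) y m (Subset.∣p∣≤n S)))
      (∑-upFrom≤pre-downFrom {h} mono m (x + 1ℤ) y S (trans p (sym (ℤ.+-assoc x 1ℤ (+ m)))))
  ∑-upFrom≤pre-downFrom {h} mono (suc m) x y (true ∷ S) p =
    subst (h x + ∑ h S (upFrom (x + 1ℤ) m) ≤_) (trans (ℤ.+-comm (h (y - + size S)) _) (sym (pre-downFrom-suc h (size S) y m (Subset.∣p∣≤n S))))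
      (mono {x} {y - + size S} (lin (+≤+ (Subset.∣p∣≤n S) ⊹ ℤ.≤-reflexive (sym p)) (e x y (+ m) (+ size S)))
       ⊹ ∑-upFrom≤pre-downFrom {h} mono m (x + 1ℤ) y S (trans p (sym (ℤ.+-assoc x 1ℤ (+ m)))))
    where
    e : ∀ x y m s → y - s - x ≡ m + (y + 1ℤ) - (s + (x + (1ℤ + m)))
    e = solve-∀

  -- Signed length

  module Path (n : ℕ) (1≤n : 1 ℕ.≤ n) where

    open Order n 1≤n public

    Distinct : ∀ {m} → Vec ℤ m → Set
    Distinct = AllPairs (λ x y → ¬ Dvd (x - y))

    private
      a+-a : ∀ a → a + - a ≡ 0ℤ
      a+-a = solve-∀
      -swap : ∀ x y → - (x - y) ≡ y + - x
      -swap = solve-∀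

    X-hit : ∀ {i z} → Dvd (z + i) → X i z ≡ 1ℤ
    X-hit = Dvd⇒χ≡1

    -- Two entries congruent to x would both step at i = - x, making that sum at least two.
    distinct-from-≤1 : ∀ {m} (P : Vec ℤ m) → (∀ i → ∑ (X i) ⊤ˢ P ≤ 1ℤ) → Distinct P
    distinct-from-≤1 [] _ = []
    distinct-from-≤1 (x ∷ P) b = All-from-∈ P (λ y i d → absurd (b (- x) ⊹ ∈⇒≤∑ (X-nonneg (- x)) i ⊹ ℤ.≤-reflexive (sym (X-hit { - x } {x} (subst Dvd (sym (a+-a x)) Dvd-0))) ⊹ ℤ.≤-reflexive (sym (X-hit { - x } {y} (subst Dvd (-swap x y) (Dvd-neg d)))))
        (e (X (- x) x) (∑ (X (- x)) ⊤ˢ P) (X (- x) y)))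
      ∷ distinct-from-≤1 P (λ i → ℤ.≤-trans (subst (_≤ X i x + ∑ (X i) ⊤ˢ P) (ℤ.+-identityˡ _) (X-nonneg i x ⊹ ℤ.≤-refl {∑ (X i) ⊤ˢ P})) (b i))
      where
      e : ∀ a s c → a + s + c + 1ℤ + 1ℤ - (1ℤ + s + a + c) ≡ 1ℤ
      e = solve-∀

    Good⇒Distinct : ∀ {P} → Good P → Distinct P
    Good⇒Distinct {P} g = distinct-from-≤1 P (λ i → ∑X≤1 {P} g i ⊤ˢ)

    distinct-unique : ∀ {m} {P : Vec ℤ m} → Distinct P → ∀ {x y} → x ∈ P → y ∈ P → Dvd (x - y) → x ≡ y
    distinct-unique (p ∷ ps) (here refl) (here refl) d = refl
    distinct-unique (p ∷ ps) (here refl) (there j) d = ⊥-elim (All⇒∈ p j d)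
    distinct-unique (p ∷ ps) {x} {y} (there i) (here refl) d = ⊥-elim (All⇒∈ p i (subst Dvd (-swap x y) (Dvd-neg d)))
    distinct-unique (p ∷ ps) (there i) (there j) d = distinct-unique ps i j d

    find-hit : ∀ {m} i (P : Vec ℤ m) → (∃ λ x → x ∈ P × Dvd (x + i)) ⊎ (∑ (X i) ⊤ˢ P ≡ 0ℤ)
    find-hit i [] = inj₂ refl
    find-hit i (x ∷ P) with χ-view (x + i) | find-hit i P
    ... | one d _ | _ = inj₁ (x , here refl , d)
    ... | zero _ _ | inj₁ (y , j , d) = inj₁ (y , there j , d)
    ... | zero _ p | inj₂ q = inj₂ (cong₂ _+_ p q)

    -- ps a b P counts the pairs x, y of entries, x standing before y, with N ∣ x + a and N ∣ y + b.
    ps : ℤ → ℤ → ∀ {m} → Vec ℤ m → ℤ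
    ps a b [] = 0ℤ
    ps a b (x ∷ P) = X a x * ∑ (X b) ⊤ˢ P + ps a b P

    *-nonneg : ∀ {a b} → 0ℤ ≤ a → 0ℤ ≤ b → 0ℤ ≤ a * b
    *-nonneg {+ a} {+ b} _ _ = subst (0ℤ ≤_) (ℤ.pos-* a b) (+≤+ z≤n)

    ps-nonneg : ∀ a b {m} (P : Vec ℤ m) → 0ℤ ≤ ps a b P
    ps-nonneg a b [] = ℤ.≤-refl
    ps-nonneg a b (x ∷ P) = *-nonneg (X-nonneg a x) (∑-nonneg (X-nonneg b) ⊤ˢ P) ⊹ ps-nonneg a b P

    ps-product : ∀ a b {m} (P : Vec ℤ m) → ps a b P + ps b a P + ∑ (λ x → X a x * X b x) ⊤ˢ P ≡ ∑ (X a) ⊤ˢ P * ∑ (X b) ⊤ˢ P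
    ps-product a b [] = refl
    ps-product a b (x ∷ P) = trans (e₁ (X a x) (X b x) (∑ (X a) ⊤ˢ P) (∑ (X b) ⊤ˢ P) (ps a b P) (ps b a P) (∑ (λ x → X a x * X b x) ⊤ˢ P))
      (trans (cong (λ t → X a x * ∑ (X b) ⊤ˢ P + X b x * ∑ (X a) ⊤ˢ P + X a x * X b x + t) (ps-product a b P)) (e₂ (X a x) (X b x) (∑ (X a) ⊤ˢ P) (∑ (X b) ⊤ˢ P)))
      where
      e₁ : ∀ α β A B p q d → α * B + p + (β * A + q) + (α * β + d) ≡ α * B + β * A + α * β + (p + q + d)
      e₁ = solve-∀
      e₂ : ∀ α β A B → α * B + β * A + α * β + A * B ≡ (α + A) * (β + B)
      e₂ = solve-∀

    -- `asc` detects residue k - 1 standing before residue k, `dsc` the opposite order. By `L0-ρ`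
    -- the k-th generator raises or lowers `L0` accordingly.
    asc dsc : ℤ → ∀ {m} → Vec ℤ m → ℤ
    asc k P = ps (- k + 1ℤ) (- k) P
    dsc k P = ps (- k) (- k + 1ℤ) P

    X-exclusive : ∀ i x → X (i + 1ℤ) x * X i x ≡ 0ℤ
    X-exclusive i x with χ-view (x + i)
    ... | zero _ p = trans (cong (X (i + 1ℤ) x *_) p) (ℤ.*-zeroʳ (X (i + 1ℤ) x))
    ... | one d _ = trans (cong (_* X i x) (¬Dvd⇒χ≡0 (λ d′ → ¬Dvd-consecutive d (subst Dvd (sym (ℤ.+-assoc x i 1ℤ)) d′)))) (ℤ.*-zeroˡ (X i x))

    -- Each of the two residues occurs once, so the product of their counts is 1; no entry has both,
    -- so this 1 comes from one of the two orders.
    asc+dsc : ∀ k {P} → Good P → asc k P + dsc k P ≡ 1ℤ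
    asc+dsc k {P} g = trans (sym (ℤ.+-identityʳ _)) (trans (cong (λ t → asc k P + dsc k P + t) (sym (∑-zero P (All-from-∈ P (λ x _ → X-exclusive (- k) x)))))
      (trans (ps-product (- k + 1ℤ) (- k) P) (cong₂ _*_ (∑X-total {P} g (- k + 1ℤ)) (∑X-total {P} g (- k)))))

    asc-or-dsc : ∀ k {P} → Good P → (asc k P ≡ 1ℤ × dsc k P ≡ 0ℤ) ⊎ (asc k P ≡ 0ℤ × dsc k P ≡ 1ℤ)
    asc-or-dsc k {P} g with 1ℤ ℤ.≤? asc k P
    ... | yes p = inj₁ (ℤ.≤-antisym (lin (ps-nonneg (- k) (- k + 1ℤ) P ⊹ ℤ.≤-reflexive (asc+dsc k {P} g)) (e₁ (asc k P) (dsc k P))) p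
                       , ℤ.≤-antisym (lin (p ⊹ ℤ.≤-reflexive (asc+dsc k {P} g)) (e₂ (asc k P) (dsc k P))) (ps-nonneg (- k) (- k + 1ℤ) P))
      where
      e₁ : ∀ a d → 1ℤ - a ≡ d + 1ℤ - (0ℤ + (a + d))
      e₁ = solve-∀
      e₂ : ∀ a d → 0ℤ - d ≡ a + 1ℤ - (1ℤ + (a + d))
      e₂ = solve-∀
    ... | no ¬p = inj₂ (a≡0 , trans (sym (ℤ.+-identityˡ (dsc k P))) (trans (cong (_+ dsc k P) (sym a≡0)) (asc+dsc k {P} g)))
      where
      e : ∀ a → 0ℤ - a ≡ 1ℤ - (a + 1ℤ)
      e = solve-∀
      a≡0 : asc k P ≡ 0ℤ
      a≡0 = ℤ.≤-antisym (lin (≰⇒+1≤ ¬p) (e (asc k P))) (ps-nonneg (- k + 1ℤ) (- k) P)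

    ps-zero : ∀ a b {m} (P : Vec ℤ m) → ps a b P ≡ 0ℤ → AllPairs (λ x y → ¬ (Dvd (x + a) × Dvd (y + b))) P
    ps-zero a b [] _ = []
    ps-zero a b (x ∷ P) p = All-from-∈ P (λ y i (d , d′) → 1≰0 (bound y i d d′)) ∷ ps-zero a b P p₂
      where
      f₁ : 0ℤ ≤ X a x * ∑ (X b) ⊤ˢ P
      f₁ = *-nonneg (X-nonneg a x) (∑-nonneg (X-nonneg b) ⊤ˢ P)
      e₁ : ∀ s t → 0ℤ - t ≡ s + 0ℤ - (0ℤ + (s + t))
      e₁ = solve-∀
      e₂ : ∀ s t → 0ℤ - s ≡ t + 0ℤ - (0ℤ + (s + t))
      e₂ = solve-∀
      p₂ : ps a b P ≡ 0ℤ
      p₂ = ℤ.≤-antisym (lin (f₁ ⊹ ℤ.≤-reflexive p) (e₁ (X a x * ∑ (X b) ⊤ˢ P) (ps a b P))) (ps-nonneg a b P)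
      p₁ : X a x * ∑ (X b) ⊤ˢ P ≤ 0ℤ
      p₁ = lin (ps-nonneg a b P ⊹ ℤ.≤-reflexive p) (e₂ (X a x * ∑ (X b) ⊤ˢ P) (ps a b P))
      bound : ∀ y → y ∈ P → Dvd (x + a) → Dvd (y + b) → 1ℤ ≤ 0ℤ
      bound y i d d′ = ℤ.≤-trans (subst (_≤ ∑ (X b) ⊤ˢ P) (X-hit {b} {y} d′) (∈⇒≤∑ (X-nonneg b) i))
        (subst (_≤ 0ℤ) (trans (cong (_* ∑ (X b) ⊤ˢ P) (X-hit {a} {x} d)) (ℤ.*-identityˡ _)) p₁)

    ps-zero⁻ : ∀ a b {m} (P : Vec ℤ m) → AllPairs (λ x y → ¬ (Dvd (x + a) × Dvd (y + b))) P → ps a b P ≡ 0ℤ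
    ps-zero⁻ a b [] _ = refl
    ps-zero⁻ a b (x ∷ P) (q ∷ qs) with χ-view (x + a)
    ... | zero _ p = cong₂ _+_ (trans (cong (_* ∑ (X b) ⊤ˢ P) p) (ℤ.*-zeroˡ (∑ (X b) ⊤ˢ P))) (ps-zero⁻ a b P qs)
    ... | one d _ = cong₂ _+_ (trans (cong (X a x *_) (∑-zero P (All.map (λ ¬dd → ¬Dvd⇒χ≡0 (λ d′ → ¬dd (d , d′))) q))) (ℤ.*-zeroʳ (X a x))) (ps-zero⁻ a b P qs)

    ps-witness : ∀ a b {m} {R : ℤ → ℤ → Set} (P : Vec ℤ m) → AllPairs R P → ps a b P ≡ 1ℤ →
      ∃ λ x → ∃ λ y → x ∈ P × y ∈ P × R x y × Dvd (x + a) × Dvd (y + b)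
    ps-witness a b [] _ ()
    ps-witness a b (x ∷ P) (r ∷ rs) p with χ-view (x + a) | find-hit b P
    ... | one d _ | inj₁ (y , j , d′) = x , y , here refl , there j , All⇒∈ r j , d , d′
    ... | one d _ | inj₂ q = let (x′ , y′ , i , j , s) = ps-witness a b P rs (trans (sym (trans (cong (λ t → X a x * t + ps a b P) q) (trans (cong (_+ ps a b P) (ℤ.*-zeroʳ (X a x))) (ℤ.+-identityˡ _)))) p) in x′ , y′ , there i , there j , s
    ... | zero _ q | _ = let (x′ , y′ , i , j , s) = ps-witness a b P rs (trans (sym (trans (cong (λ t → t * ∑ (X b) ⊤ˢ P + ps a b P) q) (trans (cong (_+ ps a b P) (ℤ.*-zeroˡ (∑ (X b) ⊤ˢ P))) (ℤ.+-identityˡ _)))) p) in x′ , y′ , there i , there j , s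

    Desc-from-asc : ∀ k {Y} → Good Y → asc k Y ≡ 0ℤ → Desc k Y
    Desc-from-asc k {Y} g p i d s = subst₂ _≤_ (pre-cong (λ z → sym (conv′ z)) s Y) (pre-cong (λ z → sym (conv z)) s Y)
      (go s Y (ps-zero (- k + 1ℤ) (- k) Y p) (∑X-total {Y} g (- k)) (ℤ.≤-reflexive (∑X-total {Y} g (- k + 1ℤ))))
      where
      e : ∀ z k i → k + i ≡ (z + i) - (z + - k)
      e = solve-∀
      e′ : ∀ z k i → k + i ≡ (z + (i + 1ℤ)) - (z + (- k + 1ℤ))
      e′ = solve-∀
      conv : ∀ z → X i z ≡ X (- k) z
      conv z = χ-cong-Dvd (subst Dvd (e z k i) d)
      conv′ : ∀ z → X (i + 1ℤ) z ≡ X (- k + 1ℤ) z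
      conv′ z = χ-cong-Dvd (subst Dvd (e′ z k i) d)
      u u′ : ℤ → ℤ
      u = X (- k)
      u′ = X (- k + 1ℤ)
      go : ∀ s {m} (P : Vec ℤ m) → AllPairs (λ x y → ¬ (Dvd (x + (- k + 1ℤ)) × Dvd (y + - k))) P → ∑ u ⊤ˢ P ≡ 1ℤ → ∑ u′ ⊤ˢ P ≤ 1ℤ → pre u′ s P ≤ pre u s P
      go zero P _ _ _ = ℤ.≤-refl
      go (suc s) [] _ _ _ = ℤ.≤-refl
      go (suc s) (x ∷ P) (q ∷ qs) t₁ t₂ with χ-view (x + - k)
      ... | one _ r = ℤ.≤-trans (ℤ.≤-trans (pre≤∑⊤ (X-nonneg (- k + 1ℤ)) (suc s) (x ∷ P)) t₂)
            (subst (λ t → 1ℤ ≤ t + pre u s P) (sym r) (ℤ.+-monoʳ-≤ 1ℤ (pre-nonneg (X-nonneg (- k)) s P)))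
      ... | zero _ r = ℤ.≤-trans (ℤ.≤-reflexive (cong (_+ pre u′ s P) (trans u′0 (sym r)))) (ℤ.+-monoʳ-≤ (u x) (go s P qs t₁′ (ℤ.≤-trans (subst (_≤ u′ x + ∑ u′ ⊤ˢ P) (ℤ.+-identityˡ _) (X-nonneg (- k + 1ℤ) x ⊹ ℤ.≤-refl {∑ u′ ⊤ˢ P})) t₂)))
        where
        t₁′ : ∑ u ⊤ˢ P ≡ 1ℤ
        t₁′ = trans (sym (ℤ.+-identityˡ _)) (trans (cong (_+ ∑ u ⊤ˢ P) (sym r)) t₁)
        u′0 : u′ x ≡ 0ℤ
        u′0 with find-hit (- k) P
        ... | inj₁ (y , j , d″) = ¬Dvd⇒χ≡0 (λ d‴ → All⇒∈ q j (d‴ , d″))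
        ... | inj₂ q₀ with trans (sym q₀) t₁′
        ...   | ()

    -- For a dominant alcove this is the number of hyperplanes separating it from the alcove of w₀;
    -- in general such hyperplanes count with a sign. Accordingly its value at the identity is minus
    -- the length of w₀.
    L0 : ∀ {m} → Vec ℤ m → ℤ
    L0 [] = 0ℤ
    L0 (x ∷ P) = ∑ (λ y → fl (x - y)) ⊤ˢ P + L0 P

    private
      χ-X : ∀ x k → χ (x - k + 1ℤ) ≡ X (- k + 1ℤ) x
      χ-X x k = cong χ (ℤ.+-assoc x (- k) 1ℤ)

    fl-ρ-pair′ : ∀ k x y → ¬ Dvd (x - y) → fl (ρ k x - ρ k y) ≡ fl (x - y) - X (- k) x * X (- k + 1ℤ) y + X (- k + 1ℤ) x * X (- k) y
    fl-ρ-pair′ k x y ¬d = trans (fl-ρ-pair k x y ¬d) (cong₂ (λ s t → fl (x - y) - X (- k) x * s + t * X (- k) y) (χ-X y k) (χ-X x k))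

    L0-ρ : ∀ k {m} (P : Vec ℤ m) → Distinct P → L0 (map (ρ k) P) ≡ L0 P - dsc k P + asc k P
    L0-ρ k [] _ = refl
    L0-ρ k (x ∷ P) (q ∷ qs) = trans (cong₂ _+_ (row P q) (L0-ρ k P qs))
        (e (∑ (λ y → fl (x - y)) ⊤ˢ P) (X (- k) x * ∑ (X (- k + 1ℤ)) ⊤ˢ P) (X (- k + 1ℤ) x * ∑ (X (- k)) ⊤ˢ P) (L0 P) (dsc k P) (asc k P))
      where
      e : ∀ a b c d f g → (a - b + c) + (d - f + g) ≡ a + d - (b + f) + (c + g)
      e = solve-∀
      e₂ : ∀ f a u u′ v v′ A A′ → f - u * v′ + u′ * v + (a - u * A′ + u′ * A) ≡ f + a - u * (v′ + A′) + u′ * (v + A)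
      e₂ = solve-∀
      e₃ : ∀ u u′ → 0ℤ ≡ 0ℤ - u * 0ℤ + u′ * 0ℤ
      e₃ = solve-∀
      row : ∀ {m} (R : Vec ℤ m) → All (λ y → ¬ Dvd (x - y)) R →
        ∑ (λ y → fl (ρ k x - y)) ⊤ˢ (map (ρ k) R) ≡ ∑ (λ y → fl (x - y)) ⊤ˢ R - X (- k) x * ∑ (X (- k + 1ℤ)) ⊤ˢ R + X (- k + 1ℤ) x * ∑ (X (- k)) ⊤ˢ R
      row [] [] = e₃ (X (- k) x) (X (- k + 1ℤ) x)
      row (y ∷ R) (¬d ∷ ¬ds) = trans (cong₂ _+_ (fl-ρ-pair′ k x y ¬d) (row R ¬ds))
        (e₂ (fl (x - y)) (∑ (λ y → fl (x - y)) ⊤ˢ R) (X (- k) x) (X (- k + 1ℤ) x) (X (- k) y) (X (- k + 1ℤ) y) (∑ (X (- k)) ⊤ˢ R) (∑ (X (- k + 1ℤ)) ⊤ˢ R))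

    -- For decreasing Y the only pair that ρ k could bring out of order is a pair (x , y) of residues k and k - 1.
    ρ-Decr : ∀ k {m} (Y : Vec ℤ m) → Decr Y → AllPairs (λ x y → Dvd (x + - k) → Dvd (y + (- k + 1ℤ)) → y + + 3 ≤ x) Y → Decr (map (ρ k) Y)
    ρ-Decr k [] _ _ = []
    ρ-Decr k (x ∷ Y) (d ∷ ds) (f ∷ fs) = row Y d f ∷ ρ-Decr k Y ds fs
      where
      pairρ : ∀ y → y + 1ℤ ≤ x → (Dvd (x + - k) → Dvd (y + (- k + 1ℤ)) → y + + 3 ≤ x) → ρ k y + 1ℤ ≤ ρ k x
      pairρ y y<x far = go (ρ-view k x) (ρ-view k y)
        where
        fin : ∀ {x′ y′} → ρ k x ≡ x′ → ρ k y ≡ y′ → y′ + 1ℤ ≤ x′ → ρ k y + 1ℤ ≤ ρ k x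
        fin refl refl p = p
        strict : ¬ (y + 1ℤ ≡ x) → y + + 2 ≤ x
        strict ≢ = lin (<⇒+1≤ (ℤ.≤∧≢⇒< y<x ≢)) (e y x)
          where
          e : ∀ y x → x - (y + + 2) ≡ x - (y + 1ℤ + 1ℤ)
          e = solve-∀
        0≤1 : 0ℤ ≤ 1ℤ
        0≤1 = +≤+ z≤n
        0≤2 : 0ℤ ≤ + 2
        0≤2 = +≤+ z≤n
        e₂ : ∀ x y → x - 1ℤ - (y - 1ℤ + 1ℤ) ≡ x - (y + 1ℤ)
        e₂ = solve-∀
        e₃ : ∀ x y → x - 1ℤ - (y + 1ℤ + 1ℤ) ≡ x - (y + + 3)
        e₃ = solve-∀
        e₄ : ∀ x y → x - 1ℤ - (y + 1ℤ) ≡ x - (y + + 2)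
        e₄ = solve-∀
        e₅ : ∀ x y → x + 1ℤ - (y - 1ℤ + 1ℤ) ≡ x + + 2 - (y + 1ℤ + 0ℤ)
        e₅ = solve-∀
        e₆ : ∀ x y → x + 1ℤ - (y + 1ℤ + 1ℤ) ≡ x - (y + 1ℤ)
        e₆ = solve-∀
        e₇ : ∀ x y → x + 1ℤ - (y + 1ℤ) ≡ x + 1ℤ - (y + 1ℤ + 0ℤ)
        e₇ = solve-∀
        e₈ : ∀ x y → x - (y - 1ℤ + 1ℤ) ≡ x + 1ℤ - (y + 1ℤ + 0ℤ)
        e₈ = solve-∀
        e₉ : ∀ x y → x - (y + 1ℤ + 1ℤ) ≡ x - (y + + 2)
        e₉ = solve-∀
        c₁ : ∀ y k → y + 1ℤ - k ≡ y - k + 1ℤ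
        c₁ = solve-∀
        go : ρView k x → ρView k y → ρ k y + 1ℤ ≤ ρ k x
        go (down _ _ _ p) (down _ _ _ q) = fin p q (lin y<x (e₂ x y))
        go (down a _ _ p) (up b _ _ q) = fin p q (lin (far a (subst Dvd (ℤ.+-assoc y (- k) 1ℤ) b)) (e₃ x y))
        go (down a _ _ p) (fix _ ¬b _ _ q) = fin p q (lin (strict (λ eq → ¬b (subst Dvd (trans (cong (_- k) (sym eq)) (c₁ y k)) a))) (e₄ x y))
        go (up _ _ _ p) (down _ _ _ q) = fin p q (lin (y<x ⊹ 0≤2) (e₅ x y))
        go (up _ _ _ p) (up _ _ _ q) = fin p q (lin y<x (e₆ x y))
        go (up _ _ _ p) (fix _ _ _ _ q) = fin p q (lin (y<x ⊹ 0≤1) (e₇ x y))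
        go (fix _ _ _ _ p) (down _ _ _ q) = fin p q (lin (y<x ⊹ 0≤1) (e₈ x y))
        go (fix ¬a _ _ _ p) (up b _ _ q) = fin p q (lin (strict (λ eq → ¬a (subst Dvd (trans (sym (c₁ y k)) (cong (_- k) eq)) b))) (e₉ x y))
        go (fix _ _ _ _ p) (fix _ _ _ _ q) = fin p q y<x
      row : ∀ {m} (R : Vec ℤ m) → All (λ y → y + 1ℤ ≤ x) R → All (λ y → Dvd (x + - k) → Dvd (y + (- k + 1ℤ)) → y + + 3 ≤ x) R → All (λ y → y + 1ℤ ≤ ρ k x) (map (ρ k) R)
      row [] [] [] = []
      row (y ∷ R) (a ∷ as) (b ∷ bs) = pairρ y a b ∷ row R as bs

    ρ-invol-map : ∀ k {m} (P : Vec ℤ m) → map (ρ k) (map (ρ k) P) ≡ P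
    ρ-invol-map k [] = refl
    ρ-invol-map k (x ∷ P) = cong₂ _∷_ (ρ-involutive k x) (ρ-invol-map k P)

  vec-ext : ∀ {A : Set} {m} (P Q : Vec A m) → (∀ c → lookup P c ≡ lookup Q c) → P ≡ Q
  vec-ext [] [] _ = refl
  vec-ext (x ∷ P) (y ∷ Q) f = cong₂ _∷_ (f Fin.zero) (vec-ext P Q (λ c → f (Fin.suc c)))

  ∈-lookup : ∀ {m} (P : Vec ℤ m) c → lookup P c ∈ P
  ∈-lookup (x ∷ P) Fin.zero = here refl
  ∈-lookup (x ∷ P) (Fin.suc c) = there (∈-lookup P c)

  AllPairs-lookup : ∀ {R : ℤ → ℤ → Set} {m} {P : Vec ℤ m} → AllPairs R P → ∀ i j → toℕ i ℕ.< toℕ j → R (lookup P i) (lookup P j)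
  AllPairs-lookup (r ∷ _) Fin.zero (Fin.suc j) _ = All⇒∈ r (∈-lookup _ j)
  AllPairs-lookup (_ ∷ rs) (Fin.suc i) (Fin.suc j) (s≤s p) = AllPairs-lookup rs i j p

  AllPairs-from-lookup : ∀ {R : ℤ → ℤ → Set} {m} (P : Vec ℤ m) → (∀ i j → toℕ i ℕ.< toℕ j → R (lookup P i) (lookup P j)) → AllPairs R P
  AllPairs-from-lookup [] f = []
  AllPairs-from-lookup {R} (x ∷ P) f = row P (λ j → f Fin.zero (Fin.suc j) (s≤s z≤n)) ∷ AllPairs-from-lookup P (λ i j p → f (Fin.suc i) (Fin.suc j) (s≤s p))
    where
    row : ∀ {m} (P : Vec ℤ m) → (∀ j → R x (lookup P j)) → All (R x) P
    row [] g = []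
    row (y ∷ P) g = g Fin.zero ∷ row P (λ j → g (Fin.suc j))

  ∑-⊥ : ∀ h {m} (P : Vec ℤ m) → ∑ h ⊥ˢ P ≡ 0ℤ
  ∑-⊥ h [] = refl
  ∑-⊥ h (x ∷ P) = ∑-⊥ h P

  ∑-all-zero : ∀ h {m} (P : Vec ℤ m) → (∀ S → ∑ h S P ≤ 0ℤ) → ∑ h ⊤ˢ P ≡ 0ℤ → All (λ x → h x ≡ 0ℤ) P
  ∑-all-zero h [] _ _ = []
  ∑-all-zero h (x ∷ P) b t = hx ∷ ∑-all-zero h P (λ S → b (false ∷ S)) rest
    where
    hx≤0 : h x ≤ 0ℤ
    hx≤0 = subst (_≤ 0ℤ) (trans (cong (λ t → h x + t) (∑-⊥ h P)) (ℤ.+-identityʳ (h x))) (b (true ∷ ⊥ˢ))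
    e₁ : ∀ a s → a - 0ℤ ≡ 0ℤ + (a + s) - (s + 0ℤ)
    e₁ = solve-∀
    hx : h x ≡ 0ℤ
    hx = ℤ.≤-antisym hx≤0 (lin (b (false ∷ ⊤ˢ) ⊹ ℤ.≤-reflexive (sym t)) (e₁ (h x) (∑ h ⊤ˢ P)))
    rest : ∑ h ⊤ˢ P ≡ 0ℤ
    rest = trans (sym (ℤ.+-identityˡ _)) (trans (cong (_+ ∑ h ⊤ˢ P) (sym hx)) t)

  pre-zero : ∀ h s {m} (P : Vec ℤ m) → All (λ x → h x ≡ 0ℤ) P → pre h s P ≡ 0ℤ
  pre-zero h zero P _ = refl
  pre-zero h (suc s) [] _ = refl
  pre-zero h (suc s) (x ∷ P) (p ∷ ps) = cong₂ _+_ p (pre-zero h s P ps)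

  ⊆-full : ∀ {A : Set} {u v : List A} → u ⊆ v → length v ℕ.≤ length u → u ≡ v
  ⊆-full [] _ = refl
  ⊆-full (_ ∷ʳ p) q = ⊥-elim (ℕ.<-irrefl refl (ℕ.≤-trans q (length-mono-≤ p)))
  ⊆-full (refl ∷ p) (s≤s q) = cong (_ ∷_) (⊆-full p q)

  -- Words in the generators and the alcoves they reach

  module Words (n : ℕ) (1≤n : 1 ℕ.≤ n) where

    open Path n 1≤n public

    Word : Set
    Word = List (Fin (suc n))

    letter : Fin (suc n) → ℤ
    letter k = + toℕ k

    idv w0v : Vec ℤ (suc n)
    idv = upFrom 0ℤ (suc n)
    w0v = downFrom (+ n) (suc n)

    -- Words are read from right to left here: the head is the last generator, which acts on the residues.
    PSr : Word → Vec ℤ (suc n)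
    PSr [] = idv
    PSr (k ∷ v) = map (ρ (letter k)) (PSr v)

    fl-small : ∀ {z} → 0ℤ ≤ z → z + 1ℤ ≤ N → fl z ≡ 0ℤ
    fl-small {z} p q = fl-unique (subst (_≤ z) (sym (ℤ.*-zeroʳ N)) p) (subst (λ t → z + 1ℤ ≤ t + N) (sym (ℤ.*-zeroʳ N)) (subst (z + 1ℤ ≤_) (sym (ℤ.+-identityˡ N)) q))

    fl≡0⇒range : ∀ {z} → fl z ≡ 0ℤ → 0ℤ ≤ z × z + 1ℤ ≤ N
    fl≡0⇒range {z} p = subst (_≤ z) (trans (cong (N *_) p) (ℤ.*-zeroʳ N)) (fl-lower z)
      , subst (z + 1ℤ ≤_) (trans (cong (λ t → N * t + N) p) (trans (cong (_+ N) (ℤ.*-zeroʳ N)) (ℤ.+-identityˡ N))) (fl-upper z)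

    Range : ℤ → Set
    Range z = 0ℤ ≤ z × z + 1ℤ ≤ N

    idv-range : All Range idv
    idv-range = All.map (λ {z} (a , b) → a , subst (z + 1ℤ ≤_) (trans (ℤ.+-identityˡ _) (sym N-def)) b) (upFrom-bounds 0ℤ (suc n))

    w0v-range : All Range w0v
    w0v-range = All.map (λ {z} (a , b) → lin b (e₁ z (+ n)) , subst (z + 1ℤ ≤_) (trans (cong +_ (ℕ.+-comm n 1)) (sym N-def)) (a ⊹ ℤ.≤-refl {1ℤ})) (downFrom-bounds (+ n) (suc n))
      where
      e₁ : ∀ z n → z - 0ℤ ≡ z + (1ℤ + n) - (n + 1ℤ)
      e₁ = solve-∀

    V0-zero : ∀ {P : Vec ℤ (suc n)} → All Range P → All (λ z → V 0ℤ z ≡ 0ℤ) P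
    V0-zero = All.map (λ {z} (a , b) → trans (cong fl (ℤ.+-identityʳ z)) (fl-small a b))

    V-N : ∀ i → V i N ≡ V i 0ℤ + 1ℤ
    V-N i = trans (cong fl (e N i)) (fl-shift (0ℤ + i) 1ℤ)
      where
      e : ∀ N i → N + i ≡ 0ℤ + i + N * 1ℤ
      e = solve-∀

    private
      V-assoc : ∀ i x → V (i + 1ℤ) x ≡ V i (x + 1ℤ)
      V-assoc i x = cong fl (e x i)
        where
        e : ∀ x i → x + (i + 1ℤ) ≡ x + 1ℤ + i
        e = solve-∀

    -- Raising the level by one shifts the values of V i along the run, so only boundary terms
    -- differ. For a run of length N the boundary contributes exactly 1, which is the induction step
    -- for `Good`.
    ∑V-upFrom : ∀ i x m → ∑ (V (i + 1ℤ)) ⊤ˢ (upFrom x m) + V i x ≡ ∑ (V i) ⊤ˢ (upFrom x m) + V i (x + + m)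
    ∑V-upFrom i x zero = cong (λ t → 0ℤ + V i t) (sym (ℤ.+-identityʳ x))
    ∑V-upFrom i x (suc m) = trans (cong (λ t → t + ∑ (V (i + 1ℤ)) ⊤ˢ (upFrom (x + 1ℤ) m) + V i x) (V-assoc i x))
      (trans (e₁ (V i (x + 1ℤ)) (∑ (V (i + 1ℤ)) ⊤ˢ (upFrom (x + 1ℤ) m)) (V i x))
      (trans (cong (λ t → V i x + t) (∑V-upFrom i (x + 1ℤ) m))
      (trans (sym (ℤ.+-assoc (V i x) _ _)) (cong (λ t → V i x + ∑ (V i) ⊤ˢ (upFrom (x + 1ℤ) m) + V i t) (ℤ.+-assoc x 1ℤ (+ m))))))
      where
      e₁ : ∀ a b c → a + b + c ≡ c + (b + a)
      e₁ = solve-∀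

    ∑V-downFrom : ∀ i x m → ∑ (V (i + 1ℤ)) ⊤ˢ (downFrom x m) + V i (x - + m + 1ℤ) ≡ ∑ (V i) ⊤ˢ (downFrom x m) + V i (x + 1ℤ)
    ∑V-downFrom i x zero = cong (λ t → 0ℤ + V i t) (cong (_+ 1ℤ) (ℤ.+-identityʳ x))
    ∑V-downFrom i x (suc m) = trans (cong (λ t → t + ∑ (V (i + 1ℤ)) ⊤ˢ (downFrom (x - 1ℤ) m) + V i (x - + suc m + 1ℤ)) (V-assoc i x))
      (trans (cong (λ t → V i (x + 1ℤ) + ∑ (V (i + 1ℤ)) ⊤ˢ (downFrom (x - 1ℤ) m) + V i t) (e₀ x (+ m)))
      (trans (ℤ.+-assoc (V i (x + 1ℤ)) _ _) (trans (cong (λ t → V i (x + 1ℤ) + t) (∑V-downFrom i (x - 1ℤ) m))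
      (trans (cong (λ t → V i (x + 1ℤ) + (∑ (V i) ⊤ˢ (downFrom (x - 1ℤ) m) + V i t)) (e₂ x)) (e₁ (V i (x + 1ℤ)) (∑ (V i) ⊤ˢ (downFrom (x - 1ℤ) m)) (V i x))))))
      where
      e₀ : ∀ x m → x - (1ℤ + m) + 1ℤ ≡ x - 1ℤ - m + 1ℤ
      e₀ = solve-∀
      e₁ : ∀ a b c → a + (b + c) ≡ c + b + a
      e₁ = solve-∀
      e₂ : ∀ x → x - 1ℤ + 1ℤ ≡ x
      e₂ = solve-∀

    private
      Good-induction : ∀ {P} → All Range P → (∀ i → ∑ (V (i + 1ℤ)) ⊤ˢ P + V i 0ℤ ≡ ∑ (V i) ⊤ˢ P + V i N) → Good P
      Good-induction {P} r step = ℤ-induction (λ i → ∑ (V i) ⊤ˢ P ≡ i) (∑-zero P (V0-zero r))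
        (λ i p → trans (step′ i) (cong (_+ 1ℤ) p))
        (λ i p → lin≡ (trans (sym (step′ i)) p) (e i (∑ (V i) ⊤ˢ P)))
        where
        e₁ : ∀ a b → a ≡ a + b - b
        e₁ = solve-∀
        e₂ : ∀ a b → a + (b + 1ℤ) - b ≡ a + 1ℤ
        e₂ = solve-∀
        e : ∀ i s → i - s ≡ i + 1ℤ - (s + 1ℤ)
        e = solve-∀
        step′ : ∀ i → ∑ (V (i + 1ℤ)) ⊤ˢ P ≡ ∑ (V i) ⊤ˢ P + 1ℤ
        step′ i = trans (e₁ _ (V i 0ℤ)) (trans (cong (_- V i 0ℤ) (trans (step i) (cong (λ t → ∑ (V i) ⊤ˢ P + t) (V-N i)))) (e₂ (∑ (V i) ⊤ˢ P) (V i 0ℤ)))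

    Good-idv : Good idv
    Good-idv = Good-induction {idv} idv-range (λ i → trans (∑V-upFrom i 0ℤ (suc n)) (cong (λ t → ∑ (V i) ⊤ˢ idv + V i t) (trans (ℤ.+-identityˡ _) (sym N-def))))

    Good-w0v : Good w0v
    Good-w0v = Good-induction {w0v} w0v-range (λ i → trans (cong (λ t → ∑ (V (i + 1ℤ)) ⊤ˢ w0v + V i t) (e (+ n)))
      (trans (∑V-downFrom i (+ n) (suc n)) (cong (λ t → ∑ (V i) ⊤ˢ w0v + V i t) (trans (cong +_ (ℕ.+-comm n 1)) (sym N-def)))))
      where
      e : ∀ n → 0ℤ ≡ n - (1ℤ + n) + 1ℤ
      e = solve-∀

    PSr-Good : ∀ v → Good (PSr v)
    PSr-Good [] = Good-idv
    PSr-Good (k ∷ v) = ρ-Good (letter k) {PSr v} (PSr-Good v)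

    PSr-Distinct : ∀ v → Distinct (PSr v)
    PSr-Distinct v = Good⇒Distinct {PSr v} (PSr-Good v)

    L0-step : ∀ k {P} → Good P → L0 (map (ρ k) P) ≤ L0 P + 1ℤ
    L0-step k {P} g = subst (_≤ L0 P + 1ℤ) (sym (L0-ρ k P (Good⇒Distinct {P} g))) (lin (ℤ.≤-reflexive (asc+dsc k {P} g) ⊹ ps-nonneg (- k) (- k + 1ℤ) P ⊹ ps-nonneg (- k) (- k + 1ℤ) P) (e (L0 P) (asc k P) (dsc k P)))
      where
      e : ∀ l a d → l + 1ℤ - (l - d + a) ≡ 1ℤ + d + d - (a + d + 0ℤ + 0ℤ)
      e = solve-∀

    -- Every letter raises `L0` by at most one. This lower bound on word length is what certifies
    -- reducedness.
    L0-length : ∀ v → L0 (PSr v) ≤ L0 idv + + length v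
    L0-length [] = ℤ.≤-reflexive (sym (ℤ.+-identityʳ _))
    L0-length (k ∷ v) = lin (L0-step (letter k) {PSr v} (PSr-Good v) ⊹ L0-length v) (e (L0 idv) (L0 (PSr v)) (L0 (PSr (k ∷ v))) (+ length v))
      where
      e : ∀ l₀ l l′ m → l₀ + (1ℤ + m) - l′ ≡ l + 1ℤ + (l₀ + m) - (l′ + l)
      e = solve-∀

    L0-Decr : ∀ {m} (Y : Vec ℤ m) → Decr Y → 0ℤ ≤ L0 Y
    L0-Decr [] _ = ℤ.≤-refl
    L0-Decr (x ∷ Y) (d ∷ ds) = row Y d ⊹ L0-Decr Y ds
      where
      e : ∀ x y → x - y - 0ℤ ≡ x + 1ℤ - (y + 1ℤ + 0ℤ)
      e = solve-∀
      row : ∀ {m} (R : Vec ℤ m) → All (λ y → y + 1ℤ ≤ x) R → 0ℤ ≤ ∑ (λ y → fl (x - y)) ⊤ˢ R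
      row [] [] = ℤ.≤-refl
      row (y ∷ R) (p ∷ ps) = subst (_≤ fl (x - y)) fl-0 (fl-mono {0ℤ} {x - y} (lin (p ⊹ +≤+ (z≤n {1})) (e x y))) ⊹ row R ps

    small-Dvd : ∀ {z} → - N + 1ℤ ≤ z → z + 1ℤ ≤ N → Dvd z → z ≡ 0ℤ
    small-Dvd {z} p q (m , refl) = trans (cong (N *_) (ℤ.≤-antisym m≤0 0≤m)) (ℤ.*-zeroʳ N)
      where
      e₁ : ∀ N m → N * 0ℤ + N - (N * m + 1ℤ) ≡ N - (N * m + 1ℤ)
      e₁ = solve-∀
      e₂ : ∀ N m → N * m + N - (N * 0ℤ + 1ℤ) ≡ N * m - (- N + 1ℤ)
      e₂ = solve-∀
      m≤0 : m ≤ 0ℤ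
      m≤0 = N*-cancel-< (lin q (e₁ N m))
      0≤m : 0ℤ ≤ m
      0≤m = N*-cancel-< (lin p (e₂ N m))

  -- The longest element of W_f

  triangle : ℕ → ℕ
  triangle zero = 0
  triangle (suc m) = m ℕ.+ triangle m

  module Bruhat (n : ℕ) (1≤n : 1 ℕ.≤ n) where

    open Words n 1≤n public

    letterOf : ℕ → Fin (suc n)
    letterOf j with j ℕ.<? suc n
    ... | yes p = fromℕ< p
    ... | no _ = Fin.zero

    letter-letterOf : ∀ {j} → j ℕ.≤ n → letter (letterOf j) ≡ + j
    letter-letterOf {j} p with j ℕ.<? suc n
    ... | yes q = cong +_ (Fin.toℕ-fromℕ< q)
    ... | no ¬q = ⊥-elim (¬q (s≤s p))

    -- longest m is the reversal of s₁ (s₂ s₁) ⋯ (s_m ⋯ s₁).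
    descend : Word → ℕ → ℕ → Word
    descend w m zero = w
    descend w m (suc d) = letterOf (suc m ℕ.∸ d) ∷ descend w m d

    longest : ℕ → Word
    longest zero = []
    longest (suc m) = descend (longest m) m (suc m)

    length-descend : ∀ w m d → length (descend w m d) ≡ d ℕ.+ length w
    length-descend w m zero = refl
    length-descend w m (suc d) = cong suc (length-descend w m d)

    length-longest : ∀ m → length (longest m) ≡ triangle (suc m)
    length-longest zero = refl
    length-longest (suc m) = trans (length-descend (longest m) m (suc m)) (cong (suc m ℕ.+_) (length-longest m))

    ⊆-descend : ∀ {u} w m d d′ → d ℕ.≤ d′ → u ⊆ descend w m d → u ⊆ descend w m d′
    ⊆-descend w m d d′ p q with ℕ.≤⇒≤′ p
    ... | p′ = go p′
      where
      go : ∀ {d′} → d ℕ.≤′ d′ → _ ⊆ descend w m d′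
      go ℕ.≤′-refl = q
      go (ℕ.≤′-step r) = _ ∷ʳ go r

    FixedAbove : ℕ → Vec ℤ (suc n) → Set
    FixedAbove m P = ∀ c → m ℕ.< toℕ c → lookup P c ≡ + toℕ c

    All-lookup : ∀ {Q : ℤ → Set} {m} {P : Vec ℤ m} → All Q P → ∀ c → Q (lookup P c)
    All-lookup a c = All⇒∈ a (∈-lookup _ c)

    index : ∀ {m} → m ℕ.≤ n → Fin (suc n)
    index p = fromℕ< (s≤s p)

    toℕ-index : ∀ {m} (p : m ℕ.≤ n) → toℕ (index p) ≡ m
    toℕ-index p = Fin.toℕ-fromℕ< (s≤s p)

    distinct-index : ∀ {P : Vec ℤ (suc n)} → Distinct P → ∀ c d → lookup P c ≡ lookup P d → c ≡ d
    distinct-index {P} D c d p with ℕ.<-cmp (toℕ c) (toℕ d)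
    ... | tri< a _ _ = ⊥-elim (AllPairs-lookup D c d a (subst Dvd (sym (trans (cong (_- lookup P d) p) (ℤ.+-inverseʳ (lookup P d)))) Dvd-0))
    ... | tri≈ _ b _ = Fin.toℕ-injective b
    ... | tri> _ _ a = ⊥-elim (AllPairs-lookup D d c a (subst Dvd (sym (trans (cong (λ t → lookup P d - t) p) (ℤ.+-inverseʳ (lookup P d)))) Dvd-0))

    -- The values above m are already taken by the fixed positions.
    value-bound : ∀ {m} (m≤n : m ℕ.≤ n) {P} → Distinct P → All Range P → FixedAbove m P → ∃ λ j → lookup P (index m≤n) ≡ + j × j ℕ.≤ m
    value-bound {m} m≤n {P} D R F with lookup P (index m≤n) in eq | All-lookup R (index m≤n)
    ... | + j | _ , j<N with j ℕ.≤? m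
    ...   | yes p = j , refl , p
    ...   | no ¬p = ⊥-elim (ℕ.<-irrefl (trans (sym (toℕ-index m≤n)) (trans (cong toℕ same) (toℕ-index j≤n))) (ℕ.≰⇒> ¬p))
      where
      j≤n : j ℕ.≤ n
      j≤n = ℕ.s≤s⁻¹ (ℤ.drop‿+≤+ (subst₂ _≤_ (cong +_ (ℕ.+-comm j 1)) N-def j<N))
      same : index m≤n ≡ index j≤n
      same = distinct-index {P} D (index m≤n) (index j≤n) (trans eq (sym (trans (F (index j≤n) (subst (m ℕ.<_) (sym (toℕ-index j≤n)) (ℕ.≰⇒> ¬p))) (cong +_ (toℕ-index j≤n)))))

    value-bound {m} m≤n {P} D R F | -[1+ j ] | () , _

    Subword : Vec ℤ (suc n) → Word → Set
    Subword P v = ∃ λ u → u ⊆ v × PSr u ≡ P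

    Subword-∷ : ∀ {P v} k → Subword (map (ρ (letter k)) P) v → Subword P (k ∷ v)
    Subword-∷ {P} k (u , s , p) = k ∷ u , refl ∷ s , trans (cong (map (ρ (letter k))) p) (ρ-invol-map (letter k) P)

    ρ-down : ∀ {k z} → z ≡ k → ρ k z ≡ z - 1ℤ
    ρ-down {k} {z} refl with ρ-view k k
    ... | down _ _ _ p = p
    ... | up d _ _ _ = ⊥-elim (¬Dvd-1 (subst Dvd (cong (_+ 1ℤ) (ℤ.+-inverseʳ k)) d))
    ... | fix ¬d _ _ _ _ = ⊥-elim (¬d (subst Dvd (sym (ℤ.+-inverseʳ k)) Dvd-0))

    ρ-up : ∀ {k z} → z + 1ℤ ≡ k → ρ k z ≡ k
    ρ-up {k} {z} refl with ρ-view (z + 1ℤ) z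
    ... | up _ _ _ p = p
    ... | down d _ _ _ = ⊥-elim (¬Dvd-1 (subst Dvd (e z) (Dvd-neg d)))
      where
      e : ∀ z → - (z - (z + 1ℤ)) ≡ 1ℤ
      e = solve-∀
    ... | fix _ ¬d _ _ _ = ⊥-elim (¬d (subst Dvd (sym (e z)) Dvd-0))
      where
      e : ∀ z → z - (z + 1ℤ) + 1ℤ ≡ 0ℤ
      e = solve-∀

    -- For 1 ≤ k ≤ n nothing wraps around: on 0, ..., n the map `ρ k` is an adjacent transposition
    -- of values.
    module InWindow {k z} (1≤k : 1ℤ ≤ k) (k<N : k + 1ℤ ≤ N) (r : Range z) where

      ρ-range : Range (ρ k z)
      ρ-range with ρ-view k z
      ... | fix _ _ _ _ p = subst Range (sym p) r
      ... | down d _ _ p = subst Range (sym p) (lin (1≤k ⊹ ℤ.≤-reflexive (sym z≡k)) (e₁ z k) , lin (proj₂ r ⊹ +≤+ (z≤n {1})) (e₂ z N))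
        where
        e₀ : ∀ z k N → z - k - (- N + 1ℤ) ≡ z + N - (0ℤ + (k + 1ℤ))
        e₀ = solve-∀
        e₀′ : ∀ z k N → N - (z - k + 1ℤ) ≡ k + N - (0ℤ + (z + 1ℤ))
        e₀′ = solve-∀
        e₁ : ∀ z k → z - 1ℤ - 0ℤ ≡ k + z - (1ℤ + k)
        e₁ = solve-∀
        e₂ : ∀ z N → N - (z - 1ℤ + 1ℤ) ≡ N + 1ℤ - (z + 1ℤ + 0ℤ)
        e₂ = solve-∀
        e₃ : ∀ z k → k - z ≡ 0ℤ - (z - k)
        e₃ = solve-∀
        0≤k : 0ℤ ≤ k
        0≤k = ℤ.≤-trans (+≤+ z≤n) 1≤k
        z≡k : z ≡ k
        z≡k = lin≡ (small-Dvd (lin (proj₁ r ⊹ k<N) (e₀ z k N)) (lin (0≤k ⊹ proj₂ r) (e₀′ z k N)) d) (e₃ z k)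
      ... | up d _ _ p = subst Range (sym p) (lin (proj₁ r ⊹ +≤+ (z≤n {1})) (e₁ z) , lin (ℤ.≤-reflexive z+1≡k ⊹ k<N) (e₂ z k N))
        where
        e₀ : ∀ z k N → z - k + 1ℤ - (- N + 1ℤ) ≡ z + N + 1ℤ - (0ℤ + (k + 1ℤ) + 0ℤ)
        e₀ = solve-∀
        e₀′ : ∀ z k N → N - (z - k + 1ℤ + 1ℤ) ≡ k + N - (1ℤ + (z + 1ℤ))
        e₀′ = solve-∀
        e₁ : ∀ z → z + 1ℤ - 0ℤ ≡ z + 1ℤ - (0ℤ + 0ℤ)
        e₁ = solve-∀
        e₂ : ∀ z k N → N - (z + 1ℤ + 1ℤ) ≡ k + N - (z + 1ℤ + (k + 1ℤ))
        e₂ = solve-∀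
        e₃ : ∀ z k → k - (z + 1ℤ) ≡ 0ℤ - (z - k + 1ℤ)
        e₃ = solve-∀
        z+1≡k : z + 1ℤ ≡ k
        z+1≡k = lin≡ (small-Dvd (lin (proj₁ r ⊹ k<N ⊹ +≤+ (z≤n {1})) (e₀ z k N)) (lin (1≤k ⊹ proj₂ r) (e₀′ z k N)) d) (e₃ z k)

      ρ-fixed : k + 1ℤ ≤ z → ρ k z ≡ z
      ρ-fixed k<z with ρ-view k z
      ... | fix _ _ _ _ p = p
      ... | down d _ _ _ = ⊥-elim (absurd (k<z ⊹ ℤ.≤-reflexive (small-Dvd (lin (k<z ⊹ 1≤N ⊹ +≤+ (z≤n {1})) (e₀ z k N)) (lin (1≤k ⊹ proj₂ r ⊹ +≤+ (z≤n {1})) (e₀′ z k N)) d)) (e₃ z k))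
        where
        e₀ : ∀ z k N → z - k - (- N + 1ℤ) ≡ z + N + 1ℤ - (k + 1ℤ + 1ℤ + 0ℤ)
        e₀ = solve-∀
        e₀′ : ∀ z k N → N - (z - k + 1ℤ) ≡ k + N + 1ℤ - (1ℤ + (z + 1ℤ) + 0ℤ)
        e₀′ = solve-∀
        e₃ : ∀ z k → k + 1ℤ + (z - k) - (z + 0ℤ) ≡ 1ℤ
        e₃ = solve-∀
      ... | up d _ _ _ = ⊥-elim (absurd (k<z ⊹ ℤ.≤-reflexive (small-Dvd (lin (k<z ⊹ 1≤N ⊹ +≤+ (z≤n {2})) (e₀ z k N)) (lin (1≤k ⊹ proj₂ r) (e₀′ z k N)) d) ⊹ +≤+ (z≤n {1})) (e₃ z k))
        where
        e₀ : ∀ z k N → z - k + 1ℤ - (- N + 1ℤ) ≡ z + N + + 2 - (k + 1ℤ + 1ℤ + 0ℤ)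
        e₀ = solve-∀
        e₀′ : ∀ z k N → N - (z - k + 1ℤ + 1ℤ) ≡ k + N - (1ℤ + (z + 1ℤ))
        e₀′ = solve-∀
        e₃ : ∀ z k → k + 1ℤ + (z - k + 1ℤ) + 0ℤ - (z + 0ℤ + 1ℤ) ≡ 1ℤ
        e₃ = solve-∀

    -- Every permutation of 0, ..., n is the value of a subword: letters of the outermost block
    -- raise the entry at position m + 1 one unit at a time to the value m + 1, and the remaining
    -- positions are handled by the shorter word.
    Subword-longest : ∀ m (m≤n : m ℕ.≤ n) {P} → Good P → All Range P → FixedAbove m P → Subword P (longest m)
    Subword-descend : ∀ m d (m<n : suc m ℕ.≤ n) {P} → Good P → All Range P → FixedAbove (suc m) P → lookup P (index m<n) ≡ + (suc m ℕ.∸ d) → d ℕ.≤ suc m →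
      Subword P (descend (longest m) m d)

    Subword-longest zero 0≤n {P} g r f with value-bound 0≤n {P} (Good⇒Distinct {P} g) r f
    ... | zero , p , _ = [] , [] , vec-ext idv P entry
      where
      entry : ∀ c → lookup idv c ≡ lookup P c
      entry Fin.zero = sym (trans (cong (lookup P) (Fin.toℕ-injective (sym (toℕ-index 0≤n)))) p)
      entry (Fin.suc c) = trans (trans (lookup-upFrom 0ℤ (suc n) (Fin.suc c)) (ℤ.+-identityˡ _)) (sym (f (Fin.suc c) (s≤s z≤n)))
    Subword-longest (suc m) m<n {P} g r f with value-bound m<n {P} (Good⇒Distinct {P} g) r f
    ... | j , p , j≤m with Subword-descend m (suc m ℕ.∸ j) m<n {P} g r f (trans p (cong +_ (sym (ℕ.m∸[m∸n]≡n j≤m)))) (ℕ.m∸n≤m (suc m) j)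
    ...   | u , s , q = u , ⊆-descend (longest m) m (suc m ℕ.∸ j) (suc m) (ℕ.m∸n≤m (suc m) j) s , q

    Subword-descend m zero m<n {P} g r f p _ = Subword-longest m (ℕ.≤-trans (ℕ.n≤1+n m) m<n) {P} g r f′
      where
      f′ : FixedAbove m P
      f′ c m<c with ℕ.m≤n⇒m<n∨m≡n m<c
      ... | inj₁ q = f c q
      ... | inj₂ q = trans (cong (lookup P) (Fin.toℕ-injective (trans (sym q) (sym (toℕ-index m<n))))) (trans p (cong +_ q))
    Subword-descend m (suc d) m<n {P} g r f p (s≤s d≤m) = Subword-∷ {P} k₀
        (Subword-descend m d m<n {map (ρ k) P} (ρ-Good k {P} g) range′ f′ p′ (ℕ.m≤n⇒m≤1+n d≤m))
      where
      k₀ : Fin (suc n)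
      k₀ = letterOf (suc m ℕ.∸ d)
      k : ℤ
      k = letter k₀
      k≡ : k ≡ + (suc m ℕ.∸ d)
      k≡ = letter-letterOf (ℕ.≤-trans (ℕ.m∸n≤m (suc m) d) m<n)
      j+1 : + (m ℕ.∸ d) + 1ℤ ≡ + (suc m ℕ.∸ d)
      j+1 = cong +_ (trans (ℕ.+-comm (m ℕ.∸ d) 1) (sym (ℕ.+-∸-assoc 1 d≤m)))
      1≤k : 1ℤ ≤ k
      1≤k = subst (1ℤ ≤_) (sym (trans k≡ (sym j+1))) (subst (λ t → 1ℤ ≤ + t) (ℕ.+-comm 1 (m ℕ.∸ d)) (+≤+ (s≤s z≤n)))
      k≤m : k ≤ + suc m
      k≤m = subst (_≤ + suc m) (sym k≡) (+≤+ (ℕ.m∸n≤m (suc m) d))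
      k<N : k + 1ℤ ≤ N
      k<N = subst (k + 1ℤ ≤_) (trans (cong +_ (ℕ.+-comm n 1)) (sym N-def)) (ℤ.≤-trans k≤m (+≤+ m<n) ⊹ ℤ.≤-refl {1ℤ})
      range′ : All Range (map (ρ k) P)
      range′ = All-from-∈ (map (ρ k) P) (λ y i → let (x , j , q) = ∈-map⁻ (ρ k) P i in subst Range (sym q) (InWindow.ρ-range 1≤k k<N (All⇒∈ r j)))
      f′ : FixedAbove (suc m) (map (ρ k) P)
      f′ c m<c = trans (Vec.lookup-map c (ρ k) P) (trans (InWindow.ρ-fixed 1≤k k<N (All-lookup r c) (subst (k + 1ℤ ≤_) (sym (f c m<c)) (ℤ.≤-trans (k≤m ⊹ ℤ.≤-refl {1ℤ}) (subst (λ t → + t ≤ + toℕ c) (ℕ.+-comm 1 (suc m)) (+≤+ m<c))))) (f c m<c))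
      p′ : lookup (map (ρ k) P) (index m<n) ≡ + (suc m ℕ.∸ d)
      p′ = trans (Vec.lookup-map (index m<n) (ρ k) P) (trans (ρ-up (trans (cong (_+ 1ℤ) p) (trans j+1 (sym k≡)))) k≡)

  -- Reduced words

  module Criterion (n : ℕ) (1≤n : 1 ℕ.≤ n) where

    open Bruhat n 1≤n public

    N≡1+n : N ≡ 1ℤ + + n
    N≡1+n = N-def

    L0-idv : L0 idv ≡ - + triangle (suc n)
    L0-idv = go 0ℤ (suc n) ℕ.≤-refl
      where
      row : ∀ x y m → x + 1ℤ ≤ y → y + + m ≤ x + N → ∑ (λ z → fl (x - z)) ⊤ˢ (upFrom y m) ≡ - + m
      row x y zero _ _ = refl
      row x y (suc m) p q = trans (cong₂ _+_ (fl-unique { - 1ℤ } (lin (q ⊹ +≤+ (z≤n {suc m})) (e₁ x y N (+ m))) (lin p (e₂ x y N)))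
          (row x (y + 1ℤ) m (lin (p ⊹ +≤+ (z≤n {1})) (e₃ x y)) (subst (_≤ x + N) (sym (ℤ.+-assoc y 1ℤ (+ m))) q))) (e₄ (+ m))
        where
        e₁ : ∀ x y N m → x - y - (N * - 1ℤ) ≡ x + N + (1ℤ + m) - (y + (1ℤ + m) + 0ℤ)
        e₁ = solve-∀
        e₂ : ∀ x y N → N * - 1ℤ + N - (x - y + 1ℤ) ≡ y - (x + 1ℤ)
        e₂ = solve-∀
        e₃ : ∀ x y → y + 1ℤ - (x + 1ℤ) ≡ y + 1ℤ - (x + 1ℤ + 0ℤ)
        e₃ = solve-∀
        e₄ : ∀ m → - 1ℤ + - m ≡ - (1ℤ + m)
        e₄ = solve-∀
      go : ∀ x m → m ℕ.≤ suc n → L0 (upFrom x m) ≡ - + triangle m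
      go x zero _ = refl
      go x (suc m) m≤n = trans (cong₂ _+_ (row x (x + 1ℤ) m ℤ.≤-refl (subst (_≤ x + N) (sym (ℤ.+-assoc x 1ℤ (+ m))) (ℤ.+-monoʳ-≤ x (subst (+ suc m ≤_) (sym N-def) (+≤+ m≤n))))) (go (x + 1ℤ) m (ℕ.≤-trans (ℕ.n≤1+n m) m≤n)))
        (sym (ℤ.neg-distrib-+ (+ m) (+ triangle m)))

    L0-w0v : 0ℤ ≤ L0 w0v
    L0-w0v = L0-Decr w0v (downFrom-Decr (+ n) (suc n))

    -- The vertex V 0 of w₀ is the origin, so all subset sums of V 0 over P are at most zero while
    -- the total is zero. Hence V 0 vanishes on P, which places P in W_f.
    D-w0v⇒range : ∀ {P} → Good P → D P w0v → All Range P
    D-w0v⇒range {P} g d = All.map (λ {z} p → fl≡0⇒range (trans (cong fl (sym (ℤ.+-identityʳ z))) p))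
      (∑-all-zero (V 0ℤ) P (λ S → subst (∑ (V 0ℤ) S P ≤_) (pre-zero (V 0ℤ) (size S) w0v (V0-zero w0v-range)) (d 0ℤ S)) (g 0ℤ))

    Subword-w0v : ∀ {P} → Good P → All Range P → Subword P (longest n)
    Subword-w0v {P} g r = Subword-longest n ℕ.≤-refl {P} g r (λ c n<c → ⊥-elim (ℕ.<-irrefl refl (ℕ.≤-trans n<c (ℕ.s≤s⁻¹ (Fin.toℕ<n c)))))

    longest-long : ∀ u → 0ℤ ≤ L0 (PSr u) → length (longest n) ℕ.≤ length u
    longest-long u p = subst (ℕ._≤ length u) (sym (length-longest n)) (ℤ.drop‿+≤+ (lin (p ⊹ L0-length u ⊹ ℤ.≤-reflexive L0-idv) (e (L0 (PSr u)) (L0 idv) (+ length u) (+ triangle (suc n)))))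
      where
      e : ∀ l l₀ u t → u - t ≡ l + (l₀ + u) + - t - (0ℤ + l + l₀)
      e = solve-∀

    -- The product is not computed. Some subword reaches `w0v`, and by the length bound that subword
    -- is the whole word.
    PSr-longest : PSr (longest n) ≡ w0v
    PSr-longest = whole (Subword-w0v {w0v} Good-w0v w0v-range)
      where
      whole : Subword w0v (longest n) → PSr (longest n) ≡ w0v
      whole (u , s , p) = trans (cong PSr (sym (⊆-full s (longest-long u (subst (λ t → 0ℤ ≤ L0 t) (sym p) L0-w0v))))) p

    -- A reduced word of Y together with one half of the Bruhat criterion: everything below Y in the
    -- vertex order is the value of a subword.
    record Reach (Y : Vec ℤ (suc n)) : Set where
      field
        word     : Word
        value    : PSr word ≡ Y
        reduced  : L0 Y ≡ L0 idv + + length word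
        complete : ∀ P → Good P → D P Y → Subword P word

    Reach-w0v : Reach w0v
    Reach-w0v = record
      { word = longest n ; value = PSr-longest
      ; reduced = ℤ.≤-antisym (subst (λ t → L0 t ≤ L0 idv + + length (longest n)) PSr-longest (L0-length (longest n)))
          (ℤ.≤-trans (ℤ.≤-reflexive (trans (cong₂ _+_ L0-idv (cong +_ (length-longest n))) (ℤ.+-inverseˡ (+ triangle (suc n))))) L0-w0v)
      ; complete = λ P g d → Subword-w0v {P} g (D-w0v⇒range {P} g d) }

    GapAt : ℤ → ℤ → ∀ {m} → Vec ℤ m → Set
    GapAt y x = All (λ b → b + + 2 ≤ x ⊎ (x ≤ b × b ≤ y))

    -- The witness is the lowest entry of the topmost run of consecutive values: nothing sits
    -- directly below it, so it can be lowered. The distance bound keeps that run shorter than N. A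
    -- vector without a gap is one full run, and `run⇒w0v` identifies it with w₀.
    find-gap : ∀ {m} x (R : Vec ℤ m) → Decr (x ∷ R) → (x ∷ R ≡ downFrom x (suc m)) ⊎ (∃ λ x′ → x′ ∈ (x ∷ R) × x + 1ℤ ≤ x′ + + m × GapAt x x′ (x ∷ R))
    find-gap x [] _ = inj₁ refl
    find-gap {suc m} x (z ∷ R) ((z<x ∷ zs) ∷ dR@(zR ∷ _)) with z + + 2 ℤ.≤? x
    ... | yes p = inj₂ (x , here refl , lin (+≤+ (z≤n {m})) (e₁ x (+ m)) , inj₂ (ℤ.≤-refl , ℤ.≤-refl) ∷ inj₁ p ∷ All.map (λ {b} b<z → inj₁ (lin (b<z ⊹ p ⊹ +≤+ (z≤n {1})) (e₂ b x z))) zR)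
      where
      e₁ : ∀ x m → x + (1ℤ + m) - (x + 1ℤ) ≡ m - 0ℤ
      e₁ = solve-∀
      e₂ : ∀ b x z → x - (b + + 2) ≡ z + x + 1ℤ - (b + 1ℤ + (z + + 2) + 0ℤ)
      e₂ = solve-∀
    ... | no ¬p with find-gap z R dR
    ...   | inj₁ q = inj₁ (cong (x ∷_) (trans q (cong (λ t → downFrom t (suc m)) z≡)))
      where
      e₀ : ∀ x z → x - 1ℤ - z ≡ x - (z + 1ℤ)
      e₀ = solve-∀
      e₁ : ∀ x z → z - (x - 1ℤ) ≡ z + + 2 - (x + 1ℤ)
      e₁ = solve-∀
      z≡ : z ≡ x - 1ℤ
      z≡ = ℤ.≤-antisym (lin z<x (e₀ x z)) (lin (≰⇒+1≤ ¬p) (e₁ x z))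
    ...   | inj₂ (x′ , i , b , gap) = inj₂ (x′ , there i , lin (b ⊹ ≰⇒+1≤ ¬p) (e₁ x x′ z (+ m)) , inj₂ (x′≤x , ℤ.≤-refl) ∷ All.map weaken gap)
      where
      e₁ : ∀ x x′ z m → x′ + (1ℤ + m) - (x + 1ℤ) ≡ x′ + m + (z + + 2) - (z + 1ℤ + (x + 1ℤ))
      e₁ = solve-∀
      e₂ : ∀ x z → x - z ≡ x + 1ℤ - (z + 1ℤ + 0ℤ)
      e₂ = solve-∀
      z≤x : z ≤ x
      z≤x = lin (z<x ⊹ +≤+ (z≤n {1})) (e₂ x z)
      x′≤x : x′ ≤ x
      x′≤x = lin (All⇒∈ (z<x ∷ zs) i ⊹ +≤+ (z≤n {1})) (e₂ x x′)
      weaken : ∀ {b} → b + + 2 ≤ x′ ⊎ (x′ ≤ b × b ≤ z) → b + + 2 ≤ x′ ⊎ (x′ ≤ b × b ≤ x)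
      weaken (inj₁ q) = inj₁ q
      weaken (inj₂ (q , r)) = inj₂ (q , ℤ.≤-trans r z≤x)

    residue : ∀ x → ∃ λ k → Dvd (x + - letter k)
    residue x = index r≤n , fl x , trans (cong (λ t → x - t) (trans (cong +_ (toℕ-index r≤n)) r≡)) (e x (N * fl x))
      where
      e : ∀ x f → x - (x - f) ≡ f
      e = solve-∀
      e₁ : ∀ x f n → n - (x - f) ≡ f + (1ℤ + n) - (x + 1ℤ)
      e₁ = solve-∀
      r≡ : + ℤ.∣ x - N * fl x ∣ ≡ x - N * fl x
      r≡ = ℤ.0≤i⇒+∣i∣≡i (ℤ.i≤j⇒0≤j-i (fl-lower x))
      r≤n : ℤ.∣ x - N * fl x ∣ ℕ.≤ n
      r≤n = ℤ.drop‿+≤+ (subst (_≤ + n) (sym r≡) (lin (subst (λ t → x + 1ℤ ≤ N * fl x + t) N≡1+n (fl-upper x)) (e₁ x (N * fl x) (+ n))))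

    run⇒w0v : ∀ y → Good (downFrom y (suc n)) → downFrom y (suc n) ≡ w0v
    run⇒w0v y g = cong (λ t → downFrom t (suc n)) y≡n
      where
      e₁ : ∀ y n → y ≡ n + (y - n)
      e₁ = solve-∀
      e₂ : ∀ y n → n - y ≡ 0ℤ - (y - n)
      e₂ = solve-∀
      e₃ : ∀ z d → z + d ≡ z + d + 0ℤ
      e₃ = solve-∀
      y≡n : y ≡ + n
      y≡n = lin≡ (trans (sym (Good-w0v (y - + n))) (trans (∑-cong (λ z → cong fl (e₃ z (y - + n))) ⊤ˢ w0v)
        (trans (sym (∑-map (V 0ℤ) (_+ (y - + n)) ⊤ˢ w0v)) (trans (cong (∑ (V 0ℤ) ⊤ˢ) (trans (sym (downFrom-shift (+ n) (y - + n) (suc n))) (cong (λ t → downFrom t (suc n)) (sym (e₁ y (+ n)))))) (g 0ℤ))))) (e₂ y (+ n))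

    Decr-pairs-∈ : ∀ {m} (Y : Vec ℤ m) {R : ℤ → ℤ → Set} → Decr Y → (∀ x y → x ∈ Y → y ∈ Y → y + 1ℤ ≤ x → R x y) → AllPairs R Y
    Decr-pairs-∈ [] _ _ = []
    Decr-pairs-∈ (x ∷ Y) (p ∷ ps) f = All-from-∈ Y (λ y i → f x y (here refl) (there i) (All⇒∈ p i)) ∷ Decr-pairs-∈ Y ps (λ a b i j → f a b (there i) (there j))

    -- The two outcomes of `D-split` correspond to subwords that omit the new letter and subwords
    -- that use it.
    reach-step : ∀ k {Y} → Decr Y → Good Y → asc (letter k) Y ≡ 0ℤ → Decr (map (ρ (letter k)) Y) → L0 Y ≡ L0 (map (ρ (letter k)) Y) + 1ℤ → Reach (map (ρ (letter k)) Y) → Reach Y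
    reach-step k {Y} dY gY a0 dZ l r = record
      { word = k ∷ word
      ; value = trans (cong (map (ρ (letter k))) value) (ρ-invol-map (letter k) Y)
      ; reduced = trans l (trans (cong (_+ 1ℤ) reduced) (e (L0 idv) (+ length word)))
      ; complete = λ P g d → go P g (D-split (letter k) {P} {Y} g gY (Desc-from-asc (letter k) {Y} gY a0) (Decr-≤ dZ) d) }
      where
      open Reach r
      e : ∀ a b → a + b + 1ℤ ≡ a + (1ℤ + b)
      e = solve-∀
      go : ∀ P → Good P → D P (map (ρ (letter k)) Y) ⊎ D (map (ρ (letter k)) P) (map (ρ (letter k)) Y) → Subword P (k ∷ word)
      go P g (inj₁ d) = let (u , s , p) = complete P g d in u , k ∷ʳ s , p
      go P g (inj₂ d) = Subword-∷ {P} k (complete (map (ρ (letter k)) P) (ρ-Good (letter k) {P} g) d)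

    -- The letter is the residue of the entry found by `find-gap`. Applying it keeps the vector
    -- decreasing and lowers `L0` by one; since `L0` is nonnegative on decreasing vectors, `fuel`
    -- cannot run out before w₀ is reached.
    reach : ∀ fuel {Y} → Decr Y → Good Y → L0 Y ≤ + fuel → Reach Y
    reach fuel {y ∷ R} dY gY bound with find-gap y R dY
    ... | inj₁ q = subst Reach (sym (trans q (run⇒w0v y (subst Good q gY)))) Reach-w0v
    ... | inj₂ (x , x∈Y , near , gap) = next fuel bound
      where
      Y : Vec ℤ (suc n)
      Y = y ∷ R
      k₀ : Fin (suc n)
      k₀ = proj₁ (residue x)
      k : ℤ
      k = letter k₀
      dx : Dvd (x + - k)
      dx = proj₂ (residue x)
      -- The entry of residue k - 1 is the one that gets raised. It is not in the top run, which is
      -- shorter than N; below the gap, a distance of exactly 2 is excluded by congruence.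
      far : ∀ b → b ∈ Y → Dvd (b + (- k + 1ℤ)) → b + + 3 ≤ x
      far b i d with All⇒∈ gap i
      ... | inj₁ p = lin (<⇒+1≤ (ℤ.≤∧≢⇒< p (λ eq → ¬Dvd-1 (subst Dvd (trans (e₁ b x k) (trans (cong (λ t → t - b - 1ℤ) (sym eq)) (e₂ b))) (Dvd-sub dx d))))) (e₃ b x)
        where
        e₁ : ∀ b x k → (x + - k) - (b + (- k + 1ℤ)) ≡ x - b - 1ℤ
        e₁ = solve-∀
        e₂ : ∀ b → b + + 2 - b - 1ℤ ≡ 1ℤ
        e₂ = solve-∀
        e₃ : ∀ b x → x - (b + + 3) ≡ x - (b + + 2 + 1ℤ)
        e₃ = solve-∀
      ... | inj₂ (x≤b , b≤y) = ⊥-elim (absurd (x≤b ⊹ ℤ.≤-reflexive (small-Dvd (lin (x≤b ⊹ 1≤N ⊹ +≤+ (z≤n {1})) (f₁ b x N)) (lin (b≤y ⊹ near ⊹ ℤ.≤-reflexive (sym N≡1+n)) (f₂ b x y N (+ n))) (subst Dvd (f₃ b x k) (Dvd-sub d dx)))) (f₄ b x))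
        where
        f₁ : ∀ b x N → b - x + 1ℤ - (- N + 1ℤ) ≡ b + N + 1ℤ - (x + 1ℤ + 0ℤ)
        f₁ = solve-∀
        f₂ : ∀ b x y N n → N - (b - x + 1ℤ + 1ℤ) ≡ y + (x + n) + N - (b + (y + 1ℤ) + (1ℤ + n))
        f₂ = solve-∀
        f₃ : ∀ b x k → (b + (- k + 1ℤ)) - (x + - k) ≡ b - x + 1ℤ
        f₃ = solve-∀
        f₄ : ∀ b x → x + (b - x + 1ℤ) - (b + 0ℤ) ≡ 1ℤ
        f₄ = solve-∀
      the-x : ∀ a → a ∈ Y → Dvd (a + - k) → a ≡ x
      the-x a i d = distinct-unique (Good⇒Distinct {Y} gY) i x∈Y (subst Dvd (e a x k) (Dvd-sub d dx))
        where
        e : ∀ a x k → (a + - k) - (x + - k) ≡ a - x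
        e = solve-∀
      dZ : Decr (map (ρ k) Y)
      dZ = ρ-Decr k Y dY (Decr-pairs-∈ Y dY (λ a b i j _ da db → subst (b + + 3 ≤_) (sym (the-x a i da)) (far b j db)))
      a0 : asc k Y ≡ 0ℤ
      a0 = ps-zero⁻ (- k + 1ℤ) (- k) Y (Decr-pairs-∈ Y dY (λ a b i j b<a (da , db) → absurd (far a i da ⊹ subst (λ t → t + 1ℤ ≤ a) (the-x b j db) b<a ⊹ +≤+ (z≤n {3})) (e a x)))
        where
        e : ∀ a x → a + + 3 + (x + 1ℤ) + 0ℤ - (x + a + + 3) ≡ 1ℤ
        e = solve-∀
      d1 : dsc k Y ≡ 1ℤ
      d1 = trans (sym (ℤ.+-identityˡ _)) (trans (cong (_+ dsc k Y) (sym a0)) (asc+dsc k {Y} gY))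
      lY : L0 Y ≡ L0 (map (ρ k) Y) + 1ℤ
      lY = trans (e (L0 Y)) (cong (_+ 1ℤ) (sym (trans (L0-ρ k Y (Good⇒Distinct {Y} gY)) (cong₂ (λ s t → L0 Y - s + t) d1 a0))))
        where
        e : ∀ l → l ≡ l - 1ℤ + 0ℤ + 1ℤ
        e = solve-∀
      next : ∀ fuel → L0 Y ≤ + fuel → Reach Y
      next zero b = ⊥-elim (absurd (b ⊹ L0-Decr (map (ρ k) Y) dZ ⊹ ℤ.≤-reflexive (sym lY)) (e (L0 Y) (L0 (map (ρ k) Y))))
        where
        e : ∀ l m → l + 0ℤ + (m + 1ℤ) - (0ℤ + m + l) ≡ 1ℤ
        e = solve-∀
      next (suc fuel) b = reach-step k₀ {Y} dY gY a0 dZ lY (reach fuel {map (ρ k) Y} dZ (ρ-Good k {Y} gY) (lin (b ⊹ ℤ.≤-reflexive (sym lY)) (e (L0 Y) (L0 (map (ρ k) Y)) (+ fuel))))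
        where
        e : ∀ l m f → f - m ≡ 1ℤ + f + l - (l + (m + 1ℤ))
        e = solve-∀

    reachable : ∀ {Y} → Decr Y → Good Y → Reach Y
    reachable {Y} d g = reach ℤ.∣ L0 Y ∣ {Y} d g (ℤ.≤-reflexive (sym (ℤ.0≤i⇒+∣i∣≡i (L0-Decr Y d))))

  -- Subwords of an arbitrary reduced word

  ∈-upFrom : ∀ x m z → x ≤ z → z + 1ℤ ≤ x + + m → z ∈ upFrom x m
  ∈-upFrom x zero z a b = ⊥-elim (absurd (a ⊹ b) (e x z))
    where
    e : ∀ x z → x + (z + 1ℤ) - (z + (x + 0ℤ)) ≡ 1ℤ
    e = solve-∀
  ∈-upFrom x (suc m) z a b with x ℤ.≟ z
  ... | yes p = here (sym p)
  ... | no ¬p = there (∈-upFrom (x + 1ℤ) m z (<⇒+1≤ (ℤ.≤∧≢⇒< a ¬p)) (subst (z + 1ℤ ≤_) (sym (ℤ.+-assoc x 1ℤ (+ m))) b))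

  module Necessity (n : ℕ) (1≤n : 1 ℕ.≤ n) where

    open Criterion n 1≤n public

    -- Y is the decreasing rearrangement of PSr v. By semi, a generator that lengthens v but not Y exchanges two entries differing by one.
    record Track (v : Word) : Set where
      field
        Y     : Vec ℤ (suc n)
        decr  : Decr Y
        good  : Good Y
        incl  : All (_∈ PSr v) Y
        semi  : AllPairs (λ x y → - 1ℤ ≤ fl (x - y)) (PSr v)
        below : ∀ u → u ⊆ v → D (PSr u) Y

    D-idv-w0v : D idv w0v
    D-idv-w0v i S = ∑-upFrom≤pre-downFrom {V i} (λ {x} {y} p → fl-mono {x + i} {y + i} (p ⊹ ℤ.≤-refl {i})) (suc n) 0ℤ (+ n) S (cong +_ (ℕ.+-comm n 1))

    track-[] : Track []
    track-[] = record
      { Y = w0v ; decr = downFrom-Decr (+ n) (suc n) ; good = Good-w0v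
      ; incl = All.map (λ {z} (a , b) → ∈-upFrom 0ℤ (suc n) z a (subst (z + 1ℤ ≤_) (trans N-def (sym (ℤ.+-identityˡ _))) b)) w0v-range
      ; semi = AllPairs-from-lookup idv (λ i j _ → semi′ (All-lookup idv-range i) (All-lookup idv-range j))
      ; below = λ { [] [] → D-idv-w0v } }
      where
      e : ∀ x y N → x - y - N * - 1ℤ ≡ x + N + 1ℤ - (0ℤ + (y + 1ℤ) + 0ℤ)
      e = solve-∀
      semi′ : ∀ {x y} → Range x → Range y → - 1ℤ ≤ fl (x - y)
      semi′ {x} {y} (a , _) (_ , b) = fl-greatest { - 1ℤ } {x - y} (lin (a ⊹ b ⊹ +≤+ (z≤n {1})) (e x y N))

    module Step (k₀ : Fin (suc n)) (v : Word) (T : Track v) (asc1 : asc (letter k₀) (PSr v) ≡ 1ℤ) (dsc0 : dsc (letter k₀) (PSr v) ≡ 0ℤ) where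

      open Track T

      k : ℤ
      k = letter k₀
      P : Vec ℤ (suc n)
      P = PSr v

      -- Only a pair in the order k, k - 1 loses a unit in its floor, and by `dsc0` there is none.
      semi′ : AllPairs (λ x y → - 1ℤ ≤ fl (x - y)) (map (ρ k) P)
      semi′ = go P semi (ps-zero (- k) (- k + 1ℤ) P dsc0) (PSr-Distinct v)
        where
        pairs : ∀ x y → - 1ℤ ≤ fl (x - y) → ¬ (Dvd (x + - k) × Dvd (y + (- k + 1ℤ))) → ¬ Dvd (x - y) → - 1ℤ ≤ fl (ρ k x - ρ k y)
        pairs x y p ¬d ¬e = subst (- 1ℤ ≤_) (sym (fl-ρ-pair′ k x y ¬e)) (lin (p ⊹ ℤ.≤-reflexive zero′ ⊹ *-nonneg (X-nonneg (- k + 1ℤ) x) (X-nonneg (- k) y)) (e (fl (x - y)) (X (- k) x * X (- k + 1ℤ) y) (X (- k + 1ℤ) x * X (- k) y)))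
          where
          e : ∀ f a b → f - a + b - - 1ℤ ≡ f + 0ℤ + b - (- 1ℤ + a + 0ℤ)
          e = solve-∀
          zero′ : X (- k) x * X (- k + 1ℤ) y ≡ 0ℤ
          zero′ with χ-view (x + - k)
          ... | zero _ q = trans (cong (_* X (- k + 1ℤ) y) q) (ℤ.*-zeroˡ (X (- k + 1ℤ) y))
          ... | one d _ = trans (cong (X (- k) x *_) (¬Dvd⇒χ≡0 (λ d′ → ¬d (d , d′)))) (ℤ.*-zeroʳ (X (- k) x))
        go : ∀ {m} (P : Vec ℤ m) → AllPairs (λ x y → - 1ℤ ≤ fl (x - y)) P → AllPairs (λ x y → ¬ (Dvd (x + - k) × Dvd (y + (- k + 1ℤ)))) P → Distinct P → AllPairs (λ x y → - 1ℤ ≤ fl (x - y)) (map (ρ k) P)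
        row : ∀ {m} x (P : Vec ℤ m) → All (λ y → - 1ℤ ≤ fl (x - y)) P → All (λ y → ¬ (Dvd (x + - k) × Dvd (y + (- k + 1ℤ)))) P → All (λ y → ¬ Dvd (x - y)) P → All (λ y → - 1ℤ ≤ fl (ρ k x - y)) (map (ρ k) P)
        row x [] [] [] [] = []
        row x (y ∷ P) (a ∷ as) (b ∷ bs) (c ∷ cs) = pairs x y a b c ∷ row x P as bs cs
        go [] [] [] [] = []
        go (x ∷ P) (a ∷ as) (b ∷ bs) (c ∷ cs) = row x P a b c ∷ go P as bs cs

      -- A subword of the longer word omits the new letter or ends in it; the second case is the
      -- lifting property.
      below-closed : ∀ {Y′} → Desc k Y′ → (∀ u → u ⊆ v → D (PSr u) Y′) → ∀ u → u ⊆ (k₀ ∷ v) → D (PSr u) Y′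
      below-closed dsc b u (_ ∷ʳ s) = b u s
      below-closed {Y′} dsc b (_ ∷ u) (refl ∷ s) = D-closed k {PSr u} {Y′} (PSr-Good u) dsc (b u s)

      ascend : asc k Y ≡ 1ℤ → dsc k Y ≡ 0ℤ → Track (k₀ ∷ v)
      ascend a1 d0 = record
        { Y = Y′
        ; decr = ρ-Decr k Y decr (AllPairs.map (λ ¬d d d′ → ⊥-elim (¬d (d , d′))) (ps-zero (- k) (- k + 1ℤ) Y d0))
        ; good = good′
        ; incl = All-from-∈ Y′ (λ y i → let (x , j , q) = ∈-map⁻ (ρ k) Y i in subst (_∈ map (ρ k) P) (sym q) (∈-map⁺ (ρ k) (All⇒∈ incl j)))
        ; semi = semi′
        ; below = below-closed {Y′} desc′ (λ u s → D-weaken k {PSr u} {Y′} desc′ (subst (D (PSr u)) (sym (ρ-invol-map k Y)) (below u s))) }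
        where
        Y′ : Vec ℤ (suc n)
        Y′ = map (ρ k) Y
        good′ : Good Y′
        good′ = ρ-Good k {Y} good
        l₁ : L0 Y′ ≡ L0 Y - 0ℤ + 1ℤ
        l₁ = trans (L0-ρ k Y (Good⇒Distinct {Y} good)) (cong₂ (λ s t → L0 Y - s + t) d0 a1)
        l₂ : L0 Y ≡ L0 Y′ - dsc k Y′ + asc k Y′
        l₂ = trans (cong L0 (sym (ρ-invol-map k Y))) (L0-ρ k Y′ (Good⇒Distinct {Y′} good′))
        a0′ : asc k Y′ ≡ 0ℤ
        a0′ with asc-or-dsc k {Y′} good′
        ... | inj₂ (p , _) = p
        ... | inj₁ (p , q) = ⊥-elim (absurd (ℤ.≤-reflexive (sym l₁) ⊹ ℤ.≤-reflexive (sym (trans l₂ (cong₂ (λ s t → L0 Y′ - s + t) q p))) ⊹ +≤+ (z≤n {1})) (e (L0 Y) (L0 Y′)))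
          where
          e : ∀ l m → l - 0ℤ + 1ℤ + (m - 0ℤ + 1ℤ) + 0ℤ - (m + l + 1ℤ) ≡ 1ℤ
          e = solve-∀
        desc′ : Desc k Y′
        desc′ = Desc-from-asc k {Y′} good′ a0′

      -- Y has the two residues in the opposite order to P, so the entries satisfy b < a although b
      -- stands first in P. `semi` bounds b - a below by - N, and congruence then leaves only b + 1
      -- = a. The generator thus permutes the entries of P, and Y remains their dominant
      -- rearrangement.
      stay : asc k Y ≡ 0ℤ → dsc k Y ≡ 1ℤ → Track (k₀ ∷ v)
      stay a0 d1 = record
        { Y = Y ; decr = decr ; good = good ; incl = All.map move incl ; semi = semi′
        ; below = below-closed {Y} (Desc-from-asc k {Y} good a0) below }
        where
        wP = ps-witness (- k + 1ℤ) (- k) P semi asc1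
        wY = ps-witness (- k) (- k + 1ℤ) Y decr d1
        b a : ℤ
        b = proj₁ wP
        a = proj₁ (proj₂ wP)
        b∈P : b ∈ P
        b∈P = proj₁ (proj₂ (proj₂ wP))
        a∈P : a ∈ P
        a∈P = proj₁ (proj₂ (proj₂ (proj₂ wP)))
        -1≤ : - 1ℤ ≤ fl (b - a)
        -1≤ = proj₁ (proj₂ (proj₂ (proj₂ (proj₂ wP))))
        db : Dvd (b + (- k + 1ℤ))
        db = proj₁ (proj₂ (proj₂ (proj₂ (proj₂ (proj₂ wP)))))
        da : Dvd (a + - k)
        da = proj₂ (proj₂ (proj₂ (proj₂ (proj₂ (proj₂ wP)))))
        unique-a : ∀ {x} → x ∈ P → Dvd (x + - k) → x ≡ a
        unique-a {x} i d = distinct-unique (PSr-Distinct v) i a∈P (subst Dvd (e x a k) (Dvd-sub d da))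
          where
          e : ∀ x a k → (x + - k) - (a + - k) ≡ x - a
          e = solve-∀
        unique-b : ∀ {x} → x ∈ P → Dvd (x + (- k + 1ℤ)) → x ≡ b
        unique-b {x} i d = distinct-unique (PSr-Distinct v) i b∈P (subst Dvd (e x b k) (Dvd-sub d db))
          where
          e : ∀ x a k → (x + (- k + 1ℤ)) - (a + (- k + 1ℤ)) ≡ x - a
          e = solve-∀
        b<a : b + 1ℤ ≤ a
        b<a = let (x , y , i , j , r , dx , dy) = wY in subst₂ (λ s t → s + 1ℤ ≤ t) (unique-b (All⇒∈ incl j) dy) (unique-a (All⇒∈ incl i) dx) r
        b+1≡a : b + 1ℤ ≡ a
        b+1≡a = lin≡ (small-Dvd (lin (lower ⊹ ℤ.≤-refl {1ℤ}) (e₁ a b N)) (lin (b<a ⊹ 1≤N) (e₂ a b N)) (subst Dvd (e₃ a b k) (Dvd-sub db da))) (e₄ a b)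
          where
          e₁ : ∀ a b N → b - a + 1ℤ - (- N + 1ℤ) ≡ b - a + 1ℤ - (N * - 1ℤ + 1ℤ)
          e₁ = solve-∀
          e₂ : ∀ a b N → N - (b - a + 1ℤ + 1ℤ) ≡ a + N - (b + 1ℤ + 1ℤ)
          e₂ = solve-∀
          e₃ : ∀ a b k → (b + (- k + 1ℤ)) - (a + - k) ≡ b - a + 1ℤ
          e₃ = solve-∀
          e₄ : ∀ a b → a - (b + 1ℤ) ≡ 0ℤ - (b - a + 1ℤ)
          e₄ = solve-∀
          lower : N * - 1ℤ ≤ b - a
          lower = ℤ.≤-trans (N*-mono -1≤) (fl-lower (b - a))
        assoc : ∀ {x} → Dvd (x - k + 1ℤ) → Dvd (x + (- k + 1ℤ))
        assoc {x} = subst Dvd (ℤ.+-assoc x (- k) 1ℤ)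
        ρb : ρ k b ≡ a
        ρb with ρ-view k b
        ... | up _ _ _ q = trans q b+1≡a
        ... | down d _ _ _ = ⊥-elim (¬Dvd-consecutive d (subst Dvd (sym (ℤ.+-assoc b (- k) 1ℤ)) db))
        ... | fix _ ¬d _ _ _ = ⊥-elim (¬d (subst Dvd (sym (ℤ.+-assoc b (- k) 1ℤ)) db))
        ρa : ρ k a ≡ b
        ρa = trans (cong (ρ k) (sym ρb)) (ρ-involutive k b)
        move : ∀ {y} → y ∈ P → y ∈ map (ρ k) P
        move {y} i with ρ-view k y
        ... | fix _ _ _ _ q = subst (_∈ map (ρ k) P) q (∈-map⁺ (ρ k) i)
        ... | down d _ _ _ = subst (_∈ map (ρ k) P) (trans ρb (sym (unique-a i d))) (∈-map⁺ (ρ k) b∈P)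
        ... | up d _ _ _ = subst (_∈ map (ρ k) P) (trans ρa (sym (unique-b i (assoc {y} d)))) (∈-map⁺ (ρ k) a∈P)

      result : Track (k₀ ∷ v)
      result with asc-or-dsc k {Y} good
      ... | inj₁ (a , d) = ascend a d
      ... | inj₂ (a , d) = stay a d

    -- Equality in the length bound forces every letter to raise `L0`, so each step is of the kind
    -- treated in `Step`.
    track : ∀ v → L0 (PSr v) ≡ L0 idv + + length v → Track v
    track [] _ = track-[]
    track (k₀ ∷ v) p = go (asc-or-dsc (letter k₀) {PSr v} (PSr-Good v))
      where
      l : L0 (PSr (k₀ ∷ v)) ≡ L0 (PSr v) - dsc (letter k₀) (PSr v) + asc (letter k₀) (PSr v)
      l = L0-ρ (letter k₀) (PSr v) (PSr-Distinct v)
      e₁ : ∀ l l₀ m → l₀ + m - l ≡ l₀ + (1ℤ + m) - (l - 0ℤ + 1ℤ)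
      e₁ = solve-∀
      go : _ → Track (k₀ ∷ v)
      go (inj₁ (a , d)) = Step.result k₀ v (track v (lin≡ (trans (cong₂ (λ s t → L0 (PSr v) - s + t) (sym d) (sym a)) (trans (sym l) p)) (e₁ (L0 (PSr v)) (L0 idv) (+ length v)))) a d
      go (inj₂ (a , d)) = ⊥-elim (absurd (ℤ.≤-reflexive (trans (sym p) (trans l (cong₂ (λ s t → L0 (PSr v) - s + t) d a))) ⊹ L0-length v ⊹ +≤+ (z≤n {1})) (e₃ (L0 (PSr v)) (L0 idv) (+ length v)))
        where
        e₃ : ∀ l l₀ m → l₀ + (1ℤ + m) + l + 0ℤ - (l - 1ℤ + 0ℤ + (l₀ + m) + 1ℤ) ≡ 1ℤ
        e₃ = solve-∀

    subwords-below : ∀ v {Y} → PSr v ≡ Y → Decr Y → L0 Y ≡ L0 idv + + length v → ∀ u → u ⊆ v → D (PSr u) Y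
    subwords-below v refl d l u s = subst (D (PSr u)) (Decr-⊆-≡ (Track.Y T) (PSr v) (Track.decr T) d (Track.incl T)) (Track.below T u s)
      where
      T : Track v
      T = track v l

  -- The action on E

  ℚ-ring : AlmostCommutativeRing 0ℓ 0ℓ
  ℚ-ring = fromCommutativeRing ℚ.+-*-commutativeRing (λ x → dec⇒maybe (0ℚ ℚ.≟ x))

  opaque
    -- A normal form for integers in ℚ, sealed for the ring solver; `ι-def` is the bridge to the
    -- quotients in the definitions.
    ι : ℤ → ℚ
    ι z = mkℚ z 0 (Coprime.sym (Coprime.1-coprimeTo ℤ.∣ z ∣))

    ι-def : ∀ z → z ℚ./ 1 ≡ ι z
    ι-def z = ℚ.↥p/↧p≡p (ι z)

    ι-+ : ∀ a b → ι (a + b) ≡ ι a ℚ.+ ι b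
    ι-+ a b = trans (sym (ι-def (a + b))) (cong (ℚ._/ 1) (sym (cong₂ _+_ (ℤ.*-identityʳ a) (ℤ.*-identityʳ b))))

    ι-* : ∀ a b → ι (a * b) ≡ ι a ℚ.* ι b
    ι-* a b = sym (ι-def (a * b))

    ι-0 : ι 0ℤ ≡ 0ℚ
    ι-0 = refl

    ι-1 : ι 1ℤ ≡ 1ℚ
    ι-1 = refl

    ι-−1 : ι (- 1ℤ) ≡ ℚ.- 1ℚ
    ι-−1 = refl

    ι-mono-≤ : ∀ {a b} → a ≤ b → ι a ℚ.≤ ι b
    ι-mono-≤ {a} {b} p = ℚ.*≤* (subst₂ _≤_ (sym (ℤ.*-identityʳ a)) (sym (ℤ.*-identityʳ b)) p)

    ι-mono-< : ∀ {a b} → a < b → ι a ℚ.< ι b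
    ι-mono-< {a} {b} p = ℚ.*<* (subst₂ _<_ (sym (ℤ.*-identityʳ a)) (sym (ℤ.*-identityʳ b)) p)

  ι-neg : ∀ a → ι (- a) ≡ ℚ.- ι a
  ι-neg a = trans (e₁ (ι (- a)) (ι a)) (trans (cong (ℚ._- ι a) (trans (sym (ι-+ (- a) a)) (trans (cong ι (ℤ.+-inverseˡ a)) ι-0))) (ℚ.+-identityˡ (ℚ.- ι a)))
    where
    e₁ : ∀ x y → x ≡ x ℚ.+ y ℚ.- y
    e₁ = solve-∀-over ℚ-ring

  ι-sub : ∀ a b → ι (a - b) ≡ ι a ℚ.- ι b
  ι-sub a b = trans (ι-+ a (- b)) (cong (ι a ℚ.+_) (ι-neg b))

  ι-cancel-≤ : ∀ {a b} → ι a ℚ.≤ ι b → a ≤ b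
  ι-cancel-≤ {a} {b} p = ℤ.≮⇒≥ (λ b<a → ℚ.<-irrefl refl (ℚ.<-≤-trans (ι-mono-< b<a) p))

  ι-cancel-< : ∀ {a b} → ι a ℚ.< ι b → a < b
  ι-cancel-< {a} {b} p = ℤ.≰⇒> (λ b≤a → ℚ.<-irrefl refl (ℚ.<-≤-trans p (ι-mono-≤ b≤a)))

  lin< : ∀ {x y a b} → x ℚ.< y → b ℚ.- a ≡ y ℚ.- x → a ℚ.< b
  lin< {x} {y} {a} {b} x<y eq = subst₂ ℚ._<_ (e₁ a x) (trans (e₂ y x a) (trans (cong (ℚ._+ a) (sym eq)) (e₃ a b))) (ℚ.+-monoˡ-< (a ℚ.- x) x<y)
    where
    e₁ : ∀ a x → x ℚ.+ (a ℚ.- x) ≡ a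
    e₁ = solve-∀-over ℚ-ring
    e₂ : ∀ y x a → y ℚ.+ (a ℚ.- x) ≡ (y ℚ.- x) ℚ.+ a
    e₂ = solve-∀-over ℚ-ring
    e₃ : ∀ a b → (b ℚ.- a) ℚ.+ a ≡ b
    e₃ = solve-∀-over ℚ-ring

  lin≡ℚ : ∀ {x y a b} → x ≡ y → b ℚ.- a ≡ y ℚ.- x → a ≡ b
  lin≡ℚ {x} {_} {a} {b} refl eq = trans (e₁ a b) (trans (cong (λ t → b ℚ.- t) eq) (e₂ b x))
    where
    e₁ : ∀ a b → a ≡ b ℚ.- (b ℚ.- a)
    e₁ = solve-∀-over ℚ-ring
    e₂ : ∀ b x → b ℚ.- (x ℚ.- x) ≡ b
    e₂ = solve-∀-over ℚ-ring

  ∑-update : ∀ h {m} (P : Vec ℤ m) i y → ∑ h ⊤ˢ (P Vec.[ i ]≔ y) + h (lookup P i) ≡ ∑ h ⊤ˢ P + h y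
  ∑-update h (x ∷ P) Fin.zero y = e (h y) (∑ h ⊤ˢ P) (h x)
    where
    e : ∀ a b c → a + b + c ≡ c + b + a
    e = solve-∀
  ∑-update h (x ∷ P) (Fin.suc i) y = trans (ℤ.+-assoc (h x) _ _) (trans (cong (λ t → h x + t) (∑-update h P i y)) (sym (ℤ.+-assoc (h x) _ _)))

  sumℚ-update : ∀ {m} (x : Vec ℚ m) i y → sumℚ (x Vec.[ i ]≔ y) ℚ.+ lookup x i ≡ sumℚ x ℚ.+ y
  sumℚ-update (z ∷ x) Fin.zero y = e y (sumℚ x) z
    where
    e : ∀ a b c → a ℚ.+ b ℚ.+ c ≡ c ℚ.+ b ℚ.+ a
    e = solve-∀-over ℚ-ring
  sumℚ-update (z ∷ x) (Fin.suc i) y = trans (ℚ.+-assoc z _ _) (trans (cong (z ℚ.+_) (sumℚ-update x i y)) (sym (ℚ.+-assoc z _ _)))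

  module Geometry (n : ℕ) (1≤n : 1 ℕ.≤ n) where

    open Necessity n 1≤n public

    -- A reflection permutes the coordinates by a transposition and then translates by integers.
    sk : Refl n → Fin (suc n) → Fin (suc n) × ℤ
    sk refl⟨ i , j , _ , k ⟩ c with c Fin.≟ j | c Fin.≟ i
    ... | yes _ | _ = i , - k
    ... | no _ | yes _ = j , k
    ... | no _ | no _ = c , 0ℤ

    perm : Refl n → Fin (suc n) → Fin (suc n)
    perm r c = proj₁ (sk r c)

    shift : Refl n → Fin (suc n) → ℤ
    shift r c = proj₂ (sk r c)

    leftRefl : Refl n → Vec ℤ (suc n) → Vec ℤ (suc n)
    leftRefl refl⟨ i , j , _ , k ⟩ P = (P Vec.[ i ]≔ (lookup P j + N * k)) Vec.[ j ]≔ (lookup P i + N * - k)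

    lookup-leftRefl : ∀ r P c → lookup (leftRefl r P) c ≡ lookup P (perm r c) + N * shift r c
    lookup-leftRefl refl⟨ i , j , _ , k ⟩ P c with c Fin.≟ j | c Fin.≟ i
    ... | yes refl | _ = Vec.lookup∘update c (P Vec.[ i ]≔ _) _
    ... | no c≢j | yes refl = trans (Vec.lookup∘update′ c≢j (P Vec.[ c ]≔ _) _) (Vec.lookup∘update c P _)
    ... | no c≢j | no c≢i = trans (Vec.lookup∘update′ c≢j (P Vec.[ i ]≔ _) _) (trans (Vec.lookup∘update′ c≢i P _) (trans (sym (ℤ.+-identityʳ (lookup P c))) (cong (λ t → lookup P c + t) (sym (ℤ.*-zeroʳ N)))))

    coordDelta-i : ∀ i j → coordDelta {n} i j i ≡ 1ℚ
    coordDelta-i i j with toℕ i ℕ.≟ toℕ i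
    ... | yes _ = refl
    ... | no ¬p = ⊥-elim (¬p refl)

    coordDelta-j : ∀ i j → i ≢ j → coordDelta {n} i j j ≡ ℚ.- 1ℚ
    coordDelta-j i j i≢j with toℕ j ℕ.≟ toℕ i | toℕ j ℕ.≟ toℕ j
    ... | yes p | _ = ⊥-elim (i≢j (sym (Fin.toℕ-injective p)))
    ... | no _ | yes _ = refl
    ... | no _ | no ¬p = ⊥-elim (¬p refl)

    coordDelta-other : ∀ i j c → c ≢ i → c ≢ j → coordDelta {n} i j c ≡ 0ℚ
    coordDelta-other i j c c≢i c≢j with toℕ c ℕ.≟ toℕ i | toℕ c ℕ.≟ toℕ j
    ... | yes p | _ = ⊥-elim (c≢i (Fin.toℕ-injective p))
    ... | no _ | yes p = ⊥-elim (c≢j (Fin.toℕ-injective p))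
    ... | no _ | no _ = refl

    lookup-reflect : ∀ r (x : Pt n) c → lookup (reflect r x) c ≡ lookup x (perm r c) ℚ.+ ι (shift r c)
    lookup-reflect refl⟨ i , j , i≢j , k ⟩ x c = trans (Vec.lookup∘tabulate (λ d → lookup x d ℚ.- (pair x i j ℚ.- ℤ→ℚ k) ℚ.* coordDelta {n} i j d) c) (trans (cong (λ t → lookup x c ℚ.- (pair x i j ℚ.- t) ℚ.* coordDelta {n} i j c) (ι-def k)) go)
      where
      Xi = lookup x i
      Xj = lookup x j
      e₁ : ∀ a b k → b ℚ.- (a ℚ.- b ℚ.- k) ℚ.* (ℚ.- 1ℚ) ≡ a ℚ.+ ℚ.- k
      e₁ = solve-∀-over ℚ-ring
      e₂ : ∀ a b k → a ℚ.- (a ℚ.- b ℚ.- k) ℚ.* 1ℚ ≡ b ℚ.+ k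
      e₂ = solve-∀-over ℚ-ring
      e₃ : ∀ a b → a ℚ.- b ℚ.* 0ℚ ≡ a ℚ.+ 0ℚ
      e₃ = solve-∀-over ℚ-ring
      go : lookup x c ℚ.- (pair x i j ℚ.- ι k) ℚ.* coordDelta {n} i j c ≡ lookup x (perm refl⟨ i , j , i≢j , k ⟩ c) ℚ.+ ι (shift refl⟨ i , j , i≢j , k ⟩ c)
      go with c Fin.≟ j | c Fin.≟ i
      ... | yes refl | _ = trans (cong (λ t → Xj ℚ.- (pair x i j ℚ.- ι k) ℚ.* t) (coordDelta-j i j i≢j)) (trans (e₁ Xi Xj (ι k)) (cong (Xi ℚ.+_) (sym (ι-neg k))))
      ... | no c≢j | yes refl = trans (cong (λ t → Xi ℚ.- (pair x i j ℚ.- ι k) ℚ.* t) (coordDelta-i i j)) (e₂ Xi Xj (ι k))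
      ... | no c≢j | no c≢i = trans (cong (λ t → lookup x c ℚ.- (pair x i j ℚ.- ι k) ℚ.* t) (coordDelta-other i j c c≢i c≢j)) (trans (e₃ (lookup x c) (pair x i j ℚ.- ι k)) (cong (lookup x c ℚ.+_) (sym ι-0)))

    perm-involutive : ∀ r c → perm r (perm r c) ≡ c
    perm-involutive refl⟨ i , j , i≢j , k ⟩ c with c Fin.≟ j | c Fin.≟ i
    perm-involutive refl⟨ i , j , i≢j , k ⟩ c | yes refl | _ with i Fin.≟ c | i Fin.≟ i
    ... | yes p | _ = ⊥-elim (i≢j p)
    ... | no _ | yes _ = refl
    ... | no _ | no ¬p = ⊥-elim (¬p refl)
    perm-involutive refl⟨ i , j , i≢j , k ⟩ c | no _ | yes refl with j Fin.≟ j
    ... | yes _ = refl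
    ... | no ¬p = ⊥-elim (¬p refl)
    perm-involutive refl⟨ i , j , i≢j , k ⟩ c | no c≢j | no c≢i with c Fin.≟ j | c Fin.≟ i
    ... | yes p | _ = ⊥-elim (c≢j p)
    ... | no _ | yes p = ⊥-elim (c≢i p)
    ... | no _ | no _ = refl

    shift-perm : ∀ r c → shift r (perm r c) ≡ - shift r c
    shift-perm refl⟨ i , j , i≢j , k ⟩ c with c Fin.≟ j | c Fin.≟ i
    shift-perm refl⟨ i , j , i≢j , k ⟩ c | yes refl | _ with i Fin.≟ c | i Fin.≟ i
    ... | yes p | _ = ⊥-elim (i≢j p)
    ... | no _ | yes _ = sym (ℤ.neg-involutive k)
    ... | no _ | no ¬p = ⊥-elim (¬p refl)
    shift-perm refl⟨ i , j , i≢j , k ⟩ c | no _ | yes refl with j Fin.≟ j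
    ... | yes _ = refl
    ... | no ¬p = ⊥-elim (¬p refl)
    shift-perm refl⟨ i , j , i≢j , k ⟩ c | no c≢j | no c≢i with c Fin.≟ j | c Fin.≟ i
    ... | yes p | _ = ⊥-elim (c≢j p)
    ... | no _ | yes p = ⊥-elim (c≢i p)
    ... | no _ | no _ = refl

    perm-injective : ∀ r {c d} → perm r c ≡ perm r d → c ≡ d
    perm-injective r {c} {d} p = trans (sym (perm-involutive r c)) (trans (cong (perm r) p) (perm-involutive r d))

    leftRefl-involutive : ∀ r P → leftRefl r (leftRefl r P) ≡ P
    leftRefl-involutive r P = vec-ext _ P λ c → trans (lookup-leftRefl r (leftRefl r P) c)
      (trans (cong (_+ N * shift r c) (trans (lookup-leftRefl r P (perm r c)) (cong₂ (λ s t → lookup P s + N * t) (perm-involutive r c) (shift-perm r c))))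
        (e (lookup P c) N (shift r c)))
      where
      e : ∀ a N s → a + N * - s + N * s ≡ a
      e = solve-∀

    reflect-involutive : ∀ r (x : Pt n) → reflect r (reflect r x) ≡ x
    reflect-involutive r x = vec-ext _ x λ c → trans (lookup-reflect r (reflect r x) c)
      (trans (cong (ℚ._+ ι (shift r c)) (trans (lookup-reflect r x (perm r c)) (cong₂ (λ s t → lookup x s ℚ.+ t) (perm-involutive r c) (trans (cong ι (shift-perm r c)) (ι-neg (shift r c))))))
        (e (lookup x c) (ι (shift r c))))
      where
      e : ∀ a s → a ℚ.+ ℚ.- s ℚ.+ s ≡ a
      e = solve-∀-over ℚ-ring

    -- The transposition does not affect sums over all entries, and the translations by N k and - N
    -- k cancel.
    leftRefl-Good : ∀ r {P} → Good P → Good (leftRefl r P)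
    leftRefl-Good refl⟨ i , j , i≢j , k ⟩ {P} g t = trans (lin≡ (cong₂ _+_ u₂ u₁) (e (∑ h ⊤ˢ P₂) (∑ h ⊤ˢ P₁) (∑ h ⊤ˢ P) (h (lookup P i)) (h (lookup P j)) k)) (g t)
      where
      h : ℤ → ℤ
      h = V t
      P₁ P₂ : Vec ℤ (suc n)
      P₁ = P Vec.[ i ]≔ (lookup P j + N * k)
      P₂ = P₁ Vec.[ j ]≔ (lookup P i + N * - k)
      hshift : ∀ z m → h (z + N * m) ≡ h z + m
      hshift z m = trans (cong fl (e₀ z (N * m) t)) (fl-shift (z + t) m)
        where
        e₀ : ∀ z a t → z + a + t ≡ z + t + a
        e₀ = solve-∀
      u₁ : ∑ h ⊤ˢ P₁ + h (lookup P i) ≡ ∑ h ⊤ˢ P + (h (lookup P j) + k)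
      u₁ = trans (∑-update h P i _) (cong (λ s → ∑ h ⊤ˢ P + s) (hshift (lookup P j) k))
      u₂ : ∑ h ⊤ˢ P₂ + h (lookup P j) ≡ ∑ h ⊤ˢ P₁ + (h (lookup P i) + - k)
      u₂ = trans (cong (λ s → ∑ h ⊤ˢ P₂ + h s) (sym (Vec.lookup∘update′ (λ p → i≢j (sym p)) P _))) (trans (∑-update h P₁ j _) (cong (λ s → ∑ h ⊤ˢ P₁ + s) (hshift (lookup P i) (- k))))
      e : ∀ s₂ s₁ s a b k → s - s₂ ≡ s₁ + (a + - k) + (s + (b + k)) - (s₂ + b + (s₁ + a))
      e = solve-∀

    reflect-update : ∀ i j i≢j k (x : Pt n) → reflect refl⟨ i , j , i≢j , k ⟩ x ≡ (x Vec.[ i ]≔ (lookup x j ℚ.+ ι k)) Vec.[ j ]≔ (lookup x i ℚ.+ ι (- k))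
    reflect-update i j i≢j k x = vec-ext _ _ λ c → trans (lookup-reflect refl⟨ i , j , i≢j , k ⟩ x c) (go c)
      where
      go : ∀ c → lookup x (perm refl⟨ i , j , i≢j , k ⟩ c) ℚ.+ ι (shift refl⟨ i , j , i≢j , k ⟩ c) ≡ lookup ((x Vec.[ i ]≔ (lookup x j ℚ.+ ι k)) Vec.[ j ]≔ (lookup x i ℚ.+ ι (- k))) c
      go c with c Fin.≟ j | c Fin.≟ i
      ... | yes refl | _ = sym (Vec.lookup∘update c (x Vec.[ i ]≔ _) _)
      ... | no c≢j | yes refl = sym (trans (Vec.lookup∘update′ c≢j (x Vec.[ c ]≔ _) _) (Vec.lookup∘update c x _))
      ... | no c≢j | no c≢i = sym (trans (Vec.lookup∘update′ c≢j (x Vec.[ i ]≔ _) _) (trans (Vec.lookup∘update′ c≢i x _) (trans (sym (ℚ.+-identityʳ (lookup x c))) (cong (lookup x c ℚ.+_) (sym ι-0)))))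

    reflect-sum : ∀ r (x : Pt n) → sumℚ (reflect r x) ≡ sumℚ x
    reflect-sum refl⟨ i , j , i≢j , k ⟩ x = trans (cong sumℚ (reflect-update i j i≢j k x)) (lin≡ℚ (cong₂ ℚ._+_ u₂ u₁) (e (sumℚ x₂) (sumℚ x₁) (sumℚ x) (lookup x i) (lookup x j) (ι k)))
      where
      x₁ x₂ : Pt n
      x₁ = x Vec.[ i ]≔ (lookup x j ℚ.+ ι k)
      x₂ = x₁ Vec.[ j ]≔ (lookup x i ℚ.+ ι (- k))
      u₁ : sumℚ x₁ ℚ.+ lookup x i ≡ sumℚ x ℚ.+ (lookup x j ℚ.+ ι k)
      u₁ = sumℚ-update x i _
      u₂ : sumℚ x₂ ℚ.+ lookup x j ≡ sumℚ x₁ ℚ.+ (lookup x i ℚ.+ ℚ.- ι k)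
      u₂ = trans (cong (sumℚ x₂ ℚ.+_) (sym (Vec.lookup∘update′ (λ p → i≢j (sym p)) x _))) (trans (sumℚ-update x₁ j _) (cong (λ s → sumℚ x₁ ℚ.+ (lookup x i ℚ.+ s)) (ι-neg k)))
      e : ∀ s₂ s₁ s a b k → s ℚ.- s₂ ≡ s₁ ℚ.+ (a ℚ.+ ℚ.- k) ℚ.+ (s ℚ.+ (b ℚ.+ k)) ℚ.- (s₂ ℚ.+ b ℚ.+ (s₁ ℚ.+ a))
      e = solve-∀-over ℚ-ring

    act-InE : ∀ w {x : Pt n} → InE x → InE (act w x)
    act-InE [] p = p
    act-InE (r ∷ w) {x} p = trans (reflect-sum r (act w x)) (act-InE w p)

    -- N times the barycentre of the alcove of w, shifted so that the fundamental alcove has (0, …, n).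
    PP : Waff n → Vec ℤ (suc n)
    PP [] = idv
    PP (r ∷ w) = leftRefl r (PP w)

    PP-Good : ∀ w → Good (PP w)
    PP-Good [] = Good-idv
    PP-Good (r ∷ w) = leftRefl-Good r {PP w} (PP-Good w)

    rem : ℤ → Fin (suc n)
    rem z = proj₁ (residue z)

    rem-spec : ∀ z → z ≡ letter (rem z) + N * fl z
    rem-spec z = trans (e z (letter (rem z))) (cong (λ t → letter (rem z) + t) (proj₂ (proj₂ (residue z))))
      where
      e : ∀ z l → z ≡ l + (z + - l)
      e = solve-∀

    letter-range : ∀ c → Range (letter c)
    letter-range c = +≤+ z≤n , subst₂ _≤_ (cong +_ (ℕ.+-comm 1 (toℕ c))) (sym N-def) (+≤+ (Fin.toℕ<n c))

    fl-letter : ∀ c f → fl (letter c + N * f) ≡ f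
    fl-letter c f = trans (fl-shift (letter c) f) (trans (cong (_+ f) (fl-small (proj₁ (letter-range c)) (proj₂ (letter-range c)))) (ℤ.+-identityˡ f))

    rem-letter : ∀ c f → rem (letter c + N * f) ≡ c
    rem-letter c f = Fin.toℕ-injective (ℤ.+-injective (lin≡ (sym (trans (rem-spec (letter c + N * f)) (cong (λ t → letter (rem (letter c + N * f)) + N * t) (fl-letter c f)))) (e (letter c) (N * f) (letter (rem (letter c + N * f))))))
      where
      e : ∀ c f l → c - l ≡ c + f - (l + f)
      e = solve-∀

    -- The extension of x to a function on ℤ with ext x (z + N) = ext x z + 1.
    ext : Pt n → ℤ → ℚ
    ext x z = lookup x (rem z) ℚ.+ ι (fl z)

    ext-letter : ∀ x c f → ext x (letter c + N * f) ≡ lookup x c ℚ.+ ι f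
    ext-letter x c f = cong₂ (λ s t → lookup x s ℚ.+ ι t) (rem-letter c f) (fl-letter c f)

    ext-shift : ∀ x z m → ext x (z + N * m) ≡ ext x z ℚ.+ ι m
    ext-shift x z m = trans (cong (ext x) (trans (cong (_+ N * m) (rem-spec z)) (e (letter (rem z)) N (fl z) m)))
      (trans (ext-letter x (rem z) (fl z + m)) (trans (cong (lookup x (rem z) ℚ.+_) (ι-+ (fl z) m)) (sym (ℚ.+-assoc (lookup x (rem z)) _ _))))
      where
      e : ∀ l N f m → l + N * f + N * m ≡ l + N * (f + m)
      e = solve-∀

    -- `PP w` is the window of the affine permutation w, and w acts on a point through its periodic
    -- extension. Equal windows therefore give equal elements; `≈⇒PP-≡` is the converse.
    act-ext : ∀ w (x : Pt n) c → lookup (act w x) c ≡ ext x (lookup (PP w) c)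
    act-ext [] x c = sym (trans (cong (ext x) (trans (lookup-upFrom 0ℤ (suc n) c) (e (letter c) N))) (trans (ext-letter x c 0ℤ) (trans (cong (lookup x c ℚ.+_) ι-0) (ℚ.+-identityʳ (lookup x c)))))
      where
      e : ∀ c N → 0ℤ + c ≡ c + N * 0ℤ
      e = solve-∀
    act-ext (r ∷ w) x c = trans (lookup-reflect r (act w x) c) (trans (cong (ℚ._+ ι (shift r c)) (act-ext w x (perm r c)))
      (trans (sym (ext-shift x (lookup (PP w) (perm r c)) (shift r c))) (cong (ext x) (sym (lookup-leftRefl r (PP w) c)))))

    PP-≡⇒≈ : ∀ u v → PP u ≡ PP v → u ≈W v
    PP-≡⇒≈ u v p x _ = vec-ext _ _ λ c → trans (act-ext u x c) (trans (cong (λ t → ext x (lookup t c)) p) (sym (act-ext v x c)))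

  -- Reversal, and alcoves as regions between hyperplanes

  lookup-∷ʳ-last : ∀ {A : Set} {m} (xs : Vec A m) x → lookup (xs Vec.∷ʳ x) (Fin.fromℕ m) ≡ x
  lookup-∷ʳ-last [] x = refl
  lookup-∷ʳ-last (_ ∷ xs) x = lookup-∷ʳ-last xs x

  lookup-∷ʳ-inject₁ : ∀ {A : Set} {m} (xs : Vec A m) x i → lookup (xs Vec.∷ʳ x) (Fin.inject₁ i) ≡ lookup xs i
  lookup-∷ʳ-inject₁ (_ ∷ xs) x Fin.zero = refl
  lookup-∷ʳ-inject₁ (_ ∷ xs) x (Fin.suc i) = lookup-∷ʳ-inject₁ xs x i

  lookup-reverse-opposite : ∀ {A : Set} {m} (xs : Vec A m) c → lookup (Vec.reverse xs) (Fin.opposite c) ≡ lookup xs c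
  lookup-reverse-opposite {m = suc m} (x ∷ xs) Fin.zero = trans (cong (λ v → lookup v (Fin.fromℕ m)) (Vec.reverse-∷ x xs)) (lookup-∷ʳ-last (Vec.reverse xs) x)
  lookup-reverse-opposite (x ∷ xs) (Fin.suc i) = trans (cong (λ v → lookup v (Fin.inject₁ (Fin.opposite i))) (Vec.reverse-∷ x xs)) (trans (lookup-∷ʳ-inject₁ (Vec.reverse xs) x (Fin.opposite i)) (lookup-reverse-opposite xs i))

  lookup-reverse : ∀ {A : Set} {m} (xs : Vec A m) c → lookup (Vec.reverse xs) c ≡ lookup xs (Fin.opposite c)
  lookup-reverse xs c = trans (cong (lookup (Vec.reverse xs)) (sym (Fin.opposite-involutive c))) (lookup-reverse-opposite xs (Fin.opposite c))

  opposite-injective : ∀ {m} {c d : Fin m} → Fin.opposite c ≡ Fin.opposite d → c ≡ d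
  opposite-injective {c = c} {d} p = trans (sym (Fin.opposite-involutive c)) (trans (cong Fin.opposite p) (Fin.opposite-involutive d))

  ∑-∷ʳ : ∀ h {m} (P : Vec ℤ m) x → ∑ h ⊤ˢ (P Vec.∷ʳ x) ≡ ∑ h ⊤ˢ P + h x
  ∑-∷ʳ h [] x = ℤ.+-comm (h x) 0ℤ
  ∑-∷ʳ h (y ∷ P) x = trans (cong (λ t → h y + t) (∑-∷ʳ h P x)) (sym (ℤ.+-assoc (h y) _ _))

  ∑-reverse : ∀ h {m} (P : Vec ℤ m) → ∑ h ⊤ˢ (Vec.reverse P) ≡ ∑ h ⊤ˢ P
  ∑-reverse h [] = refl
  ∑-reverse h (x ∷ P) = trans (cong (∑ h ⊤ˢ) (Vec.reverse-∷ x P)) (trans (∑-∷ʳ h (Vec.reverse P) x) (trans (cong (_+ h x) (∑-reverse h P)) (ℤ.+-comm _ (h x))))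

  ∑-lookup-cong : ∀ h k {m} (P Q : Vec ℤ m) → (∀ j → h (lookup P j) ≡ k (lookup Q j)) → ∑ h ⊤ˢ P ≡ ∑ k ⊤ˢ Q
  ∑-lookup-cong h k [] [] _ = refl
  ∑-lookup-cong h k (x ∷ P) (y ∷ Q) f = cong₂ _+_ (f Fin.zero) (∑-lookup-cong h k P Q (λ j → f (Fin.suc j)))

  sumℚ-scale : ∀ κ (h : ℤ → ℤ) {m} (P : Vec ℤ m) → sumℚ (map (λ z → κ ℚ.* ι (h z)) P) ≡ κ ℚ.* ι (∑ h ⊤ˢ P)
  sumℚ-scale κ h [] = sym (trans (cong (κ ℚ.*_) ι-0) (ℚ.*-zeroʳ κ))
  sumℚ-scale κ h (x ∷ P) = trans (cong (κ ℚ.* ι (h x) ℚ.+_) (sumℚ-scale κ h P)) (trans (sym (ℚ.*-distribˡ-+ κ _ _)) (cong (κ ℚ.*_) (sym (ι-+ (h x) _))))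

  ∑-upFrom : ∀ k x m → ∑ (λ z → z + z - k) ⊤ˢ (upFrom x m) ≡ + m * (x + x + + m - 1ℤ - k)
  ∑-upFrom k x zero = refl
  ∑-upFrom k x (suc m) = trans (cong (λ t → x + x - k + t) (∑-upFrom k (x + 1ℤ) m)) (e k x (+ m))
    where
    e : ∀ k x m → x + x - k + m * (x + 1ℤ + (x + 1ℤ) + m - 1ℤ - k) ≡ (1ℤ + m) * (x + x + (1ℤ + m) - 1ℤ - k)
    e = solve-∀

  module Alcoves (n : ℕ) (1≤n : 1 ℕ.≤ n) where

    open Geometry n 1≤n public

    private
      2N-1 : ℕ
      2N-1 = suc (n ℕ.+ n)

      2N : ℚ
      2N = mkℚ (+ suc 2N-1) 0 (Coprime.sym (Coprime.1-coprimeTo (suc 2N-1)))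

    opaque
      -- The value is 1 / (2 N); the factor 2 makes the centring by n / 2 integral.
      κ : ℚ
      κ = ℚ.1/ 2N

      instance
        κ-pos : ℚ.Positive κ
        κ-pos = _

      κ-inverse : ∀ f → κ ℚ.* ι (N * f + N * f) ≡ ι f
      κ-inverse f = trans (cong (κ ℚ.*_) (trans (cong ι 2N*f) (ι-* (+ suc 2N-1) f)))
        (trans (sym (ℚ.*-assoc κ (ι (+ suc 2N-1)) (ι f))) (trans (cong (ℚ._* ι f) (trans (cong (κ ℚ.*_) (trans (sym (ι-def (+ suc 2N-1))) (ℚ.↥p/↧p≡p 2N))) (ℚ.*-inverseˡ 2N))) (ℚ.*-identityˡ (ι f))))
        where
        e : ∀ n f → (1ℤ + n) * f + (1ℤ + n) * f ≡ (1ℤ + (1ℤ + (n + n))) * f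
        e = solve-∀
        2N*f : N * f + N * f ≡ + suc 2N-1 * f
        2N*f = trans (cong (λ t → t * f + t * f) N≡1+n) (e (+ n) f)

    κ-mono-< : ∀ {a b} → a < b → κ ℚ.* ι a ℚ.< κ ℚ.* ι b
    κ-mono-< p = ℚ.*-monoʳ-<-pos κ (ι-mono-< p)

    κ-cancel-≤ : ∀ {a b} → κ ℚ.* ι a ℚ.≤ κ ℚ.* ι b → a ≤ b
    κ-cancel-≤ p = ι-cancel-≤ (ℚ.*-cancelˡ-≤-pos κ p)

    centred : ℤ → ℤ
    centred z = z + z - + n

    opaque
      bary : ℤ → ℚ
      bary z = κ ℚ.* ι (centred z)

      bary-def : ∀ z → bary z ≡ κ ℚ.* ι (centred z)
      bary-def z = refl

    -- The barycentre of the fundamental alcove, with coordinates (2 z - n) / (2 N) for z = 0, ...,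
    -- n. Its image under w determines `PP w`, so equality in W_aff is tested at this one point.
    bpt : Pt n
    bpt = map bary idv

    bary-diff : ∀ x y → bary x ℚ.- bary y ≡ κ ℚ.* ι ((x - y) + (x - y))
    bary-diff x y = trans (cong₂ ℚ._-_ (bary-def x) (bary-def y)) (trans (e κ (ι (centred x)) (ι (centred y))) (cong (κ ℚ.*_) (trans (sym (ι-sub (centred x) (centred y))) (cong ι (e′ x y (+ n))))))
      where
      e : ∀ k a b → k ℚ.* a ℚ.- k ℚ.* b ≡ k ℚ.* (a ℚ.- b)
      e = solve-∀-over ℚ-ring
      e′ : ∀ x y n → x + x - n - (y + y - n) ≡ (x - y) + (x - y)
      e′ = solve-∀

    bary-shift : ∀ z f → bary (z + N * f) ≡ bary z ℚ.+ ι f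
    bary-shift z f = trans (bary-def (z + N * f)) (trans (cong (κ ℚ.*_) (trans (cong ι (e z (N * f) (+ n))) (ι-+ (centred z) (N * f + N * f)))) (trans (ℚ.*-distribˡ-+ κ (ι (centred z)) (ι (N * f + N * f))) (cong₂ ℚ._+_ (sym (bary-def z)) (κ-inverse f))))
      where
      e : ∀ z a n → z + a + (z + a) - n ≡ z + z - n + (a + a)
      e = solve-∀

    lookup-bpt : ∀ c → lookup bpt c ≡ bary (letter c)
    lookup-bpt c = trans (Vec.lookup-map c bary idv) (cong bary (trans (lookup-upFrom 0ℤ (suc n) c) (ℤ.+-identityˡ (letter c))))

    ext-bpt : ∀ z → ext bpt z ≡ bary z
    ext-bpt z = trans (cong (ℚ._+ ι (fl z)) (lookup-bpt (rem z))) (trans (sym (bary-shift (letter (rem z)) (fl z))) (cong bary (sym (rem-spec z))))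

    act-bpt : ∀ w c → lookup (act w bpt) c ≡ bary (lookup (PP w) c)
    act-bpt w c = trans (act-ext w bpt c) (ext-bpt (lookup (PP w) c))

    double-cancel : ∀ {a b} → a + a ≤ b + b → a ≤ b
    double-cancel {a} {b} p with a ℤ.≤? b
    ... | yes q = q
    ... | no ¬q = ⊥-elim (absurd (p ⊹ ≰⇒+1≤ ¬q ⊹ ≰⇒+1≤ ¬q ⊹ +≤+ (z≤n {1})) (e a b))
      where
      e : ∀ a b → a + a + (b + 1ℤ) + (b + 1ℤ) + 0ℤ - (b + b + a + a + 1ℤ) ≡ 1ℤ
      e = solve-∀

    bary-cancel-≤ : ∀ {x y} → bary x ℚ.≤ bary y → x ≤ y
    bary-cancel-≤ {x} {y} p = double-cancel (lin (κ-cancel-≤ {centred x} {centred y} (subst₂ ℚ._≤_ (bary-def x) (bary-def y) p)) (e x y (+ n)))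
      where
      e : ∀ x y n → y + y - (x + x) ≡ y + y - n - (x + x - n)
      e = solve-∀

    bary-injective : ∀ {x y} → bary x ≡ bary y → x ≡ y
    bary-injective p = ℤ.≤-antisym (bary-cancel-≤ (ℚ.≤-reflexive p)) (bary-cancel-≤ (ℚ.≤-reflexive (sym p)))

    bpt-InE : InE bpt
    bpt-InE = trans (cong sumℚ (Vec.map-cong bary-def idv)) (trans (sumℚ-scale κ centred idv) (trans (cong (λ t → κ ℚ.* ι t) (trans (∑-upFrom (+ n) 0ℤ (suc n)) (e (+ n)))) (trans (cong (κ ℚ.*_) ι-0) (ℚ.*-zeroʳ κ))))
      where
      e : ∀ n → (1ℤ + n) * (0ℤ + 0ℤ + (1ℤ + n) - 1ℤ - n) ≡ 0ℤ
      e = solve-∀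

    ≈⇒PP-≡ : ∀ u v → u ≈W v → PP u ≡ PP v
    ≈⇒PP-≡ u v p = vec-ext _ _ λ c → bary-injective (trans (sym (act-bpt u c)) (trans (cong (λ x → lookup x c) (p bpt bpt-InE)) (act-bpt v c)))

    Between : ℤ → ℚ → Set
    Between f q = ι f ℚ.< q × q ℚ.< ι (f + 1ℤ)

    -- An alcove is cut out by the floors of its coordinate differences, which are read off from N
    -- times its barycentre.
    Region : Vec ℤ (suc n) → Pt n → Set
    Region P y = ∀ i j → i ≢ j → Between (fl (lookup P i - lookup P j)) (pair y i j)

    between-shift : ∀ {f q} m → Between f q → Between (f + m) (q ℚ.+ ι m)
    between-shift {f} {q} m (a , b) = subst (ℚ._< q ℚ.+ ι m) (sym (ι-+ f m)) (ℚ.+-monoˡ-< (ι m) a)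
      , subst (q ℚ.+ ι m ℚ.<_) (trans (sym (ι-+ (f + 1ℤ) m)) (cong ι (e f m))) (ℚ.+-monoˡ-< (ι m) b)
      where
      e : ∀ f m → f + 1ℤ + m ≡ f + m + 1ℤ
      e = solve-∀

    between-unique : ∀ {f g q} → Between f q → Between g q → f ≡ g
    between-unique {f} {g} (a , b) (c , d) = ℤ.≤-antisym (half (ι-cancel-< (ℚ.<-trans a d))) (half (ι-cancel-< (ℚ.<-trans c b)))
      where
      e : ∀ x y → y - x ≡ y + 1ℤ - (x + 1ℤ)
      e = solve-∀
      half : ∀ {x y} → x < y + 1ℤ → x ≤ y
      half {x} {y} p = lin (<⇒+1≤ p) (e x y)

    region-reflect : ∀ r {P y} → Region P y → Region (leftRefl r P) (reflect r y)
    region-reflect r {P} {y} R i j i≢j = subst₂ Between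
        (sym (trans (cong fl (trans (cong₂ _-_ (lookup-leftRefl r P i) (lookup-leftRefl r P j)) (e₁ (lookup P (perm r i)) (lookup P (perm r j)) N (shift r i) (shift r j)))) (fl-shift _ _)))
        (sym (trans (cong₂ ℚ._-_ (lookup-reflect r y i) (lookup-reflect r y j)) (trans (e₂ (lookup y (perm r i)) (lookup y (perm r j)) (ι (shift r i)) (ι (shift r j))) (cong (pair y (perm r i) (perm r j) ℚ.+_) (sym (ι-sub (shift r i) (shift r j)))))))
        (between-shift (shift r i - shift r j) (R (perm r i) (perm r j) (λ p → i≢j (perm-injective r p))))
      where
      e₁ : ∀ a b N s t → a + N * s - (b + N * t) ≡ a - b + N * (s - t)
      e₁ = solve-∀
      e₂ : ∀ a b s t → a ℚ.+ s ℚ.- (b ℚ.+ t) ≡ a ℚ.- b ℚ.+ (s ℚ.- t)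
      e₂ = solve-∀-over ℚ-ring

    idv-floor-< : ∀ i j → toℕ i ℕ.< toℕ j → fl (lookup idv i - lookup idv j) ≡ - 1ℤ
    idv-floor-< i j i<j = trans (cong fl (cong₂ _-_ (lookup-upFrom 0ℤ (suc n) i) (lookup-upFrom 0ℤ (suc n) j)))
      (fl-unique (lin (proj₂ (letter-range j) ⊹ proj₁ (letter-range i) ⊹ +≤+ (z≤n {1})) (e₁ (letter i) (letter j) N)) (lin (+≤+ i<j) (e₂ (letter i) (letter j) N)))
      where
      e₁ : ∀ i j N → 0ℤ + i - (0ℤ + j) - N * - 1ℤ ≡ N + i + 1ℤ - (j + 1ℤ + 0ℤ + 0ℤ)
      e₁ = solve-∀
      e₂ : ∀ i j N → N * - 1ℤ + N - (0ℤ + i - (0ℤ + j) + 1ℤ) ≡ j - (1ℤ + i)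
      e₂ = solve-∀

    idv-floor-> : ∀ i j → toℕ j ℕ.< toℕ i → fl (lookup idv i - lookup idv j) ≡ 0ℤ
    idv-floor-> i j j<i = trans (cong fl (cong₂ _-_ (lookup-upFrom 0ℤ (suc n) i) (lookup-upFrom 0ℤ (suc n) j)))
      (fl-small (lin (+≤+ j<i ⊹ +≤+ (z≤n {1})) (e₁ (letter i) (letter j))) (lin (proj₂ (letter-range i) ⊹ proj₁ (letter-range j)) (e₂ (letter i) (letter j) N)))
      where
      e₁ : ∀ i j → 0ℤ + i - (0ℤ + j) - 0ℤ ≡ i + 1ℤ - (1ℤ + j + 0ℤ)
      e₁ = solve-∀
      e₂ : ∀ i j N → N - (0ℤ + i - (0ℤ + j) + 1ℤ) ≡ N + j - (i + 1ℤ + 0ℤ)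
      e₂ = solve-∀

    InAid⇒region : ∀ {x} → InAid x → Region idv x
    InAid⇒region {x} (_ , f) i j i≢j with ℕ.<-cmp (toℕ i) (toℕ j)
    ... | tri< p _ _ = subst (λ t → Between t (pair x i j)) (sym (idv-floor-< i j p)) (subst₂ (λ s t → s ℚ.< pair x i j × pair x i j ℚ.< t) (sym ι-−1) (sym ι-0) (f i j p))
    ... | tri≈ _ p _ = ⊥-elim (i≢j (Fin.toℕ-injective p))
    ... | tri> _ _ p = subst (λ t → Between t (pair x i j)) (sym (idv-floor-> i j p)) (subst₂ (λ s t → s ℚ.< pair x i j × pair x i j ℚ.< t) (sym ι-0) (sym ι-1) (lin< (proj₂ (f j i p)) (e₁ (lookup x i) (lookup x j)) , lin< (proj₁ (f j i p)) (e₂ (lookup x i) (lookup x j))))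
      where
      e₁ : ∀ a b → a ℚ.- b ℚ.- 0ℚ ≡ 0ℚ ℚ.- (b ℚ.- a)
      e₁ = solve-∀-over ℚ-ring
      e₂ : ∀ a b → 1ℚ ℚ.- (a ℚ.- b) ≡ b ℚ.- a ℚ.- (ℚ.- 1ℚ)
      e₂ = solve-∀-over ℚ-ring

    region⇒InAid : ∀ {x} → InE x → Region idv x → InAid x
    region⇒InAid {x} p R = p , λ i j i<j → subst₂ (λ s t → s ℚ.< pair x i j × pair x i j ℚ.< t) ι-−1 ι-0 (subst (λ t → Between t (pair x i j)) (idv-floor-< i j i<j) (R i j (λ eq → ℕ.<-irrefl (cong toℕ eq) i<j)))

    act-region : ∀ w {x} → Region idv x → Region (PP w) (act w x)
    act-region [] R = R
    act-region (r ∷ w) {x} R = region-reflect r {PP w} {act w x} (act-region w {x} R)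

    alcove⇒region : ∀ w {y} → InAlcove w y → InE y × Region (PP w) y
    alcove⇒region w (x , a , refl) = act-InE w {x} (proj₁ a) , act-region w {x} (InAid⇒region {x} a)

    region⇒alcove : ∀ w {y} → InE y → Region (PP w) y → InAlcove w y
    region⇒alcove [] {y} p R = y , region⇒InAid {y} p R , refl
    region⇒alcove (r ∷ w) {y} p R = extend (region⇒alcove w {reflect r y} (trans (reflect-sum r y) p) R′)
      where
      R′ : Region (PP w) (reflect r y)
      R′ = subst (λ P → Region P (reflect r y)) (leftRefl-involutive r (PP w)) (region-reflect r {leftRefl r (PP w)} {y} R)
      extend : InAlcove w (reflect r y) → InAlcove (r ∷ w) y
      extend (x , a , q) = x , a , trans (cong (reflect r) q) (reflect-involutive r y)

    bpt-InAid : InAid bpt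
    bpt-InAid = bpt-InE , λ i j i<j → subst (λ t → (ℚ.- 1ℚ ℚ.< t) × (t ℚ.< 0ℚ)) (sym (trans (cong₂ ℚ._-_ (lookup-bpt i) (lookup-bpt j)) (bary-diff (letter i) (letter j))))
      ( subst (ℚ._< κ ℚ.* ι ((letter i - letter j) + (letter i - letter j))) (trans (κ-inverse (- 1ℤ)) ι-−1) (κ-mono-< (+1≤⇒< (lin (proj₂ (letter-range j) ⊹ proj₂ (letter-range j) ⊹ proj₁ (letter-range i) ⊹ proj₁ (letter-range i) ⊹ +≤+ (z≤n {1})) (e₁ (letter i) (letter j) N))))
      , subst (κ ℚ.* ι ((letter i - letter j) + (letter i - letter j)) ℚ.<_) (trans (cong (κ ℚ.*_) ι-0) (ℚ.*-zeroʳ κ)) (κ-mono-< (+1≤⇒< (lin (+≤+ i<j ⊹ +≤+ i<j ⊹ +≤+ (z≤n {1})) (e₂ (letter i) (letter j))))) )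
      where
      e₁ : ∀ i j N → (i - j) + (i - j) - (N * - 1ℤ + N * - 1ℤ + 1ℤ) ≡ N + N + i + i + 1ℤ - (j + 1ℤ + (j + 1ℤ) + 0ℤ + 0ℤ + 0ℤ)
      e₁ = solve-∀
      e₂ : ∀ i j → 0ℤ - (i - j + (i - j) + 1ℤ) ≡ j + j + 1ℤ - (1ℤ + i + (1ℤ + i) + 0ℤ)
      e₂ = solve-∀

    bpt-alcove : ∀ w → InAlcove w (act w bpt)
    bpt-alcove w = bpt , bpt-InAid , refl

    χ-neg : ∀ z → χ (- z) ≡ χ z
    χ-neg z with χ-view z
    ... | one d p = trans (Dvd⇒χ≡1 (Dvd-neg d)) (sym p)
    ... | zero ¬d p = trans (¬Dvd⇒χ≡0 (λ d → ¬d (subst Dvd (ℤ.neg-involutive z) (Dvd-neg d)))) (sym p)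

    -- Raising z by one raises exactly one of the floors, because every residue modulo N occurs once
    -- in P.
    ∑-floor-diff : ∀ {P} → Good P → ∀ z → ∑ (λ y → fl (z - y)) ⊤ˢ P ≡ z + ∑ (λ y → fl (0ℤ - y)) ⊤ˢ P
    ∑-floor-diff {P} g = ℤ-induction (λ z → f z ≡ z + f 0ℤ) (sym (ℤ.+-identityˡ _)) (λ z p → trans (step z) (trans (cong (_+ 1ℤ) p) (e₁ z (f 0ℤ)))) (λ z p → lin≡ (trans (sym (step z)) p) (e₂ z (f z) (f 0ℤ)))
      where
      f : ℤ → ℤ
      f z = ∑ (λ y → fl (z - y)) ⊤ˢ P
      e₁ : ∀ z c → z + c + 1ℤ ≡ z + 1ℤ + c
      e₁ = solve-∀
      e₂ : ∀ z a c → z + c - a ≡ z + 1ℤ + c - (a + 1ℤ)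
      e₂ = solve-∀
      c₁ : ∀ z y → z + 1ℤ - y ≡ z - y + 1ℤ
      c₁ = solve-∀
      c₂ : ∀ z y → z - y + 1ℤ ≡ - (y + (- z - 1ℤ))
      c₂ = solve-∀
      step : ∀ z → f (z + 1ℤ) ≡ f z + 1ℤ
      step z = trans (∑-cong (λ y → trans (cong fl (c₁ z y)) (trans (fl-succ (z - y)) (cong (λ t → fl (z - y) + t) (trans (cong χ (c₂ z y)) (χ-neg (y + (- z - 1ℤ))))))) ⊤ˢ P)
        (trans (∑-+ (λ y → fl (z - y)) (X (- z - 1ℤ)) ⊤ˢ P) (cong (λ t → f z + t) (∑X-total {P} g (- z - 1ℤ))))

    -- By `∑-floor-diff` the floors give the entries up to a common shift t; comparing the vertex
    -- sum of Q at level t with that of P at level 0 shows that t vanishes.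
    floors-determine : ∀ {P Q} → Good P → Good Q → (∀ i j → fl (lookup P i - lookup P j) ≡ fl (lookup Q i - lookup Q j)) → P ≡ Q
    floors-determine {P} {Q} gP gQ F = vec-ext P Q λ c → trans (shifted c) (trans (cong (λ s → lookup Q c + s) t≡0) (ℤ.+-identityʳ _))
      where
      fP fQ t : ℤ
      fP = ∑ (λ y → fl (0ℤ - y)) ⊤ˢ P
      fQ = ∑ (λ y → fl (0ℤ - y)) ⊤ˢ Q
      t = fQ - fP
      e : ∀ p q a b → q + (b - a) - p ≡ q + b - (p + a)
      e = solve-∀
      shifted : ∀ c → lookup P c ≡ lookup Q c + t
      shifted c = lin≡ (trans (sym (∑-floor-diff {P} gP (lookup P c))) (trans (∑-lookup-cong (λ y → fl (lookup P c - y)) (λ y → fl (lookup Q c - y)) P Q (F c)) (∑-floor-diff {Q} gQ (lookup Q c)))) (e (lookup P c) (lookup Q c) fP fQ)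
      t≡0 : t ≡ 0ℤ
      t≡0 = trans (sym (gQ t)) (trans (∑-lookup-cong (V t) (V 0ℤ) Q P (λ c → trans (cong fl (sym (shifted c))) (cong fl (sym (ℤ.+-identityʳ (lookup P c)))))) (gP 0ℤ))

    -- Left and right multiplication commute: a reflection permutes positions and translates by
    -- multiples of N, and `ρ` acts on values periodically.
    leftRefl-map-ρ : ∀ r k P → leftRefl r (map (ρ k) P) ≡ map (ρ k) (leftRefl r P)
    leftRefl-map-ρ r k P = vec-ext _ _ λ c → trans (lookup-leftRefl r (map (ρ k) P) c) (trans (cong (_+ N * shift r c) (Vec.lookup-map (perm r c) (ρ k) P))
      (trans (sym (ρ-shift k (lookup P (perm r c)) (shift r c))) (trans (cong (ρ k) (sym (lookup-leftRefl r P c))) (sym (Vec.lookup-map c (ρ k) (leftRefl r P))))))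

    private
      ρ-fix : ∀ {k z} → ¬ Dvd (z - k) → ¬ Dvd (z - k + 1ℤ) → ρ k z ≡ z
      ρ-fix {k} {z} ¬d ¬d′ with ρ-view k z
      ... | fix _ _ _ _ p = p
      ... | down d _ _ _ = ⊥-elim (¬d d)
      ... | up d _ _ _ = ⊥-elim (¬d′ d)

    lookup-idv : ∀ c → lookup idv c ≡ letter c
    lookup-idv c = trans (lookup-upFrom 0ℤ (suc n) c) (ℤ.+-identityˡ (letter c))

    letter-inj : ∀ {c d} → letter c ≡ letter d → c ≡ d
    letter-inj p = Fin.toℕ-injective (ℤ.+-injective p)

    letter-Dvd : ∀ {c d} → Dvd (letter c - letter d) → c ≡ d
    letter-Dvd {c} {d} p = letter-inj (lin≡ (small-Dvd (lin (proj₁ (letter-range c) ⊹ proj₂ (letter-range d)) (e₁ (letter c) (letter d) N)) (lin (proj₂ (letter-range c) ⊹ proj₁ (letter-range d)) (e₂ (letter c) (letter d) N)) p) (e₃ (letter c) (letter d)))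
      where
      e₁ : ∀ c d N → c - d - (- N + 1ℤ) ≡ c + N - (0ℤ + (d + 1ℤ))
      e₁ = solve-∀
      e₂ : ∀ c d N → N - (c - d + 1ℤ) ≡ N + d - (c + 1ℤ + 0ℤ)
      e₂ = solve-∀
      e₃ : ∀ c d → d - c ≡ 0ℤ - (c - d)
      e₃ = solve-∀

    -- At the identity, multiplying by a generator on the left or on the right is the same. The
    -- affine generator turns the first entry 0 into - 1 and the last entry n into N.
    simple-idv : ∀ k → leftRefl (simple 1≤n k) idv ≡ map (ρ (letter k)) idv
    simple-idv k = vec-ext _ _ λ c → trans (lookup-leftRefl (simple 1≤n k) idv c) (trans (go k c) (sym (trans (Vec.lookup-map c (ρ (letter k)) idv) (cong (ρ (letter k)) (lookup-idv c)))))
      where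
      z₁ : ∀ a N → a + N * 0ℤ ≡ a
      z₁ = solve-∀
      go : ∀ k c → lookup idv (perm (simple 1≤n k) c) + N * shift (simple 1≤n k) c ≡ ρ (letter k) (letter c)
      go Fin.zero c with c Fin.≟ Fin.fromℕ n | c Fin.≟ Fin.zero
      ... | yes refl | _ = trans (cong (_+ N * 1ℤ) (lookup-idv Fin.zero)) (sym (at-last (ρ-view 0ℤ (letter (Fin.fromℕ n)))))
        where
        e₀ : ∀ N → 0ℤ + N * 1ℤ ≡ N
        e₀ = solve-∀
        e₁ : ∀ m → m + 1ℤ ≡ 1ℤ + m
        e₁ = solve-∀
        last+1 : letter (Fin.fromℕ n) + 1ℤ ≡ N
        last+1 = trans (cong (λ t → + t + 1ℤ) (Fin.toℕ-fromℕ n)) (trans (e₁ (+ n)) (sym N-def))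
        dvd : Dvd (letter (Fin.fromℕ n) - 0ℤ + 1ℤ)
        dvd = 1ℤ , trans (cong (_+ 1ℤ) {letter (Fin.fromℕ n) - 0ℤ} {letter (Fin.fromℕ n)} (ℤ.+-identityʳ (letter (Fin.fromℕ n)))) (trans last+1 (sym (ℤ.*-identityʳ N)))
        at-last : ρView 0ℤ (letter (Fin.fromℕ n)) → ρ 0ℤ (letter (Fin.fromℕ n)) ≡ 0ℤ + N * 1ℤ
        at-last (up _ _ _ p) = trans p (trans last+1 (sym (e₀ N)))
        at-last (down d _ _ _) = ⊥-elim (¬Dvd-consecutive d dvd)
        at-last (fix _ ¬d _ _ _) = ⊥-elim (¬d dvd)
      ... | no _ | yes refl = trans (cong (_+ N * - 1ℤ) (trans (lookup-idv (Fin.fromℕ n)) (cong +_ (Fin.toℕ-fromℕ n)))) (trans (cong (λ t → + n + t * - 1ℤ) N≡1+n) (trans (e (+ n)) (sym (ρ-down {0ℤ} {0ℤ} refl))))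
        where
        e : ∀ n → n + (1ℤ + n) * - 1ℤ ≡ 0ℤ - 1ℤ
        e = solve-∀
      ... | no c≢l | no c≢0 = trans (z₁ _ N) (trans (lookup-idv c) (sym (ρ-fix (λ d → c≢0 (letter-Dvd {c} {Fin.zero} d)) (λ d → c≢l (letter-Dvd {c} {Fin.fromℕ n} (subst Dvd eq (Dvd-sub d (1ℤ , sym (ℤ.*-identityʳ N)))))))))
        where
        e : ∀ c n → c - 0ℤ + 1ℤ - (1ℤ + n) ≡ c - n
        e = solve-∀
        eq : letter c - 0ℤ + 1ℤ - N ≡ letter c - letter (Fin.fromℕ n)
        eq = trans (cong (λ t → letter c - 0ℤ + 1ℤ - t) N≡1+n) (trans (e (letter c) (+ n)) (cong (λ t → letter c - + t) (sym (Fin.toℕ-fromℕ n))))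
      go (Fin.suc i) c with c Fin.≟ Fin.suc i | c Fin.≟ Fin.inject₁ i
      ... | yes refl | _ = trans (z₁ _ N) (trans (lookup-idv (Fin.inject₁ i)) (trans (cong +_ (Fin.toℕ-inject₁ i)) (sym (trans (ρ-down refl) (e (+ toℕ i))))))
        where
        e : ∀ i → 1ℤ + i - 1ℤ ≡ i
        e = solve-∀
      ... | no _ | yes refl = trans (z₁ _ N) (trans (lookup-idv (Fin.suc i)) (sym (ρ-up (trans (cong (λ t → + t + 1ℤ) (Fin.toℕ-inject₁ i)) (ℤ.+-comm (+ toℕ i) 1ℤ)))))
      ... | no c≢s | no c≢i = trans (z₁ _ N) (trans (lookup-idv c) (sym (ρ-fix (λ d → c≢s (letter-Dvd {c} {Fin.suc i} d)) (λ d → c≢i (letter-Dvd {c} {Fin.inject₁ i} (subst Dvd (trans (e (letter c) (+ toℕ i)) (cong (λ t → letter c - + t) (sym (Fin.toℕ-inject₁ i)))) d))))))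
        where
        e : ∀ c i → c - (1ℤ + i) + 1ℤ ≡ c - i
        e = solve-∀

    PP-snoc : ∀ w k → PP (w List.++ simple 1≤n k ∷ []) ≡ map (ρ (letter k)) (PP w)
    PP-snoc [] k = simple-idv k
    PP-snoc (r ∷ w) k = trans (cong (leftRefl r) (PP-snoc w k)) (leftRefl-map-ρ r (letter k) (PP w))

    -- `PSr` puts the last generator at the head, whereas a word of W_aff starts with its leftmost
    -- factor; hence the reversal.
    PP-word : ∀ v → PP (⟦ 1≤n ⟧S (List.reverse v)) ≡ PSr v
    PP-word [] = refl
    PP-word (k ∷ v) = trans (cong PP (trans (cong (⟦ 1≤n ⟧S) (List.unfold-reverse k v)) (List.map-++ (simple 1≤n) (List.reverse v) (k ∷ [])))) (trans (PP-snoc (⟦ 1≤n ⟧S (List.reverse v)) k) (cong (map (ρ (letter k))) (PP-word v)))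

    PP-word′ : ∀ v → PP (⟦ 1≤n ⟧S v) ≡ PSr (List.reverse v)
    PP-word′ v = trans (cong (λ t → PP (⟦ 1≤n ⟧S t)) (sym (List.reverse-involutive v))) (PP-word (List.reverse v))

  -- Fundamental weights

  ind : ℕ → ℕ → ℚ
  ind c i with c ℕ.≤? i
  ... | yes _ = 1ℚ
  ... | no _ = 0ℚ

  ind-yes : ∀ {c i} → c ℕ.≤ i → ind c i ≡ 1ℚ
  ind-yes {c} {i} p with c ℕ.≤? i
  ... | yes _ = refl
  ... | no ¬p = ⊥-elim (¬p p)

  ind-no : ∀ {c i} → ¬ c ℕ.≤ i → ind c i ≡ 0ℚ
  ind-no {c} {i} ¬p with c ℕ.≤? i
  ... | yes p = ⊥-elim (¬p p)
  ... | no _ = refl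

  ind-suc : ∀ c i → ind (suc c) (suc i) ≡ ind c i
  ind-suc c i with c ℕ.≤? i
  ... | yes p = ind-yes (s≤s p)
  ... | no ¬p = ind-no (λ q → ¬p (ℕ.s≤s⁻¹ q))

  μ : ∀ {m} → Fin m → ℚ
  μ {m} i = (+ suc (toℕ i)) ℚ./ suc m

  private
    ϖ-zero : ∀ {m} (i : Fin m) → lookup (ϖ i) Fin.zero ≡ 1ℚ ℚ.- μ i
    ϖ-zero i with 0 ℕ.≤? toℕ i
    ... | yes _ = refl
    ... | no ¬p = ⊥-elim (¬p z≤n)

    -- The case distinction inside `ϖ` is local to it and cannot be named. The right side is left to
    -- unification so that the `with` below can evaluate it.
    ϖ-suc′ : ∀ {m} (i : Fin m) c → lookup (ϖ i) (Fin.suc c) ≡ _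
    ϖ-suc′ i c = Vec.lookup∘tabulate _ c

    ϖ-suc : ∀ {m} (i : Fin m) c → lookup (ϖ i) (Fin.suc c) ≡ ind (suc (toℕ c)) (toℕ i) ℚ.- μ i
    ϖ-suc i c with suc (toℕ c) ℕ.≤? toℕ i | ϖ-suc′ i c
    ... | yes _ | p = p
    ... | no _ | p = p

  ϖ-entry : ∀ {m} (i : Fin m) c → lookup (ϖ i) c ≡ ind (toℕ c) (toℕ i) ℚ.- μ i
  ϖ-entry i Fin.zero = trans (ϖ-zero i) (cong (ℚ._- μ i) (sym (ind-yes {0} {toℕ i} z≤n)))
  ϖ-entry i (Fin.suc c) = ϖ-suc i c

  sum-ind : ∀ m i → i ℕ.< m → sumℚ (tabulate {n = m} (λ c → ind (toℕ c) i)) ≡ ι (+ suc i)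
  sum-ind (suc m) zero _ = trans (cong₂ ℚ._+_ (ind-yes {0} {0} z≤n) (zeros m 0)) (sym ι-1)
    where
    zeros : ∀ m k → sumℚ (tabulate {n = m} (λ c → ind (suc (k ℕ.+ toℕ c)) 0)) ≡ 0ℚ
    zeros zero k = refl
    zeros (suc m) k = cong₂ ℚ._+_ (ind-no {suc (k ℕ.+ 0)} {0} (λ ())) (trans (cong (sumℚ {m}) (Vec.tabulate-cong (λ c → cong (λ t → ind (suc t) 0) (ℕ.+-suc k (toℕ c))))) (zeros m (suc k)))
  sum-ind (suc m) (suc i) (s≤s p) = trans (cong₂ ℚ._+_ (trans (ind-yes {0} {suc i} z≤n) (sym ι-1)) (trans (cong (sumℚ {m}) (Vec.tabulate-cong (λ c → ind-suc (toℕ c) i))) (sum-ind m i p))) (sym (ι-+ 1ℤ (+ suc i)))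

  sum-sub-const : ∀ {m} (f : Fin m → ℚ) k → sumℚ (tabulate (λ c → f c ℚ.- k)) ≡ sumℚ (tabulate f) ℚ.- ι (+ m) ℚ.* k
  sum-sub-const {zero} f k = trans (e k) (cong (λ t → 0ℚ ℚ.- t ℚ.* k) (sym ι-0))
    where
    e : ∀ k → 0ℚ ≡ 0ℚ ℚ.- 0ℚ ℚ.* k
    e = solve-∀-over ℚ-ring
  sum-sub-const {suc m} f k = trans (cong (f Fin.zero ℚ.- k ℚ.+_) (sum-sub-const (λ c → f (Fin.suc c)) k))
    (trans (e (f Fin.zero) (sumℚ (tabulate (λ c → f (Fin.suc c)))) (ι (+ m)) k) (cong (λ t → f Fin.zero ℚ.+ sumℚ (tabulate (λ c → f (Fin.suc c))) ℚ.- t ℚ.* k) (sym (trans (ι-+ 1ℤ (+ m)) (cong (ℚ._+ ι (+ m)) ι-1)))))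
    where
    e : ∀ a s m k → a ℚ.- k ℚ.+ (s ℚ.- m ℚ.* k) ≡ a ℚ.+ s ℚ.- (1ℚ ℚ.+ m) ℚ.* k
    e = solve-∀-over ℚ-ring

  opaque
    unfolding ι

    ι*μ : ∀ m a → ι (+ suc m) ℚ.* ((+ a) ℚ./ suc m) ≡ ι (+ a)
    ι*μ m a = trans (cong (ι (+ suc m) ℚ.*_) μ≡) (trans (e (ι (+ suc m)) (ι (+ a)) inv) (trans (cong (ℚ._* ι (+ a)) (ℚ.*-inverseʳ (ι (+ suc m)))) (ℚ.*-identityˡ (ι (+ a)))))
      where
      inv : ℚ
      inv = ℚ.1/ (ι (+ suc m))
      μ≡ : (+ a) ℚ./ suc m ≡ ι (+ a) ℚ.* inv
      μ≡ = ℚ./-cong (sym (ℤ.*-identityʳ (+ a))) (sym (ℕ.+-identityʳ (suc m)))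
      e : ∀ x y z → x ℚ.* (y ℚ.* z) ≡ x ℚ.* z ℚ.* y
      e = solve-∀-over ℚ-ring

  sum-ϖ : ∀ {m} (i : Fin m) → sumℚ (ϖ i) ≡ 0ℚ
  sum-ϖ {m} i = trans (cong sumℚ (vec-ext (ϖ i) (tabulate (λ c → ind (toℕ c) (toℕ i) ℚ.- μ i)) (λ c → trans (ϖ-entry i c) (sym (Vec.lookup∘tabulate (λ c → ind (toℕ c) (toℕ i) ℚ.- μ i) c)))))
    (trans (sum-sub-const {suc m} (λ c → ind (toℕ c) (toℕ i)) (μ i))
    (trans (cong₂ ℚ._-_ (sum-ind (suc m) (toℕ i) (ℕ.m≤n⇒m≤1+n (Fin.toℕ<n i))) (ι*μ m (suc (toℕ i)))) (ℚ.+-inverseʳ (ι (+ suc (toℕ i))))))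

  -- The partition attached to λ: entry c is λ_{c+1} + ... + λ_n, the coordinate of the weight up to
  -- the constant that makes all coordinates sum to zero.
  sfx : ∀ {m} → Vec ℕ m → ℕ → ℤ
  sfx [] c = 0ℤ
  sfx (x ∷ l) zero = + x + sfx l zero
  sfx (x ∷ l) (suc c) = sfx l c

  sum-sfx : ∀ {m} (l : Vec ℕ m) c → sumℚ (tabulate (λ i → ι (+ lookup l i) ℚ.* ind c (toℕ i))) ≡ ι (sfx l c)
  sum-sfx [] c = sym ι-0
  sum-sfx (x ∷ l) zero = trans (cong₂ ℚ._+_ (trans (cong (ι (+ x) ℚ.*_) (ind-yes {0} {0} z≤n)) (ℚ.*-identityʳ (ι (+ x))))
    (trans (cong sumℚ (Vec.tabulate-cong (λ i → cong (ι (+ lookup l i) ℚ.*_) (trans (ind-yes {0} {suc (toℕ i)} z≤n) (sym (ind-yes {0} {toℕ i} z≤n)))))) (sum-sfx l zero))) (sym (ι-+ (+ x) (sfx l zero)))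
  sum-sfx (x ∷ l) (suc c) = trans (cong₂ ℚ._+_ (trans (cong (ι (+ x) ℚ.*_) (ind-no {suc c} {0} (λ ()))) (ℚ.*-zeroʳ (ι (+ x))))
    (trans (cong sumℚ (Vec.tabulate-cong (λ i → cong (ι (+ lookup l i) ℚ.*_) (ind-suc c (toℕ i))))) (sum-sfx l c))) (ℚ.+-identityˡ _)

  lookup-fold : ∀ {m k} (vs : Vec (Vec ℚ k) m) c → lookup (Vec.foldr _ (Vec.zipWith ℚ._+_) (Vec.replicate _ 0ℚ) vs) c ≡ sumℚ (map (λ v → lookup v c) vs)
  lookup-fold [] c = Vec.lookup-replicate c 0ℚ
  lookup-fold (v ∷ vs) c = trans (Vec.lookup-zipWith ℚ._+_ c v _) (cong (lookup v c ℚ.+_) (lookup-fold vs c))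

  sum-zipWith : ∀ {k} (u v : Vec ℚ k) → sumℚ (Vec.zipWith ℚ._+_ u v) ≡ sumℚ u ℚ.+ sumℚ v
  sum-zipWith [] [] = refl
  sum-zipWith (a ∷ u) (b ∷ v) = trans (cong (a ℚ.+ b ℚ.+_) (sum-zipWith u v)) (e a b (sumℚ u) (sumℚ v))
    where
    e : ∀ a b c d → a ℚ.+ b ℚ.+ (c ℚ.+ d) ≡ a ℚ.+ c ℚ.+ (b ℚ.+ d)
    e = solve-∀-over ℚ-ring

  sum-fold-zero : ∀ {m k} (f : Fin m → Vec ℚ k) → (∀ i → sumℚ (f i) ≡ 0ℚ) → sumℚ (Vec.foldr _ (Vec.zipWith ℚ._+_) (Vec.replicate _ 0ℚ) (tabulate f)) ≡ 0ℚ
  sum-fold-zero {zero} {k} f p = zeros k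
    where
    zeros : ∀ k → sumℚ (Vec.replicate k 0ℚ) ≡ 0ℚ
    zeros zero = refl
    zeros (suc k) = trans (ℚ.+-identityˡ _) (zeros k)
  sum-fold-zero {suc m} f p = trans (sum-zipWith (f Fin.zero) _) (cong₂ ℚ._+_ (p Fin.zero) (sum-fold-zero (λ i → f (Fin.suc i)) (λ i → p (Fin.suc i))))

  sum-map-* : ∀ {k} a (v : Vec ℚ k) → sumℚ (map (a ℚ.*_) v) ≡ a ℚ.* sumℚ v
  sum-map-* a [] = sym (ℚ.*-zeroʳ a)
  sum-map-* a (x ∷ v) = trans (cong (a ℚ.* x ℚ.+_) (sum-map-* a v)) (sym (ℚ.*-distribˡ-+ a x (sumℚ v)))

  weight-InE : ∀ {m} (l : Vec ℕ m) → InE (weight l)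
  weight-InE l = sum-fold-zero (λ i → map (λ q → ((+ lookup l i) ℚ./ 1) ℚ.* q) (ϖ i)) (λ i → trans (sum-map-* ((+ lookup l i) ℚ./ 1) (ϖ i)) (trans (cong (((+ lookup l i) ℚ./ 1) ℚ.*_) (sum-ϖ i)) (ℚ.*-zeroʳ ((+ lookup l i) ℚ./ 1))))

  sum-tabulate-sub : ∀ {m} (f g : Fin m → ℚ) → sumℚ (tabulate (λ i → f i ℚ.- g i)) ≡ sumℚ (tabulate f) ℚ.- sumℚ (tabulate g)
  sum-tabulate-sub {zero} f g = refl
  sum-tabulate-sub {suc m} f g = trans (cong (f Fin.zero ℚ.- g Fin.zero ℚ.+_) (sum-tabulate-sub (λ i → f (Fin.suc i)) (λ i → g (Fin.suc i)))) (e (f Fin.zero) (g Fin.zero) _ _)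
    where
    e : ∀ a b c d → a ℚ.- b ℚ.+ (c ℚ.- d) ≡ a ℚ.+ c ℚ.- (b ℚ.+ d)
    e = solve-∀-over ℚ-ring

  weight-const : ∀ {m} → Vec ℕ m → ℚ
  weight-const l = sumℚ (tabulate (λ i → ι (+ lookup l i) ℚ.* μ i))

  weight-entry : ∀ {m} (l : Vec ℕ m) c → lookup (weight l) c ≡ ι (sfx l (toℕ c)) ℚ.- weight-const l
  weight-entry l c = trans (lookup-fold (tabulate F) c) (trans (cong sumℚ (trans (sym (Vec.tabulate-∘ (λ v → lookup v c) F)) (Vec.tabulate-cong entry)))
    (trans (sum-tabulate-sub (λ i → ι (+ lookup l i) ℚ.* ind (toℕ c) (toℕ i)) (λ i → ι (+ lookup l i) ℚ.* μ i)) (cong (ℚ._- weight-const l) (sum-sfx l (toℕ c)))))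
    where
    F : _ → Vec ℚ _
    F i = map (λ q → ((+ lookup l i) ℚ./ 1) ℚ.* q) (ϖ i)
    e : ∀ a b c → a ℚ.* (b ℚ.- c) ≡ a ℚ.* b ℚ.- a ℚ.* c
    e = solve-∀-over ℚ-ring
    entry : ∀ i → lookup (F i) c ≡ ι (+ lookup l i) ℚ.* ind (toℕ c) (toℕ i) ℚ.- ι (+ lookup l i) ℚ.* μ i
    entry i = trans (Vec.lookup-map c _ (ϖ i)) (trans (cong₂ ℚ._*_ (ι-def (+ lookup l i)) (ϖ-entry i c)) (e (ι (+ lookup l i)) (ind (toℕ c) (toℕ i)) (μ i)))

  -- The alcove of θ and its Bruhat interval

  consecutive⇒AllPairs : ∀ {R : ℤ → ℤ → Set} → (∀ {x y z} → R x y → R y z → R x z) → ∀ {m} (P : Vec ℤ (suc m)) →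
    (∀ i → R (lookup P (Fin.inject₁ i)) (lookup P (Fin.suc i))) → AllPairs R P
  consecutive⇒AllPairs {R} tr (x ∷ P) f = AllPairs-from-lookup (x ∷ P) (go (x ∷ P) f)
    where
    go : ∀ {m} (P : Vec ℤ (suc m)) → (∀ i → R (lookup P (Fin.inject₁ i)) (lookup P (Fin.suc i))) → ∀ i j → toℕ i ℕ.< toℕ j → R (lookup P i) (lookup P j)
    go (x ∷ y ∷ P) f Fin.zero (Fin.suc Fin.zero) _ = f Fin.zero
    go (x ∷ y ∷ P) f Fin.zero (Fin.suc (Fin.suc j)) _ = tr (f Fin.zero) (go (y ∷ P) (λ i → f (Fin.suc i)) Fin.zero (Fin.suc j) (s≤s z≤n))
    go (x ∷ y ∷ P) f (Fin.suc i) (Fin.suc j) (s≤s p) = go (y ∷ P) (λ i → f (Fin.suc i)) i j p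

  <-step-trans : ∀ {x y z} → y + 1ℤ ≤ x → z + 1ℤ ≤ y → z + 1ℤ ≤ x
  <-step-trans {x} {y} {z} p q = lin (p ⊹ q ⊹ +≤+ (z≤n {1})) (e x y z)
    where
    e : ∀ x y z → x - (z + 1ℤ) ≡ x + y + 1ℤ - (y + 1ℤ + (z + 1ℤ) + 0ℤ)
    e = solve-∀

  sfx-step : ∀ {m} (l : Vec ℕ m) i → sfx l (toℕ i) ≡ + lookup l i + sfx l (suc (toℕ i))
  sfx-step (x ∷ []) Fin.zero = refl
  sfx-step (x ∷ y ∷ l) Fin.zero = refl
  sfx-step (x ∷ l) (Fin.suc i) = sfx-step l i

  module Theta (n : ℕ) (1≤n : 1 ℕ.≤ n) where

    open Alcoves n 1≤n public

    Lam : Vec ℕ n → Vec ℤ (suc n)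
    Lam l = tabulate (λ c → sfx l (toℕ c))

    lookup-Lam : ∀ l c → lookup (Lam l) c ≡ sfx l (toℕ c)
    lookup-Lam l c = Vec.lookup∘tabulate (λ c → sfx l (toℕ c)) c

    Kap : Vec ℕ n → ℤ
    Kap l = ∑ (λ z → z) ⊤ˢ (Lam l)

    -- Translation by λ adds N times `Lam l`, whose entries sum to `Kap l` and not to zero; the
    -- common shift by `Kap l` restores the normalisation `Good`.
    Qv : Vec ℤ (suc n) → Vec ℕ n → Vec ℤ (suc n)
    Qv A l = Vec.zipWith (λ a b → a + N * b - Kap l) A (Lam l)

    lookup-Qv : ∀ A l c → lookup (Qv A l) c ≡ lookup A c + N * sfx l (toℕ c) - Kap l
    lookup-Qv A l c = trans (Vec.lookup-zipWith _ c A (Lam l)) (cong (λ t → lookup A c + N * t - Kap l) (lookup-Lam l c))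

    ∑-Qv : ∀ i κ {m} (A L : Vec ℤ m) → ∑ (V i) ⊤ˢ (Vec.zipWith (λ a b → a + N * b - κ) A L) ≡ ∑ (V (i - κ)) ⊤ˢ A + ∑ (λ z → z) ⊤ˢ L
    ∑-Qv i κ [] [] = refl
    ∑-Qv i κ (a ∷ A) (b ∷ L) = trans (cong₂ _+_ (trans (cong fl (e₁ a N b κ i)) (fl-shift (a + (i - κ)) b)) (∑-Qv i κ A L)) (e₂ (V (i - κ) a) b (∑ (V (i - κ)) ⊤ˢ A) (∑ (λ z → z) ⊤ˢ L))
      where
      e₁ : ∀ a N b k i → a + N * b - k + i ≡ a + (i - k) + N * b
      e₁ = solve-∀
      e₂ : ∀ x y z w → x + y + (z + w) ≡ x + z + (y + w)
      e₂ = solve-∀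

    Qv-Good : ∀ A l → Good A → Good (Qv A l)
    Qv-Good A l g i = trans (∑-Qv i (Kap l) A (Lam l)) (trans (cong (_+ Kap l) (g (i - Kap l))) (e i (Kap l)))
      where
      e : ∀ i k → i - k + k ≡ i
      e = solve-∀

    reverse-Good : ∀ P → Good P → Good (Vec.reverse P)
    reverse-Good P g i = trans (∑-reverse (V i) P) (g i)

    Qof : Waff n → Vec ℕ n → Vec ℤ (suc n)
    Qof a l = Qv (Vec.reverse (PP a)) l

    Qof-Good : ∀ a l → Good (Qof a l)
    Qof-Good a l = Qv-Good (Vec.reverse (PP a)) l (reverse-Good (PP a) (PP-Good a))

    Qof-floor : ∀ a l i j → fl (lookup (Qof a l) i - lookup (Qof a l) j) ≡ fl (lookup (PP a) (Fin.opposite i) - lookup (PP a) (Fin.opposite j)) + (sfx l (toℕ i) - sfx l (toℕ j))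
    Qof-floor a l i j = trans (cong fl (trans (cong₂ _-_ (entry i) (entry j)) (e (lookup (PP a) (Fin.opposite i)) (lookup (PP a) (Fin.opposite j)) N (sfx l (toℕ i)) (sfx l (toℕ j)) (Kap l)))) (fl-shift _ _)
      where
      entry : ∀ i → lookup (Qof a l) i ≡ lookup (PP a) (Fin.opposite i) + N * sfx l (toℕ i) - Kap l
      entry i = trans (lookup-Qv (Vec.reverse (PP a)) l i) (cong (λ t → t + N * sfx l (toℕ i) - Kap l) (lookup-reverse (PP a) i))
      e : ∀ a b N s t k → a + N * s - k - (b + N * t - k) ≡ a - b + N * (s - t)
      e = solve-∀

    Translate : Vec ℕ n → Pt n → Pt n
    Translate l z = Vec.zipWith ℚ._+_ (w₀ z) (weight l)

    Translate-pair : ∀ l z i j → pair (Translate l z) i j ≡ pair z (Fin.opposite i) (Fin.opposite j) ℚ.+ ι (sfx l (toℕ i) - sfx l (toℕ j))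
    Translate-pair l z i j = trans (cong₂ ℚ._-_ (entry i) (entry j)) (trans (e (lookup z (Fin.opposite i)) (lookup z (Fin.opposite j)) (ι (sfx l (toℕ i))) (ι (sfx l (toℕ j))) (weight-const l)) (cong (pair z (Fin.opposite i) (Fin.opposite j) ℚ.+_) (sym (ι-sub _ _))))
      where
      entry : ∀ i → lookup (Translate l z) i ≡ lookup z (Fin.opposite i) ℚ.+ (ι (sfx l (toℕ i)) ℚ.- weight-const l)
      entry i = trans (Vec.lookup-zipWith ℚ._+_ i (w₀ z) (weight l)) (cong₂ ℚ._+_ (lookup-reverse z i) (weight-entry l i))
      e : ∀ a b s t k → a ℚ.+ (s ℚ.- k) ℚ.- (b ℚ.+ (t ℚ.- k)) ≡ a ℚ.- b ℚ.+ (s ℚ.- t)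
      e = solve-∀-over ℚ-ring

    Translate-region : ∀ a l z → Region (PP a) z → Region (Qof a l) (Translate l z)
    Translate-region a l z R i j i≢j = subst₂ Between (sym (Qof-floor a l i j)) (sym (Translate-pair l z i j)) (between-shift (sfx l (toℕ i) - sfx l (toℕ j)) (R (Fin.opposite i) (Fin.opposite j) (λ p → i≢j (opposite-injective p))))

    Translate-region⁻ : ∀ a l z → Region (Qof a l) (Translate l z) → Region (PP a) z
    Translate-region⁻ a l z R i j i≢j = subst₂ Between eqf eqp (between-shift (- d) (R (Fin.opposite i) (Fin.opposite j) (λ p → i≢j (opposite-injective p))))
      where
      d : ℤ
      d = sfx l (toℕ (Fin.opposite i)) - sfx l (toℕ (Fin.opposite j))
      e₁ : ∀ f d → f + d + - d ≡ f
      e₁ = solve-∀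
      e₂ : ∀ f d → f ℚ.+ d ℚ.+ ℚ.- d ≡ f
      e₂ = solve-∀-over ℚ-ring
      opp : ∀ {A : Set} (F : Fin (suc n) → Fin (suc n) → A) → F (Fin.opposite (Fin.opposite i)) (Fin.opposite (Fin.opposite j)) ≡ F i j
      opp F = cong₂ F (Fin.opposite-involutive i) (Fin.opposite-involutive j)
      eqf : fl (lookup (Qof a l) (Fin.opposite i) - lookup (Qof a l) (Fin.opposite j)) + - d ≡ fl (lookup (PP a) i - lookup (PP a) j)
      eqf = trans (cong (_+ - d) (trans (Qof-floor a l (Fin.opposite i) (Fin.opposite j)) (cong (_+ d) (opp (λ s t → fl (lookup (PP a) s - lookup (PP a) t)))))) (e₁ (fl (lookup (PP a) i - lookup (PP a) j)) d)
      eqp : pair (Translate l z) (Fin.opposite i) (Fin.opposite j) ℚ.+ ι (- d) ≡ pair z i j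
      eqp = trans (cong₂ ℚ._+_ (trans (Translate-pair l z (Fin.opposite i) (Fin.opposite j)) (cong (ℚ._+ ι d) (opp (pair z)))) (ι-neg d)) (e₂ (pair z i j) (ι d))

    sum-reverse : ∀ {m} (v : Vec ℚ m) → sumℚ (Vec.reverse v) ≡ sumℚ v
    sum-reverse [] = refl
    sum-reverse (x ∷ v) = trans (cong sumℚ (Vec.reverse-∷ x v)) (trans (snoc (Vec.reverse v) x) (trans (cong (ℚ._+ x) (sum-reverse v)) (ℚ.+-comm (sumℚ v) x)))
      where
      snoc : ∀ {m} (v : Vec ℚ m) x → sumℚ (v Vec.∷ʳ x) ≡ sumℚ v ℚ.+ x
      snoc [] x = ℚ.+-comm x 0ℚ
      snoc (y ∷ v) x = trans (cong (y ℚ.+_) (snoc v x)) (sym (ℚ.+-assoc y (sumℚ v) x))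

    untranslate : Vec ℕ n → Pt n → Pt n
    untranslate l y = Vec.reverse (Vec.zipWith ℚ._-_ y (weight l))

    Translate-untranslate : ∀ l y → Translate l (untranslate l y) ≡ y
    Translate-untranslate l y = trans (cong (λ t → Vec.zipWith ℚ._+_ t (weight l)) (Vec.reverse-involutive (Vec.zipWith ℚ._-_ y (weight l)))) (cancel y (weight l))
      where
      e : ∀ a b → a ℚ.- b ℚ.+ b ≡ a
      e = solve-∀-over ℚ-ring
      cancel : ∀ {m} (u v : Vec ℚ m) → Vec.zipWith ℚ._+_ (Vec.zipWith ℚ._-_ u v) v ≡ u
      cancel [] [] = refl
      cancel (a ∷ u) (b ∷ v) = cong₂ _∷_ (e a b) (cancel u v)

    untranslate-InE : ∀ l y → InE y → InE (untranslate l y)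
    untranslate-InE l y p = trans (sum-reverse (Vec.zipWith ℚ._-_ y (weight l))) (trans (sub y (weight l)) (cong₂ ℚ._-_ p (weight-InE l)))
      where
      e : ∀ a b c d → a ℚ.- b ℚ.+ (c ℚ.- d) ≡ a ℚ.+ c ℚ.- (b ℚ.+ d)
      e = solve-∀-over ℚ-ring
      sub : ∀ {m} (u v : Vec ℚ m) → sumℚ (Vec.zipWith ℚ._-_ u v) ≡ sumℚ u ℚ.- sumℚ v
      sub [] [] = refl
      sub (a ∷ u) (b ∷ v) = trans (cong (a ℚ.- b ℚ.+_) (sub u v)) (e a b (sumℚ u) (sumℚ v))

    theta-from-PP : ∀ a l θ → PP θ ≡ Qof a l → IsTheta a l θ
    theta-from-PP a l θ p y yE = to , from
      where
      to : InAlcove θ y → Σ (Pt n) λ z → InAlcove a z × Translate l z ≡ y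
      to A = untranslate l y , region⇒alcove a (untranslate-InE l y yE) (Translate-region⁻ a l (untranslate l y) (subst₂ Region p (sym (Translate-untranslate l y)) (proj₂ (alcove⇒region θ A)))) , Translate-untranslate l y
      from : (Σ (Pt n) λ z → InAlcove a z × Translate l z ≡ y) → InAlcove θ y
      from (z , A , q) = region⇒alcove θ yE (subst₂ Region (sym p) q (Translate-region a l z (proj₂ (alcove⇒region a A))))

    -- One point decides: the barycentre of the alcove of θ lies in both regions, so all floors
    -- agree.
    PP-from-theta : ∀ a l θ → IsTheta a l θ → PP θ ≡ Qof a l
    PP-from-theta a l θ T = floors-determine {PP θ} {Qof a l} (PP-Good θ) (Qof-Good a l) same
      where
      y : Pt n
      y = act θ bpt
      A = bpt-alcove θ
      yE : InE y
      yE = act-InE θ {bpt} bpt-InE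
      image : Σ (Pt n) λ z → InAlcove a z × Translate l z ≡ y
      image = proj₁ (T y yE) A
      R : Region (Qof a l) y
      R = subst (Region (Qof a l)) (proj₂ (proj₂ image)) (Translate-region a l (proj₁ image) (proj₂ (alcove⇒region a (proj₁ (proj₂ image)))))
      R′ : Region (PP θ) y
      R′ = proj₂ (alcove⇒region θ A)
      same : ∀ i j → fl (lookup (PP θ) i - lookup (PP θ) j) ≡ fl (lookup (Qof a l) i - lookup (Qof a l) j)
      same i j with i Fin.≟ j
      ... | no i≢j = between-unique (R′ i j i≢j) (R i j i≢j)
      ... | yes refl = cong fl (trans (ℤ.+-inverseʳ (lookup (PP θ) i)) (sym (ℤ.+-inverseʳ (lookup (Qof a l) i))))

    Gaps : Vec ℤ (suc n) → Set
    Gaps A = ∀ i → lookup A (Fin.suc i) + 1ℤ ≤ lookup A (Fin.inject₁ i) × lookup A (Fin.inject₁ i) + 1ℤ ≤ lookup A (Fin.suc i) + N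

    -- The box is tested at the barycentre of the alcove. It gives weak bounds there, and distinct
    -- residues exclude the differences 0 and N.
    InF⇒Gaps : ∀ a → InF a → Gaps (Vec.reverse (PP a))
    InF⇒Gaps a F i = strict₁ , strict₂
      where
      w : InΠ⁻ (act a bpt)
      w = F (act a bpt) (bpt-alcove a)
      x : Pt n
      x = proj₁ w
      A : Vec ℤ (suc n)
      A = Vec.reverse (PP a)
      entry : ∀ c → lookup x c ≡ bary (lookup A c)
      entry c = trans (sym (lookup-reverse-opposite x c)) (trans (cong (λ v → lookup v (Fin.opposite c)) (proj₂ (proj₂ w))) (trans (act-bpt a (Fin.opposite c)) (cong bary (sym (lookup-reverse (PP a) c)))))
      u v : ℤ
      u = lookup A (Fin.inject₁ i)
      v = lookup A (Fin.suc i)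
      pr : pair x (Fin.inject₁ i) (Fin.suc i) ≡ κ ℚ.* ι ((u - v) + (u - v))
      pr = trans (cong₂ ℚ._-_ (entry (Fin.inject₁ i)) (entry (Fin.suc i))) (bary-diff u v)
      bounds : (0ℚ ℚ.≤ pair x (Fin.inject₁ i) (Fin.suc i)) × (pair x (Fin.inject₁ i) (Fin.suc i) ℚ.≤ 1ℚ)
      bounds = proj₂ (proj₁ (proj₂ w)) i
      0≤ : 0ℤ ≤ u - v
      0≤ = double-cancel {0ℤ} (κ-cancel-≤ (subst₂ ℚ._≤_ (sym (trans (cong (κ ℚ.*_) ι-0) (ℚ.*-zeroʳ κ))) pr (proj₁ bounds)))
      ≤N : u - v ≤ N * 1ℤ
      ≤N = double-cancel (κ-cancel-≤ (subst₂ ℚ._≤_ pr (sym (trans (κ-inverse 1ℤ) ι-1)) (proj₂ bounds)))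
      ¬D : ¬ Dvd (u - v)
      ¬D = AllPairs-lookup (Good⇒Distinct {A} (reverse-Good (PP a) (PP-Good a))) (Fin.inject₁ i) (Fin.suc i) (s≤s (ℕ.≤-reflexive (Fin.toℕ-inject₁ i)))
      e₁ : ∀ u v → u - (v + 1ℤ) ≡ u - v - (0ℤ + 1ℤ)
      e₁ = solve-∀
      e₂ : ∀ u v N → v + N - (u + 1ℤ) ≡ N * 1ℤ - (u - v + 1ℤ)
      e₂ = solve-∀
      strict₁ : v + 1ℤ ≤ u
      strict₁ = lin (<⇒+1≤ (ℤ.≤∧≢⇒< 0≤ (λ p → ¬D (subst Dvd p Dvd-0)))) (e₁ u v)
      strict₂ : u + 1ℤ ≤ v + N
      strict₂ = lin (<⇒+1≤ (ℤ.≤∧≢⇒< ≤N (λ p → ¬D (1ℤ , p)))) (e₂ u v N)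

    Qv-Decr : ∀ A l → Gaps A → Decr (Qv A l)
    Qv-Decr A l gaps = consecutive⇒AllPairs (λ {x} {y} {z} → <-step-trans {x} {y} {z}) (Qv A l) step
      where
      step : ∀ i → lookup (Qv A l) (Fin.suc i) + 1ℤ ≤ lookup (Qv A l) (Fin.inject₁ i)
      step i = subst₂ (λ s t → s + 1ℤ ≤ t) (sym (lookup-Qv A l (Fin.suc i))) (sym (trans (lookup-Qv A l (Fin.inject₁ i)) (cong (λ t → lookup A (Fin.inject₁ i) + N * t - Kap l) (trans (cong (sfx l) (Fin.toℕ-inject₁ i)) (sfx-step l i)))))
        (lin (proj₁ (gaps i) ⊹ N*-mono (+≤+ (z≤n {lookup l i}))) (e (lookup A (Fin.inject₁ i)) (lookup A (Fin.suc i)) N (+ lookup l i) (sfx l (suc (toℕ i))) (Kap l)))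
        where
        e : ∀ u v N x s k → u + N * (x + s) - k - (v + N * s - k + 1ℤ) ≡ u + N * x - (v + 1ℤ + N * 0ℤ)
        e = solve-∀

    -- The two halves meet here: the vertex order gives a subword of the constructed reduced word,
    -- and a subword of any reduced word gives the vertex order.
    module Interval {Y : Vec ℤ (suc n)} (dY : Decr Y) (gY : Good Y) where

      open Reach (reachable {Y} dY gY) public

      wordS : SWord n
      wordS = List.reverse word

      PP-wordS : PP (⟦ 1≤n ⟧S wordS) ≡ Y
      PP-wordS = trans (PP-word word) value

      word-shortest : ∀ v → PSr v ≡ Y → length word ℕ.≤ length v
      word-shortest v p = ℤ.drop‿+≤+ (lin (ℤ.≤-reflexive (sym reduced) ⊹ subst (λ t → L0 t ≤ L0 idv + + length v) p (L0-length v)) (e (L0 idv) (L0 Y) (+ length word) (+ length v)))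
        where
        e : ∀ i y w v → v - w ≡ y + (i + v) - (i + w + y)
        e = solve-∀

      wordS-reduced : ∀ θ → PP θ ≡ Y → IsReducedFor 1≤n wordS θ
      wordS-reduced θ p = PP-≡⇒≈ (⟦ 1≤n ⟧S wordS) θ (trans PP-wordS (sym p)) , λ v′ q →
        subst₂ ℕ._≤_ (sym (List.length-reverse word)) (List.length-reverse v′) (word-shortest (List.reverse v′) (trans (sym (PP-word′ v′)) (trans (≈⇒PP-≡ (⟦ 1≤n ⟧S v′) θ q) p)))

      D⇒Bruhat : ∀ θ → PP θ ≡ Y → ∀ x → D (PP x) Y → Bruhat≤ 1≤n x θ
      D⇒Bruhat θ p x d = wordS , wordS-reduced θ p , List.reverse u , reverse⁺ s , PP-≡⇒≈ (⟦ 1≤n ⟧S (List.reverse u)) x (trans (PP-word u) q)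
        where
        sub : Subword (PP x) word
        sub = complete (PP x) (PP-Good x) d
        u = proj₁ sub
        s = proj₁ (proj₂ sub)
        q = proj₂ (proj₂ sub)

      Bruhat⇒D : ∀ θ → PP θ ≡ Y → ∀ x → Bruhat≤ 1≤n x θ → D (PP x) Y
      Bruhat⇒D θ p x (v , (v≈θ , shortest) , u , s , u≈x) = subst (λ t → D t Y) (trans (sym (PP-word′ u)) (≈⇒PP-≡ (⟦ 1≤n ⟧S u) x u≈x)) (subwords-below (List.reverse v) {Y} vY dY len (List.reverse u) (reverse⁺ s))
        where
        vY : PSr (List.reverse v) ≡ Y
        vY = trans (sym (PP-word′ v)) (trans (≈⇒PP-≡ (⟦ 1≤n ⟧S v) θ v≈θ) p)
        len≡ : length word ≡ length (List.reverse v)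
        len≡ = ℕ.≤-antisym (word-shortest (List.reverse v) vY) (subst₂ ℕ._≤_ (sym (List.length-reverse v)) (List.length-reverse word) (shortest wordS (proj₁ (wordS-reduced θ p))))
        len : L0 Y ≡ L0 idv + + length (List.reverse v)
        len = trans reduced (cong (λ t → L0 idv + + t) len≡)

      element : ∀ P → Good P → D P Y → ∃ λ x → PP x ≡ P
      element P g d = ⟦ 1≤n ⟧S (List.reverse (proj₁ sub)) , trans (PP-word (proj₁ sub)) (proj₂ (proj₂ sub))
        where
        sub : Subword P word
        sub = complete P g d

  -- Chain polynomials

  infix 4 _⊑_
  -- Both equations are kept because submodularity produces a union and an intersection, which are
  -- then rewritten directly.
  _⊑_ : ∀ {m} → Subset m → Subset m → Set
  T ⊑ S = T ∪ S ≡ S × T ∩ S ≡ T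

  ⊑-refl : ∀ {m} {S : Subset m} → S ⊑ S
  ⊑-refl {S = S} = Subset.∪-idem S , Subset.∩-idem S

  ⊑-trans : ∀ {m} {S T U : Subset m} → S ⊑ T → T ⊑ U → S ⊑ U
  ⊑-trans {S = S} {T} {U} (a , b) (c , d) =
    trans (cong (S ∪_) (sym c)) (trans (sym (Subset.∪-assoc S T U)) (trans (cong (_∪ U) a) c)) ,
    trans (cong (_∩ U) (sym b)) (trans (Subset.∩-assoc S T U) (trans (cong (S ∩_) d) b))

  ⊑-⊤ : ∀ {m} {S : Subset m} → S ⊑ ⊤ˢ
  ⊑-⊤ {S = S} = Subset.∪-zeroʳ S , Subset.∩-identityʳ S

  ⊥-⊑ : ∀ {m} {S : Subset m} → ⊥ˢ ⊑ S
  ⊥-⊑ {S = S} = Subset.∪-identityˡ S , Subset.∩-zeroˡ S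

  out-⊑-out : ∀ {m} {S T : Subset m} → S ⊑ T → (false ∷ S) ⊑ (false ∷ T)
  out-⊑-out (a , b) = cong (false ∷_) a , cong (false ∷_) b

  out-⊑-in : ∀ {m} {S T : Subset m} → S ⊑ T → (false ∷ S) ⊑ (true ∷ T)
  out-⊑-in (a , b) = cong (true ∷_) a , cong (false ∷_) b

  in-⊑-in : ∀ {m} {S T : Subset m} → S ⊑ T → (true ∷ S) ⊑ (true ∷ T)
  in-⊑-in (a , b) = cong (true ∷_) a , cong (true ∷_) b

  -- A polynomial all of whose monomials are products over chains of subsets containing T; the second index bounds the degree.
  data CP {m : ℕ} : Subset m → ℕ → Set where
    con : ∀ {T d} → ℚ → CP T d
    _⊕_ : ∀ {T d} → CP T d → CP T d → CP T d
    var : ∀ {T d} S → T ⊑ S → CP S d → CP T (suc d)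

  ⟦_⟧ : ∀ {m d} {T : Subset m} → CP T d → (Subset m → ℚ) → ℚ
  ⟦ con q ⟧ G = q
  ⟦ F ⊕ F′ ⟧ G = ⟦ F ⟧ G ℚ.+ ⟦ F′ ⟧ G
  ⟦ var S _ F ⟧ G = G S ℚ.* ⟦ F ⟧ G

  ⟦⟧-cong : ∀ {m d} {T : Subset m} (F : CP T d) {G G′} → (∀ S → T ⊑ S → G S ≡ G′ S) → ⟦ F ⟧ G ≡ ⟦ F ⟧ G′
  ⟦⟧-cong (con q) p = refl
  ⟦⟧-cong (F ⊕ F′) p = cong₂ ℚ._+_ (⟦⟧-cong F p) (⟦⟧-cong F′ p)
  ⟦⟧-cong (var S T⊑S F) p = cong₂ ℚ._*_ (p S T⊑S) (⟦⟧-cong F (λ S′ q → p S′ (⊑-trans T⊑S q)))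

  scale : ∀ {m d} {T : Subset m} → ℚ → CP T d → CP T d
  scale k (con q) = con (k ℚ.* q)
  scale k (F ⊕ F′) = scale k F ⊕ scale k F′
  scale k (var S p F) = var S p (scale k F)

  ⟦scale⟧ : ∀ {m d} {T : Subset m} k (F : CP T d) G → ⟦ scale k F ⟧ G ≡ k ℚ.* ⟦ F ⟧ G
  ⟦scale⟧ k (con q) G = refl
  ⟦scale⟧ k (F ⊕ F′) G = trans (cong₂ ℚ._+_ (⟦scale⟧ k F G) (⟦scale⟧ k F′ G)) (sym (ℚ.*-distribˡ-+ k (⟦ F ⟧ G) (⟦ F′ ⟧ G)))
  ⟦scale⟧ k (var S p F) G = trans (cong (G S ℚ.*_) (⟦scale⟧ k F G)) (e (G S) k (⟦ F ⟧ G))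
    where
    e : ∀ a b c → a ℚ.* (b ℚ.* c) ≡ b ℚ.* (a ℚ.* c)
    e = solve-∀-over ℚ-ring

  raise : ∀ {m d} {T : Subset m} → CP T d → CP T (suc d)
  raise (con q) = con q
  raise (F ⊕ F′) = raise F ⊕ raise F′
  raise (var S p F) = var S p (raise F)

  ⟦raise⟧ : ∀ {m d} {T : Subset m} (F : CP T d) G → ⟦ raise F ⟧ G ≡ ⟦ F ⟧ G
  ⟦raise⟧ (con q) G = refl
  ⟦raise⟧ (F ⊕ F′) G = cong₂ ℚ._+_ (⟦raise⟧ F G) (⟦raise⟧ F′ G)
  ⟦raise⟧ (var S p F) G = cong (G S ℚ.*_) (⟦raise⟧ F G)

  lower : ∀ {m d} {T T′ : Subset m} → T′ ⊑ T → CP T d → CP T′ d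
  lower q (con k) = con k
  lower q (F ⊕ F′) = lower q F ⊕ lower q F′
  lower q (var S p F) = var S (⊑-trans q p) F

  ⟦lower⟧ : ∀ {m d} {T T′ : Subset m} (q : T′ ⊑ T) (F : CP T d) G → ⟦ lower q F ⟧ G ≡ ⟦ F ⟧ G
  ⟦lower⟧ q (con k) G = refl
  ⟦lower⟧ q (F ⊕ F′) G = cong₂ ℚ._+_ (⟦lower⟧ q F G) (⟦lower⟧ q F′ G)
  ⟦lower⟧ q (var S p F) G = refl

  invSuc : ℕ → ℚ
  invSuc k = ℚ.1/ (mkℚ (+ suc k) 0 (Coprime.sym (Coprime.1-coprimeTo (suc k))))

  opaque
    unfolding ι
    ι*invSuc : ∀ k → ι (+ suc k) ℚ.* invSuc k ≡ 1ℚ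
    ι*invSuc k = ℚ.*-inverseʳ (ι (+ suc k))

  -- rising k t = t (t + 1) ⋯ (t + k - 1) / k!, so that summation over t raises the index by one.
  rising : ℕ → ℚ → ℚ
  rising zero t = 1ℚ
  rising (suc k) t = invSuc k ℚ.* ((t ℚ.+ ι (+ k)) ℚ.* rising k t)

  rising-suc : ∀ k t → ι (+ suc k) ℚ.* rising (suc k) t ≡ (t ℚ.+ ι (+ k)) ℚ.* rising k t
  rising-suc k t = trans (sym (ℚ.*-assoc (ι (+ suc k)) (invSuc k) _)) (trans (cong (ℚ._* ((t ℚ.+ ι (+ k)) ℚ.* rising k t)) (ι*invSuc k)) (ℚ.*-identityˡ _))

  ι-suc : ∀ k → ι (+ suc k) ≡ 1ℚ ℚ.+ ι (+ k)
  ι-suc k = trans (ι-+ 1ℤ (+ k)) (cong (ℚ._+ ι (+ k)) ι-1)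

  ι-suc-cancel : ∀ k {a b} → ι (+ suc k) ℚ.* a ≡ ι (+ suc k) ℚ.* b → a ≡ b
  ι-suc-cancel k {a} {b} p = trans (sym (unit a)) (trans (cong (invSuc k ℚ.*_) p) (unit b))
    where
    unit : ∀ a → invSuc k ℚ.* (ι (+ suc k) ℚ.* a) ≡ a
    unit a = trans (sym (ℚ.*-assoc (invSuc k) (ι (+ suc k)) a)) (trans (cong (ℚ._* a) (trans (ℚ.*-comm (invSuc k) (ι (+ suc k))) (ι*invSuc k))) (ℚ.*-identityˡ a))

  -- Pascal's rule; the division by k + 1 in the definition is cleared by `ι-suc-cancel`.
  rising-diff : ∀ k t → rising (suc k) t ≡ rising (suc k) (t ℚ.- 1ℚ) ℚ.+ rising k t
  rising-diff zero t = ι-suc-cancel 0 (trans (rising-suc 0 t) (trans (trans (cong (λ z → (t ℚ.+ z) ℚ.* 1ℚ) ι-0) (e₁ t)) (sym (trans (ℚ.*-distribˡ-+ (ι (+ 1)) (rising 1 (t ℚ.- 1ℚ)) 1ℚ) (cong₂ ℚ._+_ (trans (rising-suc 0 (t ℚ.- 1ℚ)) (cong (λ z → (t ℚ.- 1ℚ ℚ.+ z) ℚ.* 1ℚ) ι-0)) (cong (ℚ._* 1ℚ) ι-1))))))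
    where
    e₁ : ∀ t → (t ℚ.+ 0ℚ) ℚ.* 1ℚ ≡ (t ℚ.- 1ℚ ℚ.+ 0ℚ) ℚ.* 1ℚ ℚ.+ 1ℚ ℚ.* 1ℚ
    e₁ = solve-∀-over ℚ-ring
  rising-diff (suc k) t = ι-suc-cancel (suc k) (trans (rising-suc (suc k) t) (trans main (sym (trans (ℚ.*-distribˡ-+ (ι (+ suc (suc k))) _ (rising (suc k) t)) (cong (ℚ._+ ι (+ suc (suc k)) ℚ.* rising (suc k) t) (rising-suc (suc k) (t ℚ.- 1ℚ)))))))
    where
    b b′ a K : ℚ
    b = rising (suc k) t
    b′ = rising (suc k) (t ℚ.- 1ℚ)
    a = rising k t
    K = ι (+ k)
    e₁ : ∀ t b′ a K → (t ℚ.+ (1ℚ ℚ.+ K)) ℚ.* (b′ ℚ.+ a) ≡ (t ℚ.- 1ℚ ℚ.+ (1ℚ ℚ.+ K)) ℚ.* b′ ℚ.+ ((b′ ℚ.+ a) ℚ.+ (t ℚ.+ K) ℚ.* a)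
    e₁ = solve-∀-over ℚ-ring
    e₂ : ∀ x y z → x ℚ.+ (y ℚ.+ z ℚ.* y) ≡ x ℚ.+ (1ℚ ℚ.+ z) ℚ.* y
    e₂ = solve-∀-over ℚ-ring
    main : (t ℚ.+ ι (+ suc k)) ℚ.* b ≡ (t ℚ.- 1ℚ ℚ.+ ι (+ suc k)) ℚ.* b′ ℚ.+ ι (+ suc (suc k)) ℚ.* b
    main = trans (cong₂ (λ x y → (t ℚ.+ x) ℚ.* y) (ι-suc k) (rising-diff k t)) (trans (e₁ t b′ a K)
      (trans (cong₂ (λ x y → (t ℚ.- 1ℚ ℚ.+ x) ℚ.* b′ ℚ.+ y) (sym (ι-suc k)) (cong₂ ℚ._+_ (sym (rising-diff k t)) (sym (rising-suc k t))))
        (trans (e₂ ((t ℚ.- 1ℚ ℚ.+ ι (+ suc k)) ℚ.* b′) b (ι (+ suc k))) (cong (λ x → (t ℚ.- 1ℚ ℚ.+ ι (+ suc k)) ℚ.* b′ ℚ.+ x ℚ.* b) (sym (ι-suc (suc k)))))))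

  sumR : (ℤ → ℚ) → ℤ → ℕ → ℚ
  sumR f a zero = 0ℚ
  sumR f a (suc k) = f a ℚ.+ sumR f (a + 1ℤ) k

  sumR-split : ∀ f a j k → sumR f a (j ℕ.+ k) ≡ sumR f a j ℚ.+ sumR f (a + + j) k
  sumR-split f a zero k = trans (cong (λ t → sumR f t k) (sym (ℤ.+-identityʳ a))) (sym (ℚ.+-identityˡ _))
  sumR-split f a (suc j) k = trans (cong (f a ℚ.+_) (trans (sumR-split f (a + 1ℤ) j k) (cong (λ t → sumR f (a + 1ℤ) j ℚ.+ sumR f t k) (ℤ.+-assoc a 1ℤ (+ j))))) (sym (ℚ.+-assoc (f a) _ _))

  sumR-cong : ∀ {f g} a k → (∀ t → a ≤ t → t + 1ℤ ≤ a + + k → f t ≡ g t) → sumR f a k ≡ sumR g a k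
  sumR-cong a zero p = refl
  sumR-cong a (suc k) p = cong₂ ℚ._+_ (p a ℤ.≤-refl (ℤ.+-monoʳ-≤ a (+≤+ (s≤s z≤n)))) (sumR-cong (a + 1ℤ) k (λ t q r → p t (lin (q ⊹ +≤+ (z≤n {1})) (e a t)) (subst (t + 1ℤ ≤_) (ℤ.+-assoc a 1ℤ (+ k)) r)))
    where
    e : ∀ a t → t - a ≡ t + 1ℤ - (a + 1ℤ + 0ℤ)
    e = solve-∀

  sumR-+ : ∀ f g a k → sumR (λ t → f t ℚ.+ g t) a k ≡ sumR f a k ℚ.+ sumR g a k
  sumR-+ f g a zero = refl
  sumR-+ f g a (suc k) = trans (cong (f a ℚ.+ g a ℚ.+_) (sumR-+ f g (a + 1ℤ) k)) (e (f a) (g a) _ _)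
    where
    e : ∀ a b c d → a ℚ.+ b ℚ.+ (c ℚ.+ d) ≡ a ℚ.+ c ℚ.+ (b ℚ.+ d)
    e = solve-∀-over ℚ-ring

  sumR-*ʳ : ∀ f q a k → sumR (λ t → f t ℚ.* q) a k ≡ sumR f a k ℚ.* q
  sumR-*ʳ f q a zero = sym (ℚ.*-zeroˡ q)
  sumR-*ʳ f q a (suc k) = trans (cong (f a ℚ.* q ℚ.+_) (sumR-*ʳ f q (a + 1ℤ) k)) (sym (ℚ.*-distribʳ-+ q (f a) _))

  sumR-*ˡ : ∀ f q a k → sumR (λ t → q ℚ.* f t) a k ≡ q ℚ.* sumR f a k
  sumR-*ˡ f q a zero = sym (ℚ.*-zeroʳ q)
  sumR-*ˡ f q a (suc k) = trans (cong (q ℚ.* f a ℚ.+_) (sumR-*ˡ f q (a + 1ℤ) k)) (sym (ℚ.*-distribˡ-+ q (f a) _))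

  sumR-const : ∀ q a k → sumR (λ _ → q) a k ≡ q ℚ.* ι (+ k)
  sumR-const q a zero = sym (trans (cong (q ℚ.*_) ι-0) (ℚ.*-zeroʳ q))
  sumR-const q a (suc k) = trans (cong (q ℚ.+_) (sumR-const q (a + 1ℤ) k)) (trans (e q (ι (+ k))) (cong (q ℚ.*_) (sym (ι-suc k))))
    where
    e : ∀ q k → q ℚ.+ q ℚ.* k ≡ q ℚ.* (1ℚ ℚ.+ k)
    e = solve-∀-over ℚ-ring

  sumR-rising : ∀ j a k → sumR (λ t → rising j (ι t)) (a + 1ℤ) k ≡ rising (suc j) (ι (a + + k)) ℚ.- rising (suc j) (ι a)
  sumR-rising j a zero = trans (sym (ℚ.+-inverseʳ (rising (suc j) (ι a)))) (cong (λ t → rising (suc j) (ι t) ℚ.- rising (suc j) (ι a)) (sym (ℤ.+-identityʳ a)))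
  sumR-rising j a (suc k) = trans (cong (rising j (ι (a + 1ℤ)) ℚ.+_) (sumR-rising j (a + 1ℤ) k))
    (trans (cong₂ (λ s t → rising j (ι (a + 1ℤ)) ℚ.+ (rising (suc j) (ι s) ℚ.- t)) (ℤ.+-assoc a 1ℤ (+ k)) step) (e (rising j (ι (a + 1ℤ))) (rising (suc j) (ι (a + + suc k))) (rising (suc j) (ι a))))
    where
    e : ∀ x y z → x ℚ.+ (y ℚ.- (z ℚ.+ x)) ≡ y ℚ.- z
    e = solve-∀-over ℚ-ring
    e₁ : ∀ x → x ℚ.+ 1ℚ ℚ.- 1ℚ ≡ x
    e₁ = solve-∀-over ℚ-ring
    step : rising (suc j) (ι (a + 1ℤ)) ≡ rising (suc j) (ι a) ℚ.+ rising j (ι (a + 1ℤ))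
    step = trans (rising-diff j (ι (a + 1ℤ))) (cong (λ s → rising (suc j) s ℚ.+ rising j (ι (a + 1ℤ))) (trans (cong (ℚ._- 1ℚ) (trans (ι-+ a 1ℤ) (cong (ι a ℚ.+_) ι-1))) (e₁ (ι a))))

  -- Polynomials in an extra variable t, written in the basis rising k, whose coefficients only involve sets true ∷ S′ with S ⊑ S′.
  data TP {m : ℕ} (S : Subset m) (d : ℕ) : Set where
    term : ∀ k e → k ℕ.+ e ≡ d → CP (true ∷ S) e → TP S d
    _⊞_  : TP S d → TP S d → TP S d

  ⟦_⟧ₜ : ∀ {m d} {S : Subset m} → TP S d → (Subset (suc m) → ℚ) → ℚ → ℚ
  ⟦ term k e _ F ⟧ₜ G t = rising k t ℚ.* ⟦ F ⟧ G
  ⟦ A ⊞ B ⟧ₜ G t = ⟦ A ⟧ₜ G t ℚ.+ ⟦ B ⟧ₜ G t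

  -- Multiplication by y - t with y = G (true ∷ S): since t + k times the k-th basis element is k +
  -- 1 times the next one, y - t acts as y + k minus that raising term.
  times : ∀ {m d} {S : Subset m} → TP S d → TP S (suc d)
  times {S = S} (term k e p F) =
    (term k (suc e) (trans (ℕ.+-suc k e) (cong suc p)) (var (true ∷ S) ⊑-refl F ⊕ raise (scale (ι (+ k)) F)))
    ⊞ term (suc k) e (cong suc p) (scale (ℚ.- ι (+ suc k)) F)
  times (A ⊞ B) = times A ⊞ times B

  ⟦times⟧ : ∀ {m d} {S : Subset m} (A : TP S d) G t → ⟦ times A ⟧ₜ G t ≡ (G (true ∷ S) ℚ.- t) ℚ.* ⟦ A ⟧ₜ G t
  ⟦times⟧ {S = S} (term k e p F) G t = trans (cong₂ ℚ._+_
      (cong (λ z → rising k t ℚ.* (y ℚ.* f ℚ.+ z)) (trans (⟦raise⟧ (scale (ι (+ k)) F) G) (⟦scale⟧ (ι (+ k)) F G)))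
      (trans (cong (rising (suc k) t ℚ.*_) (⟦scale⟧ (ℚ.- ι (+ suc k)) F G)) (trans (e₁ (rising (suc k) t) (ι (+ suc k)) f) (cong (λ z → ℚ.- (z ℚ.* f)) (rising-suc k t)))))
    (e₂ (rising k t) y f (ι (+ k)) t)
    where
    y f : ℚ
    y = G (true ∷ S)
    f = ⟦ F ⟧ G
    e₁ : ∀ r k f → r ℚ.* ((ℚ.- k) ℚ.* f) ≡ ℚ.- ((k ℚ.* r) ℚ.* f)
    e₁ = solve-∀-over ℚ-ring
    e₂ : ∀ r y f k t → r ℚ.* (y ℚ.* f ℚ.+ k ℚ.* f) ℚ.+ ℚ.- (((t ℚ.+ k) ℚ.* r) ℚ.* f) ≡ (y ℚ.- t) ℚ.* (r ℚ.* f)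
    e₂ = solve-∀-over ℚ-ring
  ⟦times⟧ {S = S} (A ⊞ B) G t = trans (cong₂ ℚ._+_ (⟦times⟧ A G t) (⟦times⟧ B G t)) (sym (ℚ.*-distribˡ-+ (G (true ∷ S) ℚ.- t) (⟦ A ⟧ₜ G t) (⟦ B ⟧ₜ G t)))

  lowerT : ∀ {m d} {S S′ : Subset m} → S′ ⊑ S → TP S d → TP S′ d
  lowerT q (term k e p F) = term k e p (lower (in-⊑-in q) F)
  lowerT q (A ⊞ B) = lowerT q A ⊞ lowerT q B

  ⟦lowerT⟧ : ∀ {m d} {S S′ : Subset m} (q : S′ ⊑ S) (A : TP S d) G t → ⟦ lowerT q A ⟧ₜ G t ≡ ⟦ A ⟧ₜ G t
  ⟦lowerT⟧ q (term k e p F) G t = cong (rising k t ℚ.*_) (⟦lower⟧ (in-⊑-in q) F G)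
  ⟦lowerT⟧ q (A ⊞ B) G t = cong₂ ℚ._+_ (⟦lowerT⟧ q A G t) (⟦lowerT⟧ q B G t)

  -- Substitutes G (true ∷ S) - t for each variable, the value of the slice beyond the breakpoints
  -- of all its sets.
  shifted : ∀ {m d} {T : Subset m} → CP T d → TP T d
  shifted (con q) = term 0 _ refl (con q)
  shifted (F ⊕ F′) = shifted F ⊞ shifted F′
  shifted (var S p F) = lowerT p (times (shifted F))

  ⟦shifted⟧ : ∀ {m d} {T : Subset m} (F : CP T d) G t → ⟦ shifted F ⟧ₜ G t ≡ ⟦ F ⟧ (λ S → G (true ∷ S) ℚ.- t)
  ⟦shifted⟧ (con q) G t = ℚ.*-identityˡ q
  ⟦shifted⟧ (F ⊕ F′) G t = cong₂ ℚ._+_ (⟦shifted⟧ F G t) (⟦shifted⟧ F′ G t)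
  ⟦shifted⟧ (var S p F) G t = trans (⟦lowerT⟧ p (times (shifted F)) G t) (trans (⟦times⟧ (shifted F) G t) (cong ((G (true ∷ S) ℚ.- t) ℚ.*_) (⟦shifted⟧ F G t)))

  -- Polynomials in x = G (false ∷ R) and y = G (true ∷ R) with coefficients above true ∷ R.
  data Two {m : ℕ} (R : Subset m) : ℕ → Set where
    base : ∀ {d} → CP (true ∷ R) d → Two R d
    xmul : ∀ {d} → Two R d → Two R (suc d)
    _⊞_  : ∀ {d} → Two R d → Two R d → Two R d

  ⟦_⟧₂ : ∀ {m d} {R : Subset m} → Two R d → (Subset (suc m) → ℚ) → ℚ
  ⟦ base F ⟧₂ G = ⟦ F ⟧ G
  ⟦_⟧₂ {R = R} (xmul A) G = G (false ∷ R) ℚ.* ⟦ A ⟧₂ G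
  ⟦ A ⊞ B ⟧₂ G = ⟦ A ⟧₂ G ℚ.+ ⟦ B ⟧₂ G

  scale₂ : ∀ {m d} {R : Subset m} → ℚ → Two R d → Two R d
  scale₂ k (base F) = base (scale k F)
  scale₂ k (xmul A) = xmul (scale₂ k A)
  scale₂ k (A ⊞ B) = scale₂ k A ⊞ scale₂ k B

  private
    swap* : ∀ a b c → a ℚ.* (b ℚ.* c) ≡ b ℚ.* (a ℚ.* c)
    swap* = solve-∀-over ℚ-ring

  ⟦scale₂⟧ : ∀ {m d} {R : Subset m} k (A : Two R d) G → ⟦ scale₂ k A ⟧₂ G ≡ k ℚ.* ⟦ A ⟧₂ G
  ⟦scale₂⟧ k (base F) G = ⟦scale⟧ k F G
  ⟦scale₂⟧ {R = R} k (xmul A) G = trans (cong (G (false ∷ R) ℚ.*_) (⟦scale₂⟧ k A G)) (swap* (G (false ∷ R)) k (⟦ A ⟧₂ G))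
  ⟦scale₂⟧ k (A ⊞ B) G = trans (cong₂ ℚ._+_ (⟦scale₂⟧ k A G) (⟦scale₂⟧ k B G)) (sym (ℚ.*-distribˡ-+ k (⟦ A ⟧₂ G) (⟦ B ⟧₂ G)))

  raise₂ : ∀ {m d} {R : Subset m} → Two R d → Two R (suc d)
  raise₂ (base F) = base (raise F)
  raise₂ (xmul A) = xmul (raise₂ A)
  raise₂ (A ⊞ B) = raise₂ A ⊞ raise₂ B

  ⟦raise₂⟧ : ∀ {m d} {R : Subset m} (A : Two R d) G → ⟦ raise₂ A ⟧₂ G ≡ ⟦ A ⟧₂ G
  ⟦raise₂⟧ (base F) G = ⟦raise⟧ F G
  ⟦raise₂⟧ {R = R} (xmul A) G = cong (G (false ∷ R) ℚ.*_) (⟦raise₂⟧ A G)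
  ⟦raise₂⟧ (A ⊞ B) G = cong₂ ℚ._+_ (⟦raise₂⟧ A G) (⟦raise₂⟧ B G)

  -- The factor y is pushed inside all factors x, since the sets of a chain monomial must increase
  -- inwards.
  ymul : ∀ {m d} {R : Subset m} → Two R d → Two R (suc d)
  ymul {R = R} (base F) = base (var (true ∷ R) ⊑-refl F)
  ymul (xmul A) = xmul (ymul A)
  ymul (A ⊞ B) = ymul A ⊞ ymul B

  ⟦ymul⟧ : ∀ {m d} {R : Subset m} (A : Two R d) G → ⟦ ymul A ⟧₂ G ≡ G (true ∷ R) ℚ.* ⟦ A ⟧₂ G
  ⟦ymul⟧ (base F) G = refl
  ⟦ymul⟧ {R = R} (xmul A) G = trans (cong (G (false ∷ R) ℚ.*_) (⟦ymul⟧ A G)) (swap* (G (false ∷ R)) (G (true ∷ R)) (⟦ A ⟧₂ G))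
  ⟦ymul⟧ {R = R} (A ⊞ B) G = trans (cong₂ ℚ._+_ (⟦ymul⟧ A G) (⟦ymul⟧ B G)) (sym (ℚ.*-distribˡ-+ (G (true ∷ R)) (⟦ A ⟧₂ G) (⟦ B ⟧₂ G)))

  two⇒CP : ∀ {m d} {R : Subset m} → Two R d → CP (false ∷ R) d
  two⇒CP (base F) = lower (out-⊑-in ⊑-refl) F
  two⇒CP {R = R} (xmul A) = var (false ∷ R) ⊑-refl (two⇒CP A)
  two⇒CP (A ⊞ B) = two⇒CP A ⊕ two⇒CP B

  ⟦two⇒CP⟧ : ∀ {m d} {R : Subset m} (A : Two R d) G → ⟦ two⇒CP A ⟧ G ≡ ⟦ A ⟧₂ G
  ⟦two⇒CP⟧ (base F) G = ⟦lower⟧ (out-⊑-in ⊑-refl) F G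
  ⟦two⇒CP⟧ {R = R} (xmul A) G = cong (G (false ∷ R) ℚ.*_) (⟦two⇒CP⟧ A G)
  ⟦two⇒CP⟧ (A ⊞ B) G = cong₂ ℚ._+_ (⟦two⇒CP⟧ A G) (⟦two⇒CP⟧ B G)

  width : ∀ {m} → (Subset (suc m) → ℚ) → Subset m → ℚ
  width G R = G (true ∷ R) ℚ.- G (false ∷ R)

  risingStep : ∀ {m d} {R : Subset m} → ℕ → Two R d → Two R (suc d)
  risingStep k A = (ymul A ⊞ scale₂ (ℚ.- 1ℚ) (xmul A)) ⊞ raise₂ (scale₂ (ι (+ k)) A)

  risingAt : ∀ {m} {R : Subset m} k {e} → CP (true ∷ R) e → Two R (k ℕ.+ e)
  risingAt zero F = base F
  risingAt (suc k) F = scale₂ (invSuc k) (risingStep k (risingAt k F))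

  ⟦risingAt⟧ : ∀ {m} {R : Subset m} k {e} (F : CP (true ∷ R) e) G → ⟦ risingAt k F ⟧₂ G ≡ rising k (width G R) ℚ.* ⟦ F ⟧ G
  ⟦risingAt⟧ zero F G = sym (ℚ.*-identityˡ (⟦ F ⟧ G))
  ⟦risingAt⟧ {R = R} (suc k) F G = trans (⟦scale₂⟧ (invSuc k) (risingStep k A) G) (trans (cong (invSuc k ℚ.*_)
      (trans (cong₂ ℚ._+_ (cong₂ ℚ._+_ (⟦ymul⟧ A G) (⟦scale₂⟧ (ℚ.- 1ℚ) (xmul A) G)) (trans (⟦raise₂⟧ (scale₂ (ι (+ k)) A) G) (⟦scale₂⟧ (ι (+ k)) A G)))
        (trans (e (G (true ∷ R)) (G (false ∷ R)) (ι (+ k)) (⟦ A ⟧₂ G)) (cong ((width G R ℚ.+ ι (+ k)) ℚ.*_) (⟦risingAt⟧ k F G)))))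
      (e₁ (invSuc k) (width G R ℚ.+ ι (+ k)) (rising k (width G R)) (⟦ F ⟧ G)))
    where
    A = risingAt k F
    e : ∀ y x k a → y ℚ.* a ℚ.+ (ℚ.- 1ℚ) ℚ.* (x ℚ.* a) ℚ.+ k ℚ.* a ≡ (y ℚ.- x ℚ.+ k) ℚ.* a
    e = solve-∀-over ℚ-ring
    e₁ : ∀ i w r f → i ℚ.* (w ℚ.* (r ℚ.* f)) ≡ i ℚ.* (w ℚ.* r) ℚ.* f
    e₁ = solve-∀-over ℚ-ring

  -- The antiderivative of A in t, evaluated at t = width G R.
  primitive-at : ∀ {m d} {S : Subset m} R → R ⊑ S → TP S d → CP (false ∷ R) (suc d)
  primitive-at R q (term k e p F) = subst (CP (false ∷ R)) (cong suc p) (two⇒CP (risingAt (suc k) (lower (in-⊑-in q) F)))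
  primitive-at R q (A ⊞ B) = primitive-at R q A ⊕ primitive-at R q B

  ⟦_⟧ₚ : ∀ {m d} {S : Subset m} → TP S d → (Subset (suc m) → ℚ) → ℚ → ℚ
  ⟦ term k e _ F ⟧ₚ G t = rising (suc k) t ℚ.* ⟦ F ⟧ G
  ⟦ A ⊞ B ⟧ₚ G t = ⟦ A ⟧ₚ G t ℚ.+ ⟦ B ⟧ₚ G t

  ⟦primitive-at⟧ : ∀ {m d} {S : Subset m} R (q : R ⊑ S) (A : TP S d) G → ⟦ primitive-at R q A ⟧ G ≡ ⟦ A ⟧ₚ G (width G R)
  ⟦primitive-at⟧ R q (term k e refl F) G = trans (⟦two⇒CP⟧ (risingAt (suc k) (lower (in-⊑-in q) F)) G) (trans (⟦risingAt⟧ (suc k) (lower (in-⊑-in q) F) G) (cong (rising (suc k) (width G R) ℚ.*_) (⟦lower⟧ (in-⊑-in q) F G)))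
  ⟦primitive-at⟧ R q (A ⊞ B) G = cong₂ ℚ._+_ (⟦primitive-at⟧ R q A G) (⟦primitive-at⟧ R q B G)

  sumR-TP : ∀ {m d} {S : Subset m} (A : TP S d) G a k → sumR (λ t → ⟦ A ⟧ₜ G (ι t)) (a + 1ℤ) k ≡ ⟦ A ⟧ₚ G (ι (a + + k)) ℚ.- ⟦ A ⟧ₚ G (ι a)
  sumR-TP (term j e _ F) G a k = trans (sumR-*ʳ (λ t → rising j (ι t)) (⟦ F ⟧ G) (a + 1ℤ) k) (trans (cong (ℚ._* ⟦ F ⟧ G) (sumR-rising j a k)) (e₁ (rising (suc j) (ι (a + + k))) (rising (suc j) (ι a)) (⟦ F ⟧ G)))
    where
    e₁ : ∀ x y z → (x ℚ.- y) ℚ.* z ≡ x ℚ.* z ℚ.- y ℚ.* z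
    e₁ = solve-∀-over ℚ-ring
  sumR-TP (A ⊞ B) G a k = trans (sumR-+ (λ t → ⟦ A ⟧ₜ G (ι t)) (λ t → ⟦ B ⟧ₜ G (ι t)) (a + 1ℤ) k) (trans (cong₂ ℚ._+_ (sumR-TP A G a k) (sumR-TP B G a k)) (e₁ (⟦ A ⟧ₚ G (ι (a + + k))) (⟦ A ⟧ₚ G (ι a)) (⟦ B ⟧ₚ G (ι (a + + k))) (⟦ B ⟧ₚ G (ι a))))
    where
    e₁ : ∀ x y z w → x ℚ.- y ℚ.+ (z ℚ.- w) ≡ x ℚ.+ z ℚ.- (y ℚ.+ w)
    e₁ = solve-∀-over ℚ-ring

  -- Slices of submodular functions and their sums

  Submod : ∀ {m} → (Subset m → ℤ) → Set
  Submod g = ∀ S T → g (S ∪ T) + g (S ∩ T) ≤ g S + g T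

  -- The breakpoint of `slice`: the value of t at which the two arguments of its minimum agree.
  gap : ∀ {m} → (Subset (suc m) → ℤ) → Subset m → ℤ
  gap g S = g (true ∷ S) - g (false ∷ S)

  slice : ∀ {m} → (Subset (suc m) → ℤ) → ℤ → Subset m → ℤ
  slice g t S = g (false ∷ S) ⊓ (g (true ∷ S) - t)

  -- Diminishing returns of a submodular function. This is what orders the breakpoints along a
  -- chain.
  gap-antitone : ∀ {m} {g : Subset (suc m) → ℤ} → Submod g → ∀ {S T} → S ⊑ T → gap g T ≤ gap g S
  gap-antitone {g = g} sub {S} {T} (a , b) = lin (subst₂ (λ u v → g (true ∷ u) + g (false ∷ v) ≤ g (true ∷ S) + g (false ∷ T)) a b (sub (true ∷ S) (false ∷ T))) (e (g (true ∷ S)) (g (false ∷ S)) (g (true ∷ T)) (g (false ∷ T)))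
    where
    e : ∀ yS xS yT xT → yS - xS - (yT - xT) ≡ yS + xT - (yT + xS)
    e = solve-∀

  slice-low : ∀ {m} (g : Subset (suc m) → ℤ) t S → t ≤ gap g S → slice g t S ≡ g (false ∷ S)
  slice-low g t S p = ℤ.i≤j⇒i⊓j≡i (lin p (e (g (true ∷ S)) (g (false ∷ S)) t))
    where
    e : ∀ y x t → y - t - x ≡ y - x - t
    e = solve-∀

  slice-high : ∀ {m} (g : Subset (suc m) → ℤ) t S → gap g S ≤ t → slice g t S ≡ g (true ∷ S) - t
  slice-high g t S p = ℤ.i≥j⇒i⊓j≡j (lin p (e (g (true ∷ S)) (g (false ∷ S)) t))
    where
    e : ∀ y x t → x - (y - t) ≡ t - (y - x)
    e = solve-∀

  -- Submodularity of g is applied to S and T extended by the first coordinates that attain their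
  -- minima; the union and the intersection of the extended sets bound the other two minima.
  slice-Submod : ∀ {m} {g : Subset (suc m) → ℤ} → Submod g → ∀ t → Submod (slice g t)
  slice-Submod {g = g} sub t S T with ℤ.⊓-sel (g (false ∷ S)) (g (true ∷ S) - t) | ℤ.⊓-sel (g (false ∷ T)) (g (true ∷ T) - t)
  ... | inj₁ p | inj₁ q = subst₂ (λ u v → slice g t (S ∪ T) + slice g t (S ∩ T) ≤ u + v) (sym p) (sym q) (ℤ.≤-trans (ℤ.i⊓j≤i (g (false ∷ (S ∪ T))) (g (true ∷ (S ∪ T)) - t) ⊹ ℤ.i⊓j≤i (g (false ∷ (S ∩ T))) (g (true ∷ (S ∩ T)) - t)) (sub (false ∷ S) (false ∷ T)))
  ... | inj₁ p | inj₂ q = subst₂ (λ u v → slice g t (S ∪ T) + slice g t (S ∩ T) ≤ u + v) (sym p) (sym q) (ℤ.≤-trans (ℤ.i⊓j≤j (g (false ∷ (S ∪ T))) (g (true ∷ (S ∪ T)) - t) ⊹ ℤ.i⊓j≤i (g (false ∷ (S ∩ T))) (g (true ∷ (S ∩ T)) - t)) (lin (sub (false ∷ S) (true ∷ T)) (e (g (true ∷ (S ∪ T))) (g (false ∷ (S ∩ T))) (g (false ∷ S)) (g (true ∷ T)) t)))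
    where
    e : ∀ u i s T′ t → s + (T′ - t) - (u - t + i) ≡ s + T′ - (u + i)
    e = solve-∀
  ... | inj₂ p | inj₁ q = subst₂ (λ u v → slice g t (S ∪ T) + slice g t (S ∩ T) ≤ u + v) (sym p) (sym q) (ℤ.≤-trans (ℤ.i⊓j≤j (g (false ∷ (S ∪ T))) (g (true ∷ (S ∪ T)) - t) ⊹ ℤ.i⊓j≤i (g (false ∷ (S ∩ T))) (g (true ∷ (S ∩ T)) - t)) (lin (sub (true ∷ S) (false ∷ T)) (e (g (true ∷ (S ∪ T))) (g (false ∷ (S ∩ T))) (g (true ∷ S)) (g (false ∷ T)) t)))
    where
    e : ∀ u i s T′ t → s - t + T′ - (u - t + i) ≡ s + T′ - (u + i)
    e = solve-∀
  ... | inj₂ p | inj₂ q = subst₂ (λ u v → slice g t (S ∪ T) + slice g t (S ∩ T) ≤ u + v) (sym p) (sym q) (ℤ.≤-trans (ℤ.i⊓j≤j (g (false ∷ (S ∪ T))) (g (true ∷ (S ∪ T)) - t) ⊹ ℤ.i⊓j≤j (g (false ∷ (S ∩ T))) (g (true ∷ (S ∩ T)) - t)) (lin (sub (true ∷ S) (true ∷ T)) (e (g (true ∷ (S ∪ T))) (g (true ∷ (S ∩ T))) (g (true ∷ S)) (g (true ∷ T)) t)))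
    where
    e : ∀ u i s T′ t → s - t + (T′ - t) - (u - t + (i - t)) ≡ s + T′ - (u + i)
    e = solve-∀

  -- The sum over t from gap ⊤ to gap T. A constant is multiplied by the number of terms. For a
  -- variable S, its factor is G (false ∷ S) while t ≤ gap S; beyond that every set above S is past
  -- its breakpoint, and the difference of a primitive between gap S and gap T remains.
  summed : ∀ {m d} {T : Subset m} → CP T d → CP (false ∷ T) (suc d)
  summed {T = T} (con q) = ((var (true ∷ T) (out-⊑-in ⊑-refl) (con q) ⊕ var (false ∷ T) ⊑-refl (con (ℚ.- q)))
    ⊕ (var (true ∷ ⊤ˢ) (out-⊑-in ⊑-⊤) (con (ℚ.- q)) ⊕ var (false ∷ ⊤ˢ) (out-⊑-out ⊑-⊤) (con q))) ⊕ con q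
  summed (F ⊕ F′) = summed F ⊕ summed F′
  summed {T = T} (var S p F) = var (false ∷ S) (out-⊑-out p) (summed F)
    ⊕ (primitive-at T p A ⊕ scale (ℚ.- 1ℚ) (lower (out-⊑-out p) (primitive-at S ⊑-refl A)))
    where A = times (shifted F)

  -- The breakpoints of t ↦ slice g t along a chain of sets are ordered, so each chain monomial sums to a polynomial.
  ⟦summed⟧ : ∀ {m d} {T : Subset m} (F : CP T d) {g} → Submod g → ∀ k → gap g T + 1ℤ ≡ gap g ⊤ˢ + + k →
    sumR (λ t → ⟦ F ⟧ (λ S → ι (slice g t S))) (gap g ⊤ˢ) k ≡ ⟦ summed F ⟧ (λ S → ι (g S))
  ⟦summed⟧ {T = T} (con q) {g} sub k p = trans (sumR-const q (gap g ⊤ˢ) k) (trans (cong (λ t → q ℚ.* t) k≡) (e q (ι (g (true ∷ T))) (ι (g (false ∷ T))) (ι (g (true ∷ ⊤ˢ))) (ι (g (false ∷ ⊤ˢ)))))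
    where
    e : ∀ q a b c d → q ℚ.* (a ℚ.- b ℚ.+ 1ℚ ℚ.- (c ℚ.- d)) ≡ a ℚ.* q ℚ.+ b ℚ.* (ℚ.- q) ℚ.+ (c ℚ.* (ℚ.- q) ℚ.+ d ℚ.* q) ℚ.+ q
    e = solve-∀-over ℚ-ring
    e₁ : ∀ a k → k ≡ a + k - a
    e₁ = solve-∀
    k≡ : ι (+ k) ≡ ι (g (true ∷ T)) ℚ.- ι (g (false ∷ T)) ℚ.+ 1ℚ ℚ.- (ι (g (true ∷ ⊤ˢ)) ℚ.- ι (g (false ∷ ⊤ˢ)))
    k≡ = trans (cong ι (trans (e₁ (gap g ⊤ˢ) (+ k)) (cong (_- gap g ⊤ˢ) (sym p)))) (trans (ι-sub (gap g T + 1ℤ) (gap g ⊤ˢ)) (cong₂ ℚ._-_ (trans (ι-+ (gap g T) 1ℤ) (cong₂ ℚ._+_ (ι-sub (g (true ∷ T)) (g (false ∷ T))) ι-1)) (ι-sub (g (true ∷ ⊤ˢ)) (g (false ∷ ⊤ˢ)))))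
  ⟦summed⟧ (F ⊕ F′) {g} sub k p = trans (sumR-+ (λ t → ⟦ F ⟧ (λ S → ι (slice g t S))) (λ t → ⟦ F′ ⟧ (λ S → ι (slice g t S))) (gap g ⊤ˢ) k) (cong₂ ℚ._+_ (⟦summed⟧ F sub k p) (⟦summed⟧ F′ sub k p))
  ⟦summed⟧ {T = T} (var S q F) {g} sub k p = trans (cong (sumR f (gap g ⊤ˢ)) k≡) (trans (sumR-split f (gap g ⊤ˢ) k₁ k₂) (cong₂ ℚ._+_ part₁ part₂))
    where
    G : Subset _ → ℚ
    G R = ι (g R)
    f : ℤ → ℚ
    f t = ⟦ var S q F ⟧ (λ S → ι (slice g t S))
    A = times (shifted F)
    dS dT d⊤ : ℤ
    dS = gap g S
    dT = gap g T
    d⊤ = gap g ⊤ˢ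
    -- The range is cut at the breakpoint of S, which is counted in the first part; hence the 1 in
    -- k₁ and none in k₂.
    k₁ k₂ : ℕ
    k₁ = ℤ.∣ dS - d⊤ + 1ℤ ∣
    k₂ = ℤ.∣ dT - dS ∣
    k₁≡ : + k₁ ≡ dS - d⊤ + 1ℤ
    k₁≡ = ℤ.0≤i⇒+∣i∣≡i (ℤ.i≤j⇒0≤j-i (gap-antitone {g = g} sub ⊑-⊤) ⊹ +≤+ (z≤n {1}))
    k₂≡ : + k₂ ≡ dT - dS
    k₂≡ = ℤ.0≤i⇒+∣i∣≡i (ℤ.i≤j⇒0≤j-i (gap-antitone {g = g} sub q))
    e₀ : ∀ a b c → b - a + 1ℤ + (c - b) ≡ c + 1ℤ - a
    e₀ = solve-∀
    e₁ : ∀ a k → a + k - a ≡ k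
    e₁ = solve-∀
    e₂ : ∀ a b → a + (b - a + 1ℤ) ≡ b + 1ℤ
    e₂ = solve-∀
    e₃ : ∀ a b → a + (b - a) ≡ b
    e₃ = solve-∀
    k≡ : k ≡ k₁ ℕ.+ k₂
    k≡ = ℤ.+-injective (sym (trans (cong₂ _+_ k₁≡ k₂≡) (trans (e₀ d⊤ dS dT) (trans (cong (_- d⊤) p) (e₁ d⊤ (+ k))))))
    end₁ : d⊤ + + k₁ ≡ dS + 1ℤ
    end₁ = trans (cong (λ t → d⊤ + t) k₁≡) (e₂ d⊤ dS)
    part₁ : sumR f d⊤ k₁ ≡ G (false ∷ S) ℚ.* ⟦ summed F ⟧ G
    part₁ = trans (sumR-cong d⊤ k₁ (λ t _ r → cong (λ z → ι z ℚ.* ⟦ F ⟧ (λ S → ι (slice g t S))) (slice-low g t S (lin (subst (t + 1ℤ ≤_) end₁ r) (e₄ t dS)))))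
      (trans (sumR-*ˡ (λ t → ⟦ F ⟧ (λ S → ι (slice g t S))) (G (false ∷ S)) d⊤ k₁) (cong (G (false ∷ S) ℚ.*_) (⟦summed⟧ F sub k₁ (sym end₁))))
      where
      e₄ : ∀ t s → s - t ≡ s + 1ℤ - (t + 1ℤ)
      e₄ = solve-∀
    high : ∀ t → dS + 1ℤ ≤ t → f t ≡ ⟦ A ⟧ₜ G (ι t)
    high t r = trans (cong₂ ℚ._*_ (at S ⊑-refl) (⟦⟧-cong F (λ R S⊑R → at R S⊑R))) (sym (trans (⟦times⟧ (shifted F) G (ι t)) (cong ((G (true ∷ S) ℚ.- ι t) ℚ.*_) (⟦shifted⟧ F G (ι t)))))
      where
      e₄ : ∀ t s → t - s ≡ t + 1ℤ - (s + 1ℤ + 0ℤ)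
      e₄ = solve-∀
      at : ∀ R → S ⊑ R → ι (slice g t R) ≡ G (true ∷ R) ℚ.- ι t
      at R S⊑R = trans (cong ι (slice-high g t R (ℤ.≤-trans (gap-antitone {g = g} sub S⊑R) (lin (r ⊹ +≤+ (z≤n {1})) (e₄ t dS))))) (ι-sub (g (true ∷ R)) t)
    part₂ : sumR f (d⊤ + + k₁) k₂ ≡ ⟦ primitive-at T q A ⟧ G ℚ.+ ⟦ scale (ℚ.- 1ℚ) (lower (out-⊑-out q) (primitive-at S ⊑-refl A)) ⟧ G
    part₂ = trans (cong (λ t → sumR f t k₂) end₁) (trans (sumR-cong (dS + 1ℤ) k₂ (λ t r _ → high t r)) (trans (sumR-TP A G dS k₂) (trans (cong₂ ℚ._-_ top bottom)
        (trans (e₅ (⟦ primitive-at T q A ⟧ G) (⟦ primitive-at S ⊑-refl A ⟧ G)) (cong (⟦ primitive-at T q A ⟧ G ℚ.+_) (sym (trans (⟦scale⟧ (ℚ.- 1ℚ) (lower (out-⊑-out q) (primitive-at S ⊑-refl A)) G) (cong (ℚ.- 1ℚ ℚ.*_) (⟦lower⟧ (out-⊑-out q) (primitive-at S ⊑-refl A) G)))))))))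
      where
      e₅ : ∀ x y → x ℚ.- y ≡ x ℚ.+ (ℚ.- 1ℚ) ℚ.* y
      e₅ = solve-∀-over ℚ-ring
      top : ⟦ A ⟧ₚ G (ι (dS + + k₂)) ≡ ⟦ primitive-at T q A ⟧ G
      top = trans (cong (⟦ A ⟧ₚ G) (trans (cong ι (trans (cong (λ t → dS + t) k₂≡) (e₃ dS dT))) (ι-sub (g (true ∷ T)) (g (false ∷ T))))) (sym (⟦primitive-at⟧ T q A G))
      bottom : ⟦ A ⟧ₚ G (ι dS) ≡ ⟦ primitive-at S ⊑-refl A ⟧ G
      bottom = trans (cong (⟦ A ⟧ₚ G) (ι-sub (g (true ∷ S)) (g (false ∷ S)))) (sym (⟦primitive-at⟧ S ⊑-refl A G))

  -- Lattice points of base polytopes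

  total : ∀ {m} → Subset m → Vec ℤ m → ℤ
  total = ∑ (λ z → z)

  Base : ∀ {m} → (Subset m → ℤ) → Vec ℤ m → Set
  Base g v = (∀ S → total S v ≤ g S) × total ⊤ˢ v ≡ g ⊤ˢ

  stack : ∀ {m} → (ℤ → List (Vec ℤ m)) → ℤ → ℕ → List (Vec ℤ (suc m))
  stack f t zero = []
  stack f t (suc k) = List.map (t ∷_) (f t) ++ stack f (t + 1ℤ) k

  -- Negative integers are sent to 0.
  pos : ℤ → ℕ
  pos (+ k) = k
  pos -[1+ _ ] = 0

  +pos : ∀ {z} → 0ℤ ≤ z → + pos z ≡ z
  +pos {+ k} _ = refl

  -- The first coordinate runs from gap g ⊤ to g of the first singleton, both included. The lower
  -- end is the inequality for the complementary set, combined with the prescribed total.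
  steps : ∀ {m} → (Subset (suc m) → ℤ) → ℕ
  steps g = pos (g (true ∷ ⊥ˢ) - gap g ⊤ˢ + 1ℤ)

  enum : ∀ m → (Subset m → ℤ) → List (Vec ℤ m)
  enum zero g = [] ∷ []
  enum (suc m) g = stack (λ t → enum m (slice g t)) (gap g ⊤ˢ) (steps g)

  pos-bound : ∀ a b t → t + 1ℤ ≤ a + + pos (b - a + 1ℤ) → a ≤ t → t ≤ b
  pos-bound a b t p q with b - a + 1ℤ in eq
  ... | + k = lin (subst (λ z → t + 1ℤ ≤ a + z) (sym eq) p) (e a b t)
    where
    e : ∀ a b t → b - t ≡ a + (b - a + 1ℤ) - (t + 1ℤ)
    e = solve-∀
  ... | -[1+ k ] = ⊥-elim (absurd (p ⊹ q) (e a t))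
    where
    e : ∀ a t → t + 1ℤ + a - (a + 0ℤ + t) ≡ 1ℤ
    e = solve-∀

  All-stack : ∀ {m} {Q : Vec ℤ (suc m) → Set} (f : ℤ → List (Vec ℤ m)) a k →
    (∀ t → a ≤ t → t + 1ℤ ≤ a + + k → LAll.All (λ v → Q (t ∷ v)) (f t)) → LAll.All Q (stack f a k)
  All-stack f a zero p = []
  All-stack f a (suc k) p = LAll.++⁺ (LAll.map⁺ (p a ℤ.≤-refl (ℤ.+-monoʳ-≤ a (+≤+ (s≤s z≤n))))) (All-stack f (a + 1ℤ) k (λ t q r → p t (lin (q ⊹ +≤+ (z≤n {1})) (e a t)) (subst (t + 1ℤ ≤_) (ℤ.+-assoc a 1ℤ (+ k)) r)))
    where
    e : ∀ a t → t - a ≡ t + 1ℤ - (a + 1ℤ + 0ℤ)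
    e = solve-∀

  ∈-stack : ∀ {m} (f : ℤ → List (Vec ℤ m)) a k t v → a ≤ t → t + 1ℤ ≤ a + + k → v ∈ᴸ f t → (t ∷ v) ∈ᴸ stack f a k
  ∈-stack f a zero t v p q _ = ⊥-elim (absurd (p ⊹ q) (e a t))
    where
    e : ∀ a t → a + (t + 1ℤ) - (t + (a + 0ℤ)) ≡ 1ℤ
    e = solve-∀
  ∈-stack f a (suc k) t v p q i with a ℤ.≟ t
  ... | yes refl = ∈-++⁺ˡ (∈ᴸ-map⁺ (a ∷_) i)
  ... | no a≢t = ∈-++⁺ʳ (List.map (a ∷_) (f a)) (∈-stack f (a + 1ℤ) k t v (<⇒+1≤ (ℤ.≤∧≢⇒< p a≢t)) (subst (t + 1ℤ ≤_) (sym (ℤ.+-assoc a 1ℤ (+ k))) q) i)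

  Distinctᴸ : ∀ {A : Set} → List A → Set
  Distinctᴸ = LPairs.AllPairs _≢_

  stack-distinct : ∀ {m} (f : ℤ → List (Vec ℤ m)) a k → (∀ t → Distinctᴸ (f t)) → Distinctᴸ (stack f a k)
  stack-distinct f a zero p = []
  stack-distinct f a (suc k) p = LPairs.++⁺ (LPairs.map⁺ (LPairs.map (λ x≢y q → x≢y (Vec.∷-injectiveʳ q)) (p a))) (stack-distinct f (a + 1ℤ) k p)
    (LAll.map⁺ (LAll.universal (λ v → All-stack {Q = λ w → a ∷ v ≢ w} f (a + 1ℤ) k (λ t q _ → LAll.universal (λ w eq → later t q (Vec.∷-injectiveˡ eq)) (f t))) (f a)))
    where
    e : ∀ a → a + 1ℤ - a ≡ 1ℤ
    e = solve-∀
    later : ∀ t → a + 1ℤ ≤ t → a ≢ t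
    later t q refl = absurd q (e a)

  enum-distinct : ∀ m g → Distinctᴸ (enum m g)
  enum-distinct zero g = [] ∷ []
  enum-distinct (suc m) g = stack-distinct (λ t → enum m (slice g t)) (gap g ⊤ˢ) (steps g) (λ t → enum-distinct m (slice g t))

  slice-⊥ : ∀ {m} (g : Subset (suc m) → ℤ) t → g ⊥ˢ ≡ 0ℤ → t ≤ g (true ∷ ⊥ˢ) → slice g t ⊥ˢ ≡ 0ℤ
  slice-⊥ g t p q = trans (slice-low g t ⊥ˢ (subst (λ z → t ≤ g (true ∷ ⊥ˢ) - z) (sym p) (lin q (e (g (true ∷ ⊥ˢ)) t)))) p
    where
    e : ∀ y t → y - 0ℤ - t ≡ y - t
    e = solve-∀

  enum-sound : ∀ m g → g ⊥ˢ ≡ 0ℤ → LAll.All (Base g) (enum m g)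
  enum-sound zero g p = ((λ { [] → ℤ.≤-reflexive (sym p) }) , sym p) ∷ []
  enum-sound (suc m) g p = All-stack (λ t → enum m (slice g t)) (gap g ⊤ˢ) (steps g) (λ t lo hi →
    LAll.map (extend t lo) (enum-sound m (slice g t) (slice-⊥ g t p (pos-bound (gap g ⊤ˢ) (g (true ∷ ⊥ˢ)) t hi lo))))
    where
    e₁ : ∀ t s y → y - (t + s) ≡ y - t - s
    e₁ = solve-∀
    e₂ : ∀ t y → t + (y - t) ≡ y
    e₂ = solve-∀
    extend : ∀ t → gap g ⊤ˢ ≤ t → ∀ {v} → Base (slice g t) v → Base g (t ∷ v)
    extend t lo {v} (b , e) = bounds , trans (cong (λ z → t + z) (trans e (slice-high g t ⊤ˢ lo))) (e₂ t (g (true ∷ ⊤ˢ)))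
      where
      bounds : ∀ S → total S (t ∷ v) ≤ g S
      bounds (false ∷ S) = ℤ.≤-trans (b S) (ℤ.i⊓j≤i (g (false ∷ S)) (g (true ∷ S) - t))
      bounds (true ∷ S) = lin (ℤ.≤-trans (b S) (ℤ.i⊓j≤j (g (false ∷ S)) (g (true ∷ S) - t))) (e₁ t (total S v) (g (true ∷ S)))

  enum-complete : ∀ m g v → Base g v → v ∈ᴸ enum m g
  enum-complete zero g [] _ = LAny.here refl
  enum-complete (suc m) g (t ∷ v) (b , e) = ∈-stack (λ t → enum m (slice g t)) (gap g ⊤ˢ) (steps g) t v lo hi (enum-complete m (slice g t) v (b′ , e′))
    where
    e₁ : ∀ t s y x → t - (y - x) ≡ t + s + x - (y + s)
    e₁ = solve-∀
    e₂ : ∀ t s y → y - t - s ≡ y - (t + s)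
    e₂ = solve-∀
    e₃ : ∀ t s → s ≡ t + s - t
    e₃ = solve-∀
    e₄ : ∀ a y t → a + (y - a + 1ℤ) - (t + 1ℤ) ≡ y - t
    e₄ = solve-∀
    e₅ : ∀ y a t → y - a + 1ℤ - 0ℤ ≡ y + t + 1ℤ - (t + a + 0ℤ)
    e₅ = solve-∀
    lo : gap g ⊤ˢ ≤ t
    lo = lin (ℤ.≤-reflexive (sym e) ⊹ b (false ∷ ⊤ˢ)) (e₁ t (total ⊤ˢ v) (g (true ∷ ⊤ˢ)) (g (false ∷ ⊤ˢ)))
    t≤ : t ≤ g (true ∷ ⊥ˢ)
    t≤ = subst (_≤ g (true ∷ ⊥ˢ)) (trans (cong (λ z → t + z) (∑-⊥ (λ z → z) v)) (ℤ.+-identityʳ t)) (b (true ∷ ⊥ˢ))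
    hi : t + 1ℤ ≤ gap g ⊤ˢ + + steps g
    hi = subst (λ z → t + 1ℤ ≤ gap g ⊤ˢ + z) (sym (+pos (lin (t≤ ⊹ lo ⊹ +≤+ (z≤n {1})) (e₅ (g (true ∷ ⊥ˢ)) (gap g ⊤ˢ) t)))) (lin t≤ (e₄ (gap g ⊤ˢ) (g (true ∷ ⊥ˢ)) t))
    b′ : ∀ S → total S v ≤ slice g t S
    b′ S = ℤ.⊓-glb (b (false ∷ S)) (lin (b (true ∷ S)) (e₂ t (total S v) (g (true ∷ S))))
    e′ : total ⊤ˢ v ≡ slice g t ⊤ˢ
    e′ = trans (e₃ t (total ⊤ˢ v)) (trans (cong (_- t) e) (sym (slice-high g t ⊤ˢ lo)))

  length-stack : ∀ {m} (f : ℤ → List (Vec ℤ m)) a k → ι (+ length (stack f a k)) ≡ sumR (λ t → ι (+ length (f t))) a k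
  length-stack f a zero = ι-0
  length-stack f a (suc k) = trans (cong (λ z → ι (+ z)) (trans (List.length-++ (List.map (a ∷_) (f a))) (cong (ℕ._+ length (stack f (a + 1ℤ) k)) (List.length-map (a ∷_) (f a)))))
    (trans (ι-+ (+ length (f a)) (+ length (stack f (a + 1ℤ) k))) (cong (ι (+ length (f a)) ℚ.+_) (length-stack f (a + 1ℤ) k)))

  -- With m + 1 coordinates the base polytope has dimension at most m, which is the degree; with one
  -- coordinate it is a single point.
  countPoly : ∀ m → CP {suc m} ⊥ˢ m
  countPoly zero = con 1ℚ
  countPoly (suc m) = summed (countPoly m)

  count-enum : ∀ m g → Submod g → g ⊥ˢ ≡ 0ℤ → ι (+ length (enum (suc m) g)) ≡ ⟦ countPoly m ⟧ (λ S → ι (g S))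
  count-enum zero g sub p = trans (length-stack (λ t → enum zero (slice g t)) (gap g ⊤ˢ) (steps g))
    (trans (sumR-const (ι (+ 1)) (gap g ⊤ˢ) (steps g)) (trans (cong (λ z → ι (+ 1) ℚ.* ι z) one) (cong₂ ℚ._*_ ι-1 ι-1)))
    where
    e : ∀ y x → y - (y - x) + 1ℤ ≡ x + 1ℤ
    e = solve-∀
    one : + steps g ≡ 1ℤ
    one = cong +_ (cong pos (trans (e (g (true ∷ [])) (g (false ∷ []))) (cong (_+ 1ℤ) p)))
  count-enum (suc m) g sub p = trans (length-stack (λ t → enum (suc m) (slice g t)) (gap g ⊤ˢ) (steps g))
    (trans (sumR-cong (gap g ⊤ˢ) (steps g) (λ t lo hi → count-enum m (slice g t) (slice-Submod {g = g} sub t) (slice-⊥ g t p (pos-bound (gap g ⊤ˢ) (g (true ∷ ⊥ˢ)) t hi lo))))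
      (⟦summed⟧ (countPoly m) {g} sub (steps g) (sym (trans (cong (λ z → gap g ⊤ˢ + z) (+pos nonneg)) (trans (e (gap g ⊤ˢ) (g (true ∷ ⊥ˢ))) (cong (_+ 1ℤ) (sym gap⊥)))))))
    where
    e : ∀ a y → a + (y - a + 1ℤ) ≡ y + 1ℤ
    e = solve-∀
    e₁ : ∀ y a → y - a + 1ℤ - 0ℤ ≡ y + 1ℤ - (a + 0ℤ)
    e₁ = solve-∀
    gap⊥ : gap g ⊥ˢ ≡ g (true ∷ ⊥ˢ)
    gap⊥ = trans (cong (λ z → g (true ∷ ⊥ˢ) - z) p) (ℤ.+-identityʳ _)
    nonneg : 0ℤ ≤ g (true ∷ ⊥ˢ) - gap g ⊤ˢ + 1ℤ
    nonneg = lin (subst (gap g ⊤ˢ ≤_) gap⊥ (gap-antitone {g = g} sub ⊥-⊑) ⊹ +≤+ (z≤n {1})) (e₁ (g (true ∷ ⊥ˢ)) (gap g ⊤ˢ))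

  -- Polynomials in λ

  sumL : ∀ {A : Set} → (A → ℚ) → List A → ℚ
  sumL f L = List.foldr ℚ._+_ 0ℚ (List.map f L)

  sumL-++ : ∀ {A : Set} (f : A → ℚ) L M → sumL f (L ++ M) ≡ sumL f L ℚ.+ sumL f M
  sumL-++ f [] M = sym (ℚ.+-identityˡ _)
  sumL-++ f (x ∷ L) M = trans (cong (f x ℚ.+_) (sumL-++ f L M)) (sym (ℚ.+-assoc (f x) _ _))

  sumL-cong : ∀ {A : Set} {f g : A → ℚ} → (∀ x → f x ≡ g x) → ∀ L → sumL f L ≡ sumL g L
  sumL-cong p [] = refl
  sumL-cong p (x ∷ L) = cong₂ ℚ._+_ (p x) (sumL-cong p L)

  sumL-+ : ∀ {A : Set} (f g : A → ℚ) L → sumL (λ x → f x ℚ.+ g x) L ≡ sumL f L ℚ.+ sumL g L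
  sumL-+ f g [] = refl
  sumL-+ f g (x ∷ L) = trans (cong (f x ℚ.+ g x ℚ.+_) (sumL-+ f g L)) (e (f x) (g x) (sumL f L) (sumL g L))
    where
    e : ∀ a b c d → a ℚ.+ b ℚ.+ (c ℚ.+ d) ≡ a ℚ.+ c ℚ.+ (b ℚ.+ d)
    e = solve-∀-over ℚ-ring

  sumL-zero : ∀ {A : Set} {f : A → ℚ} → (∀ x → f x ≡ 0ℚ) → ∀ L → sumL f L ≡ 0ℚ
  sumL-zero p [] = refl
  sumL-zero p (x ∷ L) = cong₂ ℚ._+_ (p x) (sumL-zero p L)

  sumL-map : ∀ {A B : Set} (f : B → ℚ) (g : A → B) L → sumL f (List.map g L) ≡ sumL (λ x → f (g x)) L
  sumL-map f g [] = refl
  sumL-map f g (x ∷ L) = cong (f (g x) ℚ.+_) (sumL-map f g L)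

  sumL-concatMap : ∀ {A B : Set} (f : B → ℚ) (g : A → List B) L → sumL f (List.concatMap g L) ≡ sumL (λ x → sumL f (g x)) L
  sumL-concatMap f g [] = refl
  sumL-concatMap f g (x ∷ L) = trans (sumL-++ f (g x) (List.concatMap g L)) (cong (sumL f (g x) ℚ.+_) (sumL-concatMap f g L))

  sumL-pick : ∀ (f : ℕ → ℚ) (g : ℕ → ℕ) {i D} → i ℕ.< D → (∀ j → j ≢ i → f (g j) ≡ 0ℚ) → sumL f (List.applyUpTo g D) ≡ f (g i)
  sumL-pick f g {zero} {suc D} _ p = trans (cong (f (g 0) ℚ.+_) (rest D (λ j → g (suc j)) (λ j → p (suc j) (λ ())))) (ℚ.+-identityʳ (f (g 0)))
    where
    rest : ∀ D (h : ℕ → ℕ) → (∀ j → f (h j) ≡ 0ℚ) → sumL f (List.applyUpTo h D) ≡ 0ℚ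
    rest zero h q = refl
    rest (suc D) h q = cong₂ ℚ._+_ (q 0) (rest D (λ j → h (suc j)) (λ j → q (suc j)))
  sumL-pick f g {suc i} {suc D} (s≤s i<D) p = trans (cong₂ ℚ._+_ (p 0 (λ ())) (sumL-pick f (λ j → g (suc j)) {i} {D} i<D (λ j j≢i → p (suc j) (λ q → j≢i (ℕ.suc-injective q))))) (ℚ.+-identityˡ _)

  infix 4 _≟ᵉ_
  _≟ᵉ_ : ∀ {n} (e e′ : Vec ℕ n) → Dec (e ≡ e′)
  _≟ᵉ_ = Vec.≡-dec ℕ._≟_

  opaque
    δ : ∀ {n} → Vec ℕ n → Vec ℕ n → ℚ
    δ e e′ with e ≟ᵉ e′
    ... | yes _ = 1ℚ
    ... | no _ = 0ℚ

    δ-refl : ∀ {n} (e : Vec ℕ n) → δ e e ≡ 1ℚ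
    δ-refl e with e ≟ᵉ e
    ... | yes _ = refl
    ... | no ¬p = ⊥-elim (¬p refl)

    δ-≢ : ∀ {n} {e e′ : Vec ℕ n} → e ≢ e′ → δ e e′ ≡ 0ℚ
    δ-≢ {e = e} {e′} p with e ≟ᵉ e′
    ... | yes q = ⊥-elim (p q)
    ... | no _ = refl

  δ-∷ : ∀ {n} i (e e′ : Vec ℕ n) → δ (i ∷ e) (i ∷ e′) ≡ δ e e′
  δ-∷ i e e′ = go (e ≟ᵉ e′)
    where
    go : Dec (e ≡ e′) → δ (i ∷ e) (i ∷ e′) ≡ δ e e′
    go (yes refl) = trans (δ-refl (i ∷ e)) (sym (δ-refl e))
    go (no ¬p) = trans (δ-≢ (λ q → ¬p (Vec.∷-injectiveʳ q))) (sym (δ-≢ ¬p))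

  box-pick : ∀ {n} D (e : Vec ℕ n) → All (ℕ._≤ D) e → (h : Vec ℕ n → ℚ) → sumL (λ e′ → δ e e′ ℚ.* h e′) (box n D) ≡ h e
  box-pick D [] [] h = trans (ℚ.+-identityʳ (δ [] [] ℚ.* h [])) (trans (cong (ℚ._* h []) (δ-refl [])) (ℚ.*-identityˡ (h [])))
  box-pick {suc n} D (i ∷ e) (i≤D ∷ e≤D) h = trans (sumL-concatMap F (λ j → List.map (j ∷_) (box n D)) (List.upTo (suc D)))
    (trans (sumL-pick (λ j → sumL F (List.map (j ∷_) (box n D))) (λ j → j) {i} {suc D} (s≤s i≤D) other)
      (trans (sumL-map F (i ∷_) (box n D)) (trans (sumL-cong (λ e′ → cong (ℚ._* h (i ∷ e′)) (δ-∷ i e e′)) (box n D)) (box-pick D e e≤D (λ e′ → h (i ∷ e′))))))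
    where
    F : Vec ℕ (suc n) → ℚ
    F e′ = δ (i ∷ e) e′ ℚ.* h e′
    other : ∀ j → j ≢ i → sumL F (List.map (j ∷_) (box n D)) ≡ 0ℚ
    other j j≢i = trans (sumL-map F (j ∷_) (box n D)) (sumL-zero (λ e′ → trans (cong (ℚ._* h (j ∷ e′)) (δ-≢ (λ q → j≢i (sym (Vec.∷-injectiveˡ q))))) (ℚ.*-zeroˡ (h (j ∷ e′)))) (box n D))

  entries≤totalDeg : ∀ {n} (e : Vec ℕ n) {D} → totalDeg e ℕ.≤ D → All (ℕ._≤ D) e
  entries≤totalDeg [] _ = []
  entries≤totalDeg (i ∷ e) p = ℕ.≤-trans (ℕ.m≤m+n i _) p ∷ entries≤totalDeg e (ℕ.≤-trans (ℕ.m≤n+m _ i) p)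

  -- The index d is a strict bound on the degree.
  data MP (n d : ℕ) : Set where
    zeroᴹ : MP n d
    mono  : ℚ → (e : Vec ℕ n) → totalDeg e ℕ.< d → MP n d
    _⊕_   : MP n d → MP n d → MP n d

  ⟦_⟧ᴹ : ∀ {n d} → MP n d → Vec ℕ n → ℚ
  ⟦ zeroᴹ ⟧ᴹ l = 0ℚ
  ⟦ mono c e _ ⟧ᴹ l = c ℚ.* monomial e l
  ⟦ F ⊕ F′ ⟧ᴹ l = ⟦ F ⟧ᴹ l ℚ.+ ⟦ F′ ⟧ᴹ l

  toPoly : ∀ {n d} → MP n d → Poly n
  toPoly zeroᴹ e′ = 0ℚ
  toPoly (mono c e _) e′ = c ℚ.* δ e e′
  toPoly (F ⊕ F′) e′ = toPoly F e′ ℚ.+ toPoly F′ e′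

  toPoly-degree : ∀ {n d} (F : MP n d) e → d ℕ.≤ totalDeg e → toPoly F e ≡ 0ℚ
  toPoly-degree zeroᴹ e p = refl
  toPoly-degree (mono c e′ q) e p = trans (cong (c ℚ.*_) (δ-≢ (λ { refl → ℕ.<-irrefl refl (ℕ.<-≤-trans q p) }))) (ℚ.*-zeroʳ c)
  toPoly-degree (F ⊕ F′) e p = cong₂ ℚ._+_ (toPoly-degree F e p) (toPoly-degree F′ e p)

  eval-+ : ∀ {n} D (p q : Poly n) l → eval D (λ e → p e ℚ.+ q e) l ≡ eval D p l ℚ.+ eval D q l
  eval-+ {n} D p q l = trans (sumL-cong (λ e → ℚ.*-distribʳ-+ (monomial e l) (p e) (q e)) (box n D)) (sumL-+ (λ e → p e ℚ.* monomial e l) (λ e → q e ℚ.* monomial e l) (box n D))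

  eval-toPoly : ∀ {n d} D (F : MP n d) → d ℕ.≤ suc D → ∀ l → eval D (toPoly F) l ≡ ⟦ F ⟧ᴹ l
  eval-toPoly {n} D zeroᴹ _ l = sumL-zero (λ e → ℚ.*-zeroˡ (monomial e l)) (box n D)
  eval-toPoly {n} D (mono c e p) d≤D l = trans (sumL-cong (λ e′ → e₁ c (δ e e′) (monomial e′ l)) (box n D)) (box-pick D e (entries≤totalDeg e (ℕ.s≤s⁻¹ (ℕ.≤-trans p d≤D))) (λ e′ → c ℚ.* monomial e′ l))
    where
    e₁ : ∀ a b c → a ℚ.* b ℚ.* c ≡ b ℚ.* (a ℚ.* c)
    e₁ = solve-∀-over ℚ-ring
  eval-toPoly D (F ⊕ F′) d≤D l = trans (eval-+ D (toPoly F) (toPoly F′) l) (cong₂ ℚ._+_ (eval-toPoly D F d≤D l) (eval-toPoly D F′ d≤D l))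

  scaleᴹ : ∀ {n d} → ℚ → MP n d → MP n d
  scaleᴹ k zeroᴹ = zeroᴹ
  scaleᴹ k (mono c e p) = mono (k ℚ.* c) e p
  scaleᴹ k (F ⊕ F′) = scaleᴹ k F ⊕ scaleᴹ k F′

  ⟦scaleᴹ⟧ : ∀ {n d} k (F : MP n d) l → ⟦ scaleᴹ k F ⟧ᴹ l ≡ k ℚ.* ⟦ F ⟧ᴹ l
  ⟦scaleᴹ⟧ k zeroᴹ l = sym (ℚ.*-zeroʳ k)
  ⟦scaleᴹ⟧ k (mono c e p) l = ℚ.*-assoc k c (monomial e l)
  ⟦scaleᴹ⟧ k (F ⊕ F′) l = trans (cong₂ ℚ._+_ (⟦scaleᴹ⟧ k F l) (⟦scaleᴹ⟧ k F′ l)) (sym (ℚ.*-distribˡ-+ k (⟦ F ⟧ᴹ l) (⟦ F′ ⟧ᴹ l)))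

  bump : ∀ {n} → Fin n → Vec ℕ n → Vec ℕ n
  bump i e = e Vec.[ i ]%= suc

  totalDeg-bump : ∀ {n} i (e : Vec ℕ n) → totalDeg (bump i e) ≡ suc (totalDeg e)
  totalDeg-bump Fin.zero (x ∷ e) = refl
  totalDeg-bump (Fin.suc i) (x ∷ e) = trans (cong (x ℕ.+_) (totalDeg-bump i e)) (ℕ.+-suc x (totalDeg e))

  monomial-bump : ∀ {n} i (e l : Vec ℕ n) → monomial (bump i e) l ≡ ι (+ lookup l i) ℚ.* monomial e l
  monomial-bump Fin.zero (x ∷ e) (y ∷ l) = trans (cong (λ z → z ℚ.* powℚ ((+ y) ℚ./ 1) x ℚ.* monomial e l) (ι-def (+ y))) (ℚ.*-assoc (ι (+ y)) _ _)
  monomial-bump (Fin.suc i) (x ∷ e) (y ∷ l) = trans (cong (powℚ ((+ y) ℚ./ 1) x ℚ.*_) (monomial-bump i e l)) (e₁ (powℚ ((+ y) ℚ./ 1) x) (ι (+ lookup l i)) (monomial e l))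
    where
    e₁ : ∀ a b c → a ℚ.* (b ℚ.* c) ≡ b ℚ.* (a ℚ.* c)
    e₁ = solve-∀-over ℚ-ring

  mulVar : ∀ {n d} → Fin n → MP n d → MP n (suc d)
  mulVar i zeroᴹ = zeroᴹ
  mulVar {d = d} i (mono c e p) = mono c (bump i e) (subst (ℕ._< suc d) (sym (totalDeg-bump i e)) (s≤s p))
  mulVar i (F ⊕ F′) = mulVar i F ⊕ mulVar i F′

  ⟦mulVar⟧ : ∀ {n d} i (F : MP n d) l → ⟦ mulVar i F ⟧ᴹ l ≡ ι (+ lookup l i) ℚ.* ⟦ F ⟧ᴹ l
  ⟦mulVar⟧ i zeroᴹ l = sym (ℚ.*-zeroʳ (ι (+ lookup l i)))
  ⟦mulVar⟧ i (mono c e p) l = trans (cong (c ℚ.*_) (monomial-bump i e l)) (e₁ c (ι (+ lookup l i)) (monomial e l))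
    where
    e₁ : ∀ a b c → a ℚ.* (b ℚ.* c) ≡ b ℚ.* (a ℚ.* c)
    e₁ = solve-∀-over ℚ-ring
  ⟦mulVar⟧ i (F ⊕ F′) l = trans (cong₂ ℚ._+_ (⟦mulVar⟧ i F l) (⟦mulVar⟧ i F′ l)) (sym (ℚ.*-distribˡ-+ (ι (+ lookup l i)) (⟦ F ⟧ᴹ l) (⟦ F′ ⟧ᴹ l)))

  -- L is a linear form if multiplication by it raises the degree by at most one.
  LinearForm : ∀ {n} → (Vec ℕ n → ℤ) → Set
  LinearForm {n} L = ∀ {d} (F : MP n d) → Σ (MP n (suc d)) λ F′ → ∀ l → ⟦ F′ ⟧ᴹ l ≡ ι (L l) ℚ.* ⟦ F ⟧ᴹ l

  linear-0 : ∀ {n} → LinearForm {n} (λ _ → 0ℤ)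
  linear-0 F = zeroᴹ , λ l → sym (trans (cong (ℚ._* ⟦ F ⟧ᴹ l) ι-0) (ℚ.*-zeroˡ (⟦ F ⟧ᴹ l)))

  linear-var : ∀ {n} (i : Fin n) → LinearForm (λ l → + lookup l i)
  linear-var i F = mulVar i F , ⟦mulVar⟧ i F

  linear-+ : ∀ {n} {L L′ : Vec ℕ n → ℤ} → LinearForm L → LinearForm L′ → LinearForm (λ l → L l + L′ l)
  linear-+ {L = L} {L′} p q F = proj₁ (p F) ⊕ proj₁ (q F) , λ l → trans (cong₂ ℚ._+_ (proj₂ (p F) l) (proj₂ (q F) l)) (trans (sym (ℚ.*-distribʳ-+ (⟦ F ⟧ᴹ l) (ι (L l)) (ι (L′ l)))) (cong (ℚ._* ⟦ F ⟧ᴹ l) (sym (ι-+ (L l) (L′ l)))))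

  linear-ext : ∀ {n} {L L′ : Vec ℕ n → ℤ} → (∀ l → L l ≡ L′ l) → LinearForm L → LinearForm L′
  linear-ext e p F = proj₁ (p F) , λ l → trans (proj₂ (p F) l) (cong (λ z → ι z ℚ.* ⟦ F ⟧ᴹ l) (e l))

  module Compose {n m} (L : Subset m → Vec ℕ n → ℤ) (lin-L : ∀ S → LinearForm (L S)) (c : Subset m → ℤ) where

    at₀ at : Vec ℕ n → Subset m → ℚ
    at₀ l S = ι (L S l)
    at l S = ι (L S l + c S)

    at-split : ∀ l S → at l S ≡ at₀ l S ℚ.+ ι (c S)
    at-split l S = ι-+ (L S l) (c S)

    compose : ∀ {d} {T : Subset m} (F : CP T d) → Σ (MP n (suc d)) λ M → ∀ l → ⟦ M ⟧ᴹ l ≡ ⟦ F ⟧ (at l)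
    compose {d} (con q) = mono q (Vec.replicate n 0) (subst (ℕ._< suc d) (sym (zeros n)) (s≤s z≤n)) , λ l → trans (cong (q ℚ.*_) (one l)) (ℚ.*-identityʳ q)
      where
      zeros : ∀ n → totalDeg (Vec.replicate n 0) ≡ 0
      zeros zero = refl
      zeros (suc n) = zeros n
      one : ∀ {n} (l : Vec ℕ n) → monomial (Vec.replicate n 0) l ≡ 1ℚ
      one [] = refl
      one (x ∷ l) = trans (ℚ.*-identityˡ _) (one l)
    compose (F ⊕ F′) = proj₁ (compose F) ⊕ proj₁ (compose F′) , λ l → cong₂ ℚ._+_ (proj₂ (compose F) l) (proj₂ (compose F′) l)
    compose {suc d} (var S p F) = proj₁ LM ⊕ raiseᴹ (scaleᴹ (ι (c S)) M) , λ l → trans (cong₂ ℚ._+_ (trans (proj₂ LM l) (cong (at₀ l S ℚ.*_) (proj₂ (compose F) l))) (trans (⟦raiseᴹ⟧ (scaleᴹ (ι (c S)) M) l) (trans (⟦scaleᴹ⟧ (ι (c S)) M l) (cong (ι (c S) ℚ.*_) (proj₂ (compose F) l)))))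
        (trans (sym (ℚ.*-distribʳ-+ (⟦ F ⟧ (at l)) (at₀ l S) (ι (c S)))) (cong (ℚ._* ⟦ F ⟧ (at l)) (sym (at-split l S))))
      where
      M = proj₁ (compose F)
      LM = lin-L S M
      raiseᴹ : ∀ {d} → MP n d → MP n (suc d)
      raiseᴹ zeroᴹ = zeroᴹ
      raiseᴹ (mono c e p) = mono c e (ℕ.m≤n⇒m≤1+n p)
      raiseᴹ (F ⊕ F′) = raiseᴹ F ⊕ raiseᴹ F′
      ⟦raiseᴹ⟧ : ∀ {d} (F : MP n d) l → ⟦ raiseᴹ F ⟧ᴹ l ≡ ⟦ F ⟧ᴹ l
      ⟦raiseᴹ⟧ zeroᴹ l = refl
      ⟦raiseᴹ⟧ (mono c e p) l = refl
      ⟦raiseᴹ⟧ (F ⊕ F′) l = cong₂ ℚ._+_ (⟦raiseᴹ⟧ F l) (⟦raiseᴹ⟧ F′ l)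

    -- Hence the top homogeneous component does not depend on the constants c.
    difference : ∀ {d} {T : Subset m} (F : CP T d) → Σ (MP n d) λ M → ∀ l → ⟦ F ⟧ (at l) ≡ ⟦ F ⟧ (at₀ l) ℚ.+ ⟦ M ⟧ᴹ l
    difference (con q) = zeroᴹ , λ l → sym (ℚ.+-identityʳ q)
    difference (F ⊕ F′) = proj₁ (difference F) ⊕ proj₁ (difference F′) , λ l → trans (cong₂ ℚ._+_ (proj₂ (difference F) l) (proj₂ (difference F′) l)) (e (⟦ F ⟧ (at₀ l)) (⟦ proj₁ (difference F) ⟧ᴹ l) (⟦ F′ ⟧ (at₀ l)) (⟦ proj₁ (difference F′) ⟧ᴹ l))
      where
      e : ∀ a b c d → a ℚ.+ b ℚ.+ (c ℚ.+ d) ≡ a ℚ.+ c ℚ.+ (b ℚ.+ d)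
      e = solve-∀-over ℚ-ring
    difference (var S p F) = proj₁ LM ⊕ scaleᴹ (ι (c S)) K , λ l → trans (trans (cong (ℚ._* ⟦ F ⟧ (at l)) (at-split l S)) (e (at₀ l S) (ι (c S)) (⟦ F ⟧ (at l)) (⟦ F ⟧ (at₀ l)) (⟦ M ⟧ᴹ l) (proj₂ (difference F) l)))
        (cong (at₀ l S ℚ.* ⟦ F ⟧ (at₀ l) ℚ.+_) (cong₂ ℚ._+_ (sym (proj₂ LM l)) (sym (trans (⟦scaleᴹ⟧ (ι (c S)) K l) (cong (ι (c S) ℚ.*_) (proj₂ (compose F) l))))))
      where
      M = proj₁ (difference F)
      LM = lin-L S M
      K = proj₁ (compose F)
      e₁ : ∀ a c f f₀ m → a ℚ.* (f₀ ℚ.+ m) ℚ.+ c ℚ.* f ≡ a ℚ.* f₀ ℚ.+ (a ℚ.* m ℚ.+ c ℚ.* f)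
      e₁ = solve-∀-over ℚ-ring
      e : ∀ a c f f₀ m → f ≡ f₀ ℚ.+ m → (a ℚ.+ c) ℚ.* f ≡ a ℚ.* f₀ ℚ.+ (a ℚ.* m ℚ.+ c ℚ.* f)
      e a c f f₀ m q = trans (ℚ.*-distribʳ-+ f a c) (trans (cong (λ z → a ℚ.* z ℚ.+ c ℚ.* f) q) (e₁ a c f f₀ m))

  -- The leading form

  length-stack-≥ : ∀ {m} (f : ℤ → List (Vec ℤ m)) c lo s a k → lo ≤ a → a + + k ≤ lo + + s →
    (∀ t → a ≤ t → t + 1ℤ ≤ a + + k → c ℕ.≤ length (f t)) → k ℕ.* c ℕ.≤ length (stack f lo s)
  length-stack-≥ f c lo s a zero _ _ _ = z≤n
  length-stack-≥ f c lo zero a (suc k) p q r = ⊥-elim (absurd (p ⊹ q ⊹ +≤+ (z≤n {k})) (e lo a (+ k)))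
    where
    e : ∀ l a k → l + (a + (1ℤ + k)) + 0ℤ - (a + (l + 0ℤ) + k) ≡ 1ℤ
    e = solve-∀
  length-stack-≥ f c lo (suc s) a (suc k) p q r with lo ℤ.≟ a
  ... | yes refl = subst (suc k ℕ.* c ℕ.≤_) (sym (trans (List.length-++ (List.map (lo ∷_) (f lo))) (cong (ℕ._+ length (stack f (lo + 1ℤ) s)) (List.length-map (lo ∷_) (f lo)))))
      (ℕ.+-mono-≤ (r lo ℤ.≤-refl (ℤ.+-monoʳ-≤ lo (+≤+ (s≤s z≤n))))
        (length-stack-≥ f c (lo + 1ℤ) s (lo + 1ℤ) k ℤ.≤-refl (lin q (e lo (+ k) (+ s)))
          (λ t u v → r t (lin (u ⊹ +≤+ (z≤n {1})) (e₁ lo t)) (subst (t + 1ℤ ≤_) (ℤ.+-assoc lo 1ℤ (+ k)) v))))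
    where
    e : ∀ l k s → l + 1ℤ + s - (l + 1ℤ + k) ≡ l + (1ℤ + s) - (l + (1ℤ + k))
    e = solve-∀
    e₁ : ∀ a t → t - a ≡ t + 1ℤ - (a + 1ℤ + 0ℤ)
    e₁ = solve-∀
  ... | no lo≢a = ℕ.≤-trans (length-stack-≥ f c (lo + 1ℤ) s a (suc k) (<⇒+1≤ (ℤ.≤∧≢⇒< p lo≢a)) (subst (a + + suc k ≤_) (sym (ℤ.+-assoc lo 1ℤ (+ s))) q) r)
      (subst (length (stack f (lo + 1ℤ) s) ℕ.≤_) (sym (List.length-++ (List.map (lo ∷_) (f lo)))) (ℕ.m≤n+m _ _))

  -- Move the first coordinate of w by at most J, compensate in the next one, and recurse with slack K - J.
  many-points : ∀ m J K (w : Vec ℤ (suc m)) g → g ⊥ˢ ≡ 0ℤ → total ⊤ˢ w ≡ g ⊤ˢ → (∀ S → S ≢ ⊥ˢ → S ≢ ⊤ˢ → total S w + + K ≤ g S) → m ℕ.* J ℕ.≤ K →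
    suc J ℕ.^ m ℕ.≤ length (enum (suc m) g)
  many-points zero J K w g p _ _ _ = length-stack-≥ (λ t → enum zero (slice g t)) 1 (gap g ⊤ˢ) (steps g) (gap g ⊤ˢ) 1 ℤ.≤-refl
      (ℤ.≤-reflexive (cong (λ z → gap g ⊤ˢ + + z) (sym (cong pos (trans (e (g (true ∷ [])) (g (false ∷ []))) (cong (_+ 1ℤ) p)))))) (λ _ _ _ → ℕ.≤-refl)
    where
    e : ∀ y x → y - (y - x) + 1ℤ ≡ x + 1ℤ
    e = solve-∀
  many-points (suc m) J K (x ∷ y ∷ w) g p tot slack J≤K = length-stack-≥ (λ t → enum (suc m) (slice g t)) (suc J ℕ.^ m) (gap g ⊤ˢ) (steps g) x (suc J) lo hi inner
    where
    J≤K′ : J ℕ.≤ K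
    J≤K′ = ℕ.≤-trans (ℕ.m≤m+n J (m ℕ.* J)) J≤K
    K′ : + (K ℕ.∸ J) ≡ + K - + J
    K′ = sym (trans (ℤ.m-n≡m⊖n K J) (ℤ.⊖-≥ J≤K′))
    rest : Vec ℤ (suc m)
    rest = y ∷ w
    ff : total ⊤ˢ rest + + K ≤ g (false ∷ ⊤ˢ)
    ff = slack (false ∷ ⊤ˢ) (λ ()) (λ ())
    tf : x + 0ℤ + + K ≤ g (true ∷ ⊥ˢ)
    tf = subst (λ z → x + z + + K ≤ g (true ∷ ⊥ˢ)) (∑-⊥ (λ z → z) rest) (slack (true ∷ ⊥ˢ) (λ ()) (λ ()))
    e₁ : ∀ x r K y f → x - (y - f) ≡ f + (x + r) + K - (r + K + y + 0ℤ)
    e₁ = solve-∀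
    lo : gap g ⊤ˢ ≤ x
    lo = lin (ff ⊹ ℤ.≤-reflexive (sym tot) ⊹ +≤+ (z≤n {K})) (e₁ x (total ⊤ˢ rest) (+ K) (g (true ∷ ⊤ˢ)) (g (false ∷ ⊤ˢ)))
    e₂ : ∀ a y x J K → a + (y - a + 1ℤ) - (x + (1ℤ + J)) ≡ y + K - (x + 0ℤ + K + J)
    e₂ = solve-∀
    e₃ : ∀ a y x K → y - a + 1ℤ - 0ℤ ≡ y + x + 1ℤ + K - (x + 0ℤ + K + a + 0ℤ + 0ℤ)
    e₃ = solve-∀
    hi : x + + suc J ≤ gap g ⊤ˢ + + steps g
    hi = subst (λ z → x + + suc J ≤ gap g ⊤ˢ + z) (sym (+pos (lin (tf ⊹ lo ⊹ +≤+ (z≤n {1}) ⊹ +≤+ (z≤n {K})) (e₃ (gap g ⊤ˢ) (g (true ∷ ⊥ˢ)) x (+ K))))) (lin (tf ⊹ +≤+ J≤K′) (e₂ (gap g ⊤ˢ) (g (true ∷ ⊥ˢ)) x (+ J) (+ K)))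
    inner : ∀ t → x ≤ t → t + 1ℤ ≤ x + + suc J → suc J ℕ.^ m ℕ.≤ length (enum (suc m) (slice g t))
    inner t x≤t t≤ = many-points m J (K ℕ.∸ J) w′ (slice g t) (slice-⊥ g t p (lin (tf ⊹ t≤ ⊹ +≤+ J≤K′) (f₁ x t (+ J) (+ K) (g (true ∷ ⊥ˢ)))))
        (trans (lin≡ tot (f₂ x t y (total ⊤ˢ w) (g (true ∷ ⊤ˢ)))) (sym (slice-high g t ⊤ˢ (ℤ.≤-trans lo x≤t)))) slack′ (subst (ℕ._≤ K ℕ.∸ J) (ℕ.m+n∸m≡n J (m ℕ.* J)) (ℕ.∸-monoˡ-≤ J J≤K))
      where
      w′ : Vec ℤ (suc m)
      w′ = (y + x - t) ∷ w
      f₁ : ∀ x t J K y → y - t ≡ y + (x + (1ℤ + J)) + K - (x + 0ℤ + K + (t + 1ℤ) + J)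
      f₁ = solve-∀
      f₂ : ∀ x t y w g → g - t - (y + x - t + w) ≡ g - (x + (y + w))
      f₂ = solve-∀
      smaller : ∀ S → total S w′ ≤ total S rest
      smaller (true ∷ S) = lin x≤t (g₁ x t y (total S w))
        where
        g₁ : ∀ x t y s → y + s - (y + x - t + s) ≡ t - x
        g₁ = solve-∀
      smaller (false ∷ S) = ℤ.≤-refl
      h₁ : ∀ s s′ K J g → g - (s′ + (K - J)) ≡ s + g + J - (s′ + (s + K) + 0ℤ)
      h₁ = solve-∀
      h₂ : ∀ s s′ K J g x t → g - t - (s′ + (K - J)) ≡ s + g + (x + (1ℤ + J)) - (s′ + (x + s + K) + (t + 1ℤ))
      h₂ = solve-∀
      slack′ : ∀ S → S ≢ ⊥ˢ → S ≢ ⊤ˢ → total S w′ + + (K ℕ.∸ J) ≤ slice g t S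
      slack′ S S≢⊥ S≢⊤ = subst (λ z → total S w′ + z ≤ slice g t S) (sym K′) (ℤ.⊓-glb
        (lin (smaller S ⊹ slack (false ∷ S) (λ q → S≢⊥ (Vec.∷-injectiveʳ q)) (λ ()) ⊹ +≤+ (z≤n {J})) (h₁ (total S rest) (total S w′) (+ K) (+ J) (g (false ∷ S))))
        (lin (smaller S ⊹ slack (true ∷ S) (λ ()) (λ q → S≢⊤ (Vec.∷-injectiveʳ q)) ⊹ t≤) (h₂ (total S rest) (total S w′) (+ K) (+ J) (g (true ∷ S)) x t)))

  powℚ-+ : ∀ q a b → powℚ q (a ℕ.+ b) ≡ powℚ q a ℚ.* powℚ q b
  powℚ-+ q zero b = sym (ℚ.*-identityˡ _)
  powℚ-+ q (suc a) b = trans (cong (q ℚ.*_) (powℚ-+ q a b)) (sym (ℚ.*-assoc q _ _))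

  powℚ-ι : ∀ K a → powℚ (ι (+ K)) a ≡ ι (+ (K ℕ.^ a))
  powℚ-ι K zero = sym ι-1
  powℚ-ι K (suc a) = trans (cong (ι (+ K) ℚ.*_) (powℚ-ι K a)) (trans (sym (ι-* (+ K) (+ (K ℕ.^ a)))) (cong ι (sym (ℤ.pos-* K (K ℕ.^ a)))))

  monomial-diag : ∀ {n} K (e : Vec ℕ n) → monomial e (Vec.replicate n K) ≡ ι (+ (K ℕ.^ totalDeg e))
  monomial-diag K e = trans (go e) (powℚ-ι K (totalDeg e))
    where
    go : ∀ {n} (e : Vec ℕ n) → monomial e (Vec.replicate n K) ≡ powℚ (ι (+ K)) (totalDeg e)
    go [] = refl
    go (x ∷ e) = trans (cong₂ (λ s t → powℚ s x ℚ.* t) (ι-def (+ K)) (go e)) (sym (powℚ-+ (ι (+ K)) x (totalDeg e)))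

  sumL-mono : ∀ {A : Set} {f g : A → ℚ} L → LAll.All (λ x → f x ℚ.≤ g x) L → sumL f L ℚ.≤ sumL g L
  sumL-mono [] [] = ℚ.≤-refl
  sumL-mono (x ∷ L) (p ∷ ps) = ℚ.+-mono-≤ p (sumL-mono L ps)

  sumL-*ʳ : ∀ {A : Set} (f : A → ℚ) q L → sumL (λ x → f x ℚ.* q) L ≡ sumL f L ℚ.* q
  sumL-*ʳ f q [] = sym (ℚ.*-zeroˡ q)
  sumL-*ʳ f q (x ∷ L) = trans (cong (f x ℚ.* q ℚ.+_) (sumL-*ʳ f q L)) (sym (ℚ.*-distribʳ-+ q (f x) (sumL f L)))

  p≤∣p∣ : ∀ p → p ℚ.≤ ℚ.∣ p ∣
  p≤∣p∣ p with ℚ.≤-total 0ℚ p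
  ... | inj₁ 0≤p = ℚ.≤-reflexive (sym (ℚ.0≤p⇒∣p∣≡p 0≤p))
  ... | inj₂ p≤0 = ℚ.≤-trans p≤0 (ℚ.0≤∣p∣ p)

  ι-nonNeg : ∀ k → ℚ.NonNegative (ι (+ k))
  ι-nonNeg k = ℚ.nonNegative (subst (ℚ._≤ ι (+ k)) ι-0 (ι-mono-≤ (+≤+ z≤n)))

  ι-positive : ∀ k → ℚ.Positive (ι (+ suc k))
  ι-positive k = ℚ.positive (subst (ℚ._< ι (+ suc k)) ι-0 (ι-mono-< (ℤ.+<+ (s≤s z≤n))))

  opaque
    unfolding ι
    archimedean : ∀ q → ∃ λ J → q ℚ.≤ ι (+ J)
    archimedean q@(mkℚ z d _) = ℤ.∣ z ∣ , ℚ.*≤* (subst (_≤ + ℤ.∣ z ∣ * + suc d) (sym (ℤ.*-identityʳ z)) (bound z))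
      where
      bound : ∀ z → z ≤ + ℤ.∣ z ∣ * + suc d
      bound (+ k) = subst (+ k ≤_) (ℤ.pos-* k (suc d)) (+≤+ (ℕ.m≤m*n k (suc d)))
      bound -[1+ k ] = ℤ.-≤+

  ^-distribʳ-* : ∀ a b k → (a ℕ.* b) ℕ.^ k ≡ a ℕ.^ k ℕ.* b ℕ.^ k
  ^-distribʳ-* a b zero = refl
  ^-distribʳ-* a b (suc k) = trans (cong (a ℕ.* b ℕ.*_) (^-distribʳ-* a b k)) (ℕ.[m*n]*[o*p]≡[m*o]*[n*p] a b (a ℕ.^ k) (b ℕ.^ k))

  -- If all coefficients of top degree vanished, the value at K = (B + 1) J on the diagonal would be
  -- at most C (B + 1)^n (J + 1)^n, with C the sum of the absolute values of the coefficients.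
  -- Taking J ≥ C (B + 1)^n contradicts the lower bound (J + 1)^(n + 1). The search over `box` turns
  -- this into an explicit exponent.
  top-coefficient : ∀ n B (F : MP (suc n) (suc (suc n))) → (∀ J → ι (+ (suc J ℕ.^ suc n)) ℚ.≤ ⟦ F ⟧ᴹ (Vec.replicate (suc n) (suc B ℕ.* J))) →
    ∃ λ e → totalDeg e ≡ suc n × toPoly F e ≢ 0ℚ
  top-coefficient n B F grow = search (LAny.any? (λ e → (totalDeg e ℕ.≟ suc n) ×-dec ¬? (toPoly F e ℚ.≟ 0ℚ)) (box (suc n) (suc n)))
    where
    p : Poly (suc n)
    p = toPoly F
    boxes : List (Vec ℕ (suc n))
    boxes = box (suc n) (suc n)
    C : ℚ
    C = sumL (λ e → ℚ.∣ p e ∣) boxes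
    b^n : ℕ
    b^n = suc B ℕ.^ n
    J : ℕ
    J = proj₁ (archimedean (C ℚ.* ι (+ b^n)))
    C≤J : C ℚ.* ι (+ b^n) ℚ.≤ ι (+ J)
    C≤J = proj₂ (archimedean (C ℚ.* ι (+ b^n)))
    K J^n : ℕ
    K = suc B ℕ.* J
    J^n = suc J ℕ.^ n
    K^≤ : ∀ {a} → a ℕ.≤ n → K ℕ.^ a ℕ.≤ b^n ℕ.* J^n
    K^≤ {a} a≤n = ℕ.≤-trans (ℕ.^-monoˡ-≤ a (ℕ.*-monoʳ-≤ (suc B) (ℕ.n≤1+n J))) (ℕ.≤-trans (ℕ.^-monoʳ-≤ (suc B ℕ.* suc J) a≤n) (ℕ.≤-reflexive (^-distribʳ-* (suc B) (suc J) n)))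
    bound : ∀ e → ¬ (totalDeg e ≡ suc n × ¬ (p e ≡ 0ℚ)) → p e ℚ.* monomial e (Vec.replicate (suc n) K) ℚ.≤ ℚ.∣ p e ∣ ℚ.* ι (+ (b^n ℕ.* J^n))
    bound e ¬t = small (totalDeg e ℕ.≤? n)
      where
      vanishing : p e ≡ 0ℚ → p e ℚ.* monomial e (Vec.replicate (suc n) K) ℚ.≤ ℚ.∣ p e ∣ ℚ.* ι (+ (b^n ℕ.* J^n))
      vanishing q = ℚ.≤-reflexive (trans (cong (ℚ._* monomial e (Vec.replicate (suc n) K)) q) (trans (ℚ.*-zeroˡ (monomial e (Vec.replicate (suc n) K))) (sym (trans (cong (λ z → ℚ.∣ z ∣ ℚ.* ι (+ (b^n ℕ.* J^n))) q) (ℚ.*-zeroˡ (ι (+ (b^n ℕ.* J^n))))))))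
      small : Dec (totalDeg e ℕ.≤ n) → p e ℚ.* monomial e (Vec.replicate (suc n) K) ℚ.≤ ℚ.∣ p e ∣ ℚ.* ι (+ (b^n ℕ.* J^n))
      small (yes d≤n) = subst (λ z → p e ℚ.* z ℚ.≤ ℚ.∣ p e ∣ ℚ.* ι (+ (b^n ℕ.* J^n))) (sym (monomial-diag K e))
        (ℚ.≤-trans (ℚ.*-monoʳ-≤-nonNeg (ι (+ (K ℕ.^ totalDeg e))) {{ι-nonNeg (K ℕ.^ totalDeg e)}} (p≤∣p∣ (p e)))
          (ℚ.*-monoˡ-≤-nonNeg ℚ.∣ p e ∣ {{ℚ.nonNegative (ℚ.0≤∣p∣ (p e))}} (ι-mono-≤ (+≤+ (K^≤ d≤n)))))
      small (no d≰n) = large (ℕ.≰⇒> d≰n) (totalDeg e ℕ.≟ suc n) (p e ℚ.≟ 0ℚ)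
        where
        large : n ℕ.< totalDeg e → Dec (totalDeg e ≡ suc n) → Dec (p e ≡ 0ℚ) → p e ℚ.* monomial e (Vec.replicate (suc n) K) ℚ.≤ ℚ.∣ p e ∣ ℚ.* ι (+ (b^n ℕ.* J^n))
        large _ _ (yes q) = vanishing q
        large _ (yes d≡) (no ¬q) = ⊥-elim (¬t (d≡ , ¬q))
        large n<d (no d≢) (no ¬q) = ⊥-elim (¬q (toPoly-degree F e (ℕ.≤∧≢⇒< n<d (λ eq → d≢ (sym eq)))))
    contradiction : LAll.All (λ e → ¬ (totalDeg e ≡ suc n × ¬ (p e ≡ 0ℚ))) boxes → ⊥
    contradiction a = ℕ.<-irrefl refl (ℤ.drop‿+≤+ (ι-cancel-≤ (ℚ.≤-trans final C≤J)))
      where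
      upper : ι (+ (suc J ℕ.^ suc n)) ℚ.≤ C ℚ.* ι (+ (b^n ℕ.* J^n))
      upper = ℚ.≤-trans (grow J) (ℚ.≤-trans (ℚ.≤-reflexive (sym (eval-toPoly (suc n) F ℕ.≤-refl (Vec.replicate (suc n) K))))
        (ℚ.≤-trans (sumL-mono boxes (LAll.map (λ {e} → bound e) a)) (ℚ.≤-reflexive (sumL-*ʳ (λ e → ℚ.∣ p e ∣) (ι (+ (b^n ℕ.* J^n))) boxes))))
      instance
        pos-J^n : ℚ.Positive (ι (+ J^n))
        pos-J^n = subst (λ z → ℚ.Positive (ι (+ z))) (ℕ.suc-pred J^n {{ℕ.m^n≢0 (suc J) n}}) (ι-positive (ℕ.pred J^n))
      final : ι (+ suc J) ℚ.≤ C ℚ.* ι (+ b^n)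
      final = ℚ.*-cancelʳ-≤-pos (ι (+ J^n)) (subst₂ ℚ._≤_ (trans (cong ι (ℤ.pos-* (suc J) J^n)) (ι-* (+ suc J) (+ J^n)))
        (trans (cong (C ℚ.*_) (trans (cong ι (ℤ.pos-* b^n J^n)) (ι-* (+ b^n) (+ J^n)))) (sym (ℚ.*-assoc C (ι (+ b^n)) (ι (+ J^n))))) upper)
    search : Dec (LAny.Any (λ e → totalDeg e ≡ suc n × ¬ (p e ≡ 0ℚ)) boxes) → ∃ λ e → totalDeg e ≡ suc n × p e ≢ 0ℚ
    search (yes a) = LAny.satisfied a
    search (no ¬a) = ⊥-elim (contradiction (LAll.¬Any⇒All¬ boxes ¬a))

  -- Counting the interval

  minUpTo : (ℕ → ℤ) → ℕ → ℤ
  minUpTo f zero = f zero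
  minUpTo f (suc k) = f (suc k) ⊓ minUpTo f k

  minUpTo≤ : ∀ f k {i} → i ℕ.≤ k → minUpTo f k ≤ f i
  minUpTo≤ f zero z≤n = ℤ.≤-refl
  minUpTo≤ f (suc k) {i} p with ℕ.m≤n⇒m<n∨m≡n p
  ... | inj₁ (s≤s q) = ℤ.≤-trans (ℤ.i⊓j≤j (f (suc k)) (minUpTo f k)) (minUpTo≤ f k q)
  ... | inj₂ refl = ℤ.i⊓j≤i (f (suc k)) (minUpTo f k)

  minUpTo-attained : ∀ f k → ∃ λ i → i ℕ.≤ k × minUpTo f k ≡ f i
  minUpTo-attained f zero = 0 , z≤n , refl
  minUpTo-attained f (suc k) with ℤ.⊓-sel (f (suc k)) (minUpTo f k) | minUpTo-attained f k
  ... | inj₁ p | _ = suc k , ℕ.≤-refl , p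
  ... | inj₂ p | i , q , r = i , ℕ.m≤n⇒m≤1+n q , trans p r

  size-∩-full : ∀ {m} (S T : Subset m) → size S ≡ size (S ∩ T) → S ⊑ T
  size-∩-full [] [] _ = refl , refl
  size-∩-full (true ∷ S) (true ∷ T) p = in-⊑-in (size-∩-full S T (ℕ.suc-injective p))
  size-∩-full (true ∷ S) (false ∷ T) p = ⊥-elim (ℕ.<-irrefl (sym p) (s≤s (Subset.∣p∩q∣≤∣p∣ S T)))
  size-∩-full (false ∷ S) (true ∷ T) p = out-⊑-in (size-∩-full S T p)
  size-∩-full (false ∷ S) (false ∷ T) p = out-⊑-out (size-∩-full S T p)

  ∑-∩-bound : ∀ {h} → (∀ z → h z ≤ 1ℤ) → ∀ {m} (S T : Subset m) P → ∑ h T P + + size (S ∩ T) ≤ ∑ h (S ∩ T) P + + size T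
  ∑-∩-bound b [] [] [] = ℤ.≤-refl
  ∑-∩-bound {h} b (true ∷ S) (true ∷ T) (x ∷ P) = lin (∑-∩-bound b S T P) (e (h x) (∑ h T P) (+ size (S ∩ T)) (∑ h (S ∩ T) P) (+ size T))
    where
    e : ∀ x a b c d → x + c + (1ℤ + d) - (x + a + (1ℤ + b)) ≡ c + d - (a + b)
    e = solve-∀
  ∑-∩-bound {h} b (false ∷ S) (true ∷ T) (x ∷ P) = lin (∑-∩-bound b S T P ⊹ b x) (e (h x) (∑ h T P) (+ size (S ∩ T)) (∑ h (S ∩ T) P) (+ size T))
    where
    e : ∀ x a b c d → c + (1ℤ + d) - (x + a + b) ≡ c + d + 1ℤ - (a + b + x)
    e = solve-∀
  ∑-∩-bound b (true ∷ S) (false ∷ T) (x ∷ P) = ∑-∩-bound b S T P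
  ∑-∩-bound b (false ∷ S) (false ∷ T) (x ∷ P) = ∑-∩-bound b S T P

  pre-mono-length : ∀ {h} → (∀ z → 0ℤ ≤ h z) → ∀ w q {m} (P : Vec ℤ m) → pre h w P ≤ pre h (w ℕ.+ q) P
  pre-mono-length nn zero q P = pre-nonneg nn q P
  pre-mono-length nn (suc w) q [] = ℤ.≤-refl
  pre-mono-length {h} nn (suc w) q (x ∷ P) = ℤ.+-monoʳ-≤ (h x) (pre-mono-length nn w q P)

  pre-zipWith : ∀ {h h₁ h₂ : ℤ → ℤ} {f} → (∀ a b → h (f a b) ≡ h₁ a + h₂ b) → ∀ s {m} (A B : Vec ℤ m) → pre h s (Vec.zipWith f A B) ≡ pre h₁ s A + pre h₂ s B
  pre-zipWith e zero A B = refl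
  pre-zipWith e (suc s) [] [] = refl
  pre-zipWith {h} {h₁} {h₂} {f} e (suc s) (a ∷ A) (b ∷ B) = trans (cong₂ _+_ (e a b) (pre-zipWith {h} e s A B)) (e′ (h₁ a) (h₂ b) (pre h₁ s A) (pre h₂ s B))
    where
    e′ : ∀ a b c d → a + b + (c + d) ≡ a + c + (b + d)
    e′ = solve-∀

  ∑-zipWith : ∀ {h h₁ h₂ : ℤ → ℤ} {f} → (∀ a b → h (f a b) ≡ h₁ a + h₂ b) → ∀ {m} (S : Subset m) A B → ∑ h S (Vec.zipWith f A B) ≡ ∑ h₁ S A + ∑ h₂ S B
  ∑-zipWith e [] [] [] = refl
  ∑-zipWith {h} {h₁} {h₂} {f} e (true ∷ S) (a ∷ A) (b ∷ B) = trans (cong₂ _+_ (e a b) (∑-zipWith {h} e S A B)) (e′ (h₁ a) (h₂ b) (∑ h₁ S A) (∑ h₂ S B))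
    where
    e′ : ∀ a b c d → a + b + (c + d) ≡ a + c + (b + d)
    e′ = solve-∀
  ∑-zipWith {h} e (false ∷ S) (a ∷ A) (b ∷ B) = ∑-zipWith {h} e S A B

  -- Stated for an arbitrary family φ in place of the coordinates of λ, since the recursion drops
  -- entries of the vector.
  linear-sfx : ∀ {n} m (φ : Fin m → Vec ℕ n → ℕ) → (∀ i → LinearForm (λ l → + φ i l)) → ∀ c → LinearForm (λ l → sfx (tabulate (λ i → φ i l)) c)
  linear-sfx zero φ p c = linear-0
  linear-sfx (suc m) φ p zero = linear-+ (p Fin.zero) (linear-sfx m (λ i → φ (Fin.suc i)) (λ i → p (Fin.suc i)) zero)
  linear-sfx (suc m) φ p (suc c) = linear-sfx m (λ i → φ (Fin.suc i)) (λ i → p (Fin.suc i)) c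

  linear-pre : ∀ {n} s m (φ : Fin m → Vec ℕ n → ℤ) → (∀ i → LinearForm (φ i)) → LinearForm (λ l → pre (λ z → z) s (tabulate (λ i → φ i l)))
  linear-pre zero m φ p = linear-0
  linear-pre (suc s) zero φ p = linear-0
  linear-pre (suc s) (suc m) φ p = linear-+ (p Fin.zero) (linear-pre s m (λ i → φ (Fin.suc i)) (λ i → p (Fin.suc i)))

  sfx-replicate : ∀ m k → sfx (Vec.replicate m k) 0 ≡ + m * + k
  sfx-replicate zero k = refl
  sfx-replicate (suc m) k = trans (cong (λ z → + k + z) (sfx-replicate m k)) (e (+ m) (+ k))
    where
    e : ∀ m k → k + m * k ≡ (1ℤ + m) * k
    e = solve-∀

  -- For λ = (2 j, ..., 2 j) the partition is 2 j (m, m - 1, ..., 0), and its prefix sums are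
  -- arithmetic series; the factor 2 clears their denominator.
  pre-replicate : ∀ m j s → s ℕ.≤ suc m → pre (λ z → z) s (tabulate {n = suc m} (λ c → sfx (Vec.replicate m (j ℕ.+ j)) (toℕ c))) ≡ + j * + s * (+ m + + m - + s + 1ℤ)
  pre-replicate m j zero _ = sym (e (+ j) (+ m))
    where
    e : ∀ j m → j * 0ℤ * (m + m - 0ℤ + 1ℤ) ≡ 0ℤ
    e = solve-∀
  pre-replicate zero j (suc zero) _ = sym (e (+ j))
    where
    e : ∀ j → j * 1ℤ * (0ℤ + 0ℤ - 1ℤ + 1ℤ) ≡ 0ℤ
    e = solve-∀
  pre-replicate zero j (suc (suc s)) (s≤s ())
  pre-replicate (suc m) j (suc s) (s≤s p) = trans (cong₂ _+_ (sfx-replicate (suc m) (j ℕ.+ j)) (pre-replicate m j s p)) (e (+ j) (+ m) (+ s))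
    where
    e : ∀ j m s → (1ℤ + m) * (j + j) + j * s * (m + m - s + 1ℤ) ≡ j * (1ℤ + s) * (1ℤ + m + (1ℤ + m) - (1ℤ + s) + 1ℤ)
    e = solve-∀

  total-replicate : ∀ {m} (S : Subset m) k → total S (Vec.replicate m k) ≡ k * + size S
  total-replicate [] k = sym (ℤ.*-zeroʳ k)
  total-replicate (true ∷ S) k = trans (cong (λ z → k + z) (total-replicate S k)) (e k (+ size S))
    where
    e : ∀ k s → k + k * s ≡ k * (1ℤ + s)
    e = solve-∀
  total-replicate (false ∷ S) k = total-replicate S k

  size≡0 : ∀ {m} (S : Subset m) → size S ≡ 0 → S ≡ ⊥ˢ
  size≡0 [] _ = refl
  size≡0 (false ∷ S) p = cong (false ∷_) (size≡0 S p)

  module Count (n : ℕ) (1≤n : 1 ℕ.≤ n) where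

    open Theta n 1≤n public

    -- The support function of the permutohedron of `Lam l` at the indicator vector of S, as the
    -- parts of `Lam l` decrease.
    G : Vec ℕ n → Subset (suc n) → ℤ
    G l S = pre (λ z → z) (size S) (Lam l)

    linear-G : ∀ S → LinearForm (λ l → G l S)
    linear-G S = linear-pre (size S) (suc n) (λ c l → sfx l (toℕ c)) (λ c → linear-ext (λ l → cong (λ v → sfx v (toℕ c)) (Vec.tabulate∘lookup l)) (linear-sfx n (λ i l → lookup l i) linear-var (toℕ c)))

    Lam-Gap : ∀ δ l → (∀ i → δ ≤ + lookup l i) → 0ℤ ≤ δ → Gap (λ z → z) δ (Lam l)
    Lam-Gap δ l b 0≤δ = consecutive⇒AllPairs (λ {x} {y} {z} p q → lin (p ⊹ q ⊹ 0≤δ) (e₁ x y z δ)) (Lam l) (λ i → subst₂ (λ s t → s + δ ≤ t) (sym (lookup-Lam l (Fin.suc i)))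
        (sym (trans (lookup-Lam l (Fin.inject₁ i)) (trans (cong (sfx l) (Fin.toℕ-inject₁ i)) (sfx-step l i)))) (lin (b i) (e₂ δ (+ lookup l i) (sfx l (suc (toℕ i))))))
      where
      e₁ : ∀ x y z d → x - (z + d) ≡ x + y + d - (y + d + (z + d) + 0ℤ)
      e₁ = solve-∀
      e₂ : ∀ d x s → x + s - (s + d) ≡ x - d
      e₂ = solve-∀

    G-⊤ : ∀ l → G l ⊤ˢ ≡ Kap l
    G-⊤ l = trans (cong (λ s → pre (λ z → z) s (Lam l)) (Subset.∣⊤∣≡n (suc n))) (pre-full (λ z → z) (Lam l))

    G-⊥ : ∀ l → G l ⊥ˢ ≡ 0ℤ
    G-⊥ l = cong (λ s → pre (λ z → z) s (Lam l)) (Subset.∣⊥∣≡0 (suc n))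

    G-Submod : ∀ l → Submod (G l)
    G-Submod l S T = pre-submodular {λ z → z} S T (Lam l) (Lam-Gap 0ℤ l (λ i → +≤+ z≤n) ℤ.≤-refl)

    module _ (A : Vec ℤ (suc n)) (r : Vec ℤ (suc n)) where

      -- The bound that the i-th vertex puts on the sum over S of the integer parts, up to the term G.
      kk : Subset (suc n) → ℕ → ℤ
      kk S i = pre (V (+ i)) (size S) A - ∑ (V (+ i)) S r

      -- The levels 0, ..., n represent all: shifting the level by N adds the same amount to both
      -- sides of a vertex inequality.
      cc : Subset (suc n) → ℤ
      cc S = minUpTo (kk S) n

      gg : Vec ℕ n → Subset (suc n) → ℤ
      gg l S = G l S + cc S

      private
        cc-value : ∀ S k → (∀ i → kk S i ≡ k) → cc S ≡ k
        cc-value S k p = let (i , _ , q) = minUpTo-attained (kk S) n in trans q (p i)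

      cc-⊥ : cc ⊥ˢ ≡ 0ℤ
      cc-⊥ = cc-value ⊥ˢ 0ℤ (λ i → cong₂ _-_ (cong (λ s → pre (V (+ i)) s A) (Subset.∣⊥∣≡0 (suc n))) (∑-⊥ (V (+ i)) r))

      cc-⊤ : Good A → Good r → cc ⊤ˢ ≡ 0ℤ
      cc-⊤ gA gr = cc-value ⊤ˢ 0ℤ (λ i → trans (cong₂ _-_ (trans (cong (λ s → pre (V (+ i)) s A) (Subset.∣⊤∣≡n (suc n))) (trans (pre-full (V (+ i)) A) (gA (+ i)))) (gr (+ i))) (ℤ.+-inverseʳ (+ i)))

      gg-⊥ : ∀ l → gg l ⊥ˢ ≡ 0ℤ
      gg-⊥ l = cong₂ _+_ (G-⊥ l) cc-⊥

      gg-⊤ : Good A → Good r → ∀ l → gg l ⊤ˢ ≡ Kap l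
      gg-⊤ gA gr l = trans (cong₂ _+_ (G-⊤ l) (cc-⊤ gA gr)) (ℤ.+-identityʳ (Kap l))

      -- The slope drop of G pays for passing from level i to level j ≤ i + n.
      uncross : Decr A → ∀ l → (∀ i → 1ℤ ≤ + lookup l i) → ∀ S T i j → i ℕ.≤ j → j ℕ.≤ n → gg l (S ∪ T) + gg l (S ∩ T) ≤ (G l S + kk S i) + (G l T + kk T j)
      uncross dA l l≥1 S T i j i≤j j≤n = go (mkSizes S T)
        where
        U I : Subset (suc n)
        U = S ∪ T
        I = S ∩ T
        Δ : ℤ → ℤ
        Δ z = V (+ j) z + - V (+ i) z
        Δ≥0 : ∀ z → 0ℤ ≤ Δ z
        Δ≥0 z = ℤ.i≤j⇒0≤j-i (fl-mono {z + + i} {z + + j} (ℤ.+-monoʳ-≤ z (+≤+ i≤j)))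
        -- The levels differ by less than N, so between them a floor jumps at most once.
        Δ≤1 : ∀ z → Δ z ≤ 1ℤ
        Δ≤1 z = lin (ℤ.≤-trans (fl-mono {z + + j} {z + + i + N * 1ℤ} (lin (+≤+ j≤n ⊹ +≤+ (z≤n {i}) ⊹ ℤ.≤-reflexive (sym N≡1+n) ⊹ +≤+ (z≤n {1})) (e₁ z (+ i) (+ j) (+ n) N))) (ℤ.≤-reflexive (fl-shift (z + + i) 1ℤ))) (e₂ (V (+ j) z) (V (+ i) z))
          where
          e₁ : ∀ z i j n N → z + i + N * 1ℤ - (z + j) ≡ n + i + N + 1ℤ - (j + 0ℤ + (1ℤ + n) + 0ℤ)
          e₁ = solve-∀
          e₂ : ∀ a b → 1ℤ - (a + - b) ≡ b + 1ℤ - a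
          e₂ = solve-∀
        ∑neg : ∀ h {m} (R : Subset m) P → ∑ (λ z → - h z) R P ≡ - ∑ h R P
        ∑neg h [] [] = refl
        ∑neg h (true ∷ R) (x ∷ P) = trans (cong (λ t → - h x + t) (∑neg h R P)) (sym (ℤ.neg-distrib-+ (h x) (∑ h R P)))
        ∑neg h (false ∷ R) (x ∷ P) = ∑neg h R P
        preneg : ∀ h s {m} (P : Vec ℤ m) → pre (λ z → - h z) s P ≡ - pre h s P
        preneg h zero P = refl
        preneg h (suc s) [] = refl
        preneg h (suc s) (x ∷ P) = trans (cong (λ t → - h x + t) (preneg h s P)) (sym (ℤ.neg-distrib-+ (h x) (pre h s P)))
        ∑Δ : ∀ R → ∑ Δ R r ≡ ∑ (V (+ j)) R r + - ∑ (V (+ i)) R r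
        ∑Δ R = trans (∑-+ (V (+ j)) (λ z → - V (+ i) z) R r) (cong (λ t → ∑ (V (+ j)) R r + t) (∑neg (V (+ i)) R r))
        preΔ : ∀ s → pre Δ s A ≡ pre (V (+ j)) s A + - pre (V (+ i)) s A
        preΔ s = trans (pre-+ (V (+ j)) (λ z → - V (+ i) z) s A) (cong (λ t → pre (V (+ j)) s A + t) (preneg (V (+ i)) s A))
        upper : ∀ a b → a ℕ.≤ n → b ℕ.≤ n → gg l U + gg l I ≤ (G l U + kk U a) + (G l I + kk I b)
        upper a b a≤n b≤n = ℤ.+-monoʳ-≤ (G l U) (minUpTo≤ (kk U) n a≤n) ⊹ ℤ.+-monoʳ-≤ (G l I) (minUpTo≤ (kk I) n b≤n)
        go : Sizes S T → gg l U + gg l I ≤ (G l S + kk S i) + (G l T + kk T j)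
        -- If S lies inside T, the union and the intersection are T and S themselves, and each keeps
        -- its own level.
        go (sizes zero q sS sT sU) = ℤ.≤-trans (upper j i j≤n (ℕ.≤-trans i≤j j≤n)) (ℤ.≤-reflexive (trans (cong₂ (λ X Y → (G l X + kk X j) + (G l Y + kk Y i)) (proj₁ S⊑T) (proj₂ S⊑T)) (ℤ.+-comm (G l T + kk T j) (G l S + kk S i))))
          where
          S⊑T : S ⊑ T
          S⊑T = size-∩-full S T (trans sS (ℕ.+-identityʳ _))
        -- Otherwise the union takes the lower level i and the intersection the higher level j. The
        -- change of level on T minus S costs at most q in the residues, and the concavity of `G`
        -- supplies (1 + p′) q.
        go (sizes p@(suc p′) q sS sT sU) = ℤ.≤-trans (upper i j (ℕ.≤-trans i≤j j≤n) j≤n)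
            (lin (conG ⊹ conV ⊹ monoΔ ⊹ ℤ.≤-reflexive (sym (∑-modular (V (+ i)) S T r)) ⊹ bound ⊹ subst (0ℤ ≤_) (ℤ.pos-* p′ q) (+≤+ z≤n))
              (final (G l U) (G l I) (G l S) (G l T) (Vi U) (Vi I) (Vi S) (Vi T) (Vj I) (Vj T) (∑ (V (+ i)) U r) (∑ (V (+ i)) I r) (∑ (V (+ i)) S r) (∑ (V (+ i)) T r) (∑ (V (+ j)) I r) (∑ (V (+ j)) T r) (+ w) (+ p′) (+ q)))
          where
          w : ℕ
          w = size I
          Vi Vj : Subset (suc n) → ℤ
          Vi R = pre (V (+ i)) (size R) A
          Vj R = pre (V (+ j)) (size R) A
          w≤ : w ℕ.+ (p ℕ.+ q) ℕ.≤ suc n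
          w≤ = subst (ℕ._≤ suc n) sU (Subset.∣p∣≤n U)
          at : ∀ h (P : Vec ℤ (suc n)) {c} → pre h (w ℕ.+ (p ℕ.+ q)) P + pre h w P + c ≤ pre h (w ℕ.+ p) P + pre h (w ℕ.+ q) P → pre h (size U) P + pre h (size I) P + c ≤ pre h (size S) P + pre h (size T) P
          at h P {c} = subst₂ _≤_ (cong (λ s → pre h s P + pre h w P + c) (sym sU)) (cong₂ (λ s t → pre h s P + pre h t P) (sym sS) (sym sT))
          conG : G l U + G l I + 1ℤ * + p * + q ≤ G l S + G l T
          conG = at (λ z → z) (Lam l) (pre-concave {λ z → z} {1ℤ} w p q (Lam l) w≤ (Lam-Gap 1ℤ l l≥1 (+≤+ z≤n)))
          conV : Vi U + Vi I + 0ℤ * + p * + q ≤ Vi S + Vi T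
          conV = at (V (+ i)) A (pre-concave {V (+ i)} {0ℤ} w p q A w≤ (AllPairs.map (λ {x} {y} y<x → subst (_≤ V (+ i) x) (sym (ℤ.+-identityʳ (V (+ i) y))) (fl-mono (y<x ⊹ ℤ.≤-refl {+ i}))) (Decr-≤ dA)))
          monoΔ : Vj I + - Vi I ≤ Vj T + - Vi T
          monoΔ = subst₂ _≤_ (preΔ w) (trans (cong (λ s → pre Δ s A) (sym sT)) (preΔ (size T))) (pre-mono-length Δ≥0 w q A)
          bound : (∑ (V (+ j)) T r + - ∑ (V (+ i)) T r) + + w ≤ (∑ (V (+ j)) I r + - ∑ (V (+ i)) I r) + (+ w + + q)
          bound = subst₂ _≤_ (cong (_+ + w) (∑Δ T)) (cong₂ _+_ (∑Δ I) (cong +_ sT)) (∑-∩-bound Δ≤1 S T r)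
          final : ∀ GU GI GS GT ViU ViI ViS ViT VjI VjT aU aI aS aT bI bT w p q →
            (GS + (ViS - aS)) + (GT + (VjT - bT)) - ((GU + (ViU - aU)) + (GI + (VjI - bI)))
            ≡ (GS + GT) + (ViS + ViT) + (VjT + - ViT) + (aU + aI) + ((bI + - aI) + (w + q)) + p * q
              - ((GU + GI + 1ℤ * (1ℤ + p) * q) + (ViU + ViI + 0ℤ * (1ℤ + p) * q) + (VjI + - ViI) + (aS + aT) + ((bT + - aT) + w) + 0ℤ)
          final = solve-∀

      gg-Submod : Decr A → ∀ l → (∀ i → 1ℤ ≤ + lookup l i) → Submod (gg l)
      gg-Submod dA l l≥1 S T = subst₂ (λ s t → gg l (S ∪ T) + gg l (S ∩ T) ≤ (G l S + s) + (G l T + t)) (sym (proj₂ (proj₂ mS))) (sym (proj₂ (proj₂ mT))) (cases (ℕ.≤-total i j))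
        where
        mS = minUpTo-attained (kk S) n
        mT = minUpTo-attained (kk T) n
        i j : ℕ
        i = proj₁ mS
        j = proj₁ mT
        cases : i ℕ.≤ j ⊎ j ℕ.≤ i → gg l (S ∪ T) + gg l (S ∩ T) ≤ (G l S + kk S i) + (G l T + kk T j)
        cases (inj₁ i≤j) = uncross dA l l≥1 S T i j i≤j (proj₁ (proj₂ mT))
        cases (inj₂ j≤i) = subst₂ _≤_ (cong₂ (λ X Y → gg l X + gg l Y) (Subset.∪-comm T S) (Subset.∩-comm T S)) (ℤ.+-comm (G l T + kk T j) (G l S + kk S i)) (uncross dA l l≥1 T S j i j≤i (proj₁ (proj₂ mS)))

    -- Alcoves are coordinatised by the residues r and the integer parts q of P + κ.
    comb : ℤ → Vec ℤ (suc n) → Vec ℤ (suc n) → Vec ℤ (suc n)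
    comb κ r q = Vec.zipWith (λ a b → a + N * b - κ) r q

    comb-V : ∀ κ i a b → V (κ + i) (a + N * b - κ) ≡ V i a + b
    comb-V κ i a b = trans (cong fl (e κ i a (N * b))) (fl-shift (a + i) b)
      where
      e : ∀ k i a b → a + b - k + (k + i) ≡ a + i + b
      e = solve-∀

    ∑-comb : ∀ κ i S r q → ∑ (V (κ + i)) S (comb κ r q) ≡ ∑ (V i) S r + total S q
    ∑-comb κ i S r q = ∑-zipWith {V (κ + i)} {V i} {λ z → z} (comb-V κ i) S r q

    pre-Qv : ∀ i s A l → pre (V (Kap l + i)) s (Qv A l) ≡ pre (V i) s A + pre (λ z → z) s (Lam l)
    pre-Qv i s A l = pre-zipWith {V (Kap l + i)} {V i} {λ z → z} (comb-V (Kap l) i) s A (Lam l)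

    -- At level `Kap l + i` the offset cancels the normalising shifts in `comb` and `Qv`, and the
    -- vertex inequality becomes the one with constant `kk A r S i`. The inequality is read off at
    -- the level attaining the minimum; `bounds⇒D` first reduces an arbitrary level modulo N.
    D⇒bounds : ∀ A l r q → D (comb (Kap l) r q) (Qv A l) → ∀ S → total S q ≤ gg A r l S
    D⇒bounds A l r q d S = subst (λ t → total S q ≤ G l S + t) (sym (proj₂ (proj₂ m))) (lin (subst₂ _≤_ (∑-comb (Kap l) (+ i) S r q) (pre-Qv (+ i) (size S) A l) (d (Kap l + + i) S)) (e (total S q) (∑ (V (+ i)) S r) (pre (V (+ i)) (size S) A) (G l S)))
      where
      m = minUpTo-attained (kk A r S) n
      i : ℕ
      i = proj₁ m
      e : ∀ q v a g → g + (a - v) - q ≡ a + g - (v + q)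
      e = solve-∀

    bounds⇒D : ∀ A l r q → (∀ S → total S q ≤ gg A r l S) → D (comb (Kap l) r q) (Qv A l)
    bounds⇒D A l r q b t S = subst (λ t → ∑ (V t) S P ≤ pre (V t) (size S) (Qv A l)) t≡ (V-shift-≤ {P} {Qv A l} (Kap l + letter (rem i)) (fl i) S level)
      where
      P : Vec ℤ (suc n)
      P = comb (Kap l) r q
      i : ℤ
      i = t - Kap l
      e₁ : ∀ k l f → k + l + f ≡ k + (l + f)
      e₁ = solve-∀
      e₂ : ∀ k t → k + (t - k) ≡ t
      e₂ = solve-∀
      t≡ : Kap l + letter (rem i) + N * fl i ≡ t
      t≡ = trans (e₁ (Kap l) (letter (rem i)) (N * fl i)) (trans (cong (λ z → Kap l + z) (sym (rem-spec i))) (e₂ (Kap l) t))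
      e₃ : ∀ q v a g → a + g - (v + q) ≡ g + (a - v) - q
      e₃ = solve-∀
      c : ℕ
      c = toℕ (rem i)
      level : ∑ (V (Kap l + + c)) S P ≤ pre (V (Kap l + + c)) (size S) (Qv A l)
      level = subst₂ _≤_ (sym (∑-comb (Kap l) (+ c) S r q)) (sym (pre-Qv (+ c) (size S) A l))
        (lin (ℤ.≤-trans (b S) (ℤ.+-monoʳ-≤ (G l S) (minUpTo≤ (kk A r S) n (ℕ.s≤s⁻¹ (Fin.toℕ<n (rem i)))))) (e₃ (total S q) (∑ (V (+ c)) S r) (pre (V (+ c)) (size S) A) (G l S)))

    comb-Good : ∀ κ r q → Good r → total ⊤ˢ q ≡ κ → Good (comb κ r q)
    comb-Good κ r q g t i = trans (cong (λ z → ∑ (V z) ⊤ˢ (comb κ r q)) (sym (e κ i))) (trans (∑-comb κ (i - κ) ⊤ˢ r q) (trans (cong₂ _+_ (g (i - κ)) t) (e₁ κ i)))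
      where
      e : ∀ k i → k + (i - k) ≡ i
      e = solve-∀
      e₁ : ∀ k i → i - k + k ≡ i
      e₁ = solve-∀

    residues quotients : ℤ → Vec ℤ (suc n) → Vec ℤ (suc n)
    residues κ P = map (λ z → letter (rem (z + κ))) P
    quotients κ P = map (λ z → fl (z + κ)) P

    comb-split : ∀ κ P → comb κ (residues κ P) (quotients κ P) ≡ P
    comb-split κ P = vec-ext _ P (λ c → trans (Vec.lookup-zipWith (λ a b → a + N * b - κ) c (residues κ P) (quotients κ P))
      (trans (cong₂ (λ a b → a + N * b - κ) (Vec.lookup-map c _ P) (Vec.lookup-map c _ P)) (trans (cong (_- κ) (sym (rem-spec (lookup P c + κ)))) (e (lookup P c) κ))))
      where
      e : ∀ z k → z + k - k ≡ z
      e = solve-∀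

    quotients-total : ∀ κ P → Good P → total ⊤ˢ (quotients κ P) ≡ κ
    quotients-total κ P g = trans (∑-map (λ z → z) (λ z → fl (z + κ)) ⊤ˢ P) (g κ)

    residues-Good : ∀ κ P → Good P → Good (residues κ P)
    residues-Good κ P g i = lin≡ (trans (sym (trans (∑-comb κ i ⊤ˢ (residues κ P) (quotients κ P)) (cong (λ t → ∑ (V i) ⊤ˢ (residues κ P) + t) (quotients-total κ P g)))) (trans (cong (∑ (V (κ + i)) ⊤ˢ) (comb-split κ P)) (g (κ + i)))) (e i κ (∑ (V i) ⊤ˢ (residues κ P)))
      where
      e : ∀ i k s → i - s ≡ k + i - (s + k)
      e = solve-∀

    residues-Range : ∀ κ P → All Range (residues κ P)
    residues-Range κ P = All-from-∈ (residues κ P) (λ y i → let (x , _ , q) = ∈-map⁻ (λ z → letter (rem (z + κ))) P i in subst Range (sym q) (letter-range (rem (x + κ))))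

    -- Adding κ back and taking floors returns q, because the residues lie in the window.
    comb-injective : ∀ κ r r′ q q′ → All Range r → All Range r′ → comb κ r q ≡ comb κ r′ q′ → r ≡ r′ × q ≡ q′
    comb-injective κ r r′ q q′ R R′ p = vec-ext r r′ (λ c → proj₁ (entry c)) , vec-ext q q′ (λ c → proj₂ (entry c))
      where
      fl-entry : ∀ {a} b → Range a → fl (a + N * b - κ + κ) ≡ b
      fl-entry {a} b (x , y) = trans (cong fl (e a (N * b) κ)) (trans (fl-shift a b) (trans (cong (_+ b) (fl-small x y)) (ℤ.+-identityˡ b)))
        where
        e : ∀ a b k → a + b - k + k ≡ a + b
        e = solve-∀
      entry : ∀ c → lookup r c ≡ lookup r′ c × lookup q c ≡ lookup q′ c
      entry c = lin≡ eq′ (e (lookup r c) (lookup r′ c) (N * lookup q′ c) κ) , q≡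
        where
        e : ∀ a a′ b k → a′ - a ≡ a′ + b - k - (a + b - k)
        e = solve-∀
        eq : lookup r c + N * lookup q c - κ ≡ lookup r′ c + N * lookup q′ c - κ
        eq = trans (sym (Vec.lookup-zipWith (λ a b → a + N * b - κ) c r q)) (trans (cong (λ v → lookup v c) p) (Vec.lookup-zipWith (λ a b → a + N * b - κ) c r′ q′))
        q≡ : lookup q c ≡ lookup q′ c
        q≡ = trans (sym (fl-entry (lookup q c) (All-lookup R c))) (trans (cong (λ z → fl (z + κ)) eq) (fl-entry (lookup q′ c) (All-lookup R′ c)))
        eq′ : lookup r c + N * lookup q′ c - κ ≡ lookup r′ c + N * lookup q′ c - κ
        eq′ = trans (cong (λ b → lookup r c + N * b - κ) (sym q≡)) eq

    windows : ∀ m → List (Vec ℤ m)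
    windows zero = [] ∷ []
    windows (suc m) = stack (λ _ → windows m) 0ℤ (suc n)

    windows-distinct : ∀ m → Distinctᴸ (windows m)
    windows-distinct zero = [] ∷ []
    windows-distinct (suc m) = stack-distinct (λ _ → windows m) 0ℤ (suc n) (λ _ → windows-distinct m)

    windows-Range : ∀ m → LAll.All (All Range) (windows m)
    windows-Range zero = [] ∷ []
    windows-Range (suc m) = All-stack (λ _ → windows m) 0ℤ (suc n) (λ t p q → LAll.map (λ R → (p , subst (t + 1ℤ ≤_) (trans (ℤ.+-identityˡ _) (sym N-def)) q) ∷ R) (windows-Range m))

    windows-complete : ∀ {m} (v : Vec ℤ m) → All Range v → v ∈ᴸ windows m
    windows-complete [] _ = LAny.here refl
    windows-complete (t ∷ v) ((p , q) ∷ R) = ∈-stack (λ _ → windows _) 0ℤ (suc n) t v p (subst (t + 1ℤ ≤_) (trans N-def (sym (ℤ.+-identityˡ _))) q) (windows-complete v R)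

    -- `Good` on one period of levels, which is decidable and extends to all levels by periodicity.
    -- The windows satisfying it are the permutations of 0, ..., n.
    GoodWindow : Vec ℤ (suc n) → Set
    GoodWindow r = ∀ (i : Fin (suc n)) → ∑ (V (letter i)) ⊤ˢ r ≡ letter i

    goodWindow? : ∀ r → Dec (GoodWindow r)
    goodWindow? r = Fin.all? (λ i → ∑ (V (letter i)) ⊤ˢ r ℤ.≟ letter i)

    GoodWindow⇒Good : ∀ {r} → GoodWindow r → Good r
    GoodWindow⇒Good {r} g i = trans (cong (λ z → ∑ (V z) ⊤ˢ r) (rem-spec i)) (trans (∑-cong (V-shift (letter (rem i)) (fl i)) ⊤ˢ r) (trans (∑-+ (V (letter (rem i))) (λ _ → fl i) ⊤ˢ r)
      (trans (cong₂ _+_ (g (rem i)) (trans (∑-const (fl i) ⊤ˢ r) (trans (cong (λ k → fl i * + k) (Subset.∣⊤∣≡n (suc n))) (trans (cong (fl i *_) (sym N-def)) (ℤ.*-comm (fl i) N))))) (sym (rem-spec i)))))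

    goodWindows : List (Vec ℤ (suc n))
    goodWindows = List.filter goodWindow? (windows (suc n))

    points : Vec ℤ (suc n) → Vec ℕ n → List (Vec ℤ (suc n)) → List (Vec ℤ (suc n))
    points A l [] = []
    points A l (r ∷ R) = List.map (comb (Kap l) r) (enum (suc n) (gg A r l)) ++ points A l R

    length-points : ∀ A l R → ι (+ length (points A l R)) ≡ sumL (λ r → ι (+ length (enum (suc n) (gg A r l)))) R
    length-points A l [] = ι-0
    length-points A l (r ∷ R) = trans (cong (λ z → ι (+ z)) (trans (List.length-++ (List.map (comb (Kap l) r) (enum (suc n) (gg A r l)))) (cong (ℕ._+ length (points A l R)) (List.length-map (comb (Kap l) r) (enum (suc n) (gg A r l))))))
      (trans (ι-+ (+ length (enum (suc n) (gg A r l))) (+ length (points A l R))) (cong (ι (+ length (enum (suc n) (gg A r l))) ℚ.+_) (length-points A l R)))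

    All-points : ∀ {Q : Vec ℤ (suc n) → Set} A l R → LAll.All (λ r → LAll.All (λ q → Q (comb (Kap l) r q)) (enum (suc n) (gg A r l))) R → LAll.All Q (points A l R)
    All-points A l [] [] = []
    All-points A l (r ∷ R) (a ∷ as) = LAll.++⁺ (LAll.map⁺ a) (All-points A l R as)

    ∈-points : ∀ A l R r q → r ∈ᴸ R → q ∈ᴸ enum (suc n) (gg A r l) → comb (Kap l) r q ∈ᴸ points A l R
    ∈-points A l (r ∷ R) .r q (LAny.here refl) i = ∈-++⁺ˡ (∈ᴸ-map⁺ (comb (Kap l) r) i)
    ∈-points A l (r′ ∷ R) r q (LAny.there j) i = ∈-++⁺ʳ (List.map (comb (Kap l) r′) (enum (suc n) (gg A r′ l))) (∈-points A l R r q j i)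

    points-distinct : ∀ A l R → Distinctᴸ R → LAll.All (All Range) R → Distinctᴸ (points A l R)
    points-distinct A l [] [] [] = []
    points-distinct A l (r ∷ R) (d ∷ ds) (g ∷ gs) = LPairs.++⁺ (LPairs.map⁺ (LPairs.map (λ q≢q′ p → q≢q′ (proj₂ (comb-injective (Kap l) r r _ _ g g p))) (enum-distinct (suc n) (gg A r l))))
      (points-distinct A l R ds gs)
      (LAll.map⁺ (LAll.universal (λ q → All-points A l R (LAll.map (λ {r′} (r≢r′ , g′) → LAll.universal (λ q′ p → r≢r′ (proj₁ (comb-injective (Kap l) r r′ q q′ g g′ p))) _) (LAll.zip (d , gs)))) (enum (suc n) (gg A r l))))

  -- The polynomial, its degree and the theorem

  sumL-const : ∀ {A : Set} q (L : List A) → sumL (λ _ → q) L ≡ ι (+ length L) ℚ.* q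
  sumL-const q [] = sym (trans (cong (ℚ._* q) ι-0) (ℚ.*-zeroˡ q))
  sumL-const q (x ∷ L) = trans (cong (q ℚ.+_) (sumL-const q L)) (trans (e q (ι (+ length L))) (cong (ℚ._* q) (sym (ι-suc (length L)))))
    where
    e : ∀ q k → q ℚ.+ k ℚ.* q ≡ (1ℚ ℚ.+ k) ℚ.* q
    e = solve-∀-over ℚ-ring

  sumᴹ : ∀ {A : Set} {n d} → (A → MP n d) → List A → MP n d
  sumᴹ f [] = zeroᴹ
  sumᴹ f (x ∷ L) = f x ⊕ sumᴹ f L

  ⟦sumᴹ⟧ : ∀ {A : Set} {n d} (f : A → MP n d) L l → ⟦ sumᴹ f L ⟧ᴹ l ≡ sumL (λ x → ⟦ f x ⟧ᴹ l) L
  ⟦sumᴹ⟧ f [] l = refl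
  ⟦sumᴹ⟧ f (x ∷ L) l = cong (⟦ f x ⟧ᴹ l ℚ.+_) (⟦sumᴹ⟧ f L l)

  length-nonempty : ∀ {A : Set} {x : A} {L} → x ∈ᴸ L → 1 ℕ.≤ length L
  length-nonempty (LAny.here _) = s≤s z≤n
  length-nonempty (LAny.there _) = s≤s z≤n

  module Final (n : ℕ) (1≤n : 1 ℕ.≤ n) where

    open Count n 1≤n public

    goodWindows-Good : LAll.All Good goodWindows
    goodWindows-Good = LAll.map (λ {r} → GoodWindow⇒Good {r}) (LAll.all-filter goodWindow? (windows (suc n)))

    goodWindows-Range : LAll.All (All Range) goodWindows
    goodWindows-Range = LAll.filter⁺ goodWindow? (windows-Range (suc n))

    goodWindows-distinct : Distinctᴸ goodWindows
    goodWindows-distinct = LPairs.filter⁺ goodWindow? (windows-distinct (suc n))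

    goodWindows-complete : ∀ {r} → Good r → All Range r → r ∈ᴸ goodWindows
    goodWindows-complete {r} g R = ∈-filter⁺ goodWindow? (windows-complete r R) (λ i → g (letter i))

    module Poly₀ = Compose {n} {suc n} (λ S l → G l S) linear-G (λ _ → 0ℤ)

    count₀ : MP n (suc n)
    count₀ = proj₁ (Poly₀.compose (countPoly n))

    ⟦count₀⟧ : ∀ l → ⟦ count₀ ⟧ᴹ l ≡ ⟦ countPoly n ⟧ (λ S → ι (G l S))
    ⟦count₀⟧ l = trans (proj₂ (Poly₀.compose (countPoly n)) l) (⟦⟧-cong (countPoly n) (λ S _ → cong ι (ℤ.+-identityʳ (G l S))))

    R# : ℚ
    R# = ι (+ length goodWindows)

    -- Every residue vector contributes the count for `G` alone up to lower degree, so neither a nor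
    -- the individual residues enter, only the number of residue vectors.
    leading : MP n (suc n)
    leading = scaleᴹ R# count₀

    module _ (A : Vec ℤ (suc n)) where

      correction : Vec ℤ (suc n) → MP n n
      correction r = proj₁ (Compose.difference {n} {suc n} (λ S l → G l S) linear-G (cc A r) (countPoly n))

      corrections : MP n n
      corrections = sumᴹ correction goodWindows

      polynomial : Poly n
      polynomial e = toPoly leading e ℚ.+ toPoly corrections e

      polynomial-top : ∀ e → n ℕ.≤ totalDeg e → polynomial e ≡ toPoly leading e
      polynomial-top e p = trans (cong (toPoly leading e ℚ.+_) (toPoly-degree corrections e p)) (ℚ.+-identityʳ (toPoly leading e))

      polynomial-degree : ∀ e → n ℕ.< totalDeg e → polynomial e ≡ 0ℚ
      polynomial-degree e p = trans (polynomial-top e (ℕ.<⇒≤ p)) (toPoly-degree leading e p)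

      points-count : Decr A → ∀ l → (∀ i → 1ℤ ≤ + lookup l i) → ι (+ length (points A l goodWindows)) ≡ eval n polynomial l
      points-count dA l l≥1 = trans (length-points A l goodWindows) (trans (sumL-cong each goodWindows) (trans (sumL-+ (λ _ → c₀) (λ r → ⟦ correction r ⟧ᴹ l) goodWindows)
        (trans (cong₂ ℚ._+_ (trans (sumL-const c₀ goodWindows) (trans (cong (R# ℚ.*_) (sym (⟦count₀⟧ l))) (sym (⟦scaleᴹ⟧ R# count₀ l)))) (sym (⟦sumᴹ⟧ correction goodWindows l)))
          (sym (trans (eval-+ n (toPoly leading) (toPoly corrections) l) (cong₂ ℚ._+_ (eval-toPoly n leading ℕ.≤-refl l) (eval-toPoly n corrections (ℕ.n≤1+n n) l)))))))
        where
        c₀ : ℚ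
        c₀ = ⟦ countPoly n ⟧ (λ S → ι (G l S))
        each : ∀ r → ι (+ length (enum (suc n) (gg A r l))) ≡ c₀ ℚ.+ ⟦ correction r ⟧ᴹ l
        each r = trans (count-enum n (gg A r l) (gg-Submod A r dA l l≥1) (gg-⊥ A r l)) (proj₂ (Compose.difference {n} {suc n} (λ S l → G l S) linear-G (cc A r) (countPoly n)) l)

    -- For λ_i = 2 n J and j = n J the permutohedron is centred at the constant vector with entries
    -- j n. The inequality for a proper nonempty set of size s holds there with slack j s (n - s +
    -- 1), which is at least j, as `many-points` requires.
    growth : ∀ J → ι (+ (suc J ℕ.^ n)) ℚ.≤ ⟦ leading ⟧ᴹ (Vec.replicate n ((n ℕ.+ n) ℕ.* J))
    growth J = ℚ.≤-trans (ι-mono-≤ (+≤+ many)) (ℚ.≤-trans (ℚ.≤-reflexive (trans (count-enum n (G l) (G-Submod l) (G-⊥ l)) (sym (⟦count₀⟧ l)))) (ℚ.≤-trans scaled (ℚ.≤-reflexive (sym (⟦scaleᴹ⟧ R# count₀ l)))))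
      where
      l : Vec ℕ n
      l = Vec.replicate n ((n ℕ.+ n) ℕ.* J)
      j : ℕ
      j = n ℕ.* J
      w : Vec ℤ (suc n)
      w = Vec.replicate (suc n) (+ j * + n)
      G≡ : ∀ S → G l S ≡ + j * + size S * (+ n + + n - + size S + 1ℤ)
      G≡ S = trans (cong (λ k → pre (λ z → z) (size S) (tabulate {n = suc n} (λ c → sfx (Vec.replicate n k) (toℕ c)))) (ℕ.*-distribʳ-+ J n n)) (pre-replicate n j (size S) (Subset.∣p∣≤n S))
      tot : total ⊤ˢ w ≡ G l ⊤ˢ
      tot = trans (total-replicate (⊤ˢ {suc n}) (+ j * + n)) (trans (cong (λ s → + j * + n * + s) (Subset.∣⊤∣≡n (suc n))) (trans (e (+ j) (+ n)) (sym (trans (G≡ ⊤ˢ) (cong (λ s → + j * + s * (+ n + + n - + s + 1ℤ)) (Subset.∣⊤∣≡n (suc n)))))))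
        where
        e : ∀ j n → j * n * (1ℤ + n) ≡ j * (1ℤ + n) * (n + n - (1ℤ + n) + 1ℤ)
        e = solve-∀
      slack : ∀ S → S ≢ ⊥ˢ → S ≢ ⊤ˢ → total S w + + j ≤ G l S
      slack S S≢⊥ S≢⊤ with size S in eq
      ... | zero = ⊥-elim (S≢⊥ (size≡0 S eq))
      ... | suc a = subst₂ _≤_ (cong (_+ + j) (sym (trans (total-replicate S (+ j * + n)) (cong (λ s → + j * + n * + s) eq)))) (trans (cong (λ s → + j * + s * (+ n + + n - + s + 1ℤ)) (sym eq)) (trans (sym (G≡ S)) (cong (λ s → pre (λ z → z) s (Lam l)) eq)))
            -- With s = a + 1 and n - s = b, the slack left after subtracting j is j ((a + 1) (b +
            -- 1) - 1).
            (lin (+≤+ (z≤n {j ℕ.* (a ℕ.+ b ℕ.+ a ℕ.* b)})) (trans (e (+ j) (+ a) (+ b) (+ n) n≡) (trans (cong (λ t → + j * (+ a + + b + t)) (sym (ℤ.pos-* a b))) (trans (sym (ℤ.pos-* j (a ℕ.+ b ℕ.+ a ℕ.* b))) (sym (ℤ.+-identityʳ (+ (j ℕ.* (a ℕ.+ b ℕ.+ a ℕ.* b)))))))))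
        where
        sa≤ : suc a ℕ.≤ suc n
        sa≤ = subst (ℕ._≤ suc n) eq (Subset.∣p∣≤n S)
        sa≤n : suc a ℕ.≤ n
        sa≤n = ℕ.s≤s⁻¹ (ℕ.≤∧≢⇒< sa≤ (λ q → S≢⊤ (Subset.∣p∣≡n⇒p≡⊤ (trans eq q))))
        b : ℕ
        b = n ℕ.∸ suc a
        n≡ : + n ≡ 1ℤ + + a + + b
        n≡ = cong +_ (sym (ℕ.m+[n∸m]≡n sa≤n))
        e : ∀ j a b n → n ≡ 1ℤ + a + b → j * (1ℤ + a) * (n + n - (1ℤ + a) + 1ℤ) - (j * n * (1ℤ + a) + j) ≡ j * (a + b + a * b)
        e j a b _ refl = e′ j a b
          where
          e′ : ∀ j a b → j * (1ℤ + a) * ((1ℤ + a + b) + (1ℤ + a + b) - (1ℤ + a) + 1ℤ) - (j * (1ℤ + a + b) * (1ℤ + a) + j) ≡ j * (a + b + a * b)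
          e′ = solve-∀
      many : suc J ℕ.^ n ℕ.≤ length (enum (suc n) (G l))
      many = many-points n J j w (G l) (G-⊥ l) tot slack ℕ.≤-refl
      1≤R# : 1ℚ ℚ.≤ R#
      1≤R# = subst (ℚ._≤ R#) ι-1 (ι-mono-≤ (+≤+ (length-nonempty (goodWindows-complete {idv} Good-idv idv-range))))
      nonneg : ℚ.NonNegative (⟦ count₀ ⟧ᴹ l)
      nonneg = subst ℚ.NonNegative (trans (count-enum n (G l) (G-Submod l) (G-⊥ l)) (sym (⟦count₀⟧ l))) (ι-nonNeg (length (enum (suc n) (G l))))
      scaled : ⟦ count₀ ⟧ᴹ l ℚ.≤ R# ℚ.* ⟦ count₀ ⟧ᴹ l
      scaled = subst (ℚ._≤ R# ℚ.* ⟦ count₀ ⟧ᴹ l) (ℚ.*-identityˡ (⟦ count₀ ⟧ᴹ l)) (ℚ.*-monoʳ-≤-nonNeg (⟦ count₀ ⟧ᴹ l) {{nonneg}} 1≤R#)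

    leading-coefficient : ∃ λ e → totalDeg e ≡ n × toPoly leading e ≢ 0ℚ
    leading-coefficient = go n 1≤n leading growth
      where
      go : ∀ n → 1 ℕ.≤ n → (F : MP n (suc n)) → (∀ J → ι (+ (suc J ℕ.^ n)) ℚ.≤ ⟦ F ⟧ᴹ (Vec.replicate n ((n ℕ.+ n) ℕ.* J))) → ∃ λ e → totalDeg e ≡ n × toPoly F e ≢ 0ℚ
      -- The successor of this B is twice the rank, matching the diagonal points of `growth`.
      go (suc n) _ F = top-coefficient n (n ℕ.+ suc n) F

    polynomial-HasDegree : ∀ A → HasDegree n (polynomial A)
    polynomial-HasDegree A = polynomial-degree A , let (e , d , ne) = leading-coefficient in
      e , d , λ z → ne (trans (sym (polynomial-top A e (ℕ.≤-reflexive (sym d)))) z)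

    module _ {Y : Vec ℤ (suc n)} (dY : Decr Y) (gY : Good Y) where

      open Interval {Y} dY gY

      realise : ∀ L → LAll.All (λ P → Good P × D P Y) L → Σ (List (Waff n)) λ W → List.map PP W ≡ L
      realise [] [] = [] , refl
      realise (P ∷ L) ((g , d) ∷ ps) = let (x , p) = element P g d ; (W , q) = realise L ps in x ∷ W , cong₂ _∷_ p q

      -- `PP` identifies the classes of `≈W` with integer vectors, and the Bruhat criterion
      -- identifies the interval with the vectors below Y; a list of those vectors is lifted back to
      -- words by `realise`.
      interval-card : ∀ θ → PP θ ≡ Y → ∀ L → LAll.All (λ P → Good P × D P Y) L → Distinctᴸ L → (∀ P → Good P → D P Y → P ∈ᴸ L) → HasCard (λ x → Bruhat≤ 1≤n x θ) (length L)
      interval-card θ p L sound distinct complete′ = W , trans (sym (List.length-map PP W)) (cong length W≡) , bruhat , inequivalent , total′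
        where
        W : List (Waff n)
        W = proj₁ (realise L sound)
        W≡ : List.map PP W ≡ L
        W≡ = proj₂ (realise L sound)
        bruhat : LAll.All (λ x → Bruhat≤ 1≤n x θ) W
        bruhat = LAll.map (λ {x} (_ , d) → D⇒Bruhat θ p x d) (LAll.map⁻ (subst (LAll.All (λ P → Good P × D P Y)) (sym W≡) sound))
        inequivalent : LPairs.AllPairs (λ u v → ¬ (u ≈W v)) W
        inequivalent = LPairs.map (λ {u} {v} ne eq → ne (≈⇒PP-≡ u v eq)) (LPairs.map⁻ (subst Distinctᴸ (sym W≡) distinct))
        total′ : ∀ w → Bruhat≤ 1≤n w θ → LAny.Any (λ u → w ≈W u) W
        total′ w b = LAny.map (λ {u} eq → PP-≡⇒≈ w u eq) (LAny.map⁻ (subst (PP w ∈ᴸ_) (sym W≡) (complete′ (PP w) (PP-Good w) (Bruhat⇒D θ p w b))))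

      theta-element : ∃ λ θ → PP θ ≡ Y
      theta-element = ⟦ 1≤n ⟧S wordS , PP-wordS

    points-sound : ∀ A l → Good A → LAll.All (λ P → Good P × D P (Qv A l)) (points A l goodWindows)
    points-sound A l gA = All-points A l goodWindows (LAll.map (λ {r} gr → LAll.map (λ {q} (b , t) → comb-Good (Kap l) r q gr (trans t (gg-⊤ A r gA gr l)) , bounds⇒D A l r q b) (enum-sound (suc n) (gg A r l) (gg-⊥ A r l))) goodWindows-Good)

    points-complete : ∀ A l → Good A → ∀ P → Good P → D P (Qv A l) → P ∈ᴸ points A l goodWindows
    points-complete A l gA P g d = subst (_∈ᴸ points A l goodWindows) (comb-split κ′ P) (∈-points A l goodWindows r q (goodWindows-complete {r} gr (residues-Range κ′ P))
        (enum-complete (suc n) (gg A r l) q (D⇒bounds A l r q (subst (λ t → D t (Qv A l)) (sym (comb-split κ′ P)) d) , trans (quotients-total κ′ P g) (sym (gg-⊤ A r gA gr l)))))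
      where
      κ′ : ℤ
      κ′ = Kap l
      r q : Vec ℤ (suc n)
      r = residues κ′ P
      q = quotients κ′ P
      gr : Good r
      gr = residues-Good κ′ P g

    module _ (a : Waff n) (F : InF a) where

      A₀ : Vec ℤ (suc n)
      A₀ = Vec.reverse (PP a)

      A₀-Good : Good A₀
      A₀-Good = reverse-Good (PP a) (PP-Good a)

      A₀-Decr : Decr A₀
      A₀-Decr = consecutive⇒AllPairs (λ {x} {y} {z} → <-step-trans {x} {y} {z}) A₀ (λ i → proj₁ (InF⇒Gaps a F i))

      qa-value : ∀ l → All (2 ℕ.≤_) l → qaIs 1≤n a l (eval n (polynomial A₀) l)
      qa-value l l≥2 = (proj₁ θ₀ , theta-from-PP a l (proj₁ θ₀) (proj₂ θ₀)) , λ θ T →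
          length L , interval-card dQ gQ θ (PP-from-theta a l θ T) L (points-sound A₀ l A₀-Good) (points-distinct A₀ l goodWindows goodWindows-distinct goodWindows-Range) (points-complete A₀ l A₀-Good)
          , trans (ι-def (+ length L)) (points-count A₀ A₀-Decr l l≥1)
        where
        L = points A₀ l goodWindows
        dQ : Decr (Qof a l)
        dQ = Qv-Decr A₀ l (InF⇒Gaps a F)
        gQ : Good (Qof a l)
        gQ = Qof-Good a l
        θ₀ = theta-element {Qof a l} dQ gQ
        l≥1 : ∀ i → 1ℤ ≤ + lookup l i
        l≥1 i = +≤+ (ℕ.≤-trans (s≤s z≤n) (entry l l≥2 i))
          where
          entry : ∀ {m} (l : Vec ℕ m) → All (2 ℕ.≤_) l → ∀ i → 2 ℕ.≤ lookup l i
          entry (x ∷ l) (p ∷ ps) Fin.zero = p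
          entry (x ∷ l) (p ∷ ps) (Fin.suc i) = entry l ps i

open import Data.Nat using (ℕ; _≤_; _<_; _%_; NonZero)
open import Data.Vec using (Vec; map)
open import Data.Vec.Relation.Unary.All using (All)
open import Data.Rational using (ℚ)
open import Data.Product using (Σ; _×_)
open import Relation.Binary.PropositionalEquality using (_≡_)
open import Data.Nat.Properties using (≤-reflexive)
open import Data.Product using (_,_)
open import Relation.Binary.PropositionalEquality using (sym)

theoremD : (n : ℕ) (h : 1 ≤ n) →
    Σ (Poly n) λ H →
    ((a : Waff n) → InF a →
    Σ ℕ λ m → Σ (NonZero m) λ m≢0 →
    Σ (Vec ℕ n → Poly n) λ p →
    ((g : Vec ℕ n) → All (_< m) g →
    HasDegree n (p g) × ((e : Vec ℕ n) → totalDeg e ≡ n → p g e ≡ H e))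
    × ((l : Vec ℕ n) → All (2 ≤_) l →
    qaIs h a l (eval n (p (map (λ x → _%_ x m {{m≢0}}) l)) l)))
-- The modulus is 1, so one polynomial serves every residue class; its part of degree n is that of
-- `leading`, which is built before a is given.
theoremD n h = Proof.toPoly leading , λ a F → 1 , _ , (λ _ → polynomial (A₀ a F)) ,
    (λ _ _ → polynomial-HasDegree (A₀ a F) , λ e d → polynomial-top (A₀ a F) e (≤-reflexive (sym d))) , qa-value a F
  where
  open Proof.Final n h
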